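{- Let $m$ and $n$ be positive integers, and put $\kappa := m + 2n + 1$ and $n':=2n$. Then \begin{align*} &\sum_{s_*} \mathcal{B}_{m,n'}(s_*;q^{n'})\,q^{\mathcal{A}_{m,n'}(s_*)+\frac{1}{2}s^{(0)}} \\ &\qquad=\frac{(q^\kappa;q^\kappa)_\infty^{n-1}(q^{\kappa/2};q^{\kappa/2})_\infty}{(q;q)_\infty^{n-1}(q^{1/2};q^{1/2})_\infty}\prod_{i=1}^n\theta(q^i;q^{\kappa/2})\prod_{1\leq i < j \leq n}\theta(q^{j-i},q^{i+j};q^\kappa), \end{align*} where the sum ranges over all families of integers $s_i^{(j)}$ ($1\le i\le m$, $0\le j\le n'-1$) with $s_1^{(j)} \geq \cdots \geq s_m^{(j)}$ for each $j$ and $s_i^{(j)} \geq s_i^{(j+1)}$ for $0\le j\le n'-1$ (where $s_i^{(n')}=0$).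
   Context: Notation: for $k\ge 0$ an integer, $(a;p)_k=(1-a)(1-ap)\cdots(1-ap^{k-1})$, $(a;p)_\infty=\prod_{j\ge0}(1-ap^j)$; $\theta(a;p)=(a;p)_\infty(p/a;p)_\infty$ and $\theta(a_1,\dots,a_k;p)=\theta(a_1;p)\cdots\theta(a_k;p)$. Identities are of formal power series in $q^{1/2}$. For positive integers $M,N$ and integers $s_i^{(j)}$ ($1\le i\le M$, $0\le j\le N$), with the conventions $s_i^{(N)}=0$ for all $i$ and $s_{M+1}^{(j)}=0$ for all $j$, and $s^{(j)}:=s_1^{(j)}+\cdots+s_M^{(j)}$, define $$\mathcal{A}_{M,N}(s_*)= -\tfrac{N}{2}s^{(0)}+s^{(1)}+\cdots+s^{(N-1)}+\tfrac{N}{2}\sum_{i=1}^M\sum_{a=1}^N\big(s_i^{(a-1)}-s_i^{(a)}\big)^2,$$ $$\mathcal{B}_{M,N}(s_*;p)=\prod_{i=1}^M\prod_{a=1}^N\frac{(p;p)_{s_i^{(a-1)}-s_{i+1}^{(a)}}}{(p;p)_{s_i^{(a-1)}-s_i^{(a)}}\,(p;p)_{s_i^{(a)}-s_{i+1}^{(a)}}}\ \prod_{i=1}^M\frac{1}{(p;p)_{s_i^{(0)}-s_{i+1}^{(0)}}}.$$ -}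

module Defs where

open import Data.Bool using (Bool; true; false; if_then_else_; _∧_)
open import Data.Nat as ℕ using (ℕ; zero; suc; _∸_; _≡ᵇ_; _≤ᵇ_)
open import Data.Integer as ℤ using (ℤ; +_; -[1+_])
open import Data.List using (List; []; _∷_; map; concatMap; upTo; filter; foldr)
open import Data.Vec as Vec using (Vec; []; _∷_; toList)

-- All series are formal power series in t = q^{1/2}, with integer
-- coefficients, represented by their coefficient sequence.
FPS : Set
FPS = ℕ → ℤ

sumTo : (ℕ → ℤ) → ℕ → ℤ
sumTo f zero    = + 0
sumTo f (suc n) = sumTo f n ℤ.+ f n

sumℕ : (ℕ → ℕ) → ℕ → ℕ
sumℕ f zero    = 0
sumℕ f (suc n) = sumℕ f n ℕ.+ f n

oneS : FPS
oneS k = if k ≡ᵇ 0 then + 1 else + 0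

mono : ℕ → FPS
mono e k = if k ≡ᵇ e then + 1 else + 0

_⊝_ : FPS → FPS → FPS
(f ⊝ g) k = f k ℤ.- g k

_⊛_ : FPS → FPS → FPS
(f ⊛ g) k = sumTo (λ i → f i ℤ.* g (k ∸ i)) (suc k)

infixl 7 _⊛_

prodTo : (ℕ → FPS) → ℕ → FPS
prodTo f zero    = oneS
prodTo f (suc n) = prodTo f n ⊛ f n

powS : FPS → ℕ → FPS
powS f zero    = oneS
powS f (suc n) = f ⊛ powS f n

-- multiplicative inverse of a series with constant term 1:
-- b₀ = 1, b_{k+1} = - Σ_{j=0}^{k} f_{j+1} b_{k-j}.
-- invUpTo f k agrees with the inverse on indices ≤ k.
invUpTo : FPS → ℕ → FPS
invUpTo f zero = oneS
invUpTo f (suc k) i =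
  if i ≡ᵇ suc k
  then ℤ.- sumTo (λ j → f (suc j) ℤ.* invUpTo f k (k ∸ j)) (suc k)
  else invUpTo f k i

inv : FPS → FPS
inv f k = invUpTo f k k

pochF : ℕ → ℕ → ℕ → FPS
pochF α β k = prodTo (λ j → oneS ⊝ mono (α ℕ.+ β ℕ.* j)) k

-- infinite q-Pochhammer (t^α ; t^β)_∞, for β ≥ 1: the coefficient of t^k
-- only depends on the factors j ≤ k.
poch∞ : ℕ → ℕ → FPS
poch∞ α β k = pochF α β (suc k) k

-- θ(t^α ; t^β) = (t^α;t^β)_∞ (t^{β-α};t^β)_∞   (used only with α < β)
theta : ℕ → ℕ → FPS
theta α β = poch∞ α β ⊛ poch∞ (β ∸ α) β

-- Families s_i^{(j)}, 0-based: i < M (paper's i-1), j < N.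
-- Out-of-range entries read as 0, implementing s_{M+1}^{(j)} = 0 and
-- s_i^{(N)} = 0.

Fam : ℕ → ℕ → Set
Fam M N = Vec (Vec ℕ N) M

nth : List ℕ → ℕ → ℕ
nth []       _       = 0
nth (x ∷ xs) zero    = x
nth (x ∷ xs) (suc i) = nth xs i

nthL : List (List ℕ) → ℕ → List ℕ
nthL []       _       = []
nthL (x ∷ xs) zero    = x
nthL (x ∷ xs) (suc i) = nthL xs i

get : ∀ {M N} → Fam M N → ℕ → ℕ → ℕ
get s i j = nth (nthL (toList (Vec.map toList s)) i) j

allL : {A : Set} → (A → Bool) → List A → Bool
allL p []       = true
allL p (x ∷ xs) = p x ∧ allL p xs

allVecs : {A : Set} → List A → (L : ℕ) → List (Vec A L)
allVecs xs zero    = [] ∷ []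
allVecs xs (suc L) = concatMap (λ x → map (x ∷_) (allVecs xs L)) xs

famsBox : (K M N : ℕ) → List (Fam M N)
famsBox K M N = allVecs (allVecs (upTo (suc K)) N) M

valid : ∀ {M N} → Fam M N → Bool
valid {M} {N} s =
  allL (λ i → allL (λ j → (get s (suc i) j ≤ᵇ get s i j) ∧ (get s i (suc j) ≤ᵇ get s i j))
                 (upTo N))
      (upTo M)

colSum : ∀ {M N} → Fam M N → ℕ → ℕ
colSum {M} s j = sumℕ (λ i → get s i j) M

sq : ℤ → ℤ
sq x = x ℤ.* x

-- t-exponent of q^{A_{M,N}(s) + s^{(0)}/2}, i.e. 2 A_{M,N}(s) + s^{(0)}
expo : ∀ {M N} → Fam M N → ℤ
expo {M} {N} s =
  ℤ.- (+ N ℤ.* + colSum s 0)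
  ℤ.+ + 2 ℤ.* (+ sumℕ (λ j → colSum s (suc j)) (N ∸ 1))
  ℤ.+ + N ℤ.* sumTo (λ i → sumTo (λ a → sq (+ get s i a ℤ.- + get s i (suc a))) N) M
  ℤ.+ + colSum s 0

Bser : ∀ {M N} → ℕ → Fam M N → FPS
Bser {M} {N} P s = numB ⊛ inv denB
  where
  pp : ℕ → FPS
  pp k = pochF P P k
  numB : FPS
  numB = prodTo (λ i → prodTo (λ a → pp (get s i a ∸ get s (suc i) (suc a))) N) M
  denB : FPS
  denB = prodTo (λ i → prodTo (λ a → pp (get s i a ∸ get s i (suc a))
                                    ⊛ pp (get s i (suc a) ∸ get s (suc i) (suc a))) N) M
       ⊛ prodTo (λ i → pp (get s i 0 ∸ get s (suc i) 0)) M

shiftCoeff : FPS → ℤ → ℤ → ℤ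
shiftCoeff f e k with k ℤ.- e
... | + r      = f r
... | -[1+ _ ] = + 0

sumList : List ℤ → ℤ
sumList = foldr ℤ._+_ (+ 0)

-- coefficient of t^k (t = q^{1/2}) of the LHS sum restricted to families
-- with all entries ≤ K; here M = m, N = n' = 2n, p = q^{n'} = t^{2n'}.
lhsTrunc : (m n K : ℕ) → ℤ → ℤ
lhsTrunc m n K k =
  sumList (map (λ s → shiftCoeff (Bser (2 ℕ.* (2 ℕ.* n)) s) (expo s) k)
               (filter (λ s → valid s Data.Bool.≟ true) (famsBox K m (2 ℕ.* n))))
  where import Data.Bool

-- RHS as a series in t = q^{1/2}, κ = m + 2n + 1:
-- q = t², q^κ = t^{2κ}, q^{κ/2} = t^κ, q^{1/2} = t.
rhsSeries : (m n : ℕ) → FPS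
rhsSeries m n = num ⊛ inv den
  where
  κ : ℕ
  κ = m ℕ.+ 2 ℕ.* n ℕ.+ 1
  num : FPS
  num = powS (poch∞ (2 ℕ.* κ) (2 ℕ.* κ)) (n ∸ 1)
      ⊛ poch∞ κ κ
      ⊛ prodTo (λ i → theta (2 ℕ.* suc i) κ) n
      ⊛ prodTo (λ j → prodTo (λ i → theta (2 ℕ.* (suc j ∸ suc i)) (2 ℕ.* κ)
                                   ⊛ theta (2 ℕ.* (suc i ℕ.+ suc j)) (2 ℕ.* κ)) j) n
  den : FPS
  den = powS (poch∞ 2 2) (n ∸ 1) ⊛ poch∞ 1 1

rhsCoeff : (m n : ℕ) → ℤ → ℤ
rhsCoeff m n (+ r)      = rhsSeries m n r
rhsCoeff m n -[1+ _ ]   = + 0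

{-# OPTIONS --safe #-}
module Submission where

-- Put t = q^{1/2}, p = t^{4n}. Up to a factor that tends to 1, the summand of the s-sum is a product of branching weights of
-- conjugate Hall–Littlewood polynomials P_λ(·;p) in the geometric alphabet t, t³, t⁵, …, because both satisfy the same Pieri rule. A bounded
-- Littlewood identity rewrites Σ_{λ₁ ≤ m} P_λ as a sum over sign changes of the letters. Along each residue class modulo 4n only sign
-- changes of an initial segment survive, so the sum becomes a determinant of theta series. A second sign sum, with a known closed
-- form and classes modulo 2κ, leads to the transposed determinant; dividing the two leaves only infinite products.

-- Multiplication by `p` raises exponents by 4n. The 2n branching variables t, t^3, ..., t^(4n-1),
-- each of which carries (-uy;p)_∞ in the Pieri rule, therefore have the generating function ∏ (1 +
-- u t^(2k+1)) of all odd powers: chains of length 2n see an infinite alphabet. Inverted letters are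
-- not power series, but they enter the weights only through 1/(1 - t^e), which makes sense for e <
-- 0 as 1 - 1/(1 - t^(-e)); hence letters are integer exponents. The constant κ is where the two
-- determinants meet: a class contributes the exponent ((m+3) + 2(n-1)) 2n r^2 = 2nκ r^2 on one side
-- and (2 + 2(n-1)) κ r^2 on the other. Neither determinant is evaluated. The term in which all
-- exponents are positive obeys the same expansion with a one-point window, so crosswise
-- multiplication matches unknown constants and determinants, and only two such terms, which are
-- products, remain to be computed. Shifting a class brings in negative powers of t, so limits live
-- in a localisation at t, and infinite sums are replaced by finite windows that are correct modulo
-- t^M.

open import Algebra.Bundles using (CommutativeRing; RawRing)
open import Algebra.Structures using (IsCommutativeRing)
import Algebra.Properties.Ring
import Algebra.Properties.Semiring.Mult.TCOptimised
import Algebra.Solver.Ring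
open import Algebra.Solver.Ring.AlmostCommutativeRing using (fromCommutativeRing; _-Raw-AlmostCommutative⟶_)
open import Data.Bool as Bool using (Bool; true; false; if_then_else_; _∧_)
open import Data.Empty using (⊥; ⊥-elim)
open import Data.Integer as Z using (ℤ; +_; -[1+_])
import Data.Integer.Properties as Zₚ
open import Data.Integer.Tactic.RingSolver using () renaming (solve-∀ to Z-solve)
open import Data.List using (List; []; _∷_; _++_; map; concatMap; concat; length; upTo; applyUpTo; filter; foldr; reverse; downFrom)
import Data.List.Properties as Lₚ
open import Data.List.Relation.Unary.All as All using (All; []; _∷_)
import Data.List.Relation.Unary.All.Properties as Allₚ
open import Data.List.Relation.Unary.AllPairs as AllPairs using (AllPairs; []; _∷_)
import Data.List.Relation.Unary.AllPairs.Properties as AllPairsₚ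
open import Data.List.Relation.Binary.Permutation.Propositional as Perm using (_↭_; prep; swap; ↭-refl; ↭-sym; ↭-trans)
import Data.List.Relation.Binary.Permutation.Propositional.Properties as Permₚ
open import Data.Maybe using (Maybe; just; nothing)
open import Data.Nat as N using (ℕ; zero; suc; _∸_; _≤_; _<_; z≤n; s≤s; _≡ᵇ_; _≤ᵇ_)
import Data.Nat.Properties as Nₚ
open import Data.Nat.Tactic.RingSolver using () renaming (solve-∀ to N-solve)
open import Data.Product using (Σ; _×_; _,_; ∃; ∃-syntax) renaming (proj₁ to fst; proj₂ to snd)
open import Data.Sum using (_⊎_; inj₁; inj₂)
open import Data.Unit using (tt)
open import Data.Vec as Vec using (Vec; []; _∷_; toList)
import Data.Vec.Properties as Vecₚ
open import Function using (_∘_; id)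
open import Level using (0ℓ)
open import Relation.Binary.Core using (Rel)
open import Relation.Binary.Structures using (IsEquivalence)
open import Relation.Binary.PropositionalEquality as ≡ using (_≡_; _≢_)
open import Relation.Nullary using (¬_; Dec; yes; no)
import Relation.Binary.Reasoning.Setoid
open import Defs

-- Level-0 instances: they leave no universe metavariables in the proofs below.
private
 cong : ∀ {A B : Set} (f : A -> B) {x y} -> x ≡ y -> f x ≡ f y
 cong f ≡.refl = ≡.refl

 cong₂ : ∀ {A B C : Set} (f : A -> B -> C) {x y u v} -> x ≡ y -> u ≡ v -> f x u ≡ f y v
 cong₂ f ≡.refl ≡.refl = ≡.refl

 subst : ∀ {A : Set} (P : A -> Set) {x y} -> x ≡ y -> P x -> P y
 subst P ≡.refl p = p

-- Commutative rings: axioms, a solver with integer constants, finite sums and products.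

CRing : Set₁
CRing = CommutativeRing 0ℓ 0ℓ

-- One-sided axioms: commutativity supplies the other halves. Power series, quotients, sequences and
-- fractions are all built from this short list.
record RingLaws : Set₁ where
 infix 4 _≈_
 infixl 6 _+_
 infixl 7 _*_
 field
  Carrier       : Set
  _≈_           : Rel Carrier 0ℓ
  _+_ _*_       : Carrier -> Carrier -> Carrier
  -_            : Carrier -> Carrier
  0# 1#         : Carrier
  isEquivalence : IsEquivalence _≈_
  +-cong        : ∀ {a b c d} -> a ≈ b -> c ≈ d -> a + c ≈ b + d
  *-cong        : ∀ {a b c d} -> a ≈ b -> c ≈ d -> a * c ≈ b * d
  neg-cong      : ∀ {a b} -> a ≈ b -> - a ≈ - b
  +-assoc       : ∀ a b c -> (a + b) + c ≈ a + (b + c)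
  +-comm        : ∀ a b -> a + b ≈ b + a
  +-identityˡ   : ∀ a -> 0# + a ≈ a
  +-inverseˡ    : ∀ a -> - a + a ≈ 0#
  *-assoc       : ∀ a b c -> (a * b) * c ≈ a * (b * c)
  *-comm        : ∀ a b -> a * b ≈ b * a
  *-identityˡ   : ∀ a -> 1# * a ≈ a
  distribʳ      : ∀ a b c -> (b + c) * a ≈ b * a + c * a

toRing : RingLaws -> CRing
toRing L = record
 { Carrier = Carrier ; _≈_ = _≈_ ; _+_ = _+_ ; _*_ = _*_ ; -_ = -_ ; 0# = 0# ; 1# = 1#
 ; isCommutativeRing = record
  { isRing = record
   { +-isAbelianGroup = record
    { isGroup = record
     { isMonoid = record
      { isSemigroup = record { isMagma = record { isEquivalence = isEquivalence ; ∙-cong = +-cong } ; assoc = +-assoc }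
      ; identity = +-identityˡ , (\ a -> trans (+-comm a 0#) (+-identityˡ a)) }
     ; inverse = +-inverseˡ , (\ a -> trans (+-comm a (- a)) (+-inverseˡ a))
     ; ⁻¹-cong = neg-cong }
    ; comm = +-comm }
   ; *-cong = *-cong
   ; *-assoc = *-assoc
   ; *-identity = *-identityˡ , (\ a -> trans (*-comm a 1#) (*-identityˡ a))
   ; distrib = (\ a b c -> trans (*-comm a (b + c)) (trans (distribʳ a b c) (+-cong (*-comm b a) (*-comm c a)))) , distribʳ }
  ; *-comm = *-comm } }
 where
 open RingLaws L
 open IsEquivalence isEquivalence using (trans)

private module Kit (R : CRing) where
 open CommutativeRing R public using (Carrier; _≈_; _+_; _*_; -_; _-_; 0#; 1#; refl; sym; trans; +-cong; +-congˡ; +-congʳ; *-cong; *-congˡ; *-congʳ; -‿cong; +-assoc; +-comm; *-assoc; *-comm; +-identityˡ; +-identityʳ; *-identityˡ; *-identityʳ; -‿inverseˡ; -‿inverseʳ; distribˡ; distribʳ; zeroˡ; zeroʳ)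
 open Relation.Binary.Reasoning.Setoid (CommutativeRing.setoid R) public using (begin_; step-≈-⟩; step-≈-⟨; step-≡-⟩; _∎)
 private
  module RP = Algebra.Properties.Ring (CommutativeRing.ring R)
  module SM = Algebra.Properties.Semiring.Mult.TCOptimised (CommutativeRing.semiring R)
  infix 8 _·1
  _·1 : ℕ -> Carrier
  n ·1 = n SM.× 1#

  -- The canonical map from the integers. Taking the solver's coefficients there, where equality is
  -- decidable, lets it cancel terms over a ring whose own equality is not.
  ⟪_⟫ : ℤ -> Carrier
  ⟪ + n ⟫ = n ·1
  ⟪ -[1+ n ] ⟫ = - (suc n ·1)

  suc·1 : ∀ n -> suc n ·1 ≈ 1# + n ·1
  suc·1 n = SM.×-homo-+ 1# 1 n

  ⊖-homo : ∀ m n -> ⟪ m Z.⊖ n ⟫ ≈ m ·1 + - (n ·1)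
  ⊖-homo m zero = sym (trans (+-congˡ RP.-0#≈0#) (+-identityʳ _))
  ⊖-homo zero (suc n) = sym (+-identityˡ _)
  ⊖-homo (suc m) (suc n) = begin
   ⟪ suc m Z.⊖ suc n ⟫ ≡⟨ cong ⟪_⟫ (Zₚ.[1+m]⊖[1+n]≡m⊖n m n) ⟩
   ⟪ m Z.⊖ n ⟫ ≈⟨ ⊖-homo m n ⟩
   m ·1 + - (n ·1) ≈⟨ +-identityˡ _ ⟨
   0# + (m ·1 + - (n ·1)) ≈⟨ +-congʳ (-‿inverseʳ 1#) ⟨
   (1# + - 1#) + (m ·1 + - (n ·1)) ≈⟨ +-assoc _ _ _ ⟩
   1# + (- 1# + (m ·1 + - (n ·1))) ≈⟨ +-congˡ (+-assoc _ _ _) ⟨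
   1# + ((- 1# + m ·1) + - (n ·1)) ≈⟨ +-congˡ (+-congʳ (+-comm _ _)) ⟩
   1# + ((m ·1 + - 1#) + - (n ·1)) ≈⟨ +-congˡ (+-assoc _ _ _) ⟩
   1# + (m ·1 + (- 1# + - (n ·1))) ≈⟨ +-assoc _ _ _ ⟨
   (1# + m ·1) + (- 1# + - (n ·1)) ≈⟨ +-congˡ (RP.-‿+-comm _ _) ⟩
   (1# + m ·1) + - (1# + n ·1) ≈⟨ +-cong (suc·1 m) (-‿cong (suc·1 n)) ⟨
   suc m ·1 + - (suc n ·1) ∎

  +-homo : ∀ i j -> ⟪ i Z.+ j ⟫ ≈ ⟪ i ⟫ + ⟪ j ⟫
  +-homo (+ m) (+ n) = SM.×-homo-+ 1# m n
  +-homo (+ m) -[1+ n ] = ⊖-homo m (suc n)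
  +-homo -[1+ m ] (+ n) = trans (⊖-homo n (suc m)) (+-comm _ _)
  +-homo -[1+ m ] -[1+ n ] = begin
   - (suc (suc (m N.+ n)) ·1) ≡⟨ cong (\ k -> - (suc k ·1)) (≡.sym (Nₚ.+-suc m n)) ⟩
   - ((suc m N.+ suc n) ·1) ≈⟨ -‿cong (SM.×-homo-+ 1# (suc m) (suc n)) ⟩
   - (suc m ·1 + suc n ·1) ≈⟨ RP.-‿+-comm _ _ ⟨
   - (suc m ·1) + - (suc n ·1) ∎

  neg-homo : ∀ i -> ⟪ Z.- i ⟫ ≈ - ⟪ i ⟫
  neg-homo (+ zero) = sym RP.-0#≈0#
  neg-homo (+ suc n) = refl
  neg-homo -[1+ n ] = sym (RP.-‿involutive _)

  *-homo-+ : ∀ m j -> ⟪ + m Z.* j ⟫ ≈ m ·1 * ⟪ j ⟫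
  *-homo-+ zero j = sym (zeroˡ _)
  *-homo-+ (suc m) j = begin
   ⟪ + suc m Z.* j ⟫ ≡⟨ cong ⟪_⟫ (Zₚ.suc-* (+ m) j) ⟩
   ⟪ j Z.+ + m Z.* j ⟫ ≈⟨ +-homo j (+ m Z.* j) ⟩
   ⟪ j ⟫ + ⟪ + m Z.* j ⟫ ≈⟨ +-cong (sym (*-identityˡ _)) (*-homo-+ m j) ⟩
   1# * ⟪ j ⟫ + m ·1 * ⟪ j ⟫ ≈⟨ distribʳ _ _ _ ⟨
   (1# + m ·1) * ⟪ j ⟫ ≈⟨ *-congʳ (suc·1 m) ⟨
   suc m ·1 * ⟪ j ⟫ ∎

  *-homo : ∀ i j -> ⟪ i Z.* j ⟫ ≈ ⟪ i ⟫ * ⟪ j ⟫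
  *-homo (+ m) j = *-homo-+ m j
  *-homo -[1+ m ] j = begin
   ⟪ -[1+ m ] Z.* j ⟫ ≡⟨ cong ⟪_⟫ (≡.sym (Zₚ.neg-distribˡ-* (+ suc m) j)) ⟩
   ⟪ Z.- (+ suc m Z.* j) ⟫ ≈⟨ neg-homo (+ suc m Z.* j) ⟩
   - ⟪ + suc m Z.* j ⟫ ≈⟨ -‿cong (*-homo-+ (suc m) j) ⟩
   - (suc m ·1 * ⟪ j ⟫) ≈⟨ RP.-‿distribˡ-* _ _ ⟩
   - (suc m ·1) * ⟪ j ⟫ ∎

  ℤ-raw : RawRing 0ℓ 0ℓ
  ℤ-raw = record { Carrier = ℤ ; _≈_ = _≡_ ; _+_ = Z._+_ ; _*_ = Z._*_ ; -_ = Z.-_ ; 0# = + 0 ; 1# = + 1 }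

  morphism : ℤ-raw -Raw-AlmostCommutative⟶ fromCommutativeRing R
  morphism = record
   { ⟦_⟧ = ⟪_⟫ ; +-homo = +-homo ; *-homo = *-homo ; -‿homo = neg-homo
   ; 0-homo = refl ; 1-homo = refl }

  coeff? : ∀ i j -> Maybe (⟪ i ⟫ ≈ ⟪ j ⟫)
  coeff? i j with i Z.≟ j
  ... | yes ≡.refl = just refl
  ... | no _ = nothing

 open Algebra.Solver.Ring ℤ-raw (fromCommutativeRing R) morphism coeff? public
  using (solve; _:=_; _:+_; _:*_; _:-_; :-_; con; Polynomial)

 0ₚ 1ₚ : ∀ {n} -> Polynomial n
 0ₚ = con (+ 0)
 1ₚ = con (+ 1)

 ≡⇒≈ : ∀ {a b} -> a ≡ b -> a ≈ b
 ≡⇒≈ ≡.refl = refl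

 ≈-cong : ∀ {A : Set} (f : A -> Carrier) {x y} -> x ≡ y -> f x ≈ f y
 ≈-cong f ≡.refl = refl

 *-zeroˡ-≈ : ∀ {x y} -> x ≈ 0# -> x * y ≈ 0#
 *-zeroˡ-≈ e = trans (*-congʳ e) (zeroˡ _)

 *-zeroʳ-≈ : ∀ {x y} -> y ≈ 0# -> x * y ≈ 0#
 *-zeroʳ-≈ e = trans (*-congˡ e) (zeroʳ _)

 *-oneˡ-≈ : ∀ {x y} -> x ≈ 1# -> x * y ≈ y
 *-oneˡ-≈ e = trans (*-congʳ e) (*-identityˡ _)

 *-oneʳ-≈ : ∀ {x y} -> y ≈ 1# -> x * y ≈ x
 *-oneʳ-≈ e = trans (*-congˡ e) (*-identityʳ _)

 x-y≈0⇒x≈y : ∀ {x y} -> x - y ≈ 0# -> x ≈ y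
 x-y≈0⇒x≈y {x} {y} e = trans (solve 2 (\ x y -> x := (x :- y) :+ y) refl x y) (trans (+-congʳ e) (+-identityˡ y))

 +-interchange : ∀ a b c d -> (a + b) + (c + d) ≈ (a + c) + (b + d)
 +-interchange = solve 4 (\ a b c d -> (a :+ b) :+ (c :+ d) := (a :+ c) :+ (b :+ d)) refl

 *-interchange : ∀ a b c d -> (a * b) * (c * d) ≈ (a * c) * (b * d)
 *-interchange = solve 4 (\ a b c d -> (a :* b) :* (c :* d) := (a :* c) :* (b :* d)) refl

 *-left-comm : ∀ a b c -> a * (b * c) ≈ b * (a * c)
 *-left-comm = solve 3 (\ a b c -> a :* (b :* c) := b :* (a :* c)) refl

 unit-cancel : ∀ {c d x y} -> c * d ≈ 1# -> c * x ≈ c * y -> x ≈ y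
 unit-cancel {c} {d} {x} {y} u e = begin
  x ≈⟨ *-identityˡ x ⟨
  1# * x ≈⟨ *-congʳ u ⟨
  (c * d) * x ≈⟨ solve 3 (\ c d x -> (c :* d) :* x := d :* (c :* x)) refl c d x ⟩
  d * (c * x) ≈⟨ *-congˡ e ⟩
  d * (c * y) ≈⟨ solve 3 (\ c d x -> d :* (c :* x) := (c :* d) :* x) refl c d y ⟩
  (c * d) * y ≈⟨ *-congʳ u ⟩
  1# * y ≈⟨ *-identityˡ y ⟩
  y ∎

 infixr 9 _^_
 _^_ : Carrier -> ℕ -> Carrier
 x ^ zero = 1#
 x ^ suc n = x * x ^ n

 ^-cong : ∀ {x y} n -> x ≈ y -> x ^ n ≈ y ^ n
 ^-cong zero e = refl
 ^-cong (suc n) e = *-cong e (^-cong n e)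

 ^-+ : ∀ x m n -> x ^ (m N.+ n) ≈ x ^ m * x ^ n
 ^-+ x zero n = sym (*-identityˡ _)
 ^-+ x (suc m) n = trans (*-congˡ (^-+ x m n)) (sym (*-assoc _ _ _))

 ^-^ : ∀ x a k -> (x ^ a) ^ k ≈ x ^ (a N.* k)
 ^-^ x a zero = ≡⇒≈ (cong (x ^_) (≡.sym (Nₚ.*-zeroʳ a)))
 ^-^ x a (suc k) = trans (*-congˡ (^-^ x a k)) (trans (sym (^-+ x a (a N.* k))) (≡⇒≈ (cong (x ^_) (≡.sym (Nₚ.*-suc a k)))))

 ^-* : ∀ x y n -> (x * y) ^ n ≈ x ^ n * y ^ n
 ^-* x y zero = sym (*-identityˡ _)
 ^-* x y (suc n) = trans (*-congˡ (^-* x y n))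
  (*-interchange x y _ _)

 private variable A B : Set

 ∑ : List A -> (A -> Carrier) -> Carrier
 ∑ [] f = 0#
 ∑ (x ∷ xs) f = f x + ∑ xs f

 ∏ : List A -> (A -> Carrier) -> Carrier
 ∏ [] f = 1#
 ∏ (x ∷ xs) f = f x * ∏ xs f

 ∑-cong : ∀ (xs : List A) {f g} -> (∀ x -> f x ≈ g x) -> ∑ xs f ≈ ∑ xs g
 ∑-cong [] e = refl
 ∑-cong (x ∷ xs) e = +-cong (e x) (∑-cong xs e)

 ∑-cong-All : ∀ {P : A -> Set} {xs : List A} {f g} -> All P xs -> (∀ x -> P x -> f x ≈ g x) -> ∑ xs f ≈ ∑ xs g
 ∑-cong-All [] e = refl
 ∑-cong-All (p ∷ ps) e = +-cong (e _ p) (∑-cong-All ps e)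

 ∑-map : ∀ (h : A -> B) xs {f : B -> Carrier} -> ∑ (map h xs) f ≈ ∑ xs (\ x -> f (h x))
 ∑-map h [] = refl
 ∑-map h (x ∷ xs) = +-congˡ (∑-map h xs)

 ∑-++ : ∀ (xs ys : List A) {f} -> ∑ (xs ++ ys) f ≈ ∑ xs f + ∑ ys f
 ∑-++ [] ys = sym (+-identityˡ _)
 ∑-++ (x ∷ xs) ys = trans (+-congˡ (∑-++ xs ys)) (sym (+-assoc _ _ _))

 ∑-concatMap : ∀ (h : A -> List B) xs {f} -> ∑ (concatMap h xs) f ≈ ∑ xs (\ x -> ∑ (h x) f)
 ∑-concatMap h [] = refl
 ∑-concatMap h (x ∷ xs) = trans (∑-++ (h x) (concatMap h xs)) (+-congˡ (∑-concatMap h xs))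

 ∑-+ : ∀ (xs : List A) {f g} -> ∑ xs (\ x -> f x + g x) ≈ ∑ xs f + ∑ xs g
 ∑-+ [] = sym (+-identityˡ _)
 ∑-+ (x ∷ xs) = trans (+-congˡ (∑-+ xs))
  (+-interchange _ _ _ _)

 ∑-*ˡ : ∀ (xs : List A) {c f} -> ∑ xs (\ x -> c * f x) ≈ c * ∑ xs f
 ∑-*ˡ [] = sym (zeroʳ _)
 ∑-*ˡ (x ∷ xs) = trans (+-congˡ (∑-*ˡ xs)) (sym (distribˡ _ _ _))

 ∑-*ʳ : ∀ (xs : List A) {c f} -> ∑ xs (\ x -> f x * c) ≈ ∑ xs f * c
 ∑-*ʳ [] = sym (zeroˡ _)
 ∑-*ʳ (x ∷ xs) = trans (+-congˡ (∑-*ʳ xs)) (sym (distribʳ _ _ _))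

 ∑-0 : ∀ (xs : List A) {f} -> (∀ x -> f x ≈ 0#) -> ∑ xs f ≈ 0#
 ∑-0 [] e = refl
 ∑-0 (x ∷ xs) e = trans (+-cong (e x) (∑-0 xs e)) (+-identityˡ _)

 ∑-0-All : ∀ {P : A -> Set} {xs : List A} {f} -> All P xs -> (∀ x -> P x -> f x ≈ 0#) -> ∑ xs f ≈ 0#
 ∑-0-All [] e = refl
 ∑-0-All (p ∷ ps) e = trans (+-cong (e _ p) (∑-0-All ps e)) (+-identityˡ _)

 ∑-swap : ∀ (xs : List A) (ys : List B) {f : A -> B -> Carrier} ->
  ∑ xs (\ x -> ∑ ys (f x)) ≈ ∑ ys (\ y -> ∑ xs (\ x -> f x y))
 ∑-swap [] ys = sym (∑-0 ys (\ _ -> refl))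
 ∑-swap (x ∷ xs) ys = trans (+-congˡ (∑-swap xs ys)) (sym (∑-+ ys))

 ∑-neg : ∀ (xs : List A) {f} -> ∑ xs (\ x -> - f x) ≈ - ∑ xs f
 ∑-neg [] = sym (Algebra.Properties.Ring.-0#≈0# (CommutativeRing.ring R))
 ∑-neg (x ∷ xs) = trans (+-congˡ (∑-neg xs)) (solve 2 (\ a b -> (:- a) :+ (:- b) := :- (a :+ b)) refl _ _)

 ∏-cong : ∀ (xs : List A) {f g} -> (∀ x -> f x ≈ g x) -> ∏ xs f ≈ ∏ xs g
 ∏-cong [] e = refl
 ∏-cong (x ∷ xs) e = *-cong (e x) (∏-cong xs e)

 ∏-cong-All : ∀ {P : A -> Set} {xs : List A} {f g} -> All P xs -> (∀ x -> P x -> f x ≈ g x) -> ∏ xs f ≈ ∏ xs g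
 ∏-cong-All [] e = refl
 ∏-cong-All (p ∷ ps) e = *-cong (e _ p) (∏-cong-All ps e)

 ∏-map : ∀ (h : A -> B) xs {f : B -> Carrier} -> ∏ (map h xs) f ≈ ∏ xs (\ x -> f (h x))
 ∏-map h [] = refl
 ∏-map h (x ∷ xs) = *-congˡ (∏-map h xs)

 ∏-++ : ∀ (xs ys : List A) {f} -> ∏ (xs ++ ys) f ≈ ∏ xs f * ∏ ys f
 ∏-++ [] ys = sym (*-identityˡ _)
 ∏-++ (x ∷ xs) ys = trans (*-congˡ (∏-++ xs ys)) (sym (*-assoc _ _ _))

 ∏-* : ∀ (xs : List A) {f g} -> ∏ xs (\ x -> f x * g x) ≈ ∏ xs f * ∏ xs g
 ∏-* [] = sym (*-identityˡ _)
 ∏-* (x ∷ xs) = trans (*-congˡ (∏-* xs))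
  (*-interchange _ _ _ _)

 ∏-1 : ∀ (xs : List A) {f} -> (∀ x -> f x ≈ 1#) -> ∏ xs f ≈ 1#
 ∏-1 [] e = refl
 ∏-1 (x ∷ xs) e = trans (*-cong (e x) (∏-1 xs e)) (*-identityˡ _)

 ∏-swap : ∀ (xs : List A) (ys : List B) {f : A -> B -> Carrier} ->
  ∏ xs (\ x -> ∏ ys (f x)) ≈ ∏ ys (\ y -> ∏ xs (\ x -> f x y))
 ∏-swap [] ys = sym (∏-1 ys (\ _ -> refl))
 ∏-swap (x ∷ xs) ys = trans (*-congˡ (∏-swap xs ys)) (sym (∏-* ys))

 ∏-↭ : ∀ {xs ys : List A} {f} -> xs ↭ ys -> ∏ xs f ≈ ∏ ys f
 ∏-↭ Perm.refl = refl
 ∏-↭ (prep x p) = *-congˡ (∏-↭ p)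
 ∏-↭ (swap x y p) = trans (*-congˡ (*-congˡ (∏-↭ p)))
  (*-left-comm _ _ _)
 ∏-↭ (Perm.trans p q) = trans (∏-↭ p) (∏-↭ q)

 ∑< : ℕ -> (ℕ -> Carrier) -> Carrier
 ∑< zero f = 0#
 ∑< (suc n) f = f 0 + ∑< n (\ k -> f (suc k))

 ∑-applyUpTo : ∀ (g : ℕ -> A) n {f : A -> Carrier} -> ∑ (applyUpTo g n) f ≈ ∑< n (\ k -> f (g k))
 ∑-applyUpTo g zero = refl
 ∑-applyUpTo g (suc n) = +-congˡ (∑-applyUpTo (\ k -> g (suc k)) n)

 ∑<-cong : ∀ n {f g} -> (∀ k -> f k ≈ g k) -> ∑< n f ≈ ∑< n g
 ∑<-cong zero e = refl
 ∑<-cong (suc n) e = +-cong (e 0) (∑<-cong n (\ k -> e (suc k)))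

 ∑<-cong-< : ∀ n {f g} -> (∀ k -> k < n -> f k ≈ g k) -> ∑< n f ≈ ∑< n g
 ∑<-cong-< zero e = refl
 ∑<-cong-< (suc n) e = +-cong (e 0 (s≤s z≤n)) (∑<-cong-< n (\ k k<n -> e (suc k) (s≤s k<n)))

 ∑<-0 : ∀ n {f} -> (∀ k -> k < n -> f k ≈ 0#) -> ∑< n f ≈ 0#
 ∑<-0 zero e = refl
 ∑<-0 (suc n) e = trans (+-cong (e 0 (s≤s z≤n)) (∑<-0 n (\ k k<n -> e (suc k) (s≤s k<n)))) (+-identityˡ _)

 ∑<-+ : ∀ n {f g} -> ∑< n (\ k -> f k + g k) ≈ ∑< n f + ∑< n g
 ∑<-+ zero = sym (+-identityˡ _)
 ∑<-+ (suc n) = trans (+-congˡ (∑<-+ n))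
  (+-interchange _ _ _ _)

 ∑<-*ˡ : ∀ n {c f} -> ∑< n (\ k -> c * f k) ≈ c * ∑< n f
 ∑<-*ˡ zero = sym (zeroʳ _)
 ∑<-*ˡ (suc n) = trans (+-congˡ (∑<-*ˡ n)) (sym (distribˡ _ _ _))

 ∑<-snoc : ∀ n {f} -> ∑< (suc n) f ≈ ∑< n f + f n
 ∑<-snoc zero = +-comm _ _
 ∑<-snoc (suc n) = trans (+-congˡ (∑<-snoc n)) (sym (+-assoc _ _ _))

 ∑<-++ : ∀ m n {f} -> ∑< (m N.+ n) f ≈ ∑< m f + ∑< n (\ k -> f (m N.+ k))
 ∑<-++ zero n = sym (+-identityˡ _)
 ∑<-++ (suc m) n = trans (+-congˡ (∑<-++ m n)) (sym (+-assoc _ _ _))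

 ∑<-extend : ∀ {m n f} -> m ≤ n -> (∀ k -> m ≤ k -> f k ≈ 0#) -> ∑< m f ≈ ∑< n f
 ∑<-extend {n = n} z≤n e = sym (∑<-0 n (\ k _ -> e k z≤n))
 ∑<-extend (s≤s m≤n) e = +-congˡ (∑<-extend m≤n (\ k m≤k -> e (suc k) (s≤s m≤k)))

 ∑<-single : ∀ n j {f} -> j < n -> (∀ k -> k ≢ j -> f k ≈ 0#) -> ∑< n f ≈ f j
 ∑<-single (suc n) zero _ e = trans (+-congˡ (∑<-0 n (\ k _ -> e (suc k) (\ ())))) (+-identityʳ _)
 ∑<-single (suc n) (suc j) (s≤s j<n) e =
  trans (+-cong (e 0 (\ ())) (∑<-single n j j<n (\ k k≢j -> e (suc k) (\ q -> k≢j (Nₚ.suc-injective q))))) (+-identityˡ _)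

 ∏< : ℕ -> (ℕ -> Carrier) -> Carrier
 ∏< zero f = 1#
 ∏< (suc n) f = f 0 * ∏< n (\ k -> f (suc k))

 ∏-applyUpTo : ∀ (g : ℕ -> A) n {f : A -> Carrier} -> ∏ (applyUpTo g n) f ≈ ∏< n (\ k -> f (g k))
 ∏-applyUpTo g zero = refl
 ∏-applyUpTo g (suc n) = *-congˡ (∏-applyUpTo (\ k -> g (suc k)) n)

 ∏<-cong-< : ∀ n {f g} -> (∀ k -> k < n -> f k ≈ g k) -> ∏< n f ≈ ∏< n g
 ∏<-cong-< zero e = refl
 ∏<-cong-< (suc n) e = *-cong (e 0 (s≤s z≤n)) (∏<-cong-< n (\ k k<n -> e (suc k) (s≤s k<n)))

 ∏<-cong : ∀ n {f g} -> (∀ k -> f k ≈ g k) -> ∏< n f ≈ ∏< n g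
 ∏<-cong n e = ∏<-cong-< n (\ k _ -> e k)

 ∏<-snoc : ∀ n {f} -> ∏< (suc n) f ≈ ∏< n f * f n
 ∏<-snoc zero = *-comm _ _
 ∏<-snoc (suc n) = trans (*-congˡ (∏<-snoc n)) (sym (*-assoc _ _ _))

 ∏<-* : ∀ n {f g} -> ∏< n (\ k -> f k * g k) ≈ ∏< n f * ∏< n g
 ∏<-* zero = sym (*-identityˡ _)
 ∏<-* (suc n) = trans (*-congˡ (∏<-* n))
  (*-interchange _ _ _ _)

 ∏<-1 : ∀ n {f} -> (∀ k -> k < n -> f k ≈ 1#) -> ∏< n f ≈ 1#
 ∏<-1 zero e = refl
 ∏<-1 (suc n) e = trans (*-cong (e 0 (s≤s z≤n)) (∏<-1 n (\ k k<n -> e (suc k) (s≤s k<n)))) (*-identityˡ _)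

 ∏<-++ : ∀ m n {f} -> ∏< (m N.+ n) f ≈ ∏< m f * ∏< n (\ k -> f (m N.+ k))
 ∏<-++ zero n = sym (*-identityˡ _)
 ∏<-++ (suc m) n = trans (*-congˡ (∏<-++ m n)) (sym (*-assoc _ _ _))

 ∏<-swap : ∀ m n {f : ℕ -> ℕ -> Carrier} -> ∏< m (\ i -> ∏< n (f i)) ≈ ∏< n (\ j -> ∏< m (\ i -> f i j))
 ∏<-swap zero n = sym (∏<-1 n (\ _ _ -> refl))
 ∏<-swap (suc m) n = trans (*-congˡ (∏<-swap m n)) (sym (∏<-* n))

 δ : ℕ -> ℕ -> Carrier
 δ m n = if m ≡ᵇ n then 1# else 0#

 δ-refl : ∀ n -> δ n n ≈ 1#
 δ-refl zero = refl
 δ-refl (suc n) = δ-refl n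

 δ-≢ : ∀ {m n} -> m ≢ n -> δ m n ≈ 0#
 δ-≢ {zero} {zero} ne = ⊥-elim (ne ≡.refl)
 δ-≢ {zero} {suc n} ne = refl
 δ-≢ {suc m} {zero} ne = refl
 δ-≢ {suc m} {suc n} ne = δ-≢ {m} {n} (\ e -> ne (cong suc e))

 ∑<-δ : ∀ n j {f : ℕ -> Carrier} -> j < n -> ∑< n (\ k -> δ j k * f k) ≈ f j
 ∑<-δ n j j<n = trans
  (∑<-single n j j<n (\ k k≢j -> trans (*-congʳ (δ-≢ {j} {k} (\ e -> k≢j (≡.sym e)))) (zeroˡ _)))
  (trans (*-congʳ (δ-refl j)) (*-identityˡ _))

-- Gaussian binomials and the identity for a single column of the Pieri rule.

tri : ℕ -> ℕ
tri zero = 0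
tri (suc n) = n N.+ tri n

private module _ (R : CRing) where
 open Kit R
 module QBinomial (p : Carrier) where

  qbin : ℕ -> ℕ -> Carrier
  qbin n zero = 1#
  qbin zero (suc k) = 0#
  qbin (suc n) (suc k) = qbin n k + p ^ suc k * qbin n (suc k)

  qbin-< : ∀ {n k} -> n < k -> qbin n k ≈ 0#
  qbin-< {zero} {suc k} _ = refl
  qbin-< {suc n} {suc k} (s≤s n<k) =
   trans (+-cong (qbin-< n<k) (*-zeroʳ-≈ (qbin-< (Nₚ.m<n⇒m<1+n n<k)))) (+-identityˡ _)

  qbin-nn : ∀ n -> qbin n n ≈ 1#
  qbin-nn zero = refl
  qbin-nn (suc n) = trans (+-cong (qbin-nn n) (*-zeroʳ-≈ (qbin-< (Nₚ.n<1+n n)))) (+-identityʳ _)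

  -- bb d a c is the q-binomial [d - c choose a - c], and 0 unless c ≤ a ≤ d.
  bb : ℕ -> ℕ -> ℕ -> Carrier
  bb d a zero = qbin d a
  bb zero a (suc c) = 0#
  bb (suc d) zero (suc c) = 0#
  bb (suc d) (suc a) (suc c) = bb d a c

  bb-a<c : ∀ d {a c} -> a < c -> bb d a c ≈ 0#
  bb-a<c zero {a} {suc c} _ = refl
  bb-a<c (suc d) {zero} {suc c} _ = refl
  bb-a<c (suc d) {suc a} {suc c} (s≤s a<c) = bb-a<c d a<c

  bb-d<a : ∀ {d a} c -> d < a -> bb d a c ≈ 0#
  bb-d<a zero d<a = qbin-< d<a
  bb-d<a {zero} (suc c) _ = refl
  bb-d<a {suc d} {suc a} (suc c) (s≤s d<a) = bb-d<a c d<a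

  bb-shift : ∀ e k c -> bb (e N.+ c) (c N.+ k) c ≡ qbin e k
  bb-shift e k zero = cong (\ z -> qbin z k) (Nₚ.+-identityʳ e)
  bb-shift e k (suc c) = ≡.trans (cong (\ z -> bb z (suc (c N.+ k)) (suc c)) (Nₚ.+-suc e c)) (bb-shift e k c)

  bb-pascal : ∀ d a c -> c ≤ d -> bb (suc d) (suc a) c ≈ bb d a c + p ^ (suc a ∸ c) * bb d (suc a) c
  bb-pascal d a zero _ = refl
  bb-pascal (suc d) zero (suc zero) _ = solve 0 (1ₚ := 0ₚ :+ 1ₚ :* 1ₚ) refl
  bb-pascal (suc zero) zero (suc (suc c)) _ = sym (trans (+-identityˡ _) (zeroʳ _))
  bb-pascal (suc (suc d)) zero (suc (suc c)) _ = sym (trans (+-identityˡ _) (zeroʳ _))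
  bb-pascal (suc d) (suc a) (suc c) (s≤s c≤d) = bb-pascal d a c c≤d

  private
   bb-down : ∀ K L c -> c < K -> c ≤ L -> bb K L c ≈ bb K L (suc c) + p ^ (L ∸ c) * bb K (suc L) (suc c)
   bb-down (suc K) zero zero _ _ = solve 0 (1ₚ := 0ₚ :+ 1ₚ :* 1ₚ) refl
   bb-down (suc K) (suc L) c (s≤s c≤K) _ = bb-pascal K L c c≤K

   -- Proved by Pascal's rule rather than by q-factorials, because no factor 1 - p^k is assumed to
   -- be invertible here. The rule is applied to the upper index, and `bb-down` repairs the lower
   -- end of the first factor.
   trinomial₀ : ∀ K L c -> bb K L c * qbin K c ≈ qbin K L * qbin L c
   trinomial₀ K L zero = refl
   trinomial₀ zero zero (suc c) = trans (zeroˡ _) (sym (zeroʳ _))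
   trinomial₀ zero (suc L) (suc c) = trans (zeroˡ _) (sym (zeroˡ _))
   trinomial₀ (suc K) zero (suc c) = trans (zeroˡ _) (sym (zeroʳ _))
   trinomial₀ (suc K) (suc L) (suc c) = begin
    bb K L c * (qbin K c + p ^ suc c * qbin K (suc c))
     ≈⟨ solve 4 (\ b x y z -> b :* (x :+ y :* z) := b :* x :+ y :* (b :* z)) refl _ _ _ _ ⟩
    bb K L c * qbin K c + p ^ suc c * (bb K L c * qbin K (suc c))
     ≈⟨ +-cong (trinomial₀ K L c) lower ⟩
    qbin K L * qbin L c + (qbin K L * (p ^ suc c * qbin L (suc c)) + p ^ suc L * qbin K (suc L) * qbin (suc L) (suc c))
     ≈⟨ solve 5 (\ a b d e f -> a :* b :+ (a :* d :+ e :* f) := a :* (b :+ d) :+ e :* f) refl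
       (qbin K L) (qbin L c) (p ^ suc c * qbin L (suc c)) (p ^ suc L * qbin K (suc L)) (qbin (suc L) (suc c)) ⟩
    qbin K L * (qbin L c + p ^ suc c * qbin L (suc c)) + p ^ suc L * qbin K (suc L) * qbin (suc L) (suc c)
     ≈⟨ distribʳ _ _ _ ⟨
    (qbin K L + p ^ suc L * qbin K (suc L)) * qbin (suc L) (suc c) ∎
    where
    lower : p ^ suc c * (bb K L c * qbin K (suc c)) ≈
        qbin K L * (p ^ suc c * qbin L (suc c)) + p ^ suc L * qbin K (suc L) * qbin (suc L) (suc c)
    -- Outside the range c < K, c ≤ L, which `bb-down` requires, both sides vanish.
    lower with c N.<? K | c N.≤? L
    ... | no c≮K | _ = trans (*-zeroʳ-≈ (trans (*-congˡ q0) (zeroʳ _)))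
        (sym (trans (+-cong (trans (*-left-comm _ _ _)
          (*-zeroʳ-≈ (trans (sym (trinomial₀ K L (suc c))) (trans (*-congˡ q0) (zeroʳ _)))))
         (trans (*-assoc _ _ _) (*-zeroʳ-≈ (trans (sym (trinomial₀ K (suc L) (suc c))) (trans (*-congˡ q0) (zeroʳ _))))))
         (+-identityˡ _)))
     where
     q0 : qbin K (suc c) ≈ 0#
     q0 = qbin-< (Nₚ.≰⇒> c≮K)
    ... | yes _ | no c≰L = trans (*-zeroʳ-≈ (*-zeroˡ-≈ (bb-a<c K (Nₚ.≰⇒> c≰L))))
        (sym (trans (+-cong (*-zeroʳ-≈ (*-zeroʳ-≈ (qbin-< (Nₚ.m<n⇒m<1+n (Nₚ.≰⇒> c≰L)))))
         (*-zeroʳ-≈ (qbin-< (s≤s (Nₚ.≰⇒> c≰L)))))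
         (+-identityˡ _)))
    ... | yes c<K | yes c≤L = begin
     p ^ suc c * (bb K L c * qbin K (suc c)) ≈⟨ *-congˡ (*-congʳ (bb-down K L c c<K c≤L)) ⟩
     p ^ suc c * ((bb K L (suc c) + p ^ (L ∸ c) * bb K (suc L) (suc c)) * qbin K (suc c))
      ≈⟨ solve 5 (\ a b d e f -> a :* ((b :+ d :* e) :* f) := a :* (b :* f) :+ (a :* d) :* (e :* f)) refl _ _ _ _ _ ⟩
     p ^ suc c * (bb K L (suc c) * qbin K (suc c)) + (p ^ suc c * p ^ (L ∸ c)) * (bb K (suc L) (suc c) * qbin K (suc c))
      ≈⟨ +-cong (*-congˡ (trinomial₀ K L (suc c)))
        (*-cong (trans (sym (^-+ p (suc c) (L ∸ c))) (≈-cong (\ z -> p ^ suc z) (Nₚ.m+[n∸m]≡n c≤L))) (trinomial₀ K (suc L) (suc c))) ⟩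
     p ^ suc c * (qbin K L * qbin L (suc c)) + p ^ suc L * (qbin K (suc L) * qbin (suc L) (suc c))
      ≈⟨ solve 6 (\ a b d e f g -> a :* (b :* d) :+ e :* (f :* g) := b :* (a :* d) :+ (e :* f) :* g) refl _ _ _ _ _ _ ⟩
     qbin K L * (p ^ suc c * qbin L (suc c)) + p ^ suc L * qbin K (suc L) * qbin (suc L) (suc c) ∎

  -- Trinomial revision. Its purpose is to decouple: the left side ties the adjacent entries K and
  -- K′ of a partition together, while on the right each of them meets only L and N.
  bb-trinomial : ∀ K L K′ N -> bb K L K′ * bb K K′ N ≈ bb K L N * bb L K′ N
  bb-trinomial K L K′ zero = trinomial₀ K L K′
  bb-trinomial zero L K′ (suc N) = trans (zeroʳ _) (sym (zeroˡ _))
  bb-trinomial (suc K) zero zero (suc N) = trans (zeroʳ _) (sym (zeroʳ _))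
  bb-trinomial (suc K) (suc L) zero (suc N) = trans (zeroʳ _) (sym (zeroʳ _))
  bb-trinomial (suc K) zero (suc K′) (suc N) = trans (zeroˡ _) (sym (zeroˡ _))
  bb-trinomial (suc K) (suc L) (suc K′) (suc N) = bb-trinomial K L K′ N

  qf : ℕ -> Carrier
  qf zero = 1#
  qf (suc n) = qf n * (1# - p ^ suc n)

  qbin-qf : ∀ a b -> qbin (a N.+ b) a * (qf a * qf b) ≈ qf (a N.+ b)
  qbin-qf zero b = trans (*-identityˡ _) (*-identityˡ _)
  qbin-qf (suc a) zero = begin
   qbin (suc a N.+ 0) (suc a) * (qf (suc a) * 1#) ≡⟨ cong (\ z -> qbin z (suc a) * (qf (suc a) * 1#)) (Nₚ.+-identityʳ (suc a)) ⟩
   qbin (suc a) (suc a) * (qf (suc a) * 1#) ≈⟨ *-cong (qbin-nn (suc a)) (*-identityʳ _) ⟩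
   1# * qf (suc a) ≈⟨ *-identityˡ _ ⟩
   qf (suc a) ≡⟨ cong qf (≡.sym (Nₚ.+-identityʳ (suc a))) ⟩
   qf (suc a N.+ 0) ∎
  qbin-qf (suc a) (suc b) = begin
   (qbin (a N.+ suc b) a + p ^ suc a * qbin (a N.+ suc b) (suc a)) * ((qf a * (1# - p ^ suc a)) * (qf b * (1# - p ^ suc b)))
    ≈⟨ solve 7 (\ x y z qa qb pa pb -> (x :+ pa :* y) :* ((qa :* z) :* (qb :* (1ₚ :- pb)))
       := z :* (x :* (qa :* (qb :* (1ₚ :- pb)))) :+ (pa :* (1ₚ :- pb)) :* (y :* ((qa :* z) :* qb)))
      refl (qbin (a N.+ suc b) a) (qbin (a N.+ suc b) (suc a)) (1# - p ^ suc a) (qf a) (qf b) (p ^ suc a) (p ^ suc b) ⟩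
   (1# - p ^ suc a) * (qbin (a N.+ suc b) a * (qf a * qf (suc b))) + (p ^ suc a * (1# - p ^ suc b)) * (qbin (a N.+ suc b) (suc a) * (qf (suc a) * qf b))
    ≈⟨ +-cong (*-congˡ (qbin-qf a (suc b))) (*-congˡ
      (trans (≈-cong (\ z -> qbin z (suc a) * (qf (suc a) * qf b)) (Nₚ.+-suc a b))
       (trans (qbin-qf (suc a) b) (≈-cong qf (≡.sym (Nₚ.+-suc a b)))))) ⟩
   (1# - p ^ suc a) * qf (a N.+ suc b) + (p ^ suc a * (1# - p ^ suc b)) * qf (a N.+ suc b)
    ≈⟨ solve 3 (\ q pa pb -> (1ₚ :- pa) :* q :+ (pa :* (1ₚ :- pb)) :* q := q :* (1ₚ :- pa :* pb)) refl _ _ _ ⟩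
   qf (a N.+ suc b) * (1# - p ^ suc a * p ^ suc b) ≈⟨ *-congˡ (+-congˡ (-‿cong (^-+ p (suc a) (suc b)))) ⟨
   qf (a N.+ suc b) * (1# - p ^ suc (a N.+ suc b)) ∎

  -- This is (-w;p)_k; the plus sign matches the generating function ∏ (1 + u x) of elementary
  -- symmetric polynomials.
  poch : Carrier -> ℕ -> Carrier
  poch w zero = 1#
  poch w (suc k) = (1# + w) * poch (p * w) k

  poch-cong : ∀ {w w′} k -> w ≈ w′ -> poch w k ≈ poch w′ k
  poch-cong zero e = refl
  poch-cong (suc k) e = *-cong (+-congˡ e) (poch-cong k (*-congˡ e))

  poch-snoc : ∀ w k -> poch w (suc k) ≈ poch w k * (1# + p ^ k * w)
  poch-snoc w zero = solve 1 (\ w -> (1ₚ :+ w) :* 1ₚ := 1ₚ :* (1ₚ :+ 1ₚ :* w)) refl w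
  poch-snoc w (suc k) = trans (*-congˡ (poch-snoc (p * w) k))
   (solve 4 (\ w x pk q -> (1ₚ :+ w) :* (x :* (1ₚ :+ pk :* (q :* w))) := ((1ₚ :+ w) :* x) :* (1ₚ :+ (q :* pk) :* w)) refl w _ _ _)

  -- When p is nilpotent, finite products stand for the infinite ones.
  poch-stable : ∀ w {k} j -> p ^ k ≈ 0# -> poch w (k N.+ j) ≈ poch w k
  poch-stable w {k} zero _ = ≈-cong (poch w) (Nₚ.+-identityʳ k)
  poch-stable w {k} (suc j) z = begin
   poch w (k N.+ suc j) ≡⟨ cong (poch w) (Nₚ.+-suc k j) ⟩
   poch w (suc (k N.+ j)) ≈⟨ poch-snoc w (k N.+ j) ⟩
   poch w (k N.+ j) * (1# + p ^ (k N.+ j) * w) ≈⟨ *-cong (poch-stable w {k} j z)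
     (+-congˡ (*-zeroˡ-≈ (trans (^-+ p k j) (trans (*-congʳ z) (zeroˡ _))))) ⟩
   poch w k * (1# + 0#) ≈⟨ *-oneʳ-≈ (+-identityʳ _) ⟩
   poch w k ∎

  qf-stable : ∀ {k} j -> p ^ k ≈ 0# -> qf (k N.+ j) ≈ qf k
  qf-stable {k} zero _ = ≈-cong qf (Nₚ.+-identityʳ k)
  qf-stable {k} (suc j) z = begin
   qf (k N.+ suc j) ≡⟨ cong qf (Nₚ.+-suc k j) ⟩
   qf (k N.+ j) * (1# - p * p ^ (k N.+ j)) ≈⟨ *-cong (qf-stable {k} j z)
    (+-congˡ (-‿cong (*-congˡ (trans (^-+ p k j) (trans (*-congʳ z) (zeroˡ _)))))) ⟩
   qf k * (1# - p * 0#) ≈⟨ solve 2 (\ q x -> q :* (1ₚ :- x :* 0ₚ) := q) refl _ _ ⟩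
   qf k ∎

  module Column (u : Carrier) where

   -- The monomial u^i y^k with the Gaussian factor p^(k(k-1)/2) of the q-binomial theorem; u marks
   -- the Pieri strip and y the branching letter.
   wt : Carrier -> ℕ -> ℕ -> Carrier
   wt y i k = u ^ i * (y ^ k * p ^ tri k)

   wt-p : ∀ y i k -> wt (p * y) i k ≈ p ^ k * wt y i k
   wt-p y i k = trans (*-congˡ (*-congʳ (^-* p y k)))
    (solve 4 (\ a b c d -> a :* ((b :* c) :* d) := b :* (a :* (c :* d))) refl _ _ _ _)

   wt-suc : ∀ y i k -> wt y i (suc k) ≈ y * (p ^ k * wt y i k)
   wt-suc y i k = trans (*-congˡ (*-congˡ (^-+ p k (tri k))))
    (solve 5 (\ a y b c d -> a :* ((y :* b) :* (c :* d)) := y :* (c :* (a :* (b :* d)))) refl _ _ _ _ _)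

   wt-u : ∀ y i k -> wt y (suc i) k ≈ u * wt y i k
   wt-u y i k = *-assoc _ _ _

   private
    suc-∸ : ∀ {a m} -> suc a ≤ m -> suc (m ∸ suc a) ≡ m ∸ a
    suc-∸ (s≤s a≤m) = ≡.sym (Nₚ.+-∸-assoc 1 a≤m)

    qbin-u : ∀ m a -> qbin m (suc a) * u ^ (m ∸ a) ≈ qbin m (suc a) * (u * u ^ (m ∸ suc a))
    qbin-u m a with suc a N.≤? m
    ... | yes a<m = *-congˡ (≈-cong (u ^_) (≡.sym (suc-∸ a<m)))
    ... | no a≮m = trans (*-congʳ (qbin-< (Nₚ.≰⇒> a≮m))) (trans (zeroˡ _) (sym (*-zeroˡ-≈ (qbin-< (Nₚ.≰⇒> a≮m)))))

   -- One column of the Pieri sum when the lower neighbour is 0: the summation index is κ = b + k,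
   -- and the upper bound is d = b + e.
   colL : ℕ -> Carrier -> ℕ -> ℕ -> ℕ -> Carrier
   colL n y a b e = ∑< n (\ k -> qbin (b N.+ k) a * (qbin e k * wt y (b N.+ k ∸ a) k))

   private
    colL-cong : ∀ n {n′} y a b e -> e < n -> e < n′ -> colL n y a b e ≈ colL n′ y a b e
    colL-cong n {n′} y a b e lt lt′ = trans (sym (∑<-extend lt van)) (∑<-extend lt′ van)
     where
     van : ∀ k -> suc e ≤ k -> qbin (b N.+ k) a * (qbin e k * wt y (b N.+ k ∸ a) k) ≈ 0#
     van k e<k = *-zeroʳ-≈ (*-zeroˡ-≈ (qbin-< e<k))

    colL-suc : ∀ n y a b e -> colL n y (suc a) (suc b) e ≈ p ^ suc a * u * colL n y (suc a) b e + colL n y a b e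
    colL-suc n y a b e = begin
     colL n y (suc a) (suc b) e ≈⟨ ∑<-cong n term ⟩
     ∑< n (\ k -> p ^ suc a * u * (qbin (b N.+ k) (suc a) * (qbin e k * wt y (b N.+ k ∸ suc a) k))
           + qbin (b N.+ k) a * (qbin e k * wt y (b N.+ k ∸ a) k)) ≈⟨ ∑<-+ n ⟩
     ∑< n (\ k -> p ^ suc a * u * (qbin (b N.+ k) (suc a) * (qbin e k * wt y (b N.+ k ∸ suc a) k))) + colL n y a b e
      ≈⟨ +-congʳ (∑<-*ˡ n) ⟩
     p ^ suc a * u * colL n y (suc a) b e + colL n y a b e ∎
     where
     term : ∀ k -> qbin (suc b N.+ k) (suc a) * (qbin e k * wt y (b N.+ k ∸ a) k) ≈
        p ^ suc a * u * (qbin (b N.+ k) (suc a) * (qbin e k * wt y (b N.+ k ∸ suc a) k))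
           + qbin (b N.+ k) a * (qbin e k * wt y (b N.+ k ∸ a) k)
     term k = begin
      (qbin (b N.+ k) a + p ^ suc a * qbin (b N.+ k) (suc a)) * (qbin e k * (u ^ (b N.+ k ∸ a) * (y ^ k * p ^ tri k)))
       ≈⟨ solve 6 (\ A P B q U Y -> (A :+ P :* B) :* (q :* (U :* Y)) := P :* ((B :* U) :* (q :* Y)) :+ A :* (q :* (U :* Y))) refl _ _ _ _ _ _ ⟩
      p ^ suc a * ((qbin (b N.+ k) (suc a) * u ^ (b N.+ k ∸ a)) * (qbin e k * (y ^ k * p ^ tri k))) + qbin (b N.+ k) a * (qbin e k * wt y (b N.+ k ∸ a) k)
       ≈⟨ +-congʳ (trans (*-congˡ (*-congʳ (qbin-u (b N.+ k) a)))
         (solve 6 (\ P B u U q Y -> P :* ((B :* (u :* U)) :* (q :* Y)) := (P :* u) :* (B :* (q :* (U :* Y)))) refl _ _ _ _ _ _)) ⟩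
      p ^ suc a * u * (qbin (b N.+ k) (suc a) * (qbin e k * wt y (b N.+ k ∸ suc a) k)) + qbin (b N.+ k) a * (qbin e k * wt y (b N.+ k ∸ a) k) ∎

    colL-0-suc : ∀ n y b e -> colL n y 0 (suc b) e ≈ u * colL n y 0 b e
    colL-0-suc n y b e = trans (∑<-cong n (\ k -> solve 4 (\ u U q Y -> 1ₚ :* (q :* ((u :* U) :* Y)) := u :* (1ₚ :* (q :* (U :* Y)))) refl _ _ _ _)) (∑<-*ˡ n)

    -- Pascal's rule in `e` replaces y by p y, because p^k is absorbed into the weight by `wt-p`.
    -- This moves the argument of the Pochhammer symbol one step and drives the induction in `base`.
    colL-e-suc : ∀ n y a e -> colL (suc n) y a 0 (suc e) ≈ colL (suc n) (p * y) a 0 e + y * colL n (p * y) a 1 e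
    colL-e-suc n y a e = begin
     f₀ + ∑< n (\ k -> qbin (suc k) a * ((qbin e k + p ^ suc k * qbin e (suc k)) * wt y (suc k ∸ a) (suc k)))
      ≈⟨ +-congˡ (trans (∑<-cong n split) (∑<-+ n)) ⟩
     f₀ + (∑< n (\ k -> g (suc k)) + ∑< n (\ k -> y * h k)) ≈⟨ trans (sym (+-assoc _ _ _)) (+-cong (+-congʳ g₀) (∑<-*ˡ n)) ⟩
     colL (suc n) (p * y) a 0 e + y * colL n (p * y) a 1 e ∎
     where
     f₀ = qbin 0 a * (1# * wt y (0 ∸ a) 0)
     g h : ℕ -> Carrier
     g k = qbin k a * (qbin e k * wt (p * y) (k ∸ a) k)
     h k = qbin (suc k) a * (qbin e k * wt (p * y) (suc k ∸ a) k)
     g₀ : f₀ ≈ g 0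
     g₀ = refl
     split : ∀ k -> qbin (suc k) a * ((qbin e k + p ^ suc k * qbin e (suc k)) * wt y (suc k ∸ a) (suc k)) ≈ g (suc k) + y * h k
     split k = begin
      qbin (suc k) a * ((qbin e k + p ^ suc k * qbin e (suc k)) * wt y (suc k ∸ a) (suc k))
       ≈⟨ solve 5 (\ A q P r W -> A :* ((q :+ P :* r) :* W) := A :* (r :* (P :* W)) :+ A :* (q :* W)) refl _ _ _ _ _ ⟩
      qbin (suc k) a * (qbin e (suc k) * (p ^ suc k * wt y (suc k ∸ a) (suc k))) + qbin (suc k) a * (qbin e k * wt y (suc k ∸ a) (suc k))
       ≈⟨ +-cong (*-congˡ (*-congˡ (sym (wt-p y (suc k ∸ a) (suc k)))))
         (trans (*-congˡ (*-congˡ (trans (wt-suc y (suc k ∸ a) k) (*-congˡ (sym (wt-p y (suc k ∸ a) k))))))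
          (solve 4 (\ A q y W -> A :* (q :* (y :* W)) := y :* (A :* (q :* W))) refl _ _ _ _)) ⟩
      g (suc k) + y * h k ∎

    -- In closed form: [k,a][e,k] = [e,a][e-a,k-a], so the sum is the q-binomial theorem with
    -- argument p^a u y, and (-uy;p)_a completes the result to (-uy;p)_e.
    base : ∀ n y a e -> e < n -> poch (u * y) a * colL n y a 0 e ≈ poch (u * y) e * (qbin e a * (y ^ a * p ^ tri a))
    base (suc n) y a zero _ = trans (*-congˡ (trans (+-congˡ (∑<-0 n (\ k _ -> *-zeroʳ-≈ (zeroˡ _)))) (+-identityʳ _))) (lem a)
     where
     lem : ∀ a -> poch (u * y) a * (qbin 0 a * (1# * wt y (0 ∸ a) 0)) ≈ 1# * (qbin 0 a * (y ^ a * p ^ tri a))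
     lem zero = solve 0 (1ₚ :* (1ₚ :* (1ₚ :* (1ₚ :* (1ₚ :* 1ₚ)))) := 1ₚ :* (1ₚ :* (1ₚ :* 1ₚ))) refl
     lem (suc a) = trans (*-congˡ (zeroˡ _)) (trans (zeroʳ _) (sym (*-zeroʳ-≈ (zeroˡ _))))
    base (suc n) y a (suc e) (s≤s e<n) = trans (*-congˡ (colL-e-suc n y a e)) (rest a)
     where
     w = u * y
     pw : u * (p * y) ≈ p * w
     pw = *-left-comm _ _ _
     ih : ∀ n′ a -> e < n′ -> poch (p * w) a * colL n′ (p * y) a 0 e ≈ poch (p * w) e * (qbin e a * (p ^ a * (y ^ a * p ^ tri a)))
     ih n′ a lt = begin
      poch (p * w) a * colL n′ (p * y) a 0 e ≈⟨ *-congʳ (poch-cong a pw) ⟨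
      poch (u * (p * y)) a * colL n′ (p * y) a 0 e ≈⟨ base n′ (p * y) a e lt ⟩
      poch (u * (p * y)) e * (qbin e a * ((p * y) ^ a * p ^ tri a)) ≈⟨ *-cong (poch-cong e pw) (*-congˡ (trans (*-congʳ (^-* p y a)) (*-assoc _ _ _))) ⟩
      poch (p * w) e * (qbin e a * (p ^ a * (y ^ a * p ^ tri a))) ∎
     rest : ∀ a -> poch w a * (colL (suc n) (p * y) a 0 e + y * colL n (p * y) a 1 e) ≈ poch w (suc e) * (qbin (suc e) a * (y ^ a * p ^ tri a))
     rest zero = begin
      1# * (colL (suc n) (p * y) 0 0 e + y * colL n (p * y) 0 1 e)
       ≈⟨ *-congˡ (+-cong (colL-cong (suc n) (p * y) 0 0 e (Nₚ.m<n⇒m<1+n e<n) e<n) (*-congˡ (colL-0-suc n (p * y) 0 e))) ⟩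
      1# * (colL n (p * y) 0 0 e + y * (u * colL n (p * y) 0 0 e))
       ≈⟨ solve 3 (\ X y u -> 1ₚ :* (X :+ y :* (u :* X)) := (1ₚ :+ u :* y) :* (1ₚ :* X)) refl _ _ _ ⟩
      (1# + w) * (poch (p * w) 0 * colL n (p * y) 0 0 e) ≈⟨ *-congˡ (ih n 0 e<n) ⟩
      (1# + w) * (poch (p * w) e * (1# * (1# * (1# * 1#))))
       ≈⟨ solve 2 (\ a b -> a :* (b :* (1ₚ :* (1ₚ :* (1ₚ :* 1ₚ)))) := (a :* b) :* (1ₚ :* (1ₚ :* 1ₚ))) refl _ _ ⟩
      poch w (suc e) * (1# * (1# * 1#)) ∎
     rest (suc a) = begin
      poch w (suc a) * (colL (suc n) (p * y) (suc a) 0 e + y * colL n (p * y) (suc a) 1 e)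
       ≈⟨ *-congˡ (+-cong (colL-cong (suc n) (p * y) (suc a) 0 e (Nₚ.m<n⇒m<1+n e<n) e<n) (*-congˡ (colL-suc n (p * y) a 0 e))) ⟩
      poch w (suc a) * (X + y * (p ^ suc a * u * X + Y))
       ≈⟨ solve 6 (\ c X y P u Y -> c :* (X :+ y :* (P :* u :* X :+ Y)) := (c :* (1ₚ :+ P :* (u :* y))) :* X :+ y :* (c :* Y)) refl _ _ _ _ _ _ ⟩
      (poch w (suc a) * (1# + p ^ suc a * w)) * X + y * (poch w (suc a) * Y)
       ≈⟨ +-congʳ (*-congʳ (poch-snoc w (suc a))) ⟨
      ((1# + w) * poch (p * w) (suc a)) * X + y * (((1# + w) * poch (p * w) a) * Y)
       ≈⟨ solve 6 (\ c b X y d Y -> (c :* b) :* X :+ y :* ((c :* d) :* Y) := c :* (b :* X :+ y :* (d :* Y))) refl _ _ _ _ _ _ ⟩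
      (1# + w) * (poch (p * w) (suc a) * X + y * (poch (p * w) a * Y))
       ≈⟨ *-congˡ (+-cong (ih n (suc a) e<n) (*-congˡ (ih n a e<n))) ⟩
      (1# + w) * (poch (p * w) e * (qbin e (suc a) * (p ^ suc a * (y ^ suc a * p ^ tri (suc a)))) + y * (poch (p * w) e * (qbin e a * (p ^ a * (y ^ a * p ^ tri a)))))
       ≈⟨ *-congˡ (+-congˡ (solve 6 (\ y E q P Y T -> y :* (E :* (q :* (P :* (Y :* T)))) := E :* (q :* ((y :* Y) :* (P :* T)))) refl _ _ _ _ _ _)) ⟩
      (1# + w) * (poch (p * w) e * (qbin e (suc a) * (p ^ suc a * (y ^ suc a * p ^ tri (suc a)))) + poch (p * w) e * (qbin e a * (y ^ suc a * (p ^ a * p ^ tri a))))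
       ≈⟨ *-congˡ (+-congˡ (*-congˡ (*-congˡ (*-congˡ (^-+ p a (tri a)))))) ⟨
      (1# + w) * (poch (p * w) e * (qbin e (suc a) * (p ^ suc a * (y ^ suc a * p ^ tri (suc a)))) + poch (p * w) e * (qbin e a * (y ^ suc a * p ^ tri (suc a))))
       ≈⟨ solve 6 (\ c E q P Z r -> c :* (E :* (q :* (P :* Z)) :+ E :* (r :* Z)) := (c :* E) :* ((r :+ P :* q) :* Z)) refl _ _ _ _ _ _ ⟩
      poch w (suc e) * (qbin (suc e) (suc a) * (y ^ suc a * p ^ tri (suc a))) ∎
      where
      X = colL n (p * y) (suc a) 0 e
      Y = colL n (p * y) a 0 e

   colR : ℕ -> Carrier -> ℕ -> ℕ -> ℕ -> Carrier
   colR n y a b e = ∑< n (\ μ -> qbin b μ * (bb (e N.+ b) a μ * wt y (b ∸ μ) (a ∸ μ)))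

   private
    colR-cong : ∀ n {n′} y a b e -> b < n -> b < n′ -> colR n y a b e ≈ colR n′ y a b e
    colR-cong n {n′} y a b e lt lt′ = trans (sym (∑<-extend lt van)) (∑<-extend lt′ van)
     where
     van : ∀ k -> suc b ≤ k -> qbin b k * (bb (e N.+ b) a k * wt y (b ∸ k) (a ∸ k)) ≈ 0#
     van k lt = *-zeroˡ-≈ (qbin-< lt)

    colR-0 : ∀ n y b e -> b < n -> colR n y 0 b e ≈ u ^ b
    colR-0 (suc n) y b e _ = trans (+-congˡ (∑<-0 n (\ k _ -> *-zeroʳ-≈ (*-zeroˡ-≈ (bb-a<c (e N.+ b) (s≤s z≤n))))))
     (solve 1 (\ U -> 1ₚ :* (1ₚ :* (U :* (1ₚ :* 1ₚ))) :+ 0ₚ := U) refl _)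

    colR-term : ∀ y a b d μ -> b ≤ d ->
     p ^ μ * qbin b μ * (bb (suc d) (suc a) μ * wt y (suc b ∸ μ) (suc a ∸ μ)) ≈
     p ^ suc a * u * (qbin b μ * (bb d (suc a) μ * wt y (b ∸ μ) (suc a ∸ μ))) + p ^ a * (u * y) * (qbin b μ * (bb d a μ * wt y (b ∸ μ) (a ∸ μ)))
    colR-term y a b d μ b≤d with μ N.≤? b
    ... | no μ≰b = trans (*-zeroˡ-≈ (trans (*-congˡ q0) (zeroʳ _)))
         (sym (trans (+-cong (*-zeroʳ-≈ (trans (*-congʳ q0) (zeroˡ _))) (*-zeroʳ-≈ (trans (*-congʳ q0) (zeroˡ _)))) (+-identityˡ _)))
     where
     q0 : qbin b μ ≈ 0#
     q0 = qbin-< (Nₚ.≰⇒> μ≰b)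
    ... | yes μ≤b = begin
     p ^ μ * q * (bb (suc d) (suc a) μ * wt y (suc b ∸ μ) (suc a ∸ μ))
      ≈⟨ *-congˡ (*-cong (bb-pascal d a μ (Nₚ.≤-trans μ≤b b≤d)) (trans (≈-cong (\ z -> wt y z (suc a ∸ μ)) (Nₚ.+-∸-assoc 1 μ≤b)) (wt-u y (b ∸ μ) (suc a ∸ μ)))) ⟩
     p ^ μ * q * ((bb d a μ + p ^ (suc a ∸ μ) * bb d (suc a) μ) * (u * W))
      ≈⟨ solve 7 (\ P q B P′ C u W -> P :* q :* ((B :+ P′ :* C) :* (u :* W)) := u :* (q :* ((P :* P′ :* C) :* W)) :+ u :* (q :* (P :* (B :* W)))) refl _ _ _ _ _ _ _ ⟩
     u * (q * ((p ^ μ * p ^ (suc a ∸ μ) * bb d (suc a) μ) * W)) + u * (q * (p ^ μ * (bb d a μ * W)))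
      ≈⟨ +-cong (*-congˡ (*-congˡ (*-congʳ one))) (*-congˡ (*-congˡ two)) ⟩
     u * (q * ((p ^ suc a * bb d (suc a) μ) * W)) + u * (q * (p ^ a * y * (bb d a μ * wt y (b ∸ μ) (a ∸ μ))))
      ≈⟨ +-cong (solve 5 (\ u q P C W -> u :* (q :* ((P :* C) :* W)) := P :* u :* (q :* (C :* W))) refl _ _ _ _ _)
           (solve 5 (\ u q P y W -> u :* (q :* (P :* y :* W)) := P :* (u :* y) :* (q :* W)) refl _ _ _ _ _) ⟩
     p ^ suc a * u * (q * (bb d (suc a) μ * W)) + p ^ a * (u * y) * (q * (bb d a μ * wt y (b ∸ μ) (a ∸ μ))) ∎
     where
     q = qbin b μ
     W = wt y (b ∸ μ) (suc a ∸ μ)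
     one : p ^ μ * p ^ (suc a ∸ μ) * bb d (suc a) μ ≈ p ^ suc a * bb d (suc a) μ
     one with μ N.≤? suc a
     ... | yes le = *-congʳ (trans (sym (^-+ p μ (suc a ∸ μ))) (≈-cong (p ^_) (Nₚ.m+[n∸m]≡n le)))
     ... | no gt = trans (trans (*-congˡ z) (zeroʳ _)) (sym (trans (*-congˡ z) (zeroʳ _)))
      where
      z : bb d (suc a) μ ≈ 0#
      z = bb-a<c d (Nₚ.≰⇒> gt)
     two : p ^ μ * (bb d a μ * W) ≈ p ^ a * y * (bb d a μ * wt y (b ∸ μ) (a ∸ μ))
     two with μ N.≤? a
     ... | yes le = begin
      p ^ μ * (bb d a μ * wt y (b ∸ μ) (suc a ∸ μ)) ≈⟨ *-congˡ (*-congˡ (trans (≈-cong (wt y (b ∸ μ)) (Nₚ.+-∸-assoc 1 le)) (wt-suc y (b ∸ μ) (a ∸ μ)))) ⟩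
      p ^ μ * (bb d a μ * (y * (p ^ (a ∸ μ) * wt y (b ∸ μ) (a ∸ μ))))
       ≈⟨ solve 5 (\ P B y Q V -> P :* (B :* (y :* (Q :* V))) := (P :* Q) :* y :* (B :* V)) refl _ _ _ _ _ ⟩
      (p ^ μ * p ^ (a ∸ μ)) * y * (bb d a μ * wt y (b ∸ μ) (a ∸ μ))
       ≈⟨ *-congʳ (*-congʳ (trans (sym (^-+ p μ (a ∸ μ))) (≈-cong (p ^_) (Nₚ.m+[n∸m]≡n le)))) ⟩
      p ^ a * y * (bb d a μ * wt y (b ∸ μ) (a ∸ μ)) ∎
     ... | no gt = trans (*-zeroʳ-≈ (trans (*-congʳ z) (zeroˡ _))) (sym (*-zeroʳ-≈ (trans (*-congʳ z) (zeroˡ _))))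
      where
      z : bb d a μ ≈ 0#
      z = bb-a<c d (Nₚ.≰⇒> gt)

    colR-suc : ∀ n y a b e -> b < n -> colR (suc n) y (suc a) (suc b) e ≈ p ^ suc a * u * colR n y (suc a) b e + (1# + p ^ a * (u * y)) * colR n y a b e
    colR-suc n y a b e b<n = begin
     colR (suc n) y (suc a) (suc b) e ≡⟨ cong (\ D -> ∑< (suc n) (\ μ -> qbin (suc b) μ * (bb D (suc a) μ * wt y (suc b ∸ μ) (suc a ∸ μ)))) (Nₚ.+-suc e b) ⟩
     1# * (bb (suc d) (suc a) 0 * wt y (suc b) (suc a)) + ∑< n (\ μ -> (qbin b μ + p ^ suc μ * qbin b (suc μ)) * (bb d a μ * wt y (b ∸ μ) (a ∸ μ)))
      ≈⟨ +-congˡ (trans (∑<-cong n (\ μ -> distribʳ _ _ _)) (∑<-+ n)) ⟩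
     1# * (bb (suc d) (suc a) 0 * wt y (suc b) (suc a)) + (colR n y a b e + ∑< n (\ μ -> p ^ suc μ * qbin b (suc μ) * (bb d a μ * wt y (b ∸ μ) (a ∸ μ))))
      ≈⟨ solve 3 (\ a b c -> 1ₚ :* a :+ (b :+ c) := b :+ ((1ₚ :* 1ₚ) :* a :+ c)) refl _ _ _ ⟩
     colR n y a b e + ∑< (suc n) (\ μ -> p ^ μ * qbin b μ * (bb (suc d) (suc a) μ * wt y (suc b ∸ μ) (suc a ∸ μ)))
      ≈⟨ +-congˡ (trans (∑<-cong (suc n) (\ μ -> colR-term y a b d μ (Nₚ.m≤n+m b e))) (trans (∑<-+ (suc n) {\ μ -> p ^ suc a * u * F μ} {\ μ -> p ^ a * (u * y) * G μ}) (+-cong (∑<-*ˡ (suc n) {f = F}) (∑<-*ˡ (suc n) {f = G})))) ⟩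
     colR n y a b e + (p ^ suc a * u * colR (suc n) y (suc a) b e + p ^ a * (u * y) * colR (suc n) y a b e)
      ≈⟨ +-congˡ (+-cong (*-congˡ (colR-cong (suc n) y (suc a) b e (Nₚ.m<n⇒m<1+n b<n) b<n)) (*-congˡ (colR-cong (suc n) y a b e (Nₚ.m<n⇒m<1+n b<n) b<n))) ⟩
     colR n y a b e + (p ^ suc a * u * colR n y (suc a) b e + p ^ a * (u * y) * colR n y a b e)
      ≈⟨ solve 4 (\ X P Y Q -> X :+ (P :* Y :+ Q :* X) := P :* Y :+ (1ₚ :+ Q) :* X) refl _ _ _ _ ⟩
     p ^ suc a * u * colR n y (suc a) b e + (1# + p ^ a * (u * y)) * colR n y a b e ∎
     where
     d = e N.+ b
     F G : ℕ -> Carrier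
     F μ = qbin b μ * (bb d (suc a) μ * wt y (b ∸ μ) (suc a ∸ μ))
     G μ = qbin b μ * (bb d a μ * wt y (b ∸ μ) (a ∸ μ))

   -- A transformation of terminating basic hypergeometric sums. Once multiplied by their Pochhammer
   -- symbols, both sides obey one recurrence in b: the extra factor 1 + p^a uy in `colR-suc` is
   -- exactly the step from (-uy;p)_a to (-uy;p)_(a+1).
   colL-colR : ∀ n n′ y a b e -> e < n -> b < n′ -> poch (u * y) a * colL n y a b e ≈ poch (u * y) e * colR n′ y a b e
   colL-colR n (suc n′) y a zero e e<n _ = trans (base n y a e e<n) (*-congˡ (sym (trans
    (+-congˡ (∑<-0 n′ (\ k _ -> zeroˡ _)))
    (trans (solve 2 (\ B V -> 1ₚ :* (B :* (1ₚ :* V)) :+ 0ₚ := B :* V) refl _ _) (*-congʳ (≈-cong (\ z -> qbin z a) (Nₚ.+-identityʳ e)))))))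
   colL-colR n (suc n′) y zero (suc b) e e<n (s≤s b<n′) = begin
    1# * colL n y 0 (suc b) e ≈⟨ *-congˡ (colL-0-suc n y b e) ⟩
    1# * (u * colL n y 0 b e) ≈⟨ solve 2 (\ u X -> 1ₚ :* (u :* X) := u :* (1ₚ :* X)) refl _ _ ⟩
    u * (1# * colL n y 0 b e) ≈⟨ *-congˡ (colL-colR n n′ y 0 b e e<n b<n′) ⟩
    u * (poch (u * y) e * colR n′ y 0 b e) ≈⟨ *-congˡ (*-congˡ (colR-0 n′ y b e b<n′)) ⟩
    u * (poch (u * y) e * u ^ b) ≈⟨ *-left-comm _ _ _ ⟩
    poch (u * y) e * u ^ suc b ≈⟨ *-congˡ (colR-0 (suc n′) y (suc b) e (s≤s b<n′)) ⟨
    poch (u * y) e * colR (suc n′) y 0 (suc b) e ∎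
   colL-colR n (suc n′) y (suc a) (suc b) e e<n (s≤s b<n′) = begin
    poch w (suc a) * colL n y (suc a) (suc b) e ≈⟨ *-congˡ (colL-suc n y a b e) ⟩
    poch w (suc a) * (p ^ suc a * u * colL n y (suc a) b e + colL n y a b e)
     ≈⟨ trans (distribˡ _ _ _) (+-cong (*-left-comm _ _ _)
       (trans (*-congʳ (poch-snoc w a)) (solve 3 (\ a b c -> (a :* b) :* c := b :* (a :* c)) refl _ _ _))) ⟩
    p ^ suc a * u * (poch w (suc a) * colL n y (suc a) b e) + (1# + p ^ a * w) * (poch w a * colL n y a b e)
     ≈⟨ +-cong (*-congˡ (colL-colR n n′ y (suc a) b e e<n b<n′)) (*-congˡ (colL-colR n n′ y a b e e<n b<n′)) ⟩
    p ^ suc a * u * (poch w e * colR n′ y (suc a) b e) + (1# + p ^ a * w) * (poch w e * colR n′ y a b e)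
     ≈⟨ solve 5 (\ P E X Q Y -> P :* (E :* X) :+ Q :* (E :* Y) := E :* (P :* X :+ Q :* Y)) refl _ _ _ _ _ ⟩
    poch w e * (p ^ suc a * u * colR n′ y (suc a) b e + (1# + p ^ a * w) * colR n′ y a b e) ≈⟨ *-congˡ (colR-suc n′ y a b e b<n′) ⟨
    poch w e * colR (suc n′) y (suc a) (suc b) e ∎
    where w = u * y

   -- All four bounds enter through differences only, so they can be lowered together until C = 0.
   -- There the terms with κ < B vanish, and `colL-colR` applies with e = d - B.
   column-identity : ∀ n y d A B C -> C ≤ A -> C ≤ B -> B ≤ d -> d < n ->
    poch (u * y) (A ∸ C) * ∑< n (\ κ -> bb d κ B * bb κ A C * wt y (κ ∸ A) (κ ∸ B)) ≈
    poch (u * y) (d ∸ B) * ∑< n (\ μ -> bb B μ C * bb d A μ * wt y (B ∸ μ) (A ∸ μ))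
   column-identity n y d A B zero _ _ B≤d d<n = begin
    poch (u * y) A * ∑< n (\ κ -> bb d κ B * qbin κ A * wt y (κ ∸ A) (κ ∸ B)) ≡⟨ cong (\ z -> poch (u * y) A * ∑< z (\ κ -> bb d κ B * qbin κ A * wt y (κ ∸ A) (κ ∸ B))) n≡ ⟩
    poch (u * y) A * ∑< (B N.+ m) (\ κ -> bb d κ B * qbin κ A * wt y (κ ∸ A) (κ ∸ B)) ≈⟨ *-congˡ (trans (∑<-++ B m) (trans (+-cong lo hi) (+-identityˡ _))) ⟩
    poch (u * y) A * colL m y A B e ≈⟨ colL-colR m n y A B e e<m (Nₚ.≤-<-trans B≤d d<n) ⟩
    poch (u * y) e * colR n y A B e ≈⟨ *-congˡ (∑<-cong n (\ μ -> trans (sym (*-assoc _ _ _)) (*-congʳ (*-congˡ (≈-cong (\ z -> bb z A μ) (Nₚ.m∸n+n≡m B≤d)))))) ⟩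
    poch (u * y) (d ∸ B) * ∑< n (\ μ -> bb B μ zero * bb d A μ * wt y (B ∸ μ) (A ∸ μ)) ∎
    where
    e = d ∸ B
    m = n ∸ B
    n≡ : n ≡ B N.+ m
    n≡ = ≡.sym (Nₚ.m+[n∸m]≡n (Nₚ.<⇒≤ (Nₚ.≤-<-trans B≤d d<n)))
    e<m : e < m
    e<m = Nₚ.∸-monoˡ-< d<n B≤d
    lo : ∑< B (\ κ -> bb d κ B * qbin κ A * wt y (κ ∸ A) (κ ∸ B)) ≈ 0#
    lo = ∑<-0 B (\ κ κ<B -> *-zeroˡ-≈ (*-zeroˡ-≈ (bb-a<c d κ<B)))
    hi : ∑< m (\ k -> bb d (B N.+ k) B * qbin (B N.+ k) A * wt y (B N.+ k ∸ A) (B N.+ k ∸ B)) ≈ colL m y A B e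
    hi = ∑<-cong m (\ k -> trans (*-cong (*-congʳ (≡⇒≈ (≡.trans (cong (\ z -> bb z (B N.+ k) B) (≡.sym (Nₚ.m∸n+n≡m B≤d))) (bb-shift e k B))))
        (≈-cong (wt y (B N.+ k ∸ A)) (Nₚ.m+n∸m≡n B k)))
       (solve 3 (\ q r W -> q :* r :* W := r :* (q :* W)) refl _ _ _))
   column-identity (suc n) y (suc d) (suc A) (suc B) (suc C) (s≤s C≤A) (s≤s C≤B) (s≤s B≤d) (s≤s d<n) =
    trans (*-congˡ (trans (+-congʳ (*-zeroˡ-≈ (zeroˡ _))) (+-identityˡ _)))
     (trans (column-identity n y d A B C C≤A C≤B B≤d d<n)
      (*-congˡ (sym (trans (+-congʳ (*-zeroˡ-≈ (zeroˡ _))) (+-identityˡ _)))))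

   -- The case A = C = 0 of the column identity: on the right only μ = 0 survives.
   qbinomial-theorem : ∀ n y d B -> B ≤ d -> d < n -> ∑< n (\ κ -> bb d κ B * wt y κ (κ ∸ B)) ≈ poch (u * y) (d ∸ B) * u ^ B
   qbinomial-theorem n y d B B≤d d<n = trans (sym (trans (*-identityˡ _) (∑<-cong n (\ κ -> *-congʳ (*-identityʳ _)))))
    (trans (column-identity n y d 0 B 0 z≤n z≤n B≤d d<n)
     (*-congˡ (trans (∑<-cong n (\ μ -> trans (*-assoc _ _ _) (*-congˡ (*-congʳ (≈-cong (\ z -> bb z 0 μ) (≡.sym (Nₚ.m∸n+n≡m B≤d))))))) (colR-0 n y B (d ∸ B) (Nₚ.≤-<-trans B≤d d<n)))))

-- Partitions by column lengths, their branching polynomials, and the Pieri rule for these.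

data Desc (d : ℕ) : ∀ {m} -> Vec ℕ m -> Set where
 []  : Desc d []
 _∷_ : ∀ {a m} {v : Vec ℕ m} -> a ≤ d -> Desc a v -> Desc d (a ∷ v)

Desc? : ∀ d {m} (v : Vec ℕ m) -> Dec (Desc d v)
Desc? d [] = yes []
Desc? d (a ∷ v) with a N.≤? d | Desc? a v
... | yes p | yes q = yes (p ∷ q)
... | no ¬p | _ = no \ { (p ∷ _) -> ¬p p }
... | yes _ | no ¬q = no \ { (_ ∷ q) -> ¬q q }

Desc-zeros : ∀ d m -> Desc d (Vec.replicate m 0)
Desc-zeros d zero = []
Desc-zeros d (suc m) = z≤n ∷ Desc-zeros 0 m

private module _ (R : CRing) where
 open Kit R
 module Divisible (t : Carrier) where

  record Div (k : ℕ) (a : Carrier) : Set where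
   constructor _,_
   field
    quotient : Carrier
    divides : a ≈ t ^ k * quotient

  Div-0⇒≈0 : ∀ {k a} -> t ^ k ≈ 0# -> Div k a -> a ≈ 0#
  Div-0⇒≈0 z (c , e) = trans e (trans (*-congʳ z) (zeroˡ _))

  Div-resp : ∀ {k a b} -> a ≈ b -> Div k a -> Div k b
  Div-resp e (c , q) = c , trans (sym e) q

  Div-0 : ∀ k -> Div k 0#
  Div-0 k = 0# , sym (zeroʳ _)

  Div-+ : ∀ {k a b} -> Div k a -> Div k b -> Div k (a + b)
  Div-+ (c , q) (d , r) = c + d , trans (+-cong q r) (sym (distribˡ _ _ _))

  Div-* : ∀ {k l a b} -> Div k a -> Div l b -> Div (k N.+ l) (a * b)
  Div-* {k} {l} (c , q) (d , r) = c * d , trans (*-cong q r) (trans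
   (*-interchange _ _ _ _) (*-congʳ (sym (^-+ t k l))))

  Div-*ˡ : ∀ {k a} b -> Div k a -> Div k (b * a)
  Div-*ˡ b (c , q) = b * c , trans (*-congˡ q) (*-left-comm _ _ _)

  Div-*ʳ : ∀ {k a} b -> Div k a -> Div k (a * b)
  Div-*ʳ b d = Div-resp (*-comm _ _) (Div-*ˡ b d)

  Div-^ : ∀ {a} -> Div 1 a -> ∀ k -> Div k (a ^ k)
  Div-^ d zero = 1# , sym (*-identityˡ _)
  Div-^ d (suc k) = Div-* d (Div-^ d k)

  Div-≤ : ∀ {k l a} -> l ≤ k -> Div k a -> Div l a
  Div-≤ {k} {l} l≤k (c , q) = t ^ (k ∸ l) * c , trans q (trans (*-congʳ
   (trans (≈-cong (t ^_) (≡.sym (Nₚ.m+[n∸m]≡n l≤k))) (^-+ t l (k ∸ l)))) (*-assoc _ _ _))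

  Div-∑ : ∀ {A : Set} {k} (xs : List A) {f} -> (∀ x -> Div k (f x)) -> Div k (∑ xs f)
  Div-∑ {k = k} [] d = Div-0 k
  Div-∑ (x ∷ xs) d = Div-+ (d x) (Div-∑ xs d)

  Div-∏ : ∀ {A : Set} (xs : List A) {f} -> (∀ x -> Div 1 (f x)) -> Div (length xs) (∏ xs f)
  Div-∏ [] d = 1# , sym (*-identityˡ _)
  Div-∏ (x ∷ xs) d = Div-* (d x) (Div-∏ xs d)

private module _ (R : CRing) where
 open Kit R
 module _ (p : Carrier) where
  open QBinomial R p
  -- `D` stands in for an infinite bound on the first column. Nonzero terms have entries at most D,
  -- so a box of entries below N > D misses none of them.
  module Branching (D N : ℕ) (D<N : D < N) where

   box : (m : ℕ) -> List (Vec ℕ m)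
   box = allVecs (upTo N)

   ∑-box : ∀ m {f : Vec ℕ (suc m) -> Carrier} -> ∑ (box (suc m)) f ≈ ∑< N (\ k -> ∑ (box m) (\ v -> f (k ∷ v)))
   ∑-box m = trans (∑-concatMap (\ k -> map (k ∷_) (box m)) (upTo N)) (trans (∑-applyUpTo id N) (∑<-cong N (\ k -> ∑-map (k ∷_) (box m))))

   δ₀ : ∀ {m} -> Vec ℕ m -> Carrier
   δ₀ [] = 1#
   δ₀ (l ∷ λs) = δ l 0 * δ₀ λs

   ∑-δ₀ : ∀ m {f : Vec ℕ m -> Carrier} -> ∑ (box m) (\ v -> f v * δ₀ v) ≈ f (Vec.replicate m 0)
   ∑-δ₀ zero = trans (+-identityʳ _) (*-identityʳ _)
   ∑-δ₀ (suc m) {f} = begin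
    ∑ (box (suc m)) (\ v -> f v * δ₀ v) ≈⟨ ∑-box m ⟩
    ∑< N (\ k -> ∑ (box m) (\ v -> f (k ∷ v) * (δ k 0 * δ₀ v)))
     ≈⟨ ∑<-cong N (\ k -> trans (∑-cong (box m) (\ v -> *-left-comm _ _ _)) (∑-*ˡ (box m))) ⟩
    ∑< N (\ k -> δ k 0 * ∑ (box m) (\ v -> f (k ∷ v) * δ₀ v))
     ≈⟨ ∑<-single N 0 (Nₚ.≤-<-trans z≤n D<N) (\ k k≢0 -> *-zeroˡ-≈ (δ-≢ k≢0)) ⟩
    1# * ∑ (box m) (\ v -> f (0 ∷ v) * δ₀ v) ≈⟨ trans (*-identityˡ _) (∑-δ₀ m) ⟩
    f (0 ∷ Vec.replicate m 0) ∎

   yp : Carrier -> ℕ -> Carrier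
   yp y k = y ^ k * p ^ tri k

   -- The weight of one branching step from λ to μ, where the vectors list column lengths and `d` is
   -- the column before the first. With d = D tending to infinity the first binomial tends to
   -- 1/(p;p)_(l-c).
   PD : Carrier -> ∀ {m} -> ℕ -> Vec ℕ m -> Vec ℕ m -> Carrier
   PD y d [] [] = 1#
   PD y d (l ∷ λs) (c ∷ μs) = bb d l c * yp y (l ∸ c) * PD y l λs μs

   RD : List Carrier -> ∀ {m} -> Vec ℕ m -> Carrier
   RD [] λs = δ₀ λs
   RD (y ∷ ys) {m} λs = ∑ (box m) (\ μs -> PD y D λs μs * RD ys μs)

   PD-¬Desc : ∀ y {m} d (λs μs : Vec ℕ m) -> ¬ Desc d λs -> PD y d λs μs ≈ 0#
   PD-¬Desc y d [] [] ¬D = ⊥-elim (¬D [])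
   PD-¬Desc y d (l ∷ λs) (c ∷ μs) ¬D with l N.≤? d
   ... | yes l≤d = *-zeroʳ-≈ (PD-¬Desc y l λs μs (\ q -> ¬D (l≤d ∷ q)))
   ... | no l≰d = *-zeroˡ-≈ (*-zeroˡ-≈ (bb-d<a c (Nₚ.≰⇒> l≰d)))

   δ₀-¬Desc : ∀ {m} d (v : Vec ℕ m) -> ¬ Desc d v -> δ₀ v ≈ 0#
   δ₀-¬Desc d [] ¬D = ⊥-elim (¬D [])
   δ₀-¬Desc d (zero ∷ v) ¬D = *-zeroʳ-≈ (δ₀-¬Desc 0 v (\ q -> ¬D (z≤n ∷ q)))
   δ₀-¬Desc d (suc a ∷ v) ¬D = zeroˡ _

   RD-¬Desc : ∀ ys {m} (λs : Vec ℕ m) -> ¬ Desc D λs -> RD ys λs ≈ 0#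
   RD-¬Desc [] λs ¬D = δ₀-¬Desc D λs ¬D
   RD-¬Desc (y ∷ ys) {m} λs ¬D = ∑-0 (box m) (\ μs -> *-zeroˡ-≈ (PD-¬Desc y D λs μs ¬D))

   module _ (t : Carrier) where
    open Divisible R t

    -- In each step of a chain the drop of the first column is paid for by the same power of a
    -- letter divisible by t, and the drops add up to k. Hence long first columns vanish modulo a
    -- power of t.
    RD-Div : ∀ {ys} -> All (Div 1) ys -> ∀ {m} k (λs : Vec ℕ m) -> Div k (RD ys (k ∷ λs))
    RD-Div [] zero λs = _ , sym (*-identityˡ _)
    RD-Div [] (suc k) λs = Div-resp (sym (zeroˡ _)) (Div-0 (suc k))
    RD-Div {y ∷ ys} (dy ∷ dys) {m} k λs = Div-∑ (box (suc m)) term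
     where
     term : ∀ μs -> Div k (PD y D (k ∷ λs) μs * RD ys μs)
     term (c ∷ μs) with c N.≤? k
     ... | yes c≤k = subst (\ z -> Div z (PD y D (k ∷ λs) (c ∷ μs) * RD ys (c ∷ μs))) (Nₚ.m∸n+n≡m c≤k)
         (Div-* (Div-*ʳ _ (Div-*ˡ _ (Div-*ʳ _ (Div-^ dy (k ∸ c))))) (RD-Div dys c μs))
     ... | no c≰k = Div-resp (sym (*-zeroˡ-≈ (*-zeroˡ-≈ (*-zeroˡ-≈ (bb-a<c D (Nₚ.≰⇒> c≰k)))))) (Div-0 k)

   module Pieri (u : Carrier) where
    open Column u

    -- The Hall-Littlewood Pieri coefficient for multiplication by the e_r: the binomials
    -- [κ_i - κ_(i+1), κ_i - λ_i] of a vertical strip κ/λ, with u to the number of added boxes. κ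
    -- has one column more than λ.
    φ : ∀ {m} -> ℕ -> Vec ℕ m -> Vec ℕ m -> Carrier
    φ k [] [] = u ^ k
    φ k (l ∷ λs) (k′ ∷ κs) = bb k l k′ * u ^ (k ∸ l) * φ k′ λs κs

    private
     Rsum Lsum : Carrier -> ∀ {m} -> ℕ -> Vec ℕ m -> Vec ℕ (suc m) -> Carrier
     Rsum y {m} d λs νs = ∑< N (\ k -> ∑ (box m) (\ κs -> φ k λs κs * PD y d (k ∷ κs) νs))
     Lsum y {m} d λs (c ∷ νs) = ∑ (box m) (\ μs -> φ c μs νs * PD y d λs μs)

     colκ colμ : Carrier -> ℕ -> ℕ -> ℕ -> ℕ -> Carrier
     colκ y d l ν₁ ν₂ = ∑< N (\ κ -> bb d κ ν₁ * bb κ l ν₂ * wt y (κ ∸ l) (κ ∸ ν₁))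
     colμ y d l ν₁ ν₂ = ∑< N (\ μ -> bb ν₁ μ ν₂ * bb d l μ * wt y (ν₁ ∸ μ) (l ∸ μ))

     -- Trinomial revision removes the only factors that link k with the next entry k′; the sum over
     -- k then splits off as a single-column sum.
     Rsum-∷ : ∀ y {m} d l (λs : Vec ℕ m) ν₁ ν₂ νs -> Rsum y d (l ∷ λs) (ν₁ ∷ ν₂ ∷ νs) ≈ colκ y d l ν₁ ν₂ * Rsum y l λs (ν₂ ∷ νs)
     Rsum-∷ y {m} d l λs ν₁ ν₂ νs = begin
      Rsum y d (l ∷ λs) (ν₁ ∷ ν₂ ∷ νs) ≈⟨ ∑<-cong N (\ k -> trans (∑-box m) (∑<-cong N (\ k′ -> ∑-cong (box m) (term k k′)))) ⟩
      ∑< N (\ k -> ∑< N (\ k′ -> ∑ (box m) (\ κs -> c k * f k′ κs)))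
       ≈⟨ ∑<-cong N (\ k -> trans (∑<-cong N (\ k′ -> ∑-*ˡ (box m))) (∑<-*ˡ N {f = \ k′ -> ∑ (box m) (f k′)})) ⟩
      ∑< N (\ k -> c k * Rsum y l λs (ν₂ ∷ νs)) ≈⟨ trans (∑<-cong N (\ k -> *-comm _ _)) (∑<-*ˡ N {f = c}) ⟩
      Rsum y l λs (ν₂ ∷ νs) * colκ y d l ν₁ ν₂ ≈⟨ *-comm _ _ ⟩
      colκ y d l ν₁ ν₂ * Rsum y l λs (ν₂ ∷ νs) ∎
      where
      c : ℕ -> Carrier
      c k = bb d k ν₁ * bb k l ν₂ * wt y (k ∸ l) (k ∸ ν₁)
      f : ℕ -> Vec ℕ m -> Carrier
      f k′ κs = φ k′ λs κs * PD y l (k′ ∷ κs) (ν₂ ∷ νs)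
      term : ∀ k k′ κs -> (bb k l k′ * u ^ (k ∸ l) * φ k′ λs κs) * (bb d k ν₁ * yp y (k ∸ ν₁) * (bb k k′ ν₂ * yp y (k′ ∸ ν₂) * PD y k′ κs νs)) ≈ c k * f k′ κs
      term k k′ κs = begin
       (bb k l k′ * u ^ (k ∸ l) * φ k′ λs κs) * (bb d k ν₁ * yp y (k ∸ ν₁) * (bb k k′ ν₂ * yp y (k′ ∸ ν₂) * PD y k′ κs νs))
        ≈⟨ solve 8 (\ a U F b Y c Z P -> (a :* U :* F) :* (b :* Y :* (c :* Z :* P)) := (a :* c) :* (b :* (U :* Y) :* (F :* (Z :* P)))) refl _ _ _ _ _ _ _ _ ⟩
       (bb k l k′ * bb k k′ ν₂) * (bb d k ν₁ * (u ^ (k ∸ l) * yp y (k ∸ ν₁)) * (φ k′ λs κs * (yp y (k′ ∸ ν₂) * PD y k′ κs νs)))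
        ≈⟨ *-congʳ (bb-trinomial k l k′ ν₂) ⟩
       (bb k l ν₂ * bb l k′ ν₂) * (bb d k ν₁ * (u ^ (k ∸ l) * yp y (k ∸ ν₁)) * (φ k′ λs κs * (yp y (k′ ∸ ν₂) * PD y k′ κs νs)))
        ≈⟨ solve 7 (\ a c b W F Z P -> (a :* c) :* (b :* W :* (F :* (Z :* P))) := (b :* a :* W) :* (F :* (c :* Z :* P))) refl _ _ _ _ _ _ _ ⟩
       c k * f k′ κs ∎

     Lsum-∷ : ∀ y {m} d l (λs : Vec ℕ m) ν₁ ν₂ νs -> Lsum y d (l ∷ λs) (ν₁ ∷ ν₂ ∷ νs) ≈ colμ y d l ν₁ ν₂ * Lsum y l λs (ν₂ ∷ νs)
     Lsum-∷ y {m} d l λs ν₁ ν₂ νs = begin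
      Lsum y d (l ∷ λs) (ν₁ ∷ ν₂ ∷ νs) ≈⟨ trans (∑-box m) (∑<-cong N (\ μ -> ∑-cong (box m) (term μ))) ⟩
      ∑< N (\ μ -> ∑ (box m) (\ μs -> c μ * (φ ν₂ μs νs * PD y l λs μs)))
       ≈⟨ ∑<-cong N (\ μ -> trans (∑-*ˡ (box m)) (*-comm _ _)) ⟩
      ∑< N (\ μ -> Lsum y l λs (ν₂ ∷ νs) * c μ) ≈⟨ ∑<-*ˡ N {f = c} ⟩
      Lsum y l λs (ν₂ ∷ νs) * colμ y d l ν₁ ν₂ ≈⟨ *-comm _ _ ⟩
      colμ y d l ν₁ ν₂ * Lsum y l λs (ν₂ ∷ νs) ∎
      where
      c : ℕ -> Carrier
      c μ = bb ν₁ μ ν₂ * bb d l μ * wt y (ν₁ ∸ μ) (l ∸ μ)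
      term : ∀ μ μs -> (bb ν₁ μ ν₂ * u ^ (ν₁ ∸ μ) * φ ν₂ μs νs) * (bb d l μ * yp y (l ∸ μ) * PD y l λs μs) ≈ c μ * (φ ν₂ μs νs * PD y l λs μs)
      term μ μs = solve 6 (\ a U F b Y P -> (a :* U :* F) :* (b :* Y :* P) := (a :* b :* (U :* Y)) :* (F :* P)) refl _ _ _ _ _ _

     -- Adding a strip commutes with removing a letter up to a Pochhammer factor. Both sides factor
     -- over columns. `column-identity` handles one column at a time and hands the factor (-uy;p)
     -- from the bound l - ν₂ to d - ν₁; the last column is the q-binomial theorem.
     core : ∀ y {m} d (λs : Vec ℕ m) ν₁ νs -> d ≤ D -> Desc d (ν₁ ∷ νs) -> Rsum y d λs (ν₁ ∷ νs) ≈ poch (u * y) (d ∸ ν₁) * Lsum y d λs (ν₁ ∷ νs)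
     core y d [] ν₁ [] d≤D (ν₁≤d ∷ []) = begin
      ∑< N (\ k -> u ^ k * (bb d k ν₁ * yp y (k ∸ ν₁) * 1#) + 0#)
       ≈⟨ ∑<-cong N (\ k -> solve 3 (\ U b Y -> U :* (b :* Y :* 1ₚ) :+ 0ₚ := b :* (U :* Y)) refl _ _ _) ⟩
      ∑< N (\ k -> bb d k ν₁ * wt y k (k ∸ ν₁)) ≈⟨ qbinomial-theorem N y d ν₁ ν₁≤d (Nₚ.≤-<-trans d≤D D<N) ⟩
      poch (u * y) (d ∸ ν₁) * u ^ ν₁ ≈⟨ *-congˡ (solve 1 (\ U -> U := U :* 1ₚ :+ 0ₚ) refl _) ⟩
      poch (u * y) (d ∸ ν₁) * (u ^ ν₁ * 1# + 0#) ∎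
     core y d (l ∷ λs) ν₁ (ν₂ ∷ νs) d≤D (ν₁≤d ∷ (ν₂≤ν₁ ∷ Dν)) with ν₂ N.≤? l | l N.≤? d
     ... | yes ν₂≤l | yes l≤d = begin
      Rsum y d (l ∷ λs) (ν₁ ∷ ν₂ ∷ νs) ≈⟨ Rsum-∷ y d l λs ν₁ ν₂ νs ⟩
      colκ y d l ν₁ ν₂ * Rsum y l λs (ν₂ ∷ νs) ≈⟨ *-congˡ (core y l λs ν₂ νs (Nₚ.≤-trans l≤d d≤D) (ν₂≤l ∷ Dν)) ⟩
      colκ y d l ν₁ ν₂ * (poch (u * y) (l ∸ ν₂) * Lsum y l λs (ν₂ ∷ νs)) ≈⟨ solve 3 (\ a b c -> a :* (b :* c) := (b :* a) :* c) refl _ _ _ ⟩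
      (poch (u * y) (l ∸ ν₂) * colκ y d l ν₁ ν₂) * Lsum y l λs (ν₂ ∷ νs) ≈⟨ *-congʳ (column-identity N y d l ν₁ ν₂ ν₂≤l ν₂≤ν₁ ν₁≤d (Nₚ.≤-<-trans d≤D D<N)) ⟩
      (poch (u * y) (d ∸ ν₁) * colμ y d l ν₁ ν₂) * Lsum y l λs (ν₂ ∷ νs) ≈⟨ *-assoc _ _ _ ⟩
      poch (u * y) (d ∸ ν₁) * (colμ y d l ν₁ ν₂ * Lsum y l λs (ν₂ ∷ νs)) ≈⟨ *-congˡ (Lsum-∷ y d l λs ν₁ ν₂ νs) ⟨
      poch (u * y) (d ∸ ν₁) * Lsum y d (l ∷ λs) (ν₁ ∷ ν₂ ∷ νs) ∎
     ... | yes _ | no l≰d = both (\ k -> zeroκ k) (\ μ -> *-zeroˡ-≈ (*-zeroʳ-≈ (bb-d<a μ (Nₚ.≰⇒> l≰d))))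
      where
      zeroκ : ∀ k -> bb d k ν₁ * bb k l ν₂ * wt y (k ∸ l) (k ∸ ν₁) ≈ 0#
      zeroκ k with k N.≤? d
      ... | yes k≤d = *-zeroˡ-≈ (*-zeroʳ-≈ (bb-d<a ν₂ (Nₚ.≤-<-trans k≤d (Nₚ.≰⇒> l≰d))))
      ... | no k≰d = *-zeroˡ-≈ (*-zeroˡ-≈ (bb-d<a ν₁ (Nₚ.≰⇒> k≰d)))
      both : (∀ k -> bb d k ν₁ * bb k l ν₂ * wt y (k ∸ l) (k ∸ ν₁) ≈ 0#) -> (∀ μ -> bb ν₁ μ ν₂ * bb d l μ * wt y (ν₁ ∸ μ) (l ∸ μ) ≈ 0#) ->
         Rsum y d (l ∷ λs) (ν₁ ∷ ν₂ ∷ νs) ≈ poch (u * y) (d ∸ ν₁) * Lsum y d (l ∷ λs) (ν₁ ∷ ν₂ ∷ νs)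
      both a b = trans (trans (Rsum-∷ y d l λs ν₁ ν₂ νs) (*-zeroˡ-≈ (∑<-0 N (\ k _ -> a k))))
       (sym (*-zeroʳ-≈ (trans (Lsum-∷ y d l λs ν₁ ν₂ νs) (*-zeroˡ-≈ (∑<-0 N (\ k _ -> b k))))))
     ... | no ν₂≰l | _ = trans (trans (Rsum-∷ y d l λs ν₁ ν₂ νs) (*-zeroˡ-≈ (∑<-0 N (\ k _ -> a k))))
       (sym (*-zeroʳ-≈ (trans (Lsum-∷ y d l λs ν₁ ν₂ νs) (*-zeroˡ-≈ (∑<-0 N (\ k _ -> b k))))))
      where
      a : ∀ k -> bb d k ν₁ * bb k l ν₂ * wt y (k ∸ l) (k ∸ ν₁) ≈ 0#
      a k = *-zeroˡ-≈ (*-zeroʳ-≈ (bb-a<c k (Nₚ.≰⇒> ν₂≰l)))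
      b : ∀ μ -> bb ν₁ μ ν₂ * bb d l μ * wt y (ν₁ ∸ μ) (l ∸ μ) ≈ 0#
      b μ with ν₂ N.≤? μ
      ... | yes ν₂≤μ = *-zeroˡ-≈ (*-zeroʳ-≈ (bb-a<c d (Nₚ.<-≤-trans (Nₚ.≰⇒> ν₂≰l) ν₂≤μ)))
      ... | no ν₂≰μ = *-zeroˡ-≈ (*-zeroˡ-≈ (bb-a<c ν₁ (Nₚ.≰⇒> ν₂≰μ)))

     φ-zeros : ∀ {m} (λs : Vec ℕ m) -> φ 0 λs (Vec.replicate m 0) ≈ δ₀ λs
     φ-zeros [] = refl
     φ-zeros (zero ∷ λs) = *-cong (*-identityˡ _) (φ-zeros λs)
     φ-zeros (suc l ∷ λs) = trans (*-congʳ (zeroˡ _)) (trans (zeroˡ _) (sym (zeroˡ _)))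

    open Divisible R using (Div)

    -- The factor in `core` depends on the first column k through (-uy;p)_(D-k). For k < M it equals
    -- (-uy;p)_(D₀), since D - k ≥ D₀ and p^(D₀) = 0; for k ≥ M the branching polynomial is
    -- divisible by t^M = 0. The letters can then be moved across one by one.
    RD-Pieri : ∀ {t} D₀ M -> p ^ D₀ ≈ 0# -> t ^ M ≈ 0# -> M N.+ D₀ ≤ D -> ∀ {ys} -> All (Div t 1) ys -> ∀ {m} (λs : Vec ℕ m) ->
     ∏ ys (\ y -> poch (u * y) D₀) * RD ys λs ≈ ∑ (box (suc m)) (\ κs -> φ (Vec.head κs) λs (Vec.tail κs) * RD ys κs)
    RD-Pieri D₀ M pD tM le {[]} [] {m} λs = begin
     1# * δ₀ λs ≈⟨ trans (*-identityˡ _) (sym (φ-zeros λs)) ⟩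
     φ 0 λs (Vec.replicate m 0) ≈⟨ ∑-δ₀ (suc m) ⟨
     ∑ (box (suc m)) (\ κs -> φ (Vec.head κs) λs (Vec.tail κs) * δ₀ κs) ∎
    RD-Pieri {t} D₀ M pD tM le {y ∷ ys} (dy ∷ dys) {m} λs = begin
     (poch (u * y) D₀ * E) * ∑ (box m) (\ μs -> PD y D λs μs * RD ys μs)
      ≈⟨ trans (*-assoc _ _ _) (*-congˡ (trans (sym (∑-*ˡ (box m))) (∑-cong (box m) (\ μs ->
        trans (*-left-comm _ _ _) (*-congˡ (RD-Pieri D₀ M pD tM le dys μs)))))) ⟩
     poch (u * y) D₀ * ∑ (box m) (\ μs -> PD y D λs μs * ∑ (box (suc m)) (\ νs -> φ (Vec.head νs) μs (Vec.tail νs) * RD ys νs))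
      ≈⟨ *-congˡ (trans (∑-cong (box m) (\ μs -> sym (∑-*ˡ (box (suc m))))) (∑-swap (box m) (box (suc m)))) ⟩
     poch (u * y) D₀ * ∑ (box (suc m)) (\ νs -> ∑ (box m) (\ μs -> PD y D λs μs * (φ (Vec.head νs) μs (Vec.tail νs) * RD ys νs)))
      ≈⟨ trans (sym (∑-*ˡ (box (suc m)))) (∑-cong (box (suc m)) each) ⟩
     ∑ (box (suc m)) (\ νs -> ∑ (box (suc m)) (\ κs -> φ (Vec.head κs) λs (Vec.tail κs) * (PD y D κs νs * RD ys νs)))
      ≈⟨ ∑-swap (box (suc m)) (box (suc m)) ⟩
     ∑ (box (suc m)) (\ κs -> ∑ (box (suc m)) (\ νs -> φ (Vec.head κs) λs (Vec.tail κs) * (PD y D κs νs * RD ys νs)))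
      ≈⟨ ∑-cong (box (suc m)) (\ κs -> ∑-*ˡ (box (suc m))) ⟩
     ∑ (box (suc m)) (\ κs -> φ (Vec.head κs) λs (Vec.tail κs) * RD (y ∷ ys) κs) ∎
     where
     E = ∏ ys (\ y -> poch (u * y) D₀)

     stable : ∀ k νs -> poch (u * y) D₀ * RD ys {suc m} (k ∷ νs) ≈ poch (u * y) (D ∸ k) * RD ys (k ∷ νs)
     stable k νs with M N.≤? k
     ... | yes M≤k = trans (trans (*-congˡ z) (zeroʳ _)) (sym (trans (*-congˡ z) (zeroʳ _)))
      where
      z : RD ys (k ∷ νs) ≈ 0#
      z = Divisible.Div-0⇒≈0 R t tM (Divisible.Div-≤ R t M≤k (RD-Div t dys k νs))
     ... | no M≰k = *-congʳ (sym (trans (≈-cong (poch (u * y)) (≡.sym (Nₚ.m+[n∸m]≡n D₀≤))) (poch-stable (u * y) {D₀} (D ∸ k ∸ D₀) pD)))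
      where
      D₀≤ : D₀ ≤ D ∸ k
      D₀≤ = Nₚ.≤-trans (Nₚ.≤-reflexive (≡.sym (Nₚ.m+n∸m≡n k D₀))) (Nₚ.∸-monoˡ-≤ k (Nₚ.≤-trans (Nₚ.+-monoˡ-≤ D₀ (Nₚ.<⇒≤ (Nₚ.≰⇒> M≰k))) le))

     each : ∀ νs -> poch (u * y) D₀ * ∑ (box m) (\ μs -> PD y D λs μs * (φ (Vec.head νs) μs (Vec.tail νs) * RD ys νs)) ≈
      ∑ (box (suc m)) (\ κs -> φ (Vec.head κs) λs (Vec.tail κs) * (PD y D κs νs * RD ys νs))
     each (k ∷ νs) with Desc? D (k ∷ νs)
     ... | no ¬D = trans (*-zeroʳ-≈ (∑-0 (box m) (\ μs -> *-zeroʳ-≈ (trans (*-congˡ z) (zeroʳ _)))))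
         (sym (∑-0 (box (suc m)) (\ κs -> *-zeroʳ-≈ (trans (*-congˡ z) (zeroʳ _)))))
      where
      z : RD ys (k ∷ νs) ≈ 0#
      z = RD-¬Desc ys (k ∷ νs) ¬D
     ... | yes Dν = begin
      poch (u * y) D₀ * ∑ (box m) (\ μs -> PD y D λs μs * (φ k μs νs * r))
       ≈⟨ *-congˡ (trans (∑-cong (box m) (\ μs -> solve 3 (\ a b c -> a :* (b :* c) := (b :* a) :* c) refl _ _ _)) (∑-*ʳ (box m))) ⟩
      poch (u * y) D₀ * (Lsum y D λs (k ∷ νs) * r) ≈⟨ *-left-comm _ _ _ ⟩
      Lsum y D λs (k ∷ νs) * (poch (u * y) D₀ * r) ≈⟨ *-congˡ (stable k νs) ⟩
      Lsum y D λs (k ∷ νs) * (poch (u * y) (D ∸ k) * r) ≈⟨ solve 3 (\ a b c -> a :* (b :* c) := (b :* a) :* c) refl _ _ _ ⟩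
      (poch (u * y) (D ∸ k) * Lsum y D λs (k ∷ νs)) * r ≈⟨ *-congʳ (core y D λs k νs Nₚ.≤-refl Dν) ⟨
      Rsum y D λs (k ∷ νs) * r ≈⟨ *-congʳ (∑-box m) ⟨
      ∑ (box (suc m)) (\ κs -> φ (Vec.head κs) λs (Vec.tail κs) * PD y D (Vec.head κs ∷ Vec.tail κs) (k ∷ νs)) * r
       ≈⟨ trans (sym (∑-*ʳ (box (suc m)))) (∑-cong (box (suc m)) (\ { (a ∷ κs) -> *-assoc _ _ _ })) ⟩
      ∑ (box (suc m)) (\ κs -> φ (Vec.head κs) λs (Vec.tail κs) * (PD y D κs (k ∷ νs) * r)) ∎
      where
      r = RD ys (k ∷ νs)

-- Sums over subsets of an alphabet and Hall-Littlewood polynomials.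

private module _ {A : Set} where

 splits : List A -> List (List A × List A)
 splits [] = ([] , []) ∷ []
 splits (x ∷ xs) = map (\ ab -> x ∷ ab .fst , ab .snd) (splits xs) ++ map (\ ab -> ab .fst , x ∷ ab .snd) (splits xs)

 picks : List A -> List (A × List A)
 picks [] = []
 picks (x ∷ xs) = (x , xs) ∷ map (\ sr -> sr .fst , x ∷ sr .snd) (picks xs)

 splits-↭ : ∀ xs -> All (\ ab -> ab .fst ++ ab .snd ↭ xs) (splits xs)
 splits-↭ [] = Perm.refl ∷ []
 splits-↭ (x ∷ xs) = Allₚ.++⁺
  (Allₚ.map⁺ (All.map (prep x) (splits-↭ xs)))
  (Allₚ.map⁺ (All.map (\ {ab} p -> ↭-trans (Permₚ.shift x (ab .fst) (ab .snd)) (prep x p)) (splits-↭ xs)))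

 picks-↭ : ∀ xs -> All (\ sr -> sr .fst ∷ sr .snd ↭ xs) (picks xs)
 picks-↭ [] = []
 picks-↭ (x ∷ xs) = Perm.refl ∷ Allₚ.map⁺ (All.map (\ p -> ↭-trans (swap _ x Perm.refl) (prep x p)) (picks-↭ xs))

 splits-length : ∀ xs -> All (\ ab -> length (ab .fst) N.+ length (ab .snd) ≡ length xs) (splits xs)
 splits-length xs = All.map (\ {ab} p -> ≡.trans (≡.sym (Lₚ.length-++ (ab .fst))) (Permₚ.↭-length p)) (splits-↭ xs)

 AllPairs-↭ : ∀ {_#_ : A -> A -> Set} -> (∀ {a b} -> a # b -> b # a) -> ∀ {xs ys} -> xs ↭ ys -> AllPairs _#_ xs -> AllPairs _#_ ys
 AllPairs-↭ #-sym Perm.refl p = p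
 AllPairs-↭ #-sym (prep x q) (a ∷ p) = Permₚ.All-resp-↭ q a ∷ AllPairs-↭ #-sym q p
 AllPairs-↭ #-sym (swap x y q) ((xy ∷ a) ∷ (b ∷ p)) = (#-sym xy ∷ Permₚ.All-resp-↭ q b) ∷ (Permₚ.All-resp-↭ q a ∷ AllPairs-↭ #-sym q p)
 AllPairs-↭ #-sym (Perm.trans q r) p = AllPairs-↭ #-sym r (AllPairs-↭ #-sym q p)

 AllPairs-++ˡ : ∀ {_#_ : A -> A -> Set} xs {ys} -> AllPairs _#_ (xs ++ ys) -> AllPairs _#_ xs
 AllPairs-++ˡ [] p = []
 AllPairs-++ˡ (x ∷ xs) (a ∷ p) = Allₚ.++⁻ˡ xs a ∷ AllPairs-++ˡ xs p

 AllPairs-++ʳ : ∀ {_#_ : A -> A -> Set} xs {ys} -> AllPairs _#_ (xs ++ ys) -> AllPairs _#_ ys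
 AllPairs-++ʳ [] p = p
 AllPairs-++ʳ (x ∷ xs) (a ∷ p) = AllPairs-++ʳ xs p

All-zip : ∀ {A : Set} {P Q : A -> Set} {xs} -> All P xs -> All Q xs -> All (\ x -> P x × Q x) xs
All-zip [] [] = []
All-zip (p ∷ ps) (q ∷ qs) = (p , q) ∷ All-zip ps qs

private module Subsets (R : CRing) where
 open Kit R
 private variable A : Set

 ∑-splits : ∀ (x : A) xs {f} -> ∑ (splits (x ∷ xs)) f ≈
  ∑ (splits xs) (\ ab -> f (x ∷ ab .fst , ab .snd)) + ∑ (splits xs) (\ ab -> f (ab .fst , x ∷ ab .snd))
 ∑-splits x xs = trans (∑-++ (map _ (splits xs)) (map _ (splits xs))) (+-cong (∑-map _ (splits xs)) (∑-map _ (splits xs)))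

 ∑-picks : ∀ (x : A) xs {f} -> ∑ (picks (x ∷ xs)) f ≈ f (x , xs) + ∑ (picks xs) (\ sr -> f (sr .fst , x ∷ sr .snd))
 ∑-picks x xs = +-congˡ (∑-map _ (picks xs))

 -- Both sides run over the ordered decompositions into three blocks.
 splits-coassoc : ∀ (xs : List A) (f : List A -> List A -> List A -> Carrier) ->
  ∑ (splits xs) (\ ac -> ∑ (splits (ac .fst)) (\ bd -> f (bd .fst) (bd .snd) (ac .snd))) ≈
  ∑ (splits xs) (\ be -> ∑ (splits (be .snd)) (\ dc -> f (be .fst) (dc .fst) (dc .snd)))
 splits-coassoc [] f = refl
 splits-coassoc (x ∷ xs) f = begin
  ∑ (splits (x ∷ xs)) (\ ac -> ∑ (splits (ac .fst)) (\ bd -> f (bd .fst) (bd .snd) (ac .snd)))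
   ≈⟨ trans (∑-splits x xs) (+-congʳ (trans (∑-cong (splits xs) (\ ac -> ∑-splits x (ac .fst))) (∑-+ (splits xs)))) ⟩
  (X₁ + X₂) + X₃ ≈⟨ +-cong (+-cong (splits-coassoc xs (\ b -> f (x ∷ b))) (splits-coassoc xs (\ b d -> f b (x ∷ d)))) (splits-coassoc xs (\ b d c -> f b d (x ∷ c))) ⟩
  (Y₁ + Y₂) + Y₃ ≈⟨ +-assoc _ _ _ ⟩
  Y₁ + (Y₂ + Y₃) ≈⟨ trans (∑-splits x xs) (+-congˡ (trans (∑-cong (splits xs) (\ be -> ∑-splits x (be .snd))) (∑-+ (splits xs)))) ⟨
  ∑ (splits (x ∷ xs)) (\ be -> ∑ (splits (be .snd)) (\ dc -> f (be .fst) (dc .fst) (dc .snd))) ∎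
  where
  X₁ = ∑ (splits xs) (\ ac -> ∑ (splits (ac .fst)) (\ bd -> f (x ∷ bd .fst) (bd .snd) (ac .snd)))
  X₂ = ∑ (splits xs) (\ ac -> ∑ (splits (ac .fst)) (\ bd -> f (bd .fst) (x ∷ bd .snd) (ac .snd)))
  X₃ = ∑ (splits xs) (\ ac -> ∑ (splits (ac .fst)) (\ bd -> f (bd .fst) (bd .snd) (x ∷ ac .snd)))
  Y₁ = ∑ (splits xs) (\ be -> ∑ (splits (be .snd)) (\ dc -> f (x ∷ be .fst) (dc .fst) (dc .snd)))
  Y₂ = ∑ (splits xs) (\ be -> ∑ (splits (be .snd)) (\ dc -> f (be .fst) (x ∷ dc .fst) (dc .snd)))
  Y₃ = ∑ (splits xs) (\ be -> ∑ (splits (be .snd)) (\ dc -> f (be .fst) (dc .fst) (x ∷ dc .snd)))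

 splits-picks : ∀ (xs : List A) (f : A -> List A -> List A -> Carrier) ->
  ∑ (splits xs) (\ st -> ∑ (picks (st .fst)) (\ sr -> f (sr .fst) (sr .snd) (st .snd))) ≈
  ∑ (picks xs) (\ sx -> ∑ (splits (sx .snd)) (\ ab -> f (sx .fst) (ab .fst) (ab .snd)))
 splits-picks [] f = +-identityʳ _
 splits-picks (x ∷ xs) f = begin
  ∑ (splits (x ∷ xs)) (\ st -> ∑ (picks (st .fst)) (\ sr -> f (sr .fst) (sr .snd) (st .snd)))
   ≈⟨ trans (∑-splits x xs) (+-congʳ (trans (∑-cong (splits xs) (\ st -> ∑-picks x (st .fst))) (∑-+ (splits xs)))) ⟩
  (Z + X₂) + X₃ ≈⟨ +-cong (+-congˡ (splits-picks xs (\ s r -> f s (x ∷ r)))) (splits-picks xs (\ s r c -> f s r (x ∷ c))) ⟩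
  (Z + Y₂) + Y₃ ≈⟨ +-assoc _ _ _ ⟩
  Z + (Y₂ + Y₃) ≈⟨ trans (∑-picks x xs) (+-congˡ (trans (∑-cong (picks xs) (\ sr -> ∑-splits x (sr .snd))) (∑-+ (picks xs)))) ⟨
  ∑ (picks (x ∷ xs)) (\ sx -> ∑ (splits (sx .snd)) (\ ab -> f (sx .fst) (ab .fst) (ab .snd))) ∎
  where
  Z = ∑ (splits xs) (\ st -> f x (st .fst) (st .snd))
  X₂ = ∑ (splits xs) (\ st -> ∑ (picks (st .fst)) (\ sr -> f (sr .fst) (x ∷ sr .snd) (st .snd)))
  X₃ = ∑ (splits xs) (\ st -> ∑ (picks (st .fst)) (\ sr -> f (sr .fst) (sr .snd) (x ∷ st .snd)))
  Y₂ = ∑ (picks xs) (\ sx -> ∑ (splits (sx .snd)) (\ ab -> f (sx .fst) (x ∷ ab .fst) (ab .snd)))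
  Y₃ = ∑ (picks xs) (\ sx -> ∑ (splits (sx .snd)) (\ ab -> f (sx .fst) (ab .fst) (x ∷ ab .snd)))

 splits-δ0 : ∀ (xs : List A) {f : List A -> List A -> Carrier} -> ∑ (splits xs) (\ st -> δ (length (st .fst)) 0 * f (st .fst) (st .snd)) ≈ f [] xs
 splits-δ0 [] = trans (+-identityʳ _) (*-identityˡ _)
 splits-δ0 (x ∷ xs) {f} = trans (∑-splits x xs) (trans (+-cong (∑-0 (splits xs) (\ _ -> zeroˡ _)) (splits-δ0 xs {\ s t -> f s (x ∷ t)})) (+-identityˡ _))

-- h a b stands for a / (a - b) and w a b for (a - p b) / (a - b).
record Kernel (R : CRing) (I : Set) : Set₁ where
 open Kit R
 field
  p       : Carrier
  _#_     : I -> I -> Set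
  #-sym   : ∀ {a b} -> a # b -> b # a
  h       : I -> I -> Carrier
  h-sum   : ∀ {a b} -> a # b -> h a b + h b a ≈ 1#
  h-three : ∀ {s v y} -> s # v -> s # y -> v # y -> h s v * h s y ≈ h v y * h s v + h y v * h s y

private module _ (R : CRing) where
 open Kit R
 open Subsets R
 module Interpolation {I : Set} (K : Kernel R I) where
  open Kernel K

  w : I -> I -> Carrier
  w a b = p + (1# - p) * h a b

  private
   w-h : ∀ {s v y} -> s # v -> s # y -> v # y -> w s y * h s v ≈ w v y * h s v + (1# - p) * h y v * h s y
   w-h {s} {v} {y} sv sy vy = begin
    (p + (1# - p) * h s y) * h s v ≈⟨ solve 3 (\ p a b -> (p :+ (1ₚ :- p) :* a) :* b := p :* b :+ (1ₚ :- p) :* (b :* a)) refl _ _ _ ⟩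
    p * h s v + (1# - p) * (h s v * h s y) ≈⟨ +-congˡ (*-congˡ (h-three sv sy vy)) ⟩
    p * h s v + (1# - p) * (h v y * h s v + h y v * h s y)
     ≈⟨ solve 5 (\ p a b c d -> p :* b :+ (1ₚ :- p) :* (a :* b :+ c :* d) := (p :+ (1ₚ :- p) :* a) :* b :+ (1ₚ :- p) :* c :* d) refl _ _ _ _ _ ⟩
    w v y * h s v + (1# - p) * h y v * h s y ∎

   flip-h : ∀ {a b} -> a # b -> h b a ≈ 1# - h a b
   flip-h {a} {b} ab = trans (solve 2 (\ x y -> y := (x :+ y) :- x) refl (h a b) (h b a)) (+-congʳ (h-sum ab))

   picks-# : ∀ {y xs} -> All (y #_) xs -> All (\ sr -> y # sr .fst) (picks xs)
   picks-# {y} {xs} a = All.map (\ q -> All.head (Permₚ.All-resp-↭ (↭-sym q) a)) (picks-↭ xs)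

  -- Partial fractions of v ↦ ∏ (v - p x) / (v - x).
  partial-fractions : ∀ {v X} -> All (v #_) X -> AllPairs _#_ X ->
   ∏ X (w v) ≈ 1# - (1# - p) * ∑ (picks X) (\ sr -> ∏ (sr .snd) (w (sr .fst)) * h (sr .fst) v)
  partial-fractions {v} {[]} [] [] = solve 1 (\ p -> 1ₚ := 1ₚ :- (1ₚ :- p) :* 0ₚ) refl p
  partial-fractions {v} {y ∷ X} (vy ∷ vX) (yX ∷ XX) = begin
   W * ∏ X (w v) ≈⟨ *-congˡ (partial-fractions vX XX) ⟩
   W * (1# - (1# - p) * Sv) ≈⟨ solve 4 (\ p h Sv Sy -> let W = p :+ (1ₚ :- p) :* h; hyv = 1ₚ :- h; c = 1ₚ :- p in
      W :* (1ₚ :- c :* Sv) := 1ₚ :- c :* ((1ₚ :- c :* Sy) :* hyv :+ (W :* Sv :+ c :* hyv :* Sy))) refl p (h v y) Sv Sy ⟩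
   1# - (1# - p) * ((1# - (1# - p) * Sy) * (1# - h v y) + (W * Sv + (1# - p) * (1# - h v y) * Sy))
    ≈⟨ +-congˡ (-‿cong (*-congˡ (+-cong (*-cong (sym (partial-fractions yX XX)) (sym (flip-h vy))) (+-congˡ (*-congʳ (*-congˡ (sym (flip-h vy)))))))) ⟩
   1# - (1# - p) * (∏ X (w y) * h y v + (W * Sv + (1# - p) * h y v * Sy))
    ≈⟨ +-congˡ (-‿cong (*-congˡ (trans (∑-picks y X) (+-congˡ sum)))) ⟨
   1# - (1# - p) * ∑ (picks (y ∷ X)) (\ sr -> ∏ (sr .snd) (w (sr .fst)) * h (sr .fst) v) ∎
   where
   W = w v y
   term : I -> I × List I -> Carrier
   term z sr = ∏ (sr .snd) (w (sr .fst)) * h (sr .fst) z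
   Sv = ∑ (picks X) (term v)
   Sy = ∑ (picks X) (term y)
   sum : ∑ (picks X) (\ sr -> (w (sr .fst) y * ∏ (sr .snd) (w (sr .fst))) * h (sr .fst) v) ≈ W * Sv + (1# - p) * h y v * Sy
   sum = begin
    ∑ (picks X) (\ sr -> (w (sr .fst) y * ∏ (sr .snd) (w (sr .fst))) * h (sr .fst) v)
     ≈⟨ ∑-cong-All (All-zip (picks-# vX) (picks-# yX)) (\ { (s , r) (vs , ys) -> begin
       (w s y * ∏ r (w s)) * h s v ≈⟨ solve 3 (\ a b c -> (a :* b) :* c := b :* (a :* c)) refl _ _ _ ⟩
       ∏ r (w s) * (w s y * h s v) ≈⟨ *-congˡ (w-h (#-sym vs) (#-sym ys) vy) ⟩
       ∏ r (w s) * (W * h s v + (1# - p) * h y v * h s y)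
        ≈⟨ solve 5 (\ P W a c b -> P :* (W :* a :+ c :* b) := W :* (P :* a) :+ c :* (P :* b)) refl _ _ _ _ _ ⟩
       W * term v (s , r) + (1# - p) * h y v * term y (s , r) ∎ }) ⟩
    ∑ (picks X) (\ sr -> W * term v sr + (1# - p) * h y v * term y sr) ≈⟨ trans (∑-+ (picks X)) (+-cong (∑-*ˡ (picks X)) (∑-*ˡ (picks X))) ⟩
    W * Sv + (1# - p) * h y v * Sy ∎

  private
   pf-1 : ∀ {v X} -> All (v #_) X -> AllPairs _#_ X ->
    ∏ X (w v) + (1# - p) * ∑ (picks X) (\ sr -> ∏ (sr .snd) (w (sr .fst)) * h (sr .fst) v) ≈ 1#
   pf-1 vX XX = trans (+-congʳ (partial-fractions vX XX)) (solve 1 (\ a -> (1ₚ :- a) :+ a := 1ₚ) refl _)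

  -- A new letter y changes the products by w s y = p + (1-p) h s y. The part with h is what partial
  -- fractions need to complete ∏ w y to 1, which gives a recursion in the number of letters.
  interpolate-1 : ∀ {X} -> AllPairs _#_ X -> (1# - p) * ∑ (picks X) (\ sr -> ∏ (sr .snd) (w (sr .fst))) ≈ 1# - p ^ length X
  interpolate-1 {[]} [] = solve 1 (\ p -> (1ₚ :- p) :* 0ₚ := 1ₚ :- 1ₚ) refl p
  interpolate-1 {y ∷ X} (yX ∷ XX) = begin
   (1# - p) * ∑ (picks (y ∷ X)) (\ sr -> ∏ (sr .snd) (w (sr .fst))) ≈⟨ *-congˡ (trans (∑-picks y X) (+-congˡ sum)) ⟩
   (1# - p) * (∏ X (w y) + (p * S + (1# - p) * Sy)) ≈⟨ solve 4 (\ c P s t -> c :* (P :+ (s :+ t)) := c :* (P :+ t) :+ c :* s) refl _ _ _ _ ⟩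
   (1# - p) * (∏ X (w y) + (1# - p) * Sy) + (1# - p) * (p * S) ≈⟨ +-cong (*-congˡ (pf-1 yX XX)) (*-left-comm _ _ _) ⟩
   (1# - p) * 1# + p * ((1# - p) * S) ≈⟨ +-congˡ (*-congˡ (interpolate-1 XX)) ⟩
   (1# - p) * 1# + p * (1# - p ^ length X) ≈⟨ solve 2 (\ p q -> (1ₚ :- p) :* 1ₚ :+ p :* (1ₚ :- q) := 1ₚ :- p :* q) refl _ _ ⟩
   1# - p ^ suc (length X) ∎
   where
   S = ∑ (picks X) (\ sr -> ∏ (sr .snd) (w (sr .fst)))
   Sy = ∑ (picks X) (\ sr -> ∏ (sr .snd) (w (sr .fst)) * h (sr .fst) y)
   sum : ∑ (picks X) (\ sr -> w (sr .fst) y * ∏ (sr .snd) (w (sr .fst))) ≈ p * S + (1# - p) * Sy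
   sum = trans (∑-cong (picks X) (\ sr -> solve 4 (\ p c a P -> (p :+ c :* a) :* P := p :* P :+ c :* (P :* a)) refl _ _ _ _))
    (trans (∑-+ (picks X)) (+-cong (∑-*ˡ (picks X)) (∑-*ˡ (picks X))))

  module _ (x : I -> Carrier) where

   e : ℕ -> List I -> Carrier
   e zero X = 1#
   e (suc k) [] = 0#
   e (suc k) (i ∷ X) = e (suc k) X + x i * e k X

   e-↭ : ∀ k {X Y} -> X ↭ Y -> e k X ≈ e k Y
   e-↭ zero _ = refl
   e-↭ (suc k) Perm.refl = refl
   e-↭ (suc k) (prep i q) = +-cong (e-↭ (suc k) q) (*-congˡ (e-↭ k q))
   e-↭ (suc zero) (swap i j q) = trans (+-congʳ (+-congʳ (e-↭ 1 q)))
    (solve 3 (\ e a b -> (e :+ b :* 1ₚ) :+ a :* 1ₚ := (e :+ a :* 1ₚ) :+ b :* 1ₚ) refl _ _ _)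
   e-↭ (suc (suc k)) (swap i j q) = trans (+-cong (+-cong (e-↭ (suc (suc k)) q) (*-congˡ (e-↭ (suc k) q))) (*-congˡ (+-cong (e-↭ (suc k) q) (*-congˡ (e-↭ k q)))))
    (solve 5 (\ e₂ e₁ e₀ a b -> (e₂ :+ b :* e₁) :+ a :* (e₁ :+ b :* e₀) := (e₂ :+ a :* e₁) :+ b :* (e₁ :+ a :* e₀)) refl _ _ _ _ _)
   e-↭ (suc k) (Perm.trans q r) = trans (e-↭ (suc k) q) (e-↭ (suc k) r)

   module _ (h-x : ∀ {s y} -> s # y -> x s * h s y ≈ x s + x y * h s y) where

    -- As in `interpolate-1`, partial fractions absorb a new letter y; the rule `h-x` separates the
    -- terms that contain y from those that do not. The result evaluates the recursion `chain` when
    -- f is the letter itself.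
    interpolate-e : ∀ k {X} -> AllPairs _#_ X ->
     (1# - p) * ∑ (picks X) (\ sr -> ∏ (sr .snd) (w (sr .fst)) * (x (sr .fst) * e k (sr .snd))) ≈ (1# - p ^ suc k) * e (suc k) X
    interpolate-e k {[]} [] = trans (zeroʳ _) (sym (zeroʳ _))
    interpolate-e zero {y ∷ X} (yX ∷ XX) = begin
     (1# - p) * ∑ (picks (y ∷ X)) (\ sr -> ∏ (sr .snd) (w (sr .fst)) * (x (sr .fst) * 1#)) ≈⟨ *-congˡ (trans (∑-picks y X) (+-congˡ sum)) ⟩
     (1# - p) * (∏ X (w y) * (x y * 1#) + (T + x y * ((1# - p) * Sy)))
      ≈⟨ solve 5 (\ c P y T S -> c :* (P :* (y :* 1ₚ) :+ (T :+ y :* (c :* S))) := c :* T :+ c :* (y :* (P :+ c :* S))) refl _ _ _ _ _ ⟩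
     (1# - p) * T + (1# - p) * (x y * (∏ X (w y) + (1# - p) * Sy)) ≈⟨ +-cong (interpolate-e zero XX) (*-congˡ (*-congˡ (pf-1 yX XX))) ⟩
     (1# - p ^ 1) * e 1 X + (1# - p) * (x y * 1#) ≈⟨ solve 3 (\ p e y -> (1ₚ :- p :* 1ₚ) :* e :+ (1ₚ :- p) :* (y :* 1ₚ) := (1ₚ :- p :* 1ₚ) :* (e :+ y :* 1ₚ)) refl _ _ _ ⟩
     (1# - p ^ 1) * (e 1 X + x y * 1#) ∎
     where
     T = ∑ (picks X) (\ sr -> ∏ (sr .snd) (w (sr .fst)) * (x (sr .fst) * 1#))
     Sy = ∑ (picks X) (\ sr -> ∏ (sr .snd) (w (sr .fst)) * h (sr .fst) y)
     sum : ∑ (picks X) (\ sr -> (w (sr .fst) y * ∏ (sr .snd) (w (sr .fst))) * (x (sr .fst) * 1#)) ≈ T + x y * ((1# - p) * Sy)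
     sum = trans (∑-cong-All (picks-# yX) (\ { (s , r) ys -> begin
       ((p + (1# - p) * h s y) * ∏ r (w s)) * (x s * 1#)
        ≈⟨ solve 4 (\ p a P x -> ((p :+ (1ₚ :- p) :* a) :* P) :* (x :* 1ₚ) := P :* (p :* x) :+ P :* ((1ₚ :- p) :* (x :* a))) refl _ _ _ _ ⟩
       ∏ r (w s) * (p * x s) + ∏ r (w s) * ((1# - p) * (x s * h s y)) ≈⟨ +-congˡ (*-congˡ (*-congˡ (h-x (#-sym ys)))) ⟩
       ∏ r (w s) * (p * x s) + ∏ r (w s) * ((1# - p) * (x s + x y * h s y))
        ≈⟨ solve 5 (\ p a P x y -> P :* (p :* x) :+ P :* ((1ₚ :- p) :* (x :+ y :* a)) := P :* (x :* 1ₚ) :+ y :* ((1ₚ :- p) :* (P :* a))) refl _ _ _ _ _ ⟩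
       ∏ r (w s) * (x s * 1#) + x y * ((1# - p) * (∏ r (w s) * h s y)) ∎ }))
      (trans (∑-+ (picks X)) (+-congˡ (trans (∑-*ˡ (picks X)) (*-congˡ (∑-*ˡ (picks X))))))
    interpolate-e (suc j) {y ∷ X} (yX ∷ XX) = begin
     (1# - p) * ∑ (picks (y ∷ X)) (\ sr -> ∏ (sr .snd) (w (sr .fst)) * (x (sr .fst) * e k (sr .snd))) ≈⟨ *-congˡ (trans (∑-picks y X) (+-congˡ sum)) ⟩
     (1# - p) * (∏ X (w y) * (x y * e k X) + (T + (p * x y * Tj + x y * e k X * ((1# - p) * Sy))))
      ≈⟨ solve 8 (\ c P y E T p Tj S -> c :* (P :* (y :* E) :+ (T :+ (p :* y :* Tj :+ y :* E :* (c :* S)))) :=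
         c :* T :+ (p :* y :* (c :* Tj) :+ c :* (y :* E :* (P :+ c :* S)))) refl _ _ _ _ _ _ _ _ ⟩
     (1# - p) * T + (p * x y * ((1# - p) * Tj) + (1# - p) * (x y * e k X * (∏ X (w y) + (1# - p) * Sy)))
      ≈⟨ +-cong (interpolate-e (suc j) XX) (+-cong (*-congˡ (interpolate-e j XX)) (*-congˡ (*-congˡ (pf-1 yX XX)))) ⟩
     (1# - p ^ suc k) * e (suc k) X + (p * x y * ((1# - p ^ k) * e k X) + (1# - p) * (x y * e k X * 1#))
      ≈⟨ solve 5 (\ p q y E₁ E -> (1ₚ :- p :* q) :* E₁ :+ (p :* y :* ((1ₚ :- q) :* E) :+ (1ₚ :- p) :* (y :* E :* 1ₚ)) := (1ₚ :- p :* q) :* (E₁ :+ y :* E)) refl _ _ _ _ _ ⟩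
     (1# - p ^ suc k) * (e (suc k) X + x y * e k X) ∎
     where
     k = suc j
     T = ∑ (picks X) (\ sr -> ∏ (sr .snd) (w (sr .fst)) * (x (sr .fst) * e k (sr .snd)))
     Tj = ∑ (picks X) (\ sr -> ∏ (sr .snd) (w (sr .fst)) * (x (sr .fst) * e j (sr .snd)))
     Sy = ∑ (picks X) (\ sr -> ∏ (sr .snd) (w (sr .fst)) * h (sr .fst) y)
     sum : ∑ (picks X) (\ sr -> (w (sr .fst) y * ∏ (sr .snd) (w (sr .fst))) * (x (sr .fst) * (e k (sr .snd) + x y * e j (sr .snd))))
        ≈ T + (p * x y * Tj + x y * e k X * ((1# - p) * Sy))
     sum = trans (∑-cong-All (All-zip (picks-# yX) (picks-↭ X)) (\ { (s , r) (ys , q) -> begin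
       ((p + (1# - p) * h s y) * ∏ r (w s)) * (x s * (e k r + x y * e j r))
        ≈⟨ solve 7 (\ p a P x y E F -> ((p :+ (1ₚ :- p) :* a) :* P) :* (x :* (E :+ y :* F)) :=
          P :* (p :* x :* E :+ p :* y :* (x :* F)) :+ P :* ((1ₚ :- p) :* ((x :* a) :* E :+ y :* a :* (x :* F)))) refl _ _ _ _ _ _ _ ⟩
       ∏ r (w s) * (p * x s * e k r + p * x y * (x s * e j r)) + ∏ r (w s) * ((1# - p) * ((x s * h s y) * e k r + x y * h s y * (x s * e j r)))
        ≈⟨ +-congˡ (*-congˡ (*-congˡ (+-cong (*-congʳ (h-x (#-sym ys))) (*-congˡ (drop s r q))))) ⟩
       ∏ r (w s) * (p * x s * e k r + p * x y * (x s * e j r)) + ∏ r (w s) * ((1# - p) * ((x s + x y * h s y) * e k r + x y * h s y * (e k X - e k r)))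
        ≈⟨ solve 8 (\ p a P x y E F G -> P :* (p :* x :* E :+ p :* y :* (x :* F)) :+ P :* ((1ₚ :- p) :* ((x :+ y :* a) :* E :+ y :* a :* (G :- E)))
          := P :* (x :* E) :+ (p :* y :* (P :* (x :* F)) :+ y :* G :* ((1ₚ :- p) :* (P :* a)))) refl _ _ _ _ _ _ _ _ ⟩
       ∏ r (w s) * (x s * e k r) + (p * x y * (∏ r (w s) * (x s * e j r)) + x y * e k X * ((1# - p) * (∏ r (w s) * h s y))) ∎ }))
      (trans (∑-+ (picks X)) (+-congˡ (trans (∑-+ (picks X)) (+-cong (∑-*ˡ (picks X)) (trans (∑-*ˡ (picks X)) (*-congˡ (∑-*ˡ (picks X))))))))
      where
      drop : ∀ s r -> s ∷ r ↭ X -> x s * e j r ≈ e k X - e k r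
      drop s r q = trans (solve 2 (\ a b -> a := (b :+ a) :- b) refl _ (e k r)) (+-congʳ (e-↭ k q))

record Alphabet (R : CRing) (I : Set) : Set₁ where
 open Kit R
 field
  kernel : Kernel R I
 open Kernel kernel public
 field
  x        : I -> Carrier
  h-x      : ∀ {s y} -> s # y -> x s * h s y ≈ x s + x y * h s y
  unit     : ℕ -> Carrier
  unit-inv : ∀ k -> (1# - p ^ suc k) * unit k ≈ 1#

private module _ (R : CRing) where
 open Kit R
 open Subsets R
 module HallLittlewood {I : Set} (𝔸 : Alphabet R I) where
  open Alphabet 𝔸
  open Interpolation R kernel public
  open QBinomial R p

  Distinct : List I -> Set
  Distinct = AllPairs _#_

  arr : List I -> List I -> Carrier
  arr S Y = ∏ S (\ s -> ∏ Y (w s))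

  xs : List I -> Carrier
  xs S = ∏ S x

  ∏-split : ∀ S Y {X : List I} {f} -> S ++ Y ↭ X -> ∏ S f * ∏ Y f ≈ ∏ X f
  ∏-split S Y q = trans (sym (∏-++ S Y)) (∏-↭ q)

  arr-splitʳ : ∀ A S Y {X} -> S ++ Y ↭ X -> arr A S * arr A Y ≈ arr A X
  arr-splitʳ A S Y q = trans (sym (∏-* A)) (∏-cong A (\ a -> ∏-split S Y q))

  Distinct-↭ : ∀ S Y {X} -> S ++ Y ↭ X -> Distinct X -> Distinct S × Distinct Y
  Distinct-↭ S Y q dX = AllPairs-++ˡ S dSY , AllPairs-++ʳ S dSY
   where dSY = AllPairs-↭ #-sym (↭-sym q) dX

  δ-subst : ∀ {m n} (g : ℕ -> Carrier) -> δ m n * g m ≈ δ m n * g n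
  δ-subst {m} {n} g with m N.≟ n
  ... | yes ≡.refl = refl
  ... | no m≢n = trans (*-zeroˡ-≈ (δ-≢ m≢n)) (sym (*-zeroˡ-≈ (δ-≢ m≢n)))

  private
   -- A weighted sum over the k-element subsets. The weight 1 yields a q-binomial and the weight x
   -- yields e_k, the Hall-Littlewood polynomial of a single column.
   Z : (I -> Carrier) -> ℕ -> List I -> Carrier
   Z f k X = ∑ (splits X) (\ st -> δ (length (st .fst)) k * (∏ (st .fst) f * arr (st .fst) (st .snd)))

   -- Averaging over the choice of one element of the subset lowers its size.
   chain : ∀ f k {X} -> Distinct X -> (1# - p ^ suc k) * Z f (suc k) X ≈
    (1# - p) * ∑ (picks X) (\ sr -> ∏ (sr .snd) (w (sr .fst)) * (f (sr .fst) * Z f k (sr .snd)))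
   chain f k {X} dX = begin
    (1# - p ^ suc k) * Z f (suc k) X ≈⟨ ∑-*ˡ (splits X) ⟨
    ∑ (splits X) (\ st -> (1# - p ^ suc k) * (δ (length (st .fst)) (suc k) * (∏ (st .fst) f * arr (st .fst) (st .snd))))
     ≈⟨ ∑-cong-All (splits-↭ X) (\ { (S , Y) q -> step S Y q }) ⟩
    ∑ (splits X) (\ st -> (1# - p) * ∑ (picks (st .fst)) (\ sr -> F (sr .fst) (sr .snd) (st .snd)))
     ≈⟨ trans (∑-*ˡ (splits X)) (*-congˡ (splits-picks X F)) ⟩
    (1# - p) * ∑ (picks X) (\ sx -> ∑ (splits (sx .snd)) (\ ab -> F (sx .fst) (ab .fst) (ab .snd)))
     ≈⟨ *-congˡ (∑-cong (picks X) (\ { (s , X′) -> trans (∑-cong-All (splits-↭ X′) (\ { (r , Y) q -> regroup s r Y q }))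
        (trans (∑-*ˡ (splits X′)) (*-congˡ (∑-*ˡ (splits X′)))) })) ⟩
    (1# - p) * ∑ (picks X) (\ sr -> ∏ (sr .snd) (w (sr .fst)) * (f (sr .fst) * Z f k (sr .snd))) ∎
    where
    F : I -> List I -> List I -> Carrier
    F s r Y = δ (length r) k * (∏ r (w s) * ((f s * ∏ r f) * (∏ Y (w s) * arr r Y)))
    regroup : ∀ s r Y {X′} -> r ++ Y ↭ X′ -> F s r Y ≈ ∏ X′ (w s) * (f s * (δ (length r) k * (∏ r f * arr r Y)))
    regroup s r Y q = trans (solve 6 (\ d W f F V A -> d :* (W :* ((f :* F) :* (V :* A))) := (W :* V) :* (f :* (d :* (F :* A)))) refl _ _ _ _ _ _)
     (*-congʳ (∏-split r Y q))
    step : ∀ S Y -> S ++ Y ↭ X -> (1# - p ^ suc k) * (δ (length S) (suc k) * (∏ S f * arr S Y)) ≈ (1# - p) * ∑ (picks S) (\ sr -> F (sr .fst) (sr .snd) Y)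
    step S Y q = begin
     (1# - p ^ suc k) * (δ (length S) (suc k) * (∏ S f * arr S Y))
      ≈⟨ solve 3 (\ a d b -> a :* (d :* b) := (d :* a) :* b) refl _ _ _ ⟩
     (δ (length S) (suc k) * (1# - p ^ suc k)) * (∏ S f * arr S Y)
      ≈⟨ *-congʳ (trans (sym (δ-subst {length S} {suc k} (\ n -> 1# - p ^ n))) (*-congˡ (sym (interpolate-1 (fst (Distinct-↭ S Y q dX)))))) ⟩
     (δ (length S) (suc k) * ((1# - p) * ∑ (picks S) (\ sr -> ∏ (sr .snd) (w (sr .fst))))) * (∏ S f * arr S Y)
      ≈⟨ solve 4 (\ d c s b -> (d :* (c :* s)) :* b := c :* ((d :* b) :* s)) refl _ _ _ _ ⟩
     (1# - p) * ((δ (length S) (suc k) * (∏ S f * arr S Y)) * ∑ (picks S) (\ sr -> ∏ (sr .snd) (w (sr .fst))))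
      ≈⟨ *-congˡ (trans (sym (∑-*ˡ (picks S))) (∑-cong-All (picks-↭ S) (\ { (s , r) q′ -> trans
        (*-congʳ (*-cong (≈-cong (\ n -> δ n (suc k)) (≡.sym (Permₚ.↭-length q′))) (*-cong (sym (∏-↭ q′)) (sym (∏-↭ q′)))))
        (solve 4 (\ d a b c -> (d :* (a :* b)) :* c := d :* (c :* (a :* b))) refl _ _ _ _) }))) ⟩
     (1# - p) * ∑ (picks S) (\ sr -> F (sr .fst) (sr .snd) Y) ∎

   iqf : ∀ n -> Σ Carrier \ c -> qf n * c ≈ 1#
   iqf zero = 1# , *-identityˡ _
   iqf (suc n) with iqf n
   ... | c , e = c * unit n , trans (*-interchange _ _ _ _)
           (trans (*-cong e (unit-inv n)) (*-identityˡ _))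

   qbin-absorb : ∀ n k -> (1# - p ^ suc n) * qbin n k ≈ (1# - p ^ suc k) * qbin (suc n) (suc k)
   qbin-absorb n k with k N.≤? n
   ... | no k≰n = trans (*-zeroʳ-≈ (qbin-< (Nₚ.≰⇒> k≰n))) (sym (*-zeroʳ-≈ (qbin-< (s≤s (Nₚ.≰⇒> k≰n)))))
   ... | yes k≤n = subst (\ n -> (1# - p ^ suc n) * qbin n k ≈ (1# - p ^ suc k) * qbin (suc n) (suc k)) (Nₚ.m+[n∸m]≡n k≤n)
     (unit-cancel {c = qf k * qf b} {fst (iqf k) * fst (iqf b)}
      (trans (*-interchange _ _ _ _) (trans (*-cong (snd (iqf k)) (snd (iqf b))) (*-identityˡ _)))
      (begin
       (qf k * qf b) * ((1# - p ^ suc (k N.+ b)) * qbin (k N.+ b) k) ≈⟨ solve 3 (\ a b c -> a :* (b :* c) := (c :* a) :* b) refl _ _ _ ⟩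
       (qbin (k N.+ b) k * (qf k * qf b)) * (1# - p ^ suc (k N.+ b)) ≈⟨ *-congʳ (qbin-qf k b) ⟩
       qf (suc k N.+ b) ≈⟨ qbin-qf (suc k) b ⟨
       qbin (suc k N.+ b) (suc k) * ((qf k * (1# - p ^ suc k)) * qf b)
        ≈⟨ solve 4 (\ a b c d -> a :* ((b :* c) :* d) := (b :* d) :* (c :* a)) refl _ _ _ _ ⟩
       (qf k * qf b) * ((1# - p ^ suc k) * qbin (suc (k N.+ b)) (suc k)) ∎))
    where b = n ∸ k

   ∏-one : ∀ (S : List I) -> ∏ S (\ _ -> 1#) ≈ 1#
   ∏-one S = ∏-1 S (\ _ -> refl)

   -- After `chain`, the inductive hypothesis no longer depends on the removed letter, so the
   -- remaining sum is `interpolate-1` and the recursion is that of the q-binomial.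
   Z-1 : ∀ k X -> Distinct X -> Z (\ _ -> 1#) k X ≈ qbin (length X) k
   Z-1 zero X _ = trans (splits-δ0 X {\ S Y -> ∏ S (\ _ -> 1#) * arr S Y}) (*-identityˡ _)
   Z-1 (suc k) [] _ = trans (+-identityʳ _) (zeroˡ _)
   Z-1 (suc k) X@(i ∷ X′) dX = unit-cancel (unit-inv k) (begin
    (1# - p ^ suc k) * Z (\ _ -> 1#) (suc k) X ≈⟨ chain (\ _ -> 1#) k dX ⟩
    (1# - p) * ∑ (picks X) (\ sr -> ∏ (sr .snd) (w (sr .fst)) * (1# * Z (\ _ -> 1#) k (sr .snd)))
     ≈⟨ *-congˡ (∑-cong-All (picks-↭ X) (\ { (s , r) q -> trans (*-congˡ (trans (*-identityˡ _) (trans (Z-1 k r (AllPairs.tail (AllPairs-↭ #-sym (↭-sym q) dX)))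
       (≈-cong (\ n -> qbin n k) (Nₚ.suc-injective (Permₚ.↭-length q)))))) (*-comm _ _) })) ⟩
    (1# - p) * ∑ (picks X) (\ sr -> qbin (length X′) k * ∏ (sr .snd) (w (sr .fst)))
     ≈⟨ trans (*-congˡ (∑-*ˡ (picks X))) (solve 3 (\ a b c -> a :* (b :* c) := (a :* c) :* b) refl _ _ _) ⟩
    ((1# - p) * ∑ (picks X) (\ sr -> ∏ (sr .snd) (w (sr .fst)))) * qbin (length X′) k ≈⟨ *-congʳ (interpolate-1 dX) ⟩
    (1# - p ^ suc (length X′)) * qbin (length X′) k ≈⟨ qbin-absorb (length X′) k ⟩
    (1# - p ^ suc k) * qbin (suc (length X′)) (suc k) ∎)

   Z-x : ∀ k X -> Distinct X -> Z x k X ≈ e x k X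
   Z-x zero X _ = trans (splits-δ0 X {\ S Y -> xs S * arr S Y}) (*-identityˡ _)
   Z-x (suc k) [] _ = trans (+-identityʳ _) (zeroˡ _)
   Z-x (suc k) X@(i ∷ X′) dX = unit-cancel (unit-inv k) (begin
    (1# - p ^ suc k) * Z x (suc k) X ≈⟨ chain x k dX ⟩
    (1# - p) * ∑ (picks X) (\ sr -> ∏ (sr .snd) (w (sr .fst)) * (x (sr .fst) * Z x k (sr .snd)))
     ≈⟨ *-congˡ (∑-cong-All (picks-↭ X) (\ { (s , r) q -> *-congˡ (*-congˡ (Z-x k r (AllPairs.tail (AllPairs-↭ #-sym (↭-sym q) dX)))) })) ⟩
    (1# - p) * ∑ (picks X) (\ sr -> ∏ (sr .snd) (w (sr .fst)) * (x (sr .fst) * e x k (sr .snd))) ≈⟨ interpolate-e x h-x k dX ⟩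
    (1# - p ^ suc k) * e x (suc k) X ∎)

  -- The Hall–Littlewood polynomial whose conjugate partition is the given sequence.
  Pf : ∀ {m} -> Vec ℕ m -> List I -> Carrier
  Pf [] X = 1#
  Pf (l ∷ λs) X = ∑ (splits X) (\ ab -> δ (length (ab .fst)) l * (xs (ab .fst) * arr (ab .fst) (ab .snd) * Pf λs (ab .fst)))

  private
   bb-sum : ∀ c a X -> Distinct X -> ∑ (splits X) (\ cs -> δ (c N.+ length (cs .fst)) a * arr (cs .fst) (cs .snd)) ≈ bb (c N.+ length X) a c
   bb-sum zero a X dX = trans (∑-cong (splits X) (\ { (S , Y) -> *-congˡ (sym (*-oneˡ-≈ (∏-one S))) })) (Z-1 a X dX)
   bb-sum (suc c) zero X dX = ∑-0 (splits X) (\ _ -> zeroˡ _)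
   bb-sum (suc c) (suc a) X dX = bb-sum c a X dX

   -- The sum is regrouped by the support B of the first column of the inner polynomial. The sets of
   -- size a between B and X then contribute a binomial independent of B.
   grow : ∀ {m} a c (νs : Vec ℕ m) X -> Distinct X ->
    ∑ (splits X) (\ as -> δ (length (as .fst)) a * (arr (as .fst) (as .snd) * Pf (c ∷ νs) (as .fst))) ≈ bb (length X) a c * Pf (c ∷ νs) X
   grow a c νs X dX = begin
    ∑ (splits X) (\ as -> δ (length (as .fst)) a * (arr (as .fst) (as .snd) * Pf (c ∷ νs) (as .fst)))
     ≈⟨ ∑-cong (splits X) (\ { (A , S) -> trans (trans (sym (*-assoc _ _ _)) (sym (∑-*ˡ (splits A))))
       (∑-cong-All (All-zip (splits-↭ A) (splits-length A)) (\ { (B , C) (q , ln) -> expand A S B C q ln })) }) ⟩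
    ∑ (splits X) (\ as -> ∑ (splits (as .fst)) (\ bc -> F (bc .fst) (bc .snd) (as .snd))) ≈⟨ splits-coassoc X F ⟩
    ∑ (splits X) (\ be -> ∑ (splits (be .snd)) (\ cs -> F (be .fst) (cs .fst) (cs .snd)))
     ≈⟨ ∑-cong-All (All-zip (splits-↭ X) (splits-length X)) (\ { (B , E) (q , ln) -> collect B E q ln }) ⟩
    ∑ (splits X) (\ be -> bb (length X) a c * (δ (length (be .fst)) c * (xs (be .fst) * arr (be .fst) (be .snd) * Pf νs (be .fst)))) ≈⟨ ∑-*ˡ (splits X) ⟩
    bb (length X) a c * Pf (c ∷ νs) X ∎
    where
    F : List I -> List I -> List I -> Carrier
    F B C S = δ (length B) c * (xs B * (arr B C * arr B S) * Pf νs B) * (δ (length B N.+ length C) a * arr C S)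
    expand : ∀ A S B C -> B ++ C ↭ A -> length B N.+ length C ≡ length A ->
     δ (length A) a * arr A S * (δ (length B) c * (xs B * arr B C * Pf νs B)) ≈ F B C S
    expand A S B C q ln = trans (*-congʳ (*-cong (≈-cong (\ n -> δ n a) (≡.sym ln)) (sym (∏-split B C q))))
     (solve 7 (\ d BS CS d′ X BC P -> d :* (BS :* CS) :* (d′ :* (X :* BC :* P)) := d′ :* (X :* (BC :* BS) :* P) :* (d :* CS)) refl _ _ _ _ _ _ _)
    collect : ∀ B E -> B ++ E ↭ X -> length B N.+ length E ≡ length X ->
     ∑ (splits E) (\ cs -> F B (cs .fst) (cs .snd)) ≈ bb (length X) a c * (δ (length B) c * (xs B * arr B E * Pf νs B))
    collect B E q ln = begin
     ∑ (splits E) (\ cs -> F B (cs .fst) (cs .snd))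
      ≈⟨ ∑-cong-All (splits-↭ E) (\ { (C , S) q′ -> *-congʳ (*-congˡ (*-congʳ (*-congˡ (arr-splitʳ B C S q′)))) }) ⟩
     ∑ (splits E) (\ cs -> δ (length B) c * (xs B * arr B E * Pf νs B) * (δ (length B N.+ length (cs .fst)) a * arr (cs .fst) (cs .snd)))
      ≈⟨ trans (∑-*ˡ (splits E)) (solve 3 (\ d b g -> d :* b :* g := (d :* g) :* b) refl _ _ _) ⟩
     (δ (length B) c * ∑ (splits E) (\ cs -> δ (length B N.+ length (cs .fst)) a * arr (cs .fst) (cs .snd))) * (xs B * arr B E * Pf νs B)
      ≈⟨ *-congʳ (trans (*-congˡ (trans (bb-sum (length B) a E (snd (Distinct-↭ B E q dX))) (≈-cong (\ n -> bb n a (length B)) ln)))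
        (δ-subst {length B} {c} (\ n -> bb (length X) a n))) ⟩
     (δ (length B) c * bb (length X) a c) * (xs B * arr B E * Pf νs B) ≈⟨ solve 3 (\ a b c -> (a :* b) :* c := b :* (a :* c)) refl _ _ _ ⟩
     bb (length X) a c * (δ (length B) c * (xs B * arr B E * Pf νs B)) ∎

  module PieriRule (D N : ℕ) (D<N : D < N) (u : Carrier) where
   open Branching R p D N D<N
   open Pieri u

   E : List I -> Carrier
   E X = ∏ X (\ i -> 1# + u * x i)

   private
    E-e : ∀ n X -> length X < n -> ∑< n (\ k -> u ^ k * e x k X) ≈ E X
    E-e (suc n) [] _ = trans (+-congˡ (∑<-0 n (\ k _ -> zeroʳ _))) (solve 0 (1ₚ :* 1ₚ :+ 0ₚ := 1ₚ) refl)
    E-e (suc n) (i ∷ X) (s≤s lt) = begin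
     u ^ 0 * 1# + ∑< n (\ k -> u ^ suc k * (e x (suc k) X + x i * e x k X))
      ≈⟨ +-congˡ (trans (∑<-cong n (\ k -> solve 5 (\ u U a b c -> (u :* U) :* (a :+ b :* c) := (u :* U) :* a :+ (u :* b) :* (U :* c)) refl u _ _ _ _)) (trans (∑<-+ n) (+-congˡ (∑<-*ˡ n)))) ⟩
     u ^ 0 * 1# + (∑< n (\ k -> u ^ suc k * e x (suc k) X) + u * x i * ∑< n (\ k -> u ^ k * e x k X)) ≈⟨ +-assoc _ _ _ ⟨
     ∑< (suc n) (\ k -> u ^ k * e x k X) + u * x i * ∑< n (\ k -> u ^ k * e x k X)
      ≈⟨ +-cong (E-e (suc n) X (Nₚ.m<n⇒m<1+n lt)) (*-congˡ (E-e n X lt)) ⟩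
     E X + u * x i * E X ≈⟨ solve 2 (\ a b -> b :+ a :* b := (1ₚ :+ a) :* b) refl _ _ ⟩
     (1# + u * x i) * E X ∎

    E-splits′ : ∀ n X -> length X < n -> Distinct X -> E X ≈ ∑ (splits X) (\ st -> u ^ length (st .fst) * (xs (st .fst) * arr (st .fst) (st .snd)))
    E-splits′ n X lX dX = begin
     E X ≈⟨ E-e n X lX ⟨
     ∑< n (\ k -> u ^ k * e x k X) ≈⟨ ∑<-cong n (\ k -> trans (*-congˡ (sym (Z-x k X dX))) (sym (∑-*ˡ (splits X)))) ⟩
     ∑< n (\ k -> ∑ (splits X) (\ st -> u ^ k * (δ (length (st .fst)) k * (xs (st .fst) * arr (st .fst) (st .snd)))))
      ≈⟨ ∑-applyUpTo id n ⟨
     ∑ (upTo n) (\ k -> ∑ (splits X) (\ st -> u ^ k * (δ (length (st .fst)) k * (xs (st .fst) * arr (st .fst) (st .snd))))) ≈⟨ ∑-swap (upTo n) (splits X) ⟩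
     ∑ (splits X) (\ st -> ∑ (upTo n) (\ k -> u ^ k * (δ (length (st .fst)) k * (xs (st .fst) * arr (st .fst) (st .snd)))))
      ≈⟨ ∑-cong-All (splits-length X) (\ { (S , Y) ln -> begin
        ∑ (upTo n) (\ k -> u ^ k * (δ (length S) k * (xs S * arr S Y))) ≈⟨ ∑-applyUpTo id n ⟩
        ∑< n (\ k -> u ^ k * (δ (length S) k * (xs S * arr S Y))) ≈⟨ ∑<-cong n (\ k -> *-left-comm _ _ _) ⟩
        ∑< n (\ k -> δ (length S) k * (u ^ k * (xs S * arr S Y))) ≈⟨ ∑<-δ n (length S) (Nₚ.≤-<-trans (Nₚ.≤-trans (Nₚ.m≤m+n _ _) (Nₚ.≤-reflexive ln)) lX) ⟩
        u ^ length S * (xs S * arr S Y) ∎ }) ⟩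
     ∑ (splits X) (\ st -> u ^ length (st .fst) * (xs (st .fst) * arr (st .fst) (st .snd))) ∎

    E-splits : ∀ X -> Distinct X -> E X ≈ ∑ (splits X) (\ st -> u ^ length (st .fst) * (xs (st .fst) * arr (st .fst) (st .snd)))
    E-splits X dX = E-splits′ (suc (length X)) X Nₚ.≤-refl dX

    -- Expanding `E B` over subsets S of B makes A ∪ S the new first column, of length k; `grow`
    -- then sums over the possible A inside it.
    extend : ∀ {m} a c (νs : Vec ℕ m) X -> Distinct X -> length X < N ->
     ∑ (splits X) (\ ab -> δ (length (ab .fst)) a * (xs (ab .fst) * arr (ab .fst) (ab .snd) * (E (ab .snd) * Pf (c ∷ νs) (ab .fst)))) ≈
     ∑< N (\ k -> bb k a c * u ^ (k ∸ a) * Pf (k ∷ c ∷ νs) X)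
    extend a c νs X dX lX = begin
     ∑ (splits X) (\ ab -> δ (length (ab .fst)) a * (xs (ab .fst) * arr (ab .fst) (ab .snd) * (E (ab .snd) * Pf (c ∷ νs) (ab .fst))))
      ≈⟨ ∑-cong-All (splits-↭ X) (\ { (A , B) q -> begin
        δ (length A) a * (xs A * arr A B * (E B * Pf (c ∷ νs) A)) ≈⟨ *-congˡ (*-congˡ (*-congʳ (E-splits B (snd (Distinct-↭ A B q dX))))) ⟩
        δ (length A) a * (xs A * arr A B * (∑ (splits B) (\ st -> u ^ length (st .fst) * (xs (st .fst) * arr (st .fst) (st .snd))) * Pf (c ∷ νs) A))
         ≈⟨ solve 5 (\ d X A E P -> d :* (X :* A :* (E :* P)) := (d :* X :* P :* A) :* E) refl _ _ _ _ _ ⟩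
        (δ (length A) a * xs A * Pf (c ∷ νs) A * arr A B) * ∑ (splits B) (\ st -> u ^ length (st .fst) * (xs (st .fst) * arr (st .fst) (st .snd)))
         ≈⟨ trans (sym (∑-*ˡ (splits B))) (∑-cong-All (splits-↭ B) (\ { (S , Y) q′ -> *-congʳ (*-congˡ (sym (arr-splitʳ A S Y q′))) })) ⟩
        ∑ (splits B) (\ st -> G A (st .fst) (st .snd)) ∎ }) ⟩
     ∑ (splits X) (\ ab -> ∑ (splits (ab .snd)) (\ st -> G (ab .fst) (st .fst) (st .snd))) ≈⟨ splits-coassoc X G ⟨
     ∑ (splits X) (\ ay -> ∑ (splits (ay .fst)) (\ as -> G (as .fst) (as .snd) (ay .snd)))
      ≈⟨ ∑-cong-All (All-zip (splits-↭ X) (splits-length X)) (\ { (A′ , Y) (q , ln) -> collect A′ Y q ln }) ⟩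
     ∑ (splits X) (\ ay -> ∑< N (\ k -> g k * (δ (length (ay .fst)) k * (xs (ay .fst) * arr (ay .fst) (ay .snd) * Pf (c ∷ νs) (ay .fst)))))
      ≈⟨ ∑-cong (splits X) (\ _ -> sym (∑-applyUpTo id N)) ⟩
     ∑ (splits X) (\ ay -> ∑ (upTo N) (\ k -> g k * (δ (length (ay .fst)) k * (xs (ay .fst) * arr (ay .fst) (ay .snd) * Pf (c ∷ νs) (ay .fst)))))
      ≈⟨ trans (∑-swap (splits X) (upTo N)) (trans (∑-applyUpTo id N) (∑<-cong N (\ k -> ∑-*ˡ (splits X)))) ⟩
     ∑< N (\ k -> bb k a c * u ^ (k ∸ a) * Pf (k ∷ c ∷ νs) X) ∎
     where
     g : ℕ -> Carrier
     g k = bb k a c * u ^ (k ∸ a)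
     G : List I -> List I -> List I -> Carrier
     G A S Y = (δ (length A) a * xs A * Pf (c ∷ νs) A * (arr A S * arr A Y)) * (u ^ length S * (xs S * arr S Y))
     collect : ∀ A′ Y -> A′ ++ Y ↭ X -> length A′ N.+ length Y ≡ length X -> ∑ (splits A′) (\ as -> G (as .fst) (as .snd) Y) ≈
      ∑< N (\ k -> g k * (δ (length A′) k * (xs A′ * arr A′ Y * Pf (c ∷ νs) A′)))
     collect A′ Y q ln = begin
      ∑ (splits A′) (\ as -> G (as .fst) (as .snd) Y)
       ≈⟨ ∑-cong-All (All-zip (splits-↭ A′) (splits-length A′)) (\ { (A , S) (q′ , ln′) -> begin
         (δ (length A) a * xs A * Pf (c ∷ νs) A * (arr A S * arr A Y)) * (u ^ length S * (xs S * arr S Y))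
          ≈⟨ solve 8 (\ d X P AS AY U XS SY -> (d :* X :* P :* (AS :* AY)) :* (U :* (XS :* SY)) := (d :* U) :* ((X :* XS) :* (AY :* SY) :* (AS :* P))) refl _ _ _ _ _ _ _ _ ⟩
         (δ (length A) a * u ^ length S) * ((xs A * xs S) * (arr A Y * arr S Y) * (arr A S * Pf (c ∷ νs) A))
          ≈⟨ *-cong (sizes (length A) (length S) (length A′) ln′) (*-congʳ (*-cong (∏-split A S q′) (∏-split A S q′))) ⟩
         (δ (length A) a * u ^ (length A′ ∸ a)) * (xs A′ * arr A′ Y * (arr A S * Pf (c ∷ νs) A))
          ≈⟨ solve 5 (\ d U XA A P -> (d :* U) :* (XA :* (A :* P)) := (U :* XA) :* (d :* (A :* P))) refl _ _ _ (arr A S) _ ⟩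
         (u ^ (length A′ ∸ a) * (xs A′ * arr A′ Y)) * (δ (length A) a * (arr A S * Pf (c ∷ νs) A)) ∎ }) ⟩
      ∑ (splits A′) (\ as -> (u ^ (length A′ ∸ a) * (xs A′ * arr A′ Y)) * (δ (length (as .fst)) a * (arr (as .fst) (as .snd) * Pf (c ∷ νs) (as .fst))))
       ≈⟨ trans (∑-*ˡ (splits A′)) (*-congˡ (grow a c νs A′ (fst (Distinct-↭ A′ Y q dX)))) ⟩
      (u ^ (length A′ ∸ a) * (xs A′ * arr A′ Y)) * (bb (length A′) a c * Pf (c ∷ νs) A′)
       ≈⟨ solve 4 (\ U X B P -> (U :* X) :* (B :* P) := (B :* U) :* (X :* P)) refl _ _ _ _ ⟩
      g (length A′) * (xs A′ * arr A′ Y * Pf (c ∷ νs) A′)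
       ≈⟨ ∑<-δ N (length A′) (Nₚ.≤-<-trans (Nₚ.≤-trans (Nₚ.m≤m+n _ _) (Nₚ.≤-reflexive ln)) lX) ⟨
      ∑< N (\ k -> δ (length A′) k * (g k * (xs A′ * arr A′ Y * Pf (c ∷ νs) A′)))
       ≈⟨ ∑<-cong N (\ k -> *-left-comm _ _ _) ⟩
      ∑< N (\ k -> g k * (δ (length A′) k * (xs A′ * arr A′ Y * Pf (c ∷ νs) A′))) ∎
      where
      sizes : ∀ i j n -> i N.+ j ≡ n -> δ i a * u ^ j ≈ δ i a * u ^ (n ∸ a)
      sizes i j _ ≡.refl = trans (*-congˡ (≈-cong (u ^_) (≡.sym (Nₚ.m+n∸m≡n i j)))) (δ-subst {i} {a} (\ b -> u ^ (i N.+ j ∸ b)))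

   -- Induction on columns. If A supports the first column and B is its complement, then E X = E A ·
   -- E B: the factor E A acts on the later columns by induction, and E B lengthens the first one by
   -- `extend`.
   Pf-Pieri : ∀ {m} (μs : Vec ℕ m) X -> Distinct X -> length X < N ->
    E X * Pf μs X ≈ ∑ (box (suc m)) (\ κs -> φ (Vec.head κs) μs (Vec.tail κs) * Pf κs X)
   Pf-Pieri [] X dX lX = begin
    E X * 1# ≈⟨ *-identityʳ _ ⟩
    E X ≈⟨ E-e N X lX ⟨
    ∑< N (\ k -> u ^ k * e x k X) ≈⟨ ∑<-cong N (\ k -> trans (*-congˡ (trans (sym (Z-x k X dX)) (∑-cong (splits X) (\ st -> *-congˡ (sym (*-identityʳ _)))))) (sym (+-identityʳ _))) ⟩
    ∑< N (\ k -> u ^ k * Pf (k ∷ []) X + 0#) ≈⟨ ∑-box 0 ⟨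
    ∑ (box 1) (\ κs -> φ (Vec.head κs) [] (Vec.tail κs) * Pf (Vec.head κs ∷ []) X) ≈⟨ ∑-cong (box 1) (\ { (k ∷ []) -> refl }) ⟩
    ∑ (box 1) (\ κs -> φ (Vec.head κs) [] (Vec.tail κs) * Pf κs X) ∎
   Pf-Pieri {suc m} (a ∷ μs) X dX lX = begin
    E X * Pf (a ∷ μs) X
     ≈⟨ trans (sym (∑-*ˡ (splits X))) (∑-cong-All (All-zip (splits-↭ X) (splits-length X)) (\ { (A , B) (q , ln) -> first A B q ln })) ⟩
    ∑ (splits X) (\ ab -> ∑ (box (suc m)) (\ νs -> φ (Vec.head νs) μs (Vec.tail νs) * H νs ab)) ≈⟨ ∑-swap (splits X) (box (suc m)) ⟩
    ∑ (box (suc m)) (\ νs -> ∑ (splits X) (\ ab -> φ (Vec.head νs) μs (Vec.tail νs) * H νs ab))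
     ≈⟨ ∑-cong (box (suc m)) (\ { (c ∷ νs) -> trans (∑-*ˡ (splits X)) (trans (*-congˡ (extend a c νs X dX lX)) (sym (∑<-*ˡ N))) }) ⟩
    ∑ (box (suc m)) (\ νs -> ∑< N (\ k -> φ (Vec.head νs) μs (Vec.tail νs) * (bb k a (Vec.head νs) * u ^ (k ∸ a) * Pf (k ∷ Vec.head νs ∷ Vec.tail νs) X)))
     ≈⟨ ∑-cong (box (suc m)) (\ _ -> sym (∑-applyUpTo id N)) ⟩
    ∑ (box (suc m)) (\ νs -> ∑ (upTo N) (\ k -> φ (Vec.head νs) μs (Vec.tail νs) * (bb k a (Vec.head νs) * u ^ (k ∸ a) * Pf (k ∷ Vec.head νs ∷ Vec.tail νs) X)))
     ≈⟨ trans (∑-swap (box (suc m)) (upTo N)) (∑-applyUpTo id N) ⟩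
    ∑< N (\ k -> ∑ (box (suc m)) (\ νs -> φ (Vec.head νs) μs (Vec.tail νs) * (bb k a (Vec.head νs) * u ^ (k ∸ a) * Pf (k ∷ Vec.head νs ∷ Vec.tail νs) X)))
     ≈⟨ ∑<-cong N (\ k -> ∑-cong (box (suc m)) (\ { (c ∷ νs) -> solve 3 (\ f b P -> f :* (b :* P) := (b :* f) :* P) refl _ _ _ })) ⟩
    ∑< N (\ k -> ∑ (box (suc m)) (\ νs -> φ k (a ∷ μs) νs * Pf (k ∷ νs) X)) ≈⟨ ∑-box (suc m) ⟨
    ∑ (box (suc (suc m))) (\ κs -> φ (Vec.head κs) (a ∷ μs) (Vec.tail κs) * Pf (Vec.head κs ∷ Vec.tail κs) X)
     ≈⟨ ∑-cong (box (suc (suc m))) (\ { (k ∷ κs) -> refl }) ⟩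
    ∑ (box (suc (suc m))) (\ κs -> φ (Vec.head κs) (a ∷ μs) (Vec.tail κs) * Pf κs X) ∎
    where
    H : Vec ℕ (suc m) -> List I × List I -> Carrier
    H νs ab = δ (length (ab .fst)) a * (xs (ab .fst) * arr (ab .fst) (ab .snd) * (E (ab .snd) * Pf νs (ab .fst)))
    first : ∀ A B -> A ++ B ↭ X -> length A N.+ length B ≡ length X ->
     E X * (δ (length A) a * (xs A * arr A B * Pf μs A)) ≈ ∑ (box (suc m)) (\ νs -> φ (Vec.head νs) μs (Vec.tail νs) * H νs (A , B))
    first A B q ln = begin
     E X * (δ (length A) a * (xs A * arr A B * Pf μs A)) ≈⟨ *-congʳ (sym (∏-split A B q)) ⟩
     (E A * E B) * (δ (length A) a * (xs A * arr A B * Pf μs A))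
      ≈⟨ solve 5 (\ EA EB d X P -> (EA :* EB) :* (d :* (X :* P)) := (d :* X :* EB) :* (EA :* P)) refl _ _ _ _ _ ⟩
     (δ (length A) a * (xs A * arr A B) * E B) * (E A * Pf μs A)
      ≈⟨ *-congˡ (Pf-Pieri μs A (fst (Distinct-↭ A B q dX)) (Nₚ.≤-<-trans (Nₚ.≤-trans (Nₚ.m≤m+n _ _) (Nₚ.≤-reflexive ln)) lX)) ⟩
     (δ (length A) a * (xs A * arr A B) * E B) * ∑ (box (suc m)) (\ νs -> φ (Vec.head νs) μs (Vec.tail νs) * Pf νs A)
      ≈⟨ trans (sym (∑-*ˡ (box (suc m)))) (∑-cong (box (suc m)) (\ νs -> solve 5 (\ d X E f P -> (d :* X :* E) :* (f :* P) := f :* (d :* (X :* (E :* P)))) refl _ _ _ _ _)) ⟩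
     ∑ (box (suc m)) (\ νs -> φ (Vec.head νs) μs (Vec.tail νs) * H νs (A , B)) ∎

  -- Generating function of all P_λ with λ₁ ≤ m, peeling off the first column of λ.
  Fsum : ℕ -> List I -> Carrier
  Fsum zero X = 1#
  Fsum (suc m) X = ∑ (splits X) (\ ab -> xs (ab .fst) * arr (ab .fst) (ab .snd) * Fsum m (ab .fst))

  module _ (D N : ℕ) (D<N : D < N) where
   open Branching R p D N D<N using (box; ∑-box)

   ∑-Pf : ∀ m X -> length X < N -> ∑ (box m) (\ λs -> Pf λs X) ≈ Fsum m X
   ∑-Pf zero X _ = +-identityʳ _
   ∑-Pf (suc m) X lX = begin
    ∑ (box (suc m)) (\ λs -> Pf λs X) ≈⟨ trans (∑-box m) (∑<-cong N (\ k -> ∑-swap (box m) (splits X))) ⟩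
    ∑< N (\ k -> ∑ (splits X) (\ ab -> ∑ (box m) (\ λs -> δ (length (ab .fst)) k * (xs (ab .fst) * arr (ab .fst) (ab .snd) * Pf λs (ab .fst)))))
     ≈⟨ trans (sym (∑-applyUpTo id N)) (∑-swap (upTo N) (splits X)) ⟩
    ∑ (splits X) (\ ab -> ∑ (upTo N) (\ k -> ∑ (box m) (\ λs -> δ (length (ab .fst)) k * (xs (ab .fst) * arr (ab .fst) (ab .snd) * Pf λs (ab .fst)))))
     ≈⟨ ∑-cong-All (splits-length X) (\ { (A , B) ln ->
       let lA = Nₚ.≤-<-trans (Nₚ.≤-trans (Nₚ.m≤m+n _ _) (Nₚ.≤-reflexive ln)) lX in
       trans (∑-applyUpTo id N) (trans (∑<-cong N (\ k -> trans (∑-*ˡ (box m)) (*-congˡ (trans (∑-*ˡ (box m)) (*-congˡ (∑-Pf m A lA))))))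
        (∑<-δ N (length A) lA)) }) ⟩
    Fsum (suc m) X ∎

-- Base change, power series, and uniqueness from the Pieri rule.

record Hom (R S : CRing) : Set where
 private
  module R = CommutativeRing R
  module S = CommutativeRing S
 field
  ⟦_⟧    : R.Carrier -> S.Carrier
  ⟦⟧-cong : ∀ {a b} -> a R.≈ b -> ⟦ a ⟧ S.≈ ⟦ b ⟧
  ⟦⟧-+   : ∀ a b -> ⟦ a R.+ b ⟧ S.≈ ⟦ a ⟧ S.+ ⟦ b ⟧
  ⟦⟧-*   : ∀ a b -> ⟦ a R.* b ⟧ S.≈ ⟦ a ⟧ S.* ⟦ b ⟧
  ⟦⟧-neg : ∀ a -> ⟦ R.- a ⟧ S.≈ S.- ⟦ a ⟧
  ⟦⟧-0   : ⟦ R.0# ⟧ S.≈ S.0#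
  ⟦⟧-1   : ⟦ R.1# ⟧ S.≈ S.1#

private module _ {R S : CRing} where
 private module R = Kit R
 open Kit S
 -- Naturality in the ring serves two purposes: adjoining the generating variable u and reducing
 -- modulo t^M.
 module HomProps (F : Hom R S) where
  open Hom F

  ⟦⟧-- : ∀ a b -> ⟦ a R.- b ⟧ ≈ ⟦ a ⟧ - ⟦ b ⟧
  ⟦⟧-- a b = trans (⟦⟧-+ _ _) (+-congˡ (⟦⟧-neg b))

  ⟦⟧-∑ : ∀ {A : Set} (xs : List A) {f} -> ⟦ R.∑ xs f ⟧ ≈ ∑ xs (\ x -> ⟦ f x ⟧)
  ⟦⟧-∑ [] = ⟦⟧-0
  ⟦⟧-∑ (x ∷ xs) = trans (⟦⟧-+ _ _) (+-congˡ (⟦⟧-∑ xs))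

  ⟦⟧-∏ : ∀ {A : Set} (xs : List A) {f} -> ⟦ R.∏ xs f ⟧ ≈ ∏ xs (\ x -> ⟦ f x ⟧)
  ⟦⟧-∏ [] = ⟦⟧-1
  ⟦⟧-∏ (x ∷ xs) = trans (⟦⟧-* _ _) (*-congˡ (⟦⟧-∏ xs))

  ⟦⟧-∏< : ∀ n {f} -> ⟦ R.∏< n f ⟧ ≈ ∏< n (\ k -> ⟦ f k ⟧)
  ⟦⟧-∏< zero = ⟦⟧-1
  ⟦⟧-∏< (suc n) = trans (⟦⟧-* _ _) (*-congˡ (⟦⟧-∏< n))

  ⟦⟧-^ : ∀ a n -> ⟦ a R.^ n ⟧ ≈ ⟦ a ⟧ ^ n
  ⟦⟧-^ a zero = ⟦⟧-1
  ⟦⟧-^ a (suc n) = trans (⟦⟧-* _ _) (*-congˡ (⟦⟧-^ a n))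

  ⟦⟧-δ : ∀ m n -> ⟦ R.δ m n ⟧ ≈ δ m n
  ⟦⟧-δ m n with m ≡ᵇ n
  ... | true = ⟦⟧-1
  ... | false = ⟦⟧-0

  module _ (p : R.Carrier) where
   private
    module RQ = QBinomial R p
   open QBinomial S ⟦ p ⟧

   ⟦⟧-qbin : ∀ n k -> ⟦ RQ.qbin n k ⟧ ≈ qbin n k
   ⟦⟧-qbin n zero = ⟦⟧-1
   ⟦⟧-qbin zero (suc k) = ⟦⟧-0
   ⟦⟧-qbin (suc n) (suc k) = trans (⟦⟧-+ _ _) (+-cong (⟦⟧-qbin n k) (trans (⟦⟧-* _ _) (*-cong (⟦⟧-^ p (suc k)) (⟦⟧-qbin n (suc k)))))

   ⟦⟧-bb : ∀ d a c -> ⟦ RQ.bb d a c ⟧ ≈ bb d a c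
   ⟦⟧-bb d a zero = ⟦⟧-qbin d a
   ⟦⟧-bb zero a (suc c) = ⟦⟧-0
   ⟦⟧-bb (suc d) zero (suc c) = ⟦⟧-0
   ⟦⟧-bb (suc d) (suc a) (suc c) = ⟦⟧-bb d a c

   module _ (D N : ℕ) (D<N : D < N) where
    private
     module RB = Branching R p D N D<N
    open Branching S ⟦ p ⟧ D N D<N

    ⟦⟧-δ₀ : ∀ {m} (v : Vec ℕ m) -> ⟦ RB.δ₀ v ⟧ ≈ δ₀ v
    ⟦⟧-δ₀ [] = ⟦⟧-1
    ⟦⟧-δ₀ (l ∷ v) = trans (⟦⟧-* _ _) (*-cong (⟦⟧-δ l 0) (⟦⟧-δ₀ v))

    ⟦⟧-PD : ∀ y {m} d (λs μs : Vec ℕ m) -> ⟦ RB.PD y d λs μs ⟧ ≈ PD ⟦ y ⟧ d λs μs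
    ⟦⟧-PD y d [] [] = ⟦⟧-1
    ⟦⟧-PD y d (l ∷ λs) (c ∷ μs) = trans (⟦⟧-* _ _) (*-cong
     (trans (⟦⟧-* _ _) (*-cong (⟦⟧-bb d l c) (trans (⟦⟧-* _ _) (*-cong (⟦⟧-^ y (l ∸ c)) (⟦⟧-^ p (tri (l ∸ c)))))))
     (⟦⟧-PD y l λs μs))

    ⟦⟧-RD : ∀ ys {m} (λs : Vec ℕ m) -> ⟦ RB.RD ys λs ⟧ ≈ RD (map ⟦_⟧ ys) λs
    ⟦⟧-RD [] λs = ⟦⟧-δ₀ λs
    ⟦⟧-RD (y ∷ ys) {m} λs = trans (⟦⟧-∑ (box m)) (∑-cong (box m) (\ μs -> trans (⟦⟧-* _ _) (*-cong (⟦⟧-PD y D λs μs) (⟦⟧-RD ys μs))))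

  module _ {I : Set} (𝔸 : Alphabet R I) where
   private
    module 𝔸 = Alphabet 𝔸
    module RH = HallLittlewood R 𝔸

   mapKernel : Kernel S I
   mapKernel = record
    { p = ⟦ 𝔸.p ⟧ ; _#_ = 𝔸._#_ ; #-sym = 𝔸.#-sym ; h = \ a b -> ⟦ 𝔸.h a b ⟧
    ; h-sum = \ ab -> trans (sym (⟦⟧-+ _ _)) (trans (⟦⟧-cong (𝔸.h-sum ab)) ⟦⟧-1)
    ; h-three = \ sv sy vy -> trans (sym (⟦⟧-* _ _)) (trans (⟦⟧-cong (𝔸.h-three sv sy vy))
      (trans (⟦⟧-+ _ _) (+-cong (⟦⟧-* _ _) (⟦⟧-* _ _)))) }

   mapAlphabet : Alphabet S I
   mapAlphabet = record
    { kernel = mapKernel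
    ; x = \ i -> ⟦ 𝔸.x i ⟧
    ; h-x = \ sy -> trans (sym (⟦⟧-* _ _)) (trans (⟦⟧-cong (𝔸.h-x sy)) (trans (⟦⟧-+ _ _) (+-congˡ (⟦⟧-* _ _))))
    ; unit = \ k -> ⟦ 𝔸.unit k ⟧
    ; unit-inv = \ k -> trans (*-congʳ (sym (trans (⟦⟧-- _ _) (+-cong ⟦⟧-1 (-‿cong (⟦⟧-^ 𝔸.p (suc k)))))))
      (trans (sym (⟦⟧-* _ _)) (trans (⟦⟧-cong (𝔸.unit-inv k)) ⟦⟧-1)) }

   open HallLittlewood S mapAlphabet

   ⟦⟧-w : ∀ a b -> ⟦ RH.w a b ⟧ ≈ w a b
   ⟦⟧-w a b = trans (⟦⟧-+ _ _) (+-congˡ (trans (⟦⟧-* _ _) (*-congʳ (trans (⟦⟧-- _ _) (+-congʳ ⟦⟧-1)))))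

   ⟦⟧-arr : ∀ A B -> ⟦ RH.arr A B ⟧ ≈ arr A B
   ⟦⟧-arr A B = trans (⟦⟧-∏ A) (∏-cong A (\ a -> trans (⟦⟧-∏ B) (∏-cong B (⟦⟧-w a))))

   ⟦⟧-Pf : ∀ {m} (λs : Vec ℕ m) X -> ⟦ RH.Pf λs X ⟧ ≈ Pf λs X
   ⟦⟧-Pf [] X = ⟦⟧-1
   ⟦⟧-Pf (l ∷ λs) X = trans (⟦⟧-∑ (splits X)) (∑-cong (splits X) (\ { (A , B) -> trans (⟦⟧-* _ _) (*-cong (⟦⟧-δ (length A) l)
    (trans (⟦⟧-* _ _) (*-cong (trans (⟦⟧-* _ _) (*-cong (⟦⟧-∏ A) (⟦⟧-arr A B))) (⟦⟧-Pf λs A)))) }))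

private module PowerSeries (R : CRing) where
 open Kit R

 PS : Set
 PS = ℕ -> Carrier

 tail : PS -> PS
 tail f k = f (suc k)

 infix 4 _≋_
 _≋_ : PS -> PS -> Set
 f ≋ g = ∀ k -> f k ≈ g k

 mul : PS -> PS -> PS
 mul f g zero = f 0 * g 0
 mul f g (suc k) = f 0 * g (suc k) + mul (tail f) g k

 mul-cong-≤ : ∀ {f f′ g g′} k -> (∀ j -> j ≤ k -> f j ≈ f′ j) -> (∀ j -> j ≤ k -> g j ≈ g′ j) -> mul f g k ≈ mul f′ g′ k
 mul-cong-≤ zero a b = *-cong (a 0 z≤n) (b 0 z≤n)
 mul-cong-≤ (suc k) a b = +-cong (*-cong (a 0 z≤n) (b (suc k) Nₚ.≤-refl))
  (mul-cong-≤ k (\ j j≤k -> a (suc j) (s≤s j≤k)) (\ j j≤k -> b j (Nₚ.m≤n⇒m≤1+n j≤k)))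

 mul-cong : ∀ {f f′ g g′} -> f ≋ f′ -> g ≋ g′ -> mul f g ≋ mul f′ g′
 mul-cong a b k = mul-cong-≤ k (\ j _ -> a j) (\ j _ -> b j)

 mul-distribʳ : ∀ h f g -> mul (\ k -> f k + g k) h ≋ (\ k -> mul f h k + mul g h k)
 mul-distribʳ h f g zero = distribʳ _ _ _
 mul-distribʳ h f g (suc k) = trans (+-cong (distribʳ _ _ _) (mul-distribʳ h (tail f) (tail g) k))
  (+-interchange _ _ _ _)

 mul-scale : ∀ c f g -> mul (\ k -> c * f k) g ≋ (\ k -> c * mul f g k)
 mul-scale c f g zero = *-assoc _ _ _
 mul-scale c f g (suc k) = trans (+-cong (*-assoc _ _ _) (mul-scale c (tail f) g k)) (sym (distribˡ _ _ _))

 mul-assoc : ∀ f g h -> mul (mul f g) h ≋ mul f (mul g h)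
 mul-assoc f g h zero = *-assoc _ _ _
 mul-assoc f g h (suc k) = begin
  (f 0 * g 0) * h (suc k) + mul (\ j -> f 0 * g (suc j) + mul (tail f) g j) h k
   ≈⟨ +-cong (*-assoc _ _ _) (trans (mul-distribʳ h _ _ k) (+-cong (mul-scale (f 0) (tail g) h k) (mul-assoc (tail f) g h k))) ⟩
  f 0 * (g 0 * h (suc k)) + (f 0 * mul (tail g) h k + mul (tail f) (mul g h) k)
   ≈⟨ solve 4 (\ a b c d -> a :* b :+ (a :* c :+ d) := a :* (b :+ c) :+ d) refl _ _ _ _ ⟩
  f 0 * (g 0 * h (suc k) + mul (tail g) h k) + mul (tail f) (mul g h) k ∎

 mul-tailʳ : ∀ f g k -> mul f g (suc k) ≈ mul f (tail g) k + f (suc k) * g 0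
 mul-tailʳ f g zero = refl
 mul-tailʳ f g (suc k) = trans (+-congˡ (mul-tailʳ (tail f) g k)) (sym (+-assoc _ _ _))

 mul-comm : ∀ f g -> mul f g ≋ mul g f
 mul-comm f g zero = *-comm _ _
 mul-comm f g (suc k) = trans (+-cong (*-comm _ _) (mul-comm (tail f) g k)) (trans (+-comm _ _) (sym (mul-tailʳ g f k)))

 0ₛ 1ₛ Xₛ : PS
 0ₛ _ = 0#
 1ₛ zero = 1#
 1ₛ (suc _) = 0#
 Xₛ zero = 0#
 Xₛ (suc k) = 1ₛ k

 const : Carrier -> PS
 const a zero = a
 const a (suc _) = 0#

 mul-0 : ∀ g -> mul 0ₛ g ≋ 0ₛ
 mul-0 g zero = zeroˡ _
 mul-0 g (suc k) = trans (+-cong (zeroˡ _) (mul-0 g k)) (+-identityˡ _)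

 mul-const : ∀ a g -> mul (const a) g ≋ (\ k -> a * g k)
 mul-const a g zero = refl
 mul-const a g (suc k) = trans (+-congˡ (mul-0 g k)) (+-identityʳ _)

 1≋const : 1ₛ ≋ const 1#
 1≋const zero = refl
 1≋const (suc k) = refl

 mul-1 : ∀ g -> mul 1ₛ g ≋ g
 mul-1 g k = trans (mul-cong {g = g} 1≋const (\ _ -> refl) k) (trans (mul-const 1# g k) (*-identityˡ _))

 mul-X-suc : ∀ g k -> mul Xₛ g (suc k) ≈ g k
 mul-X-suc g k = trans (+-cong (zeroˡ _) (mul-1 g k)) (+-identityˡ _)

 psRing : CRing
 psRing = toRing (record
  { Carrier = PS ; _≈_ = _≋_ ; _+_ = \ f g k -> f k + g k ; _*_ = mul ; -_ = \ f k -> - f k ; 0# = 0ₛ ; 1# = 1ₛ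
  ; isEquivalence = record { refl = \ _ -> refl ; sym = \ e k -> sym (e k) ; trans = \ e e′ k -> trans (e k) (e′ k) }
  ; +-cong = \ a b k -> +-cong (a k) (b k) ; *-cong = mul-cong ; neg-cong = \ a k -> -‿cong (a k)
  ; +-assoc = \ _ _ _ _ -> +-assoc _ _ _ ; +-comm = \ _ _ _ -> +-comm _ _ ; +-identityˡ = \ _ _ -> +-identityˡ _ ; +-inverseˡ = \ _ _ -> -‿inverseˡ _
  ; *-assoc = mul-assoc ; *-comm = mul-comm ; *-identityˡ = mul-1 ; distribʳ = mul-distribʳ })

 constHom : Hom R psRing
 constHom = record
  { ⟦_⟧ = const
  ; ⟦⟧-cong = \ { e zero -> e ; e (suc _) -> refl }
  ; ⟦⟧-+ = \ { a b zero -> refl ; a b (suc _) -> sym (+-identityˡ _) }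
  ; ⟦⟧-* = \ { a b zero -> refl ; a b (suc k) -> sym (trans (mul-const a (const b) (suc k)) (zeroʳ _)) }
  ; ⟦⟧-neg = \ { a zero -> refl ; a (suc _) -> sym (Algebra.Properties.Ring.-0#≈0# (CommutativeRing.ring R)) }
  ; ⟦⟧-0 = \ { zero -> refl ; (suc _) -> refl }
  ; ⟦⟧-1 = \ k -> sym (1≋const k) }

 X^ : ∀ e k -> Kit._^_ psRing Xₛ e k ≈ δ k e
 X^ zero zero = refl
 X^ zero (suc k) = refl
 X^ (suc e) zero = zeroˡ _
 X^ (suc e) (suc k) = trans (mul-X-suc _ k) (X^ e k)

 ∑-coeff : ∀ {A : Set} (xs : List A) (f : A -> PS) k -> Kit.∑ psRing xs f k ≈ ∑ xs (\ x -> f x k)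
 ∑-coeff [] f k = refl
 ∑-coeff (x ∷ xs) f k = +-congˡ (∑-coeff xs f k)

-- Both sides satisfy the same Pieri rule, which determines them by comparing coefficients of u.
private module _ (R : CRing) where
 open Kit R
 open PowerSeries R
 private module U = Kit psRing
 module _ {I : Set} (𝔸 : Alphabet R I) where
  open Alphabet 𝔸
  open QBinomial R p
  open HallLittlewood R 𝔸
  open HomProps constHom
  module Uniqueness (D N : ℕ) (D<N : D < N) where
   open Branching R p D N D<N
   private
    module BU = Branching psRing (const p) D N D<N
    module PU = BU.Pieri Xₛ
    module HU = HallLittlewood psRing (mapAlphabet 𝔸)
    module RU = HU.PieriRule D N D<N Xₛ

    size : ∀ {m} -> ℕ -> Vec ℕ m -> Vec ℕ m -> ℕ
    size k [] [] = k
    size k (l ∷ λs) (k′ ∷ κs) = (k ∸ l) N.+ size k′ λs κs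

    φc : ∀ {m} -> ℕ -> Vec ℕ m -> Vec ℕ m -> Carrier
    φc k [] [] = 1#
    φc k (l ∷ λs) (k′ ∷ κs) = bb k l k′ * φc k′ λs κs

    φ-split : ∀ {m} k (λs κs : Vec ℕ m) -> PU.φ k λs κs U.≈ const (φc k λs κs) U.* Xₛ U.^ size k λs κs
    φ-split k [] [] = U.sym (U.*-oneˡ-≈ (\ j -> sym (1≋const j)))
    φ-split k (l ∷ λs) (k′ ∷ κs) = U.trans (U.*-cong (U.*-congʳ (U.sym (⟦⟧-bb p k l k′))) (φ-split k′ λs κs))
     (U.trans (U.*-interchange _ _ _ _)
      (U.*-cong (U.sym (Hom.⟦⟧-* constHom _ _)) (U.sym (U.^-+ Xₛ (k ∸ l) (size k′ λs κs)))))

    φ-coeff : ∀ {m} k (λs κs : Vec ℕ m) a r -> (PU.φ k λs κs U.* const a) r ≈ φc k λs κs * δ r (size k λs κs) * a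
    φ-coeff k λs κs a r = trans (U.trans (U.*-congʳ (φ-split k λs κs)) (U.trans (U.*-comm _ _) (U.sym (U.*-assoc _ _ _))) r)
     (trans (U.*-congʳ (U.sym (Hom.⟦⟧-* constHom a (φc k λs κs))) r)
      (trans (mul-const _ _ r) (trans (*-congˡ (X^ (size k λs κs) r)) (solve 3 (\ a b c -> (a :* b) :* c := b :* c :* a) refl _ _ _))))

    -- Triangularity of the Pieri rule: the strip κ/μ has at least as many boxes as the last column
    -- of κ, with equality only if κ is μ followed by one new column.
    data Interlace {m} (k : ℕ) (μs κs : Vec ℕ m) : Set where
     vanish : φc k μs κs ≈ 0# -> Interlace k μs κs
     small  : Vec.last (k ∷ κs) < size k μs κs -> Interlace k μs κs
     equal  : k ∷ κs ≡ μs Vec.∷ʳ size k μs κs -> Interlace k μs κs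

    last-∷ʳ : ∀ {m} (v : Vec ℕ m) a -> Vec.last (v Vec.∷ʳ a) ≡ a
    last-∷ʳ [] a = ≡.refl
    last-∷ʳ (x ∷ []) a = ≡.refl
    last-∷ʳ (x ∷ y ∷ v) a = last-∷ʳ (y ∷ v) a

    interlace : ∀ {m} k (μs κs : Vec ℕ m) -> Interlace k μs κs
    interlace k [] [] = equal ≡.refl
    interlace k (l ∷ μs) (k′ ∷ κs) with l N.≤? k
    ... | no l≰k = vanish (*-zeroˡ-≈ (bb-d<a k′ (Nₚ.≰⇒> l≰k)))
    ... | yes l≤k with interlace k′ μs κs
    ...   | vanish z = vanish (trans (*-congˡ z) (zeroʳ _))
    ...   | small lt = small (Nₚ.<-≤-trans lt (Nₚ.m≤n+m _ (k ∸ l)))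
    ...   | equal e with l N.≟ k
    ...     | yes ≡.refl = equal (cong₂ Vec._∷_ ≡.refl (≡.trans e (cong (\ z -> μs Vec.∷ʳ (z N.+ size k′ μs κs)) (≡.sym (Nₚ.n∸n≡0 k)))))
    ...     | no l≢k = small (Nₚ.≤-<-trans (Nₚ.≤-reflexive (≡.trans (cong Vec.last e) (last-∷ʳ μs _)))
              (Nₚ.m<n+m (size k′ μs κs) (Nₚ.m<n⇒0<n∸m (Nₚ.≤∧≢⇒< l≤k l≢k))))

    bb-diag : ∀ k {c} -> c ≤ k -> bb k k c ≈ 1#
    bb-diag k z≤n = qbin-nn k
    bb-diag (suc k) (s≤s c≤k) = bb-diag k c≤k

    diagonal : ∀ {m d} k (μs κs : Vec ℕ m) r -> k ∷ κs ≡ μs Vec.∷ʳ r -> Desc d (k ∷ κs) -> φc k μs κs ≈ 1# × size k μs κs ≡ r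
    diagonal k [] [] r e _ = refl , Vecₚ.∷-injectiveˡ e
    diagonal k (l ∷ μs) (k′ ∷ κs) r e (_ ∷ Dκ@(k′≤k ∷ _)) with Vecₚ.∷-injectiveˡ e
    ... | ≡.refl with diagonal k′ μs κs r (Vecₚ.∷-injectiveʳ e) Dκ
    ...   | c , sz = trans (*-cong (bb-diag k k′≤k) c) (*-identityˡ _) , ≡.trans (cong (N._+ size k′ μs κs) (Nₚ.n∸n≡0 k)) sz

    ∑-box-single : ∀ {m d} (v : Vec ℕ m) {f} -> d < N -> Desc d v -> (∀ v′ -> v′ ≢ v -> f v′ ≈ 0#) -> ∑ (box m) f ≈ f v
    ∑-box-single [] _ _ _ = +-identityʳ _
    ∑-box-single {suc m} (a ∷ v) {f} d<N (a≤d ∷ Dv) z = trans (∑-box m) (trans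
     (∑<-single N a (Nₚ.≤-<-trans a≤d d<N) (\ k k≢a -> ∑-0 (box m) (\ v′ -> z (k ∷ v′) (\ e -> k≢a (Vecₚ.∷-injectiveˡ e)))))
     (∑-box-single v (Nₚ.≤-<-trans a≤d d<N) Dv (\ v′ v′≢v -> z (a ∷ v′) (\ e -> v′≢v (Vecₚ.∷-injectiveʳ e)))))

   Pf-¬Desc : ∀ {m} d (λs : Vec ℕ m) X -> length X ≤ d -> ¬ Desc d λs -> Pf λs X ≈ 0#
   Pf-¬Desc d [] X _ ¬D = ⊥-elim (¬D [])
   Pf-¬Desc d (l ∷ λs) X lX ¬D = ∑-0-All (splits-length X) (\ { (A , B) ln -> term A B ln })
    where
    term : ∀ A B -> length A N.+ length B ≡ length X -> δ (length A) l * (xs A * arr A B * Pf λs A) ≈ 0#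
    term A B ln with length A N.≟ l
    ... | no ne = *-zeroˡ-≈ (δ-≢ ne)
    ... | yes ≡.refl = *-zeroʳ-≈ (*-zeroʳ-≈ (Pf-¬Desc (length A) λs A Nₚ.≤-refl
        (\ q -> ¬D (Nₚ.≤-trans (Nₚ.≤-trans (Nₚ.m≤m+n _ _) (Nₚ.≤-reflexive ln)) lX ∷ q))))

   private
    RD-[] : ∀ ys -> RD ys [] ≈ 1#
    RD-[] [] = refl
    RD-[] (y ∷ ys) = trans (+-identityʳ _) (trans (*-identityˡ _) (RD-[] ys))

   open Divisible using (Div; _,_)

   -- The hypothesis on generating functions gives both families the same Pieri rule. Its
   -- coefficient of u^r at μ expresses the value at μ with last column r appended by values whose
   -- last column is shorter, so induction on the number of columns and then on r determines
   -- everything.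
   RD≈Pf : ∀ {t} D₀ M -> p ^ D₀ ≈ 0# -> t ^ M ≈ 0# -> M N.+ D₀ ≤ D -> ∀ {ys} -> All (Div R t 1) ys -> ∀ {X} -> Distinct X -> length X ≤ D ->
    U.∏ (map const ys) (\ y -> QBinomial.poch psRing (const p) (Xₛ U.* y) D₀) U.≈ U.∏ X (\ i -> U.1# U.+ Xₛ U.* const (x i)) ->
    ∀ {m} (λs : Vec ℕ m) -> RD ys λs ≈ Pf λs X
   RD≈Pf {t} D₀ M pD tM le {ys} dys {X} dX lX EE = main
    where
    lX′ : length X < N
    lX′ = Nₚ.≤-<-trans lX D<N

    open Hom constHom

    Udys : ∀ {ys} -> All (Div R t 1) ys -> All (Div psRing (const t) 1) (map const ys)
    Udys [] = []
    Udys ((c , e) ∷ ds) = (const c , U.trans (⟦⟧-cong e) (U.trans (⟦⟧-* _ _) (U.*-congʳ (⟦⟧-^ t 1)))) ∷ Udys ds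

    pieri-R : ∀ {m} (μs : Vec ℕ m) -> RU.E X U.* const (RD ys μs) U.≈ U.∑ (box (suc m)) (\ κs -> PU.φ (Vec.head κs) μs (Vec.tail κs) U.* const (RD ys κs))
    pieri-R {m} μs = U.trans (U.*-cong (U.sym EE) (⟦⟧-RD p D N D<N ys μs))
     (U.trans (PU.RD-Pieri D₀ M (U.trans (U.sym (⟦⟧-^ p D₀)) (U.trans (⟦⟧-cong pD) ⟦⟧-0)) (U.trans (U.sym (⟦⟧-^ t M)) (U.trans (⟦⟧-cong tM) ⟦⟧-0)) le (Udys dys) μs)
      (U.∑-cong (box (suc m)) (\ κs -> U.*-congˡ (U.sym (⟦⟧-RD p D N D<N ys κs)))))

    pieri-P : ∀ {m} (μs : Vec ℕ m) -> RU.E X U.* const (Pf μs X) U.≈ U.∑ (box (suc m)) (\ κs -> PU.φ (Vec.head κs) μs (Vec.tail κs) U.* const (Pf κs X))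
    pieri-P {m} μs = U.trans (U.*-congˡ (⟦⟧-Pf 𝔸 μs X)) (U.trans (RU.Pf-Pieri μs X dX lX′)
     (U.∑-cong (box (suc m)) (\ κs -> U.*-congˡ (U.sym (⟦⟧-Pf 𝔸 κs X)))))

    coeff : ∀ {m} -> Vec ℕ m -> ℕ -> Vec ℕ (suc m) -> Carrier
    coeff μs r κs = φc (Vec.head κs) μs (Vec.tail κs) * δ r (size (Vec.head κs) μs (Vec.tail κs))

    compare : ∀ {m} (μs : Vec ℕ m) -> RD ys μs ≈ Pf μs X -> ∀ r ->
     ∑ (box (suc m)) (\ κs -> coeff μs r κs * (RD ys κs - Pf κs X)) ≈ 0#
    compare {m} μs e r = begin
     ∑ (box (suc m)) (\ κs -> coeff μs r κs * (RD ys κs - Pf κs X))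
      ≈⟨ ∑-cong (box (suc m)) (\ κs -> solve 3 (\ c a b -> c :* (a :- b) := c :* a :+ (:- (c :* b))) refl _ _ _) ⟩
     ∑ (box (suc m)) (\ κs -> coeff μs r κs * RD ys κs + - (coeff μs r κs * Pf κs X)) ≈⟨ trans (∑-+ (box (suc m))) (+-congˡ (∑-neg (box (suc m)))) ⟩
     ∑ (box (suc m)) (\ κs -> coeff μs r κs * RD ys κs) - ∑ (box (suc m)) (\ κs -> coeff μs r κs * Pf κs X)
      ≈⟨ +-cong (sym (extract (RD ys))) (-‿cong (sym (extract (\ κs -> Pf κs X)))) ⟩
     U.∑ (box (suc m)) (\ κs -> PU.φ (Vec.head κs) μs (Vec.tail κs) U.* const (RD ys κs)) r - U.∑ (box (suc m)) (\ κs -> PU.φ (Vec.head κs) μs (Vec.tail κs) U.* const (Pf κs X)) r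
      ≈⟨ +-cong (sym (pieri-R μs r)) (-‿cong (sym (U.trans (U.*-congˡ (⟦⟧-cong e)) (pieri-P μs) r))) ⟩
     (RU.E X U.* const (RD ys μs)) r - (RU.E X U.* const (RD ys μs)) r ≈⟨ -‿inverseʳ _ ⟩
     0# ∎
     where
     extract : ∀ (g : Vec ℕ (suc m) -> Carrier) -> U.∑ (box (suc m)) (\ κs -> PU.φ (Vec.head κs) μs (Vec.tail κs) U.* const (g κs)) r ≈ ∑ (box (suc m)) (\ κs -> coeff μs r κs * g κs)
     extract g = trans (∑-coeff (box (suc m)) _ r) (∑-cong (box (suc m)) (\ κs -> φ-coeff (Vec.head κs) μs (Vec.tail κs) (g κs) r))

    -- The bound `b` makes the strong induction on the last column structural.
    step : ∀ {m} -> (∀ (μs : Vec ℕ m) -> RD ys μs ≈ Pf μs X) -> ∀ b r -> r < b -> ∀ (μs : Vec ℕ m) -> RD ys (μs Vec.∷ʳ r) ≈ Pf (μs Vec.∷ʳ r) X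
    step {m} IH (suc b) r (s≤s r≤b) μs = go (μs Vec.∷ʳ r) ≡.refl
     where
     smaller : ∀ (κs : Vec ℕ (suc m)) -> Vec.last κs < r -> RD ys κs ≈ Pf κs X
     smaller κs lt = subst (\ κ -> RD ys κ ≈ Pf κ X) (≡.sym (snd (snd (Vec.initLast κs))))
      (step IH b (Vec.last κs) (Nₚ.<-≤-trans lt r≤b) (Vec.init κs))
     go : ∀ κ* -> κ* ≡ μs Vec.∷ʳ r -> RD ys κ* ≈ Pf κ* X
     go κ*@(k* ∷ κs*) eq with Desc? D κ*
     ... | no ¬D = trans (RD-¬Desc ys κ* ¬D) (sym (Pf-¬Desc D κ* X lX ¬D))
     ... | yes Dκ = x-y≈0⇒x≈y (begin
       RD ys κ* - Pf κ* X ≈⟨ *-identityˡ _ ⟨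
       1# * (RD ys κ* - Pf κ* X) ≈⟨ *-congʳ one ⟨
       coeff μs r κ* * (RD ys κ* - Pf κ* X) ≈⟨ ∑-box-single κ* D<N Dκ other ⟨
       ∑ (box (suc m)) (\ κs -> coeff μs r κs * (RD ys κs - Pf κs X)) ≈⟨ compare μs (IH μs) r ⟩
       0# ∎)
      where
      dg = diagonal k* μs κs* r eq Dκ
      one : coeff μs r κ* ≈ 1#
      one = trans (*-cong (dg .fst) (trans (≈-cong (δ r) (dg .snd)) (δ-refl r))) (*-identityˡ _)
      other : ∀ κs -> κs ≢ κ* -> coeff μs r κs * (RD ys κs - Pf κs X) ≈ 0#
      other (k ∷ κs) ne with size k μs κs N.≟ r
      ... | no sz≢r = *-zeroˡ-≈ (*-zeroʳ-≈ (δ-≢ (\ e -> sz≢r (≡.sym e))))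
      ... | yes sz with interlace k μs κs
      ...   | vanish z = *-zeroˡ-≈ (trans (*-congʳ z) (zeroˡ _))
      ...   | small lt = *-zeroʳ-≈ (trans (+-congʳ (smaller (k ∷ κs) (subst (Vec.last (k ∷ κs) <_) sz lt))) (-‿inverseʳ _))
      ...   | equal e = ⊥-elim (ne (≡.trans e (≡.trans (cong (μs Vec.∷ʳ_) sz) (≡.sym eq))))

    main : ∀ {m} (λs : Vec ℕ m) -> RD ys λs ≈ Pf λs X
    main [] = RD-[] ys
    main {suc m} λs with Vec.initLast λs
    ... | μs , r , ≡.refl = step main (suc r) r Nₚ.≤-refl μs

-- Letters that are powers of t, sums over sign changes, and the bounded Littlewood identity.

record Geom (R : CRing) : Set where
 open Kit R
 field
  t       : Carrier
  geo     : ℕ -> Carrier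
  geo-inv : ∀ k -> (1# - t ^ suc k) * geo k ≈ 1#

private
 add-diff : ∀ a b -> a Z.+ (b Z.- a) ≡ b
 add-diff = Z-solve

 sub-diff : ∀ a b -> b Z.- (b Z.- a) ≡ a
 sub-diff = Z-solve

private module _ (R : CRing) where
 open Kit R
 module Geometric (𝔾 : Geom R) where
  open Geom 𝔾

  -- H e is 1 / (1 - t^e) also for e < 0; the value at 0 is junk.
  H : ℤ -> Carrier
  H (+ zero) = 0#
  H (+ suc k) = geo k
  H -[1+ k ] = 1# - geo k

  H-inv : ∀ k -> k ≢ 0 -> (1# - t ^ k) * H (+ k) ≈ 1#
  H-inv zero ne = ⊥-elim (ne ≡.refl)
  H-inv (suc k) _ = geo-inv k

  H-sum : ∀ e -> e ≢ + 0 -> H e + H (Z.- e) ≈ 1#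
  H-sum (+ zero) ne = ⊥-elim (ne ≡.refl)
  H-sum (+ suc k) _ = solve 1 (\ a -> a :+ (1ₚ :- a) := 1ₚ) refl _
  H-sum -[1+ k ] _ = solve 1 (\ a -> (1ₚ :- a) :+ a := 1ₚ) refl _

  H-neg : ∀ e -> e ≢ + 0 -> H (Z.- e) ≈ 1# - H e
  H-neg e ne = trans (solve 2 (\ a b -> b := (a :+ b) :- a) refl (H e) (H (Z.- e))) (+-congʳ (H-sum e ne))

  t-H : ∀ k -> k ≢ 0 -> t ^ k * H (+ k) ≈ H (+ k) - 1#
  t-H k ne = trans (solve 2 (\ a b -> a :* b := b :- (1ₚ :- a) :* b) refl _ _) (+-congˡ (-‿cong (H-inv k ne)))

  private
   H-pos-* : ∀ a b -> a ≢ 0 -> b ≢ 0 -> H (+ a) * H (+ b) ≈ H (+ (a N.+ b)) * (H (+ a) + H (+ b) - 1#)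
   H-pos-* a b a≢0 b≢0 = unit-cancel (H-inv (a N.+ b) ab≢0) (begin
    (1# - t ^ (a N.+ b)) * (x * y) ≈⟨ *-congʳ (+-congˡ (-‿cong (^-+ t a b))) ⟩
    (1# - t ^ a * t ^ b) * (x * y)
     ≈⟨ solve 4 (\ u v x y -> (1ₚ :- u :* v) :* (x :* y) := ((1ₚ :- u) :* x) :* y :+ ((1ₚ :- v) :* y) :* x :- ((1ₚ :- u) :* x) :* ((1ₚ :- v) :* y)) refl _ _ _ _ ⟩
    ((1# - t ^ a) * x) * y + ((1# - t ^ b) * y) * x - ((1# - t ^ a) * x) * ((1# - t ^ b) * y)
     ≈⟨ +-cong (+-cong (*-congʳ (H-inv a a≢0)) (*-congʳ (H-inv b b≢0))) (-‿cong (*-cong (H-inv a a≢0) (H-inv b b≢0))) ⟩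
    1# * y + 1# * x - 1# * 1# ≈⟨ solve 2 (\ x y -> 1ₚ :* y :+ 1ₚ :* x :- 1ₚ :* 1ₚ := 1ₚ :* (x :+ y :- 1ₚ)) refl _ _ ⟩
    1# * (x + y - 1#) ≈⟨ *-congʳ (H-inv (a N.+ b) ab≢0) ⟨
    ((1# - t ^ (a N.+ b)) * H (+ (a N.+ b))) * (x + y - 1#) ≈⟨ *-assoc _ _ _ ⟩
    (1# - t ^ (a N.+ b)) * (H (+ (a N.+ b)) * (x + y - 1#)) ∎)
    where
    x = H (+ a)
    y = H (+ b)
    ab≢0 : a N.+ b ≢ 0
    ab≢0 e = a≢0 (Nₚ.m+n≡0⇒m≡0 a e)

   Three : ℤ -> ℤ -> Set
   Three a b = H a * H b ≈ H (b Z.- a) * H a + H (a Z.- b) * H b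

   three-sym : ∀ {a b} -> Three a b -> Three b a
   three-sym e = trans (*-comm _ _) (trans e (+-comm _ _))

   three-shift : ∀ a c -> c ≢ 0 -> ∀ {b} -> b ≡ a Z.+ + c -> H a * H b ≈ H (+ c) * H a + H (Z.- + c) * H b -> Three a b
   three-shift a c _ ≡.refl e = trans e (+-cong (*-congʳ (≈-cong H (lem₁ a (+ c)))) (*-congʳ (≈-cong H (lem₂ a (+ c)))))
    where
    lem₁ : ∀ a c -> c ≡ (a Z.+ c) Z.- a
    lem₁ = Z-solve
    lem₂ : ∀ a c -> Z.- c ≡ a Z.- (a Z.+ c)
    lem₂ = Z-solve

   -- By symmetry the second exponent may be taken to be the larger one. Negative exponents enter
   -- through H(-e) = 1 - H(e), so every sign pattern comes down to the product rule `H-pos-*`.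
   three-core : ∀ a c -> c ≢ 0 -> a ≢ + 0 -> a Z.+ + c ≢ + 0 -> Three a (a Z.+ + c)
   three-core (+ a) c c≢0 a≢0 _ = three-shift (+ a) c c≢0 ≡.refl (begin
    H (+ a) * H (+ (a N.+ c)) ≈⟨ solve 3 (\ x z b -> x :* b := (b :* (x :+ z :- 1ₚ)) :+ (1ₚ :- z) :* b) refl (H (+ a)) (H (+ c)) _ ⟩
    H (+ (a N.+ c)) * (H (+ a) + H (+ c) - 1#) + (1# - H (+ c)) * H (+ (a N.+ c))
     ≈⟨ +-cong (sym (H-pos-* a c (\ e -> a≢0 (cong +_ e)) c≢0)) (*-congʳ (sym (H-neg (+ c) (\ e -> c≢0 (Zₚ.+-injective e))))) ⟩
    H (+ a) * H (+ c) + H (Z.- + c) * H (+ (a N.+ c)) ≈⟨ +-congʳ (*-comm _ _) ⟩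
    H (+ c) * H (+ a) + H (Z.- + c) * H (+ (a N.+ c)) ∎)
   three-core -[1+ a ] c c≢0 _ b≢0 with -[1+ a ] Z.+ + c in eq
   ... | + zero = ⊥-elim (b≢0 ≡.refl)
   ... | + suc b = three-shift -[1+ a ] c c≢0 (≡.sym eq) (begin
    (1# - geo a) * geo b ≈⟨ solve 3 (\ x y z -> (1ₚ :- x) :* y := y :- x :* y) refl _ _ 0# ⟩
    geo b - H (+ suc a) * H (+ suc b) ≈⟨ +-congˡ (-‿cong (trans (H-pos-* (suc a) (suc b) (\ ()) (\ ())) (*-congʳ (≈-cong (H ∘ +_) (≡.sym c≡))))) ⟩
    geo b - H (+ c) * (geo a + geo b - 1#) ≈⟨ solve 3 (\ x y z -> y :- z :* (x :+ y :- 1ₚ) := z :* (1ₚ :- x) :+ (1ₚ :- z) :* y) refl _ _ _ ⟩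
    H (+ c) * (1# - geo a) + (1# - H (+ c)) * geo b ≈⟨ +-congˡ (*-congʳ (sym (H-neg (+ c) (\ e -> c≢0 (Zₚ.+-injective e))))) ⟩
    H (+ c) * (1# - geo a) + H (Z.- + c) * geo b ∎)
    where
    c≡ : c ≡ suc a N.+ suc b
    c≡ = Zₚ.+-injective (≡.trans (lem (+ suc a) (+ c)) (cong (\ z -> + suc a Z.+ z) eq))
     where
     lem : ∀ a c -> c ≡ a Z.+ (Z.- a Z.+ c)
     lem = Z-solve
   ... | -[1+ b ] = three-shift -[1+ a ] c c≢0 (≡.sym eq) (begin
    (1# - geo a) * (1# - geo b) ≈⟨ solve 3 (\ x y z -> (1ₚ :- x) :* (1ₚ :- y) := (z :* (1ₚ :- x) :+ (1ₚ :- z) :* (1ₚ :- y)) :+ (x :* (y :+ z :- 1ₚ) :- y :* z)) refl _ _ (H (+ c)) ⟩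
    (H (+ c) * (1# - geo a) + (1# - H (+ c)) * (1# - geo b)) + (geo a * (geo b + H (+ c) - 1#) - geo b * H (+ c))
     ≈⟨ +-cong (+-congˡ (*-congʳ (sym (H-neg (+ c) (\ e -> c≢0 (Zₚ.+-injective e))))))
       (trans (+-congʳ (trans (*-congʳ (≈-cong (H ∘ +_) a≡)) (sym (H-pos-* (suc b) c (\ ()) c≢0)))) (-‿inverseʳ _)) ⟩
    (H (+ c) * (1# - geo a) + H (Z.- + c) * (1# - geo b)) + 0# ≈⟨ +-identityʳ _ ⟩
    H (+ c) * (1# - geo a) + H (Z.- + c) * (1# - geo b) ∎)
    where
    a≡ : suc a ≡ suc b N.+ c
    a≡ = Zₚ.+-injective (≡.trans (lem (+ suc a) (+ c)) (cong (\ z -> Z.- z Z.+ + c) eq))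
     where
     lem : ∀ a c -> a ≡ Z.- (Z.- a Z.+ c) Z.+ c
     lem = Z-solve

  H-three : ∀ a b -> a ≢ + 0 -> b ≢ + 0 -> a ≢ b -> Three a b
  H-three a b a≢0 b≢0 a≢b = go (b Z.- a) ≡.refl
   where
   go : ∀ d -> b Z.- a ≡ d -> Three a b
   go (+ c) eq = subst (Three a) b≡ (three-core a c c≢0 a≢0 (subst (_≢ + 0) (≡.sym b≡) b≢0))
    where
    b≡ : a Z.+ + c ≡ b
    b≡ = ≡.trans (cong (\ z -> a Z.+ z) (≡.sym eq)) (add-diff a b)
    c≢0 : c ≢ 0
    c≢0 ≡.refl = a≢b (≡.trans (≡.sym (Zₚ.+-identityʳ a)) b≡)
   go -[1+ c ] eq = three-sym {b} {a} (subst (Three b) a≡ (three-core b (suc c) (\ ()) b≢0 (subst (_≢ + 0) (≡.sym a≡) a≢0)))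
    where
    a≡ : b Z.+ + suc c ≡ a
    a≡ = ≡.trans (cong (\ z -> b Z.- z) (≡.sym eq)) (sub-diff a b)

  t-H-diff : ∀ a b -> a ≢ b -> t ^ a * H (+ b Z.- + a) ≈ t ^ a + t ^ b * H (+ b Z.- + a)
  t-H-diff a b a≢b with + b Z.- + a in eq
  ... | + zero = ⊥-elim (a≢b (≡.sym (Zₚ.+-injective (≡.trans (≡.sym (add-diff (+ a) (+ b))) (≡.trans (cong (\ z -> + a Z.+ z) eq) (Zₚ.+-identityʳ (+ a)))))))
  ... | + suc c = begin
   t ^ a * geo c ≈⟨ solve 3 (\ u v g -> u :* g := u :* ((1ₚ :- v) :* g) :+ (u :* v) :* g) refl _ (t ^ suc c) _ ⟩
   t ^ a * ((1# - t ^ suc c) * geo c) + (t ^ a * t ^ suc c) * geo c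
    ≈⟨ +-cong (*-oneʳ-≈ (geo-inv c)) (*-congʳ (trans (sym (^-+ t a (suc c))) (≈-cong (t ^_) b≡))) ⟩
   t ^ a + t ^ b * geo c ∎
   where
   b≡ : a N.+ suc c ≡ b
   b≡ = Zₚ.+-injective (≡.trans (cong (\ z -> + a Z.+ z) (≡.sym eq)) (add-diff (+ a) (+ b)))
  ... | -[1+ c ] = begin
   t ^ a * (1# - geo c) ≈⟨ *-congʳ (trans (≈-cong (t ^_) (≡.sym a≡)) (^-+ t b (suc c))) ⟩
   (t ^ b * t ^ suc c) * (1# - geo c) ≈⟨ solve 3 (\ u v g -> (u :* v) :* (1ₚ :- g) := (u :* v) :+ (u :* (1ₚ :- g) :- u :* (1ₚ :- (1ₚ :- v) :* g))) refl _ _ _ ⟩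
   (t ^ b * t ^ suc c) + (t ^ b * (1# - geo c) - t ^ b * (1# - (1# - t ^ suc c) * geo c))
    ≈⟨ +-cong (trans (sym (^-+ t b (suc c))) (≈-cong (t ^_) a≡))
      (trans (+-congˡ (-‿cong (*-congˡ (trans (+-congˡ (-‿cong (geo-inv c))) (-‿inverseʳ _))))) (solve 2 (\ a b -> a :- b :* 0ₚ := a) refl _ _)) ⟩
   t ^ a + t ^ b * (1# - geo c) ∎
   where
   a≡ : b N.+ suc c ≡ a
   a≡ = Zₚ.+-injective (≡.trans (cong (\ z -> + b Z.- z) (≡.sym eq)) (sub-diff (+ a) (+ b)))

  diff≢0 : ∀ {a b : ℤ} -> a ≢ b -> b Z.- a ≢ + 0
  diff≢0 {a} {b} ne e = ne (≡.trans (≡.sym (Zₚ.+-identityʳ a)) (≡.trans (cong (\ z -> a Z.+ z) (≡.sym e)) (add-diff a b)))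

  -- The index a stands for the letter t^a. Since t^a/(t^a - t^b) = 1/(1 - t^(b-a)) depends on the
  -- difference alone, letters with negative exponents are available without inverting t.
  ℤ-kernel : Carrier -> Kernel R ℤ
  ℤ-kernel p = record
   { p = p ; _#_ = _≢_ ; #-sym = \ ne e -> ne (≡.sym e) ; h = \ a b -> H (b Z.- a)
   ; h-sum = \ {a} {b} ne -> trans (+-congˡ (≈-cong H (lem a b))) (H-sum (b Z.- a) (diff≢0 ne))
   ; h-three = \ {s} {v} {y} sv sy vy -> trans (H-three (v Z.- s) (y Z.- s) (diff≢0 sv) (diff≢0 sy) (\ e -> vy (cancel s v y e)))
     (+-cong (*-congʳ (≈-cong H (lem₂ s v y))) (*-congʳ (≈-cong H (lem₂ s y v)))) }
   where
   lem : ∀ a b -> a Z.- b ≡ Z.- (b Z.- a)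
   lem = Z-solve
   lem₂ : ∀ s v y -> (y Z.- s) Z.- (v Z.- s) ≡ y Z.- v
   lem₂ = Z-solve
   lem₃ : ∀ s v -> (v Z.- s) Z.+ s ≡ v
   lem₃ = Z-solve
   cancel : ∀ s v y -> v Z.- s ≡ y Z.- s -> v ≡ y
   cancel s v y e = ≡.trans (≡.sym (lem₃ s v)) (≡.trans (cong (\ z -> z Z.+ s) e) (lem₃ s y))

  ℕ-alphabet : ∀ P -> P ≢ 0 -> Alphabet R ℕ
  ℕ-alphabet P P≢0 = record
   { kernel = record
    { p = t ^ P ; _#_ = _≢_ ; #-sym = \ ne e -> ne (≡.sym e) ; h = \ a b -> H (+ b Z.- + a)
    ; h-sum = \ ne -> Kernel.h-sum K (inj ne)
    ; h-three = \ sv sy vy -> Kernel.h-three K (inj sv) (inj sy) (inj vy) }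
   ; x = t ^_
   ; h-x = \ {s} {y} ne -> t-H-diff s y ne
   ; unit = \ k -> H (+ (P N.* suc k))
   ; unit-inv = \ k -> trans (*-congʳ (+-congˡ (-‿cong (^^ P (suc k))))) (H-inv (P N.* suc k) (\ e -> P≢0 (prod≡0 P k e))) }
   where
   K = ℤ-kernel (t ^ P)
   inj : ∀ {a b : ℕ} -> a ≢ b -> + a ≢ + b
   inj ne e = ne (Zₚ.+-injective e)
   prod≡0 : ∀ P k -> P N.* suc k ≡ 0 -> P ≡ 0
   prod≡0 zero k _ = ≡.refl
   ^^ : ∀ P k -> (t ^ P) ^ k ≈ t ^ (P N.* k)
   ^^ P zero = ≈-cong (t ^_) (≡.sym (Nₚ.*-zeroʳ P))
   ^^ P (suc k) = trans (*-congˡ (^^ P k)) (trans (sym (^-+ t P (P N.* k))) (≈-cong (t ^_) (≡.sym (Nₚ.*-suc P k))))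

signs : List ℤ -> List (List ℤ)
signs [] = [] ∷ []
signs (z ∷ zs) = map (z ∷_) (signs zs) ++ map ((Z.- z) ∷_) (signs zs)

infix 4 _⟂_
_⟂_ : ℤ -> ℤ -> Set
a ⟂ b = a ≢ b × a ≢ Z.- b

⟂-sym : ∀ {a b} -> a ⟂ b -> b ⟂ a
⟂-sym {a} {b} (p , q) = (\ e -> p (≡.sym e)) , (\ e -> q (≡.trans (≡.sym (Zₚ.neg-involutive a)) (cong Z.-_ (≡.sym e))))

⟂-negʳ : ∀ {a b} -> a ⟂ b -> a ⟂ Z.- b
⟂-negʳ {a} {b} (p , q) = q , (\ e -> p (≡.trans e (Zₚ.neg-involutive b)))

⟂-negˡ : ∀ {a b} -> a ⟂ b -> Z.- a ⟂ b
⟂-negˡ p = ⟂-sym (⟂-negʳ (⟂-sym p))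

neg≢0 : ∀ {a : ℤ} -> a ≢ + 0 -> Z.- a ≢ + 0
neg≢0 {a} ne e = ne (≡.trans (≡.sym (Zₚ.neg-involutive a)) (cong Z.-_ e))

record Good (X : List ℤ) : Set where
 constructor good
 field
  nonzero : All (_≢ + 0) X
  apart   : AllPairs _⟂_ X

signs-All : ∀ {P : ℤ -> Set} -> (∀ {z} -> P z -> P (Z.- z)) -> ∀ {X} -> All P X -> All (All P) (signs X)
signs-All ng [] = [] ∷ []
signs-All ng (px ∷ pX) = Allₚ.++⁺ (Allₚ.map⁺ (All.map (px ∷_) (signs-All ng pX))) (Allₚ.map⁺ (All.map (ng px ∷_) (signs-All ng pX)))

signs-AllPairs : ∀ {X} -> AllPairs _⟂_ X -> All (AllPairs _⟂_) (signs X)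
signs-AllPairs [] = [] ∷ []
signs-AllPairs {x ∷ X} (px ∷ pX) = Allₚ.++⁺
 (Allₚ.map⁺ (All.map (\ { (a , b) -> a ∷ b }) (All-zip (signs-All ⟂-negʳ px) (signs-AllPairs pX))))
 (Allₚ.map⁺ (All.map (\ { (a , b) -> All.map ⟂-negˡ a ∷ b }) (All-zip (signs-All ⟂-negʳ px) (signs-AllPairs pX))))

signs-length : ∀ X -> All (\ zs -> length zs ≡ length X) (signs X)
signs-length [] = ≡.refl ∷ []
signs-length (x ∷ X) = Allₚ.++⁺ (Allₚ.map⁺ (All.map (cong suc) (signs-length X))) (Allₚ.map⁺ (All.map (cong suc) (signs-length X)))

private module _ (R : CRing) where
 open Kit R
 open Subsets R
 module _ (𝔾 : Geom R) where
  open Geom 𝔾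
  open Geometric R 𝔾
  module SignSums (p : Carrier) where
   open Interpolation R (ℤ-kernel p) using (w; partial-fractions; interpolate-1) public

   -- This is (1 - p t^e)/(1 - t^e), the interaction of two letters whose exponents add up to e.
   G : ℤ -> Carrier
   G e = p + (1# - p) * H e

   pairs : List ℤ -> Carrier
   pairs [] = 1#
   pairs (z ∷ zs) = ∏ zs (\ y -> G (z Z.+ y)) * pairs zs

   wt : (ℤ -> Carrier) -> List ℤ -> Carrier
   wt φ zs = ∏ zs φ * pairs zs

   pairs-↭ : ∀ {xs ys} -> xs ↭ ys -> pairs xs ≈ pairs ys
   pairs-↭ Perm.refl = refl
   pairs-↭ (prep x q) = *-cong (∏-↭ q) (pairs-↭ q)
   pairs-↭ (swap x y q) = trans (*-cong (*-cong (≈-cong G (Zₚ.+-comm x y)) (∏-↭ q)) (*-cong (∏-↭ q) (pairs-↭ q)))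
    (*-interchange _ _ _ _)
   pairs-↭ (Perm.trans q r) = trans (pairs-↭ q) (pairs-↭ r)

   wt-↭ : ∀ φ {xs ys} -> xs ↭ ys -> wt φ xs ≈ wt φ ys
   wt-↭ φ q = *-cong (∏-↭ q) (pairs-↭ q)

   cross : List ℤ -> List ℤ -> Carrier
   cross xs ys = ∏ xs (\ a -> ∏ ys (\ b -> G (a Z.+ b)))

   pairs-++ : ∀ xs ys -> pairs (xs ++ ys) ≈ pairs xs * (cross xs ys * pairs ys)
   pairs-++ [] ys = sym (trans (*-identityˡ _) (*-identityˡ _))
   pairs-++ (z ∷ xs) ys = trans (*-cong (∏-++ xs ys) (pairs-++ xs ys))
    (solve 5 (\ a b c d e -> (a :* b) :* (c :* (d :* e)) := (a :* c) :* ((b :* d) :* e)) refl _ _ _ _ _)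

   wt-++ : ∀ φ xs ys -> wt φ (xs ++ ys) ≈ wt φ xs * (cross xs ys * wt φ ys)
   wt-++ φ xs ys = trans (*-cong (∏-++ xs ys) (pairs-++ xs ys))
    (solve 5 (\ a b c d e -> (a :* b) :* (c :* (d :* e)) := (a :* c) :* (d :* (b :* e))) refl _ _ _ _ _)

   ∑-signs : ∀ z zs {f : List ℤ -> Carrier} -> ∑ (signs (z ∷ zs)) f ≈ ∑ (signs zs) (\ v -> f (z ∷ v) + f ((Z.- z) ∷ v))
   ∑-signs z zs = trans (∑-++ (map (z ∷_) (signs zs)) (map ((Z.- z) ∷_) (signs zs)))
    (trans (+-cong (∑-map (z ∷_) (signs zs)) (∑-map ((Z.- z) ∷_) (signs zs))) (sym (∑-+ (signs zs))))

   picks-signs : ∀ X (f : ℤ -> List ℤ -> Carrier) -> ∑ (signs X) (\ zs -> ∑ (picks zs) (\ sr -> f (sr .fst) (sr .snd))) ≈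
    ∑ (picks X) (\ sr -> ∑ (signs (sr .snd)) (\ r -> f (sr .fst) r + f (Z.- fst sr) r))
   picks-signs [] f = +-identityʳ _
   picks-signs (x ∷ X) f = begin
    ∑ (signs (x ∷ X)) (\ zs -> ∑ (picks zs) (\ sr -> f (sr .fst) (sr .snd)))
     ≈⟨ trans (∑-signs x X) (∑-cong (signs X) (\ v -> trans (+-cong (∑-picks x v) (∑-picks (Z.- x) v))
       (trans (+-interchange _ _ _ _) (+-congˡ (sym (∑-+ (picks v))))))) ⟩
    ∑ (signs X) (\ v -> (f x v + f (Z.- x) v) + ∑ (picks v) (\ sr -> g (sr .fst) (sr .snd))) ≈⟨ ∑-+ (signs X) ⟩
    ∑ (signs X) (\ v -> f x v + f (Z.- x) v) + ∑ (signs X) (\ v -> ∑ (picks v) (\ sr -> g (sr .fst) (sr .snd))) ≈⟨ +-congˡ (picks-signs X g) ⟩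
    ∑ (signs X) (\ v -> f x v + f (Z.- x) v) + ∑ (picks X) (\ sr -> ∑ (signs (sr .snd)) (\ r -> g (sr .fst) r + g (Z.- fst sr) r))
     ≈⟨ +-congˡ (∑-cong (picks X) (\ sr -> trans (∑-cong (signs (sr .snd)) (\ r ->
       +-interchange _ _ _ _)) (sym (∑-signs x (sr .snd))))) ⟩
    ∑ (signs X) (\ v -> f x v + f (Z.- x) v) + ∑ (picks X) (\ sr -> ∑ (signs (x ∷ sr .snd)) (\ r -> f (sr .fst) r + f (Z.- fst sr) r)) ≈⟨ ∑-picks x X ⟨
    ∑ (picks (x ∷ X)) (\ sr -> ∑ (signs (sr .snd)) (\ r -> f (sr .fst) r + f (Z.- fst sr) r)) ∎
    where
    g : ℤ -> List ℤ -> Carrier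
    g s r = f s (x ∷ r) + f s ((Z.- x) ∷ r)

   private
    w-G : ∀ s y -> w (Z.- s) y ≈ G (s Z.+ y)
    w-G s y = ≈-cong G (lem s y)
     where
     lem : ∀ s y -> y Z.- (Z.- s) ≡ s Z.+ y
     lem = Z-solve

    w-G′ : ∀ s y -> w s y ≈ G (Z.- s Z.+ y)
    w-G′ s y = ≈-cong G (Zₚ.+-comm y (Z.- s))

   -- Summing over the sign of s kills odd functions of s, since ∏ G (y - s) G (y + s) is even.
   odd-cancel : ∀ (φ ω : ℤ -> Carrier) X -> All (\ s -> ω (Z.- s) ≈ - ω s) X ->
    ∑ (signs X) (\ zs -> ∑ (picks zs) (\ sr -> ω (sr .fst) * (∏ (sr .snd) (w (sr .fst)) * (∏ (sr .snd) φ * (∏ (sr .snd) (\ y -> G (sr .fst Z.+ y)) * pairs (sr .snd)))))) ≈ 0#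
   odd-cancel φ ω X odd = trans (picks-signs X _) (∑-0-All (All.map (\ q -> All.head (Permₚ.All-resp-↭ (↭-sym q) odd)) (picks-↭ X))
    (\ { (s , r) od -> ∑-0 (signs r) (\ v -> begin
     ω s * (∏ v (w s) * (∏ v φ * (∏ v (\ y -> G (s Z.+ y)) * pairs v))) + ω (Z.- s) * (∏ v (w (Z.- s)) * (∏ v φ * (∏ v (\ y -> G (Z.- s Z.+ y)) * pairs v)))
      ≈⟨ +-congˡ (*-cong od (*-cong (∏-cong v (w-G s)) (*-congˡ (*-congʳ (∏-cong v (\ y -> sym (w-G′ s y))))))) ⟩
     ω s * (∏ v (w s) * (∏ v φ * (∏ v (\ y -> G (s Z.+ y)) * pairs v))) + (- ω s) * (∏ v (\ y -> G (s Z.+ y)) * (∏ v φ * (∏ v (w s) * pairs v)))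
      ≈⟨ solve 5 (\ o a b c d -> o :* (a :* (b :* (c :* d))) :+ (:- o) :* (c :* (b :* (a :* d))) := 0ₚ) refl _ _ _ _ _ ⟩
     0# ∎) }))

   private
    regroup : ∀ φ (ψ : ℤ -> Carrier) zs ->
     ∑ (picks zs) (\ sr -> ∏ (sr .snd) (w (sr .fst)) * ψ (sr .fst)) * wt φ zs ≈
     ∑ (picks zs) (\ sr -> (ψ (sr .fst) * φ (sr .fst)) * (∏ (sr .snd) (w (sr .fst)) * (∏ (sr .snd) φ * (∏ (sr .snd) (\ y -> G (sr .fst Z.+ y)) * pairs (sr .snd)))))
    regroup φ ψ zs = trans (sym (∑-*ʳ (picks zs))) (∑-cong-All (picks-↭ zs) (\ { (s , r) q ->
     trans (*-congˡ (sym (wt-↭ φ q))) (solve 6 (\ a b c d e f -> (a :* b) :* ((c :* d) :* (e :* f)) := (b :* c) :* (a :* (d :* (e :* f)))) refl _ _ _ _ _ _) }))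

    apart-± : ∀ {y zs} -> All (y ⟂_) zs -> All (y ≢_) zs × All (Z.- y ≢_) zs
    apart-± a = All.map fst a , All.map (\ q -> fst (⟂-negˡ q)) a

    pf± : ∀ y zs -> All (y ⟂_) zs -> AllPairs _⟂_ zs ->
     (∏ zs (\ z -> G (y Z.+ z)) ≈ 1# - (1# - p) * ∑ (picks zs) (\ sr -> ∏ (sr .snd) (w (sr .fst)) * H (Z.- y Z.- sr .fst))) ×
     (∏ zs (\ z -> G (Z.- y Z.+ z)) ≈ 1# - (1# - p) * ∑ (picks zs) (\ sr -> ∏ (sr .snd) (w (sr .fst)) * H (y Z.- sr .fst)))
    pf± y zs a d = trans (∏-cong zs (\ z -> sym (w-G y z))) (partial-fractions (snd (apart-± a)) (AllPairs.map fst d))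
          , trans (∏-cong zs (\ z -> sym (w-G′ y z))) (partial-fractions (fst (apart-± a)) (AllPairs.map fst d))

    H-flip₁ : ∀ y s -> y ⟂ s -> H (Z.- y Z.- (Z.- s)) ≈ 1# - H (y Z.- s)
    H-flip₁ y s (p , _) = trans (≈-cong H (lem y s)) (H-neg (y Z.- s) (diff≢0 (\ e -> p (≡.sym e))))
     where
     lem : ∀ y s -> Z.- y Z.- (Z.- s) ≡ Z.- (y Z.- s)
     lem = Z-solve

    H-flip₂ : ∀ y s -> y ⟂ s -> H (y Z.- (Z.- s)) ≈ 1# - H (Z.- y Z.- s)
    H-flip₂ y s ap = trans (≈-cong H (lem y s)) (H-neg (Z.- y Z.- s) (diff≢0 (\ e -> fst (⟂-negˡ ap) (≡.sym e))))
     where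
     lem : ∀ y s -> y Z.- (Z.- s) ≡ Z.- (Z.- y Z.- s)
     lem = Z-solve

   -- The factors that contain ±y are expanded in partial fractions. The constant terms cancel
   -- because φ is odd, and every residue at another letter s is an odd function of s, which
   -- `odd-cancel` removes.
   odd-sum-0 : ∀ φ y X -> (∀ z -> z ≢ + 0 -> φ (Z.- z) ≈ - φ z) -> Good (y ∷ X) -> ∑ (signs (y ∷ X)) (wt φ) ≈ 0#
   odd-sum-0 φ y X odd (good (y0 ∷ X0) (yX ∷ XX)) = begin
    ∑ (signs (y ∷ X)) (wt φ) ≈⟨ ∑-signs y X ⟩
    ∑ (signs X) (\ v -> wt φ (y ∷ v) + wt φ ((Z.- y) ∷ v))
     ≈⟨ ∑-cong-All (All-zip (signs-All ⟂-negʳ yX) (signs-AllPairs XX)) (\ v (a , d) -> begin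
       (φ y * ∏ v φ) * (∏ v (\ z -> G (y Z.+ z)) * pairs v) + (φ (Z.- y) * ∏ v φ) * (∏ v (\ z -> G (Z.- y Z.+ z)) * pairs v)
        ≈⟨ +-cong (*-congˡ (*-congʳ (fst (pf± y v a d)))) (*-cong (*-congʳ (odd y y0)) (*-congʳ (snd (pf± y v a d)))) ⟩
       (φ y * ∏ v φ) * ((1# - (1# - p) * S₁ v) * pairs v) + (- φ y * ∏ v φ) * ((1# - (1# - p) * S₂ v) * pairs v)
        ≈⟨ solve 6 (\ f F c a b P -> (f :* F) :* ((1ₚ :- c :* a) :* P) :+ ((:- f) :* F) :* ((1ₚ :- c :* b) :* P) := f :* c :* ((b :- a) :* (F :* P))) refl _ _ _ _ _ _ ⟩
       φ y * (1# - p) * ((S₂ v - S₁ v) * wt φ v)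
        ≈⟨ *-congˡ (trans (*-congʳ (combine v)) (regroup φ ψ v)) ⟩
       φ y * (1# - p) * T v ∎) ⟩
    ∑ (signs X) (\ v -> φ y * (1# - p) * T v) ≈⟨ ∑-*ˡ (signs X) ⟩
    φ y * (1# - p) * ∑ (signs X) T ≈⟨ *-congˡ (odd-cancel φ (\ s -> ψ s * φ s) X (All.map even-odd (All-zip yX X0))) ⟩
    φ y * (1# - p) * 0# ≈⟨ zeroʳ _ ⟩
    0# ∎
    where
    ψ : ℤ -> Carrier
    ψ s = H (y Z.- s) - H (Z.- y Z.- s)
    S₁ S₂ T : List ℤ -> Carrier
    S₁ v = ∑ (picks v) (\ sr -> ∏ (sr .snd) (w (sr .fst)) * H (Z.- y Z.- sr .fst))
    S₂ v = ∑ (picks v) (\ sr -> ∏ (sr .snd) (w (sr .fst)) * H (y Z.- sr .fst))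
    T v = ∑ (picks v) (\ sr -> (ψ (sr .fst) * φ (sr .fst)) * (∏ (sr .snd) (w (sr .fst)) * (∏ (sr .snd) φ * (∏ (sr .snd) (\ y -> G (sr .fst Z.+ y)) * pairs (sr .snd)))))
    combine : ∀ v -> S₂ v - S₁ v ≈ ∑ (picks v) (\ sr -> ∏ (sr .snd) (w (sr .fst)) * ψ (sr .fst))
    combine v = trans (+-congˡ (sym (∑-neg (picks v)))) (trans (sym (∑-+ (picks v))) (∑-cong (picks v) (\ sr -> solve 3 (\ a b c -> a :* b :+ (:- (a :* c)) := a :* (b :- c)) refl _ _ _)))
    even-odd : ∀ {s} -> y ⟂ s × s ≢ + 0 -> ψ (Z.- s) * φ (Z.- s) ≈ - (ψ s * φ s)
    even-odd {s} (ys , s0) = trans (*-cong (+-cong (H-flip₂ y s ys) (-‿cong (H-flip₁ y s ys))) (odd s s0))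
     (solve 3 (\ a b f -> ((1ₚ :- b) :- (1ₚ :- a)) :* (:- f) := :- ((a :- b) :* f)) refl _ _ _)

   module _ (τ : Carrier) where

    -- This is (1 + τ t^e)/(1 - t^e).
    φτ : ℤ -> Carrier
    φτ e = (1# + τ) * H e - τ

    τ-prod : ℕ -> Carrier
    τ-prod zero = 1#
    τ-prod (suc n) = (1# - τ * p ^ n) * τ-prod n

    -- Partial fractions in the letter y leave the constant 1 - τ p^(|X|) and residues at the other
    -- letters. These are odd in the letter and cancel over its two signs, so each letter
    -- contributes one factor of (τ;p).
    sign-sum : ∀ X -> Good X -> ∑ (signs X) (wt φτ) ≈ τ-prod (length X)
    sign-sum [] _ = solve 0 (1ₚ :* 1ₚ :+ 0ₚ := 1ₚ) refl
    sign-sum (y ∷ X) (good (y0 ∷ X0) (yX ∷ XX)) = begin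
     ∑ (signs (y ∷ X)) (wt φτ) ≈⟨ ∑-signs y X ⟩
     ∑ (signs X) (\ v -> wt φτ (y ∷ v) + wt φτ ((Z.- y) ∷ v))
      ≈⟨ ∑-cong-All (All-zip (All-zip (signs-All ⟂-negʳ yX) (signs-AllPairs XX)) (All-zip (signs-All neg≢0 X0) (signs-length X))) (\ { v ((a , d) , (v0 , ln)) -> begin
        (φτ y * ∏ v φτ) * (∏ v (\ z -> G (y Z.+ z)) * pairs v) + (φτ (Z.- y) * ∏ v φτ) * (∏ v (\ z -> G (Z.- y Z.+ z)) * pairs v)
         ≈⟨ solve 6 (\ f F a g b P -> (f :* F) :* (a :* P) :+ (g :* F) :* (b :* P) := (f :* a :+ g :* b) :* (F :* P)) refl _ _ _ _ _ _ ⟩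
        (φτ y * ∏ v (\ z -> G (y Z.+ z)) + φτ (Z.- y) * ∏ v (\ z -> G (Z.- y Z.+ z))) * wt φτ v ≈⟨ *-congʳ (bracket v a d v0 ln) ⟩
        ((1# - τ * p ^ length X) - (1# - p) * ∑ (picks v) (\ sr -> ∏ (sr .snd) (w (sr .fst)) * ψ (sr .fst))) * wt φτ v
         ≈⟨ solve 4 (\ a c s W -> (a :- c :* s) :* W := a :* W :+ (:- c) :* (s :* W)) refl _ _ _ _ ⟩
        (1# - τ * p ^ length X) * wt φτ v + (- (1# - p)) * (∑ (picks v) (\ sr -> ∏ (sr .snd) (w (sr .fst)) * ψ (sr .fst)) * wt φτ v)
         ≈⟨ +-congˡ (*-congˡ (regroup φτ ψ v)) ⟩
        (1# - τ * p ^ length X) * wt φτ v + (- (1# - p)) * T v ∎ }) ⟩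
     ∑ (signs X) (\ v -> (1# - τ * p ^ length X) * wt φτ v + (- (1# - p)) * T v) ≈⟨ trans (∑-+ (signs X)) (+-cong (∑-*ˡ (signs X)) (∑-*ˡ (signs X))) ⟩
     (1# - τ * p ^ length X) * ∑ (signs X) (wt φτ) + (- (1# - p)) * ∑ (signs X) T
      ≈⟨ +-cong (*-congˡ (sign-sum X (good X0 XX))) (*-congˡ (odd-cancel φτ (\ s -> ψ s * φτ s) X (All.map odd yX))) ⟩
     (1# - τ * p ^ length X) * τ-prod (length X) + (- (1# - p)) * 0# ≈⟨ solve 2 (\ a b -> a :+ b :* 0ₚ := a) refl _ _ ⟩
     (1# - τ * p ^ length X) * τ-prod (length X) ∎
     where
     ψ : ℤ -> Carrier
     ψ s = φτ (Z.- s) * (H (Z.- y Z.- s) + H (y Z.- s) - 1#)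
     T : List ℤ -> Carrier
     T v = ∑ (picks v) (\ sr -> (ψ (sr .fst) * φτ (sr .fst)) * (∏ (sr .snd) (w (sr .fst)) * (∏ (sr .snd) φτ * (∏ (sr .snd) (\ y -> G (sr .fst Z.+ y)) * pairs (sr .snd)))))

     odd : ∀ {s} -> y ⟂ s -> ψ (Z.- s) * φτ (Z.- s) ≈ - (ψ s * φτ s)
     odd {s} ys = trans (*-congʳ (*-cong (≈-cong φτ (Zₚ.neg-involutive s)) (+-congʳ (+-cong (H-flip₁ y s ys) (H-flip₂ y s ys)))))
      (solve 4 (\ f g a b -> (f :* (((1ₚ :- a) :+ (1ₚ :- b)) :- 1ₚ)) :* g := :- ((g :* ((b :+ a) :- 1ₚ)) :* f)) refl _ _ _ _)

     H-H : ∀ y s -> y ≢ + 0 -> s ≢ + 0 -> y ⟂ s -> φτ y * H (Z.- y Z.- s) ≈ φτ (Z.- s) * H (Z.- y Z.- s) - (1# + τ) * H (Z.- s) * H (Z.- y)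
     H-H y s y0 s0 ys = begin
      ((1# + τ) * H y - τ) * b ≈⟨ *-congʳ (+-congʳ (*-congˡ (trans (≈-cong H (≡.sym (Zₚ.neg-involutive y))) (H-neg (Z.- y) (neg≢0 y0))))) ⟩
      ((1# + τ) * (1# - H (Z.- y)) - τ) * b ≈⟨ solve 3 (\ τ a b -> ((1ₚ :+ τ) :* (1ₚ :- a) :- τ) :* b := (1ₚ :+ τ) :* (b :- a :* b) :- τ :* b) refl _ _ _ ⟩
      (1# + τ) * (b - H (Z.- y) * b) - τ * b
       ≈⟨ +-congʳ (*-congˡ (+-congˡ (-‿cong (H-three (Z.- y) (Z.- y Z.- s) (neg≢0 y0) (diff≢0 (\ e -> fst (⟂-negˡ ys) (≡.sym e))) ne)))) ⟩
      (1# + τ) * (b - (H ((Z.- y Z.- s) Z.- (Z.- y)) * H (Z.- y) + H (Z.- y Z.- (Z.- y Z.- s)) * b)) - τ * b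
       ≈⟨ +-congʳ (*-congˡ (+-congˡ (-‿cong (+-cong (*-congʳ (≈-cong H (lem₁ y s))) (*-congʳ (trans (≈-cong H (lem₂ y s)) (H-neg (Z.- s) (neg≢0 s0)))))))) ⟩
      (1# + τ) * (b - (H (Z.- s) * H (Z.- y) + (1# - H (Z.- s)) * b)) - τ * b
       ≈⟨ solve 4 (\ τ b h a -> (1ₚ :+ τ) :* (b :- (h :* a :+ (1ₚ :- h) :* b)) :- τ :* b := ((1ₚ :+ τ) :* h :- τ) :* b :- (1ₚ :+ τ) :* h :* a) refl _ _ _ _ ⟩
      φτ (Z.- s) * b - (1# + τ) * H (Z.- s) * H (Z.- y) ∎
      where
      b = H (Z.- y Z.- s)
      lem₁ : ∀ y s -> (Z.- y Z.- s) Z.- (Z.- y) ≡ Z.- s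
      lem₁ = Z-solve
      lem₂ : ∀ y s -> Z.- y Z.- (Z.- y Z.- s) ≡ Z.- (Z.- s)
      lem₂ = Z-solve
      lem₃ : ∀ y s -> y ≡ (y Z.- s) Z.+ s
      lem₃ = Z-solve
      ne : Z.- y ≢ Z.- y Z.- s
      ne e = s0 (≡.trans (≡.sym (lem₄ y s)) (≡.trans (cong (\ z -> Z.- y Z.- z) (≡.sym e)) (Zₚ.+-inverseʳ (Z.- y))))
       where
       lem₄ : ∀ y s -> Z.- y Z.- (Z.- y Z.- s) ≡ s
       lem₄ = Z-solve

     both : ∀ s -> s ≢ + 0 -> y ⟂ s -> φτ y * H (Z.- y Z.- s) + φτ (Z.- y) * H (y Z.- s) ≈ ψ s - τ
     both s s0 ys = begin
      φτ y * H (Z.- y Z.- s) + φτ (Z.- y) * H (y Z.- s)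
       ≈⟨ +-cong (H-H y s y0 s0 ys) (trans (*-congˡ (≈-cong (\ z -> H (z Z.- s)) (≡.sym (Zₚ.neg-involutive y))))
         (trans (H-H (Z.- y) s (neg≢0 y0) s0 (⟂-negˡ ys))
          (+-cong (*-congˡ (≈-cong (\ z -> H (z Z.- s)) (Zₚ.neg-involutive y))) (-‿cong (*-congˡ (≈-cong H (Zₚ.neg-involutive y))))))) ⟩
      (φτ (Z.- s) * H (Z.- y Z.- s) - (1# + τ) * H (Z.- s) * H (Z.- y)) + (φτ (Z.- s) * H (y Z.- s) - (1# + τ) * H (Z.- s) * H y)
       ≈⟨ +-congʳ (+-congˡ (-‿cong (*-congˡ (H-neg y y0)))) ⟩
      (φτ (Z.- s) * H (Z.- y Z.- s) - (1# + τ) * H (Z.- s) * (1# - H y)) + (φτ (Z.- s) * H (y Z.- s) - (1# + τ) * H (Z.- s) * H y)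
       ≈⟨ solve 5 (\ τ h a b c -> let f = (1ₚ :+ τ) :* h :- τ in
         (f :* a :- (1ₚ :+ τ) :* h :* (1ₚ :- c)) :+ (f :* b :- (1ₚ :+ τ) :* h :* c) := f :* ((a :+ b) :- 1ₚ) :- τ) refl _ _ _ _ _ ⟩
      ψ s - τ ∎

     bracket : ∀ v -> All (y ⟂_) v -> AllPairs _⟂_ v -> All (_≢ + 0) v -> length v ≡ length X ->
      φτ y * ∏ v (\ z -> G (y Z.+ z)) + φτ (Z.- y) * ∏ v (\ z -> G (Z.- y Z.+ z)) ≈
      (1# - τ * p ^ length X) - (1# - p) * ∑ (picks v) (\ sr -> ∏ (sr .snd) (w (sr .fst)) * ψ (sr .fst))
     bracket v a d v0 ln = begin
      φτ y * ∏ v (\ z -> G (y Z.+ z)) + φτ (Z.- y) * ∏ v (\ z -> G (Z.- y Z.+ z)) ≈⟨ +-cong (*-congˡ (fst (pf± y v a d))) (*-congˡ (snd (pf± y v a d))) ⟩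
      φτ y * (1# - (1# - p) * S₁) + φτ (Z.- y) * (1# - (1# - p) * S₂)
       ≈⟨ solve 5 (\ f g c a b -> f :* (1ₚ :- c :* a) :+ g :* (1ₚ :- c :* b) := (f :+ g) :- c :* (f :* a :+ g :* b)) refl _ _ _ _ _ ⟩
      (φτ y + φτ (Z.- y)) - (1# - p) * (φτ y * S₁ + φτ (Z.- y) * S₂) ≈⟨ +-cong sumφ (-‿cong (*-congˡ sumS)) ⟩
      (1# - τ) - (1# - p) * (Sψ + (- τ) * S₀) ≈⟨ solve 4 (\ τ c a b -> (1ₚ :- τ) :- c :* (a :+ (:- τ) :* b) := ((1ₚ :- τ) :+ τ :* (c :* b)) :- c :* a) refl _ _ _ _ ⟩
      ((1# - τ) + τ * ((1# - p) * S₀)) - (1# - p) * Sψ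
       ≈⟨ +-congʳ (+-congˡ (*-congˡ (trans (interpolate-1 (AllPairs.map fst d)) (≈-cong (\ n -> 1# - p ^ n) ln)))) ⟩
      ((1# - τ) + τ * (1# - p ^ length X)) - (1# - p) * Sψ ≈⟨ +-congʳ (solve 2 (\ τ q -> (1ₚ :- τ) :+ τ :* (1ₚ :- q) := 1ₚ :- τ :* q) refl _ _) ⟩
      (1# - τ * p ^ length X) - (1# - p) * Sψ ∎
      where
      Pr : ℤ × List ℤ -> Carrier
      Pr sr = ∏ (sr .snd) (w (sr .fst))
      S₀ = ∑ (picks v) Pr
      S₁ = ∑ (picks v) (\ sr -> Pr sr * H (Z.- y Z.- sr .fst))
      S₂ = ∑ (picks v) (\ sr -> Pr sr * H (y Z.- sr .fst))
      Sψ = ∑ (picks v) (\ sr -> Pr sr * ψ (sr .fst))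
      sumφ : φτ y + φτ (Z.- y) ≈ 1# - τ
      sumφ = trans (+-congˡ (+-congʳ (*-congˡ (H-neg y y0)))) (solve 2 (\ τ h -> ((1ₚ :+ τ) :* h :- τ) :+ ((1ₚ :+ τ) :* (1ₚ :- h) :- τ) := 1ₚ :- τ) refl _ _)
      sumS : φτ y * S₁ + φτ (Z.- y) * S₂ ≈ Sψ + (- τ) * S₀
      sumS = trans (+-cong (sym (∑-*ˡ (picks v))) (sym (∑-*ˡ (picks v)))) (trans (sym (∑-+ (picks v)))
       (trans (∑-cong-All (All-zip (picks-first v0) (picks-first a)) (\ { (s , r) (s0 , ys) ->
         trans (solve 5 (\ f P a g b -> f :* (P :* a) :+ g :* (P :* b) := P :* (f :* a :+ g :* b)) refl _ _ _ _ _)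
          (trans (*-congˡ (both s s0 ys)) (solve 3 (\ P a τ -> P :* (a :- τ) := P :* a :+ (:- τ) :* P) refl _ _ _)) }))
        (trans (∑-+ (picks v)) (+-congˡ (∑-*ˡ (picks v))))))
       where
       picks-first : ∀ {Q : ℤ -> Set} {v} -> All Q v -> All (\ sr -> Q (sr .fst)) (picks v)
       picks-first {v = v} a = All.map (\ q -> All.head (Permₚ.All-resp-↭ (↭-sym q) a)) (picks-↭ v)

-- The bounded Littlewood identity: Σ P_λ over λ₁ ≤ m as a sum over sign vectors.
private module _ (R : CRing) where
 open Kit R
 open Subsets R
 module _ (𝔾 : Geom R) where
  open Geom 𝔾
  open Geometric R 𝔾
  module Littlewood (P : ℕ) (P≢0 : P ≢ 0) where
   open HallLittlewood R (ℕ-alphabet P P≢0) using (arr; xs; Fsum; Distinct; ∏-split; arr-splitʳ; Distinct-↭)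
   open SignSums R 𝔾 (t ^ P) using (G; pairs; wt; wt-↭; wt-++; cross; ∑-signs; odd-sum-0; φτ; τ-prod; sign-sum)

   -- A letter x has weight 1/(1 - x). Inverting it replaces x by 1/x and costs x^m, where m is the
   -- bound on the number of columns.
   W : ℕ -> ℤ -> Carrier
   W m (+ k) = H (+ k)
   W m -[1+ k ] = H -[1+ k ] * t ^ (m N.* suc k)

   Admissible : List ℕ -> Set
   Admissible X = All (_≢ 0) X × Distinct X

   Admissible-↭ : ∀ A B {X} -> A ++ B ↭ X -> Admissible X -> Admissible A × Admissible B
   Admissible-↭ A B q (n , d) =
    (Allₚ.++⁻ˡ A n′ , fst (Distinct-↭ A B q d)) , (Allₚ.++⁻ʳ A n′ , snd (Distinct-↭ A B q d))
    where n′ = Permₚ.All-resp-↭ (↭-sym q) n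

   Admissible⇒Good : ∀ {X} -> Admissible X -> Good (map +_ X)
   Admissible⇒Good (n , d) = good (Allₚ.map⁺ (All.map (\ ne e -> ne (Zₚ.+-injective e)) n)) (ap n d)
    where
    ne-neg : ∀ a {b} -> b ≢ 0 -> + a ≢ Z.- + b
    ne-neg a {zero} b0 _ = b0 ≡.refl
    ne-neg a {suc b} _ ()
    ap : ∀ {X} -> All (_≢ 0) X -> Distinct X -> AllPairs _⟂_ (map +_ X)
    ap [] [] = []
    ap {x ∷ X} (x0 ∷ X0) (xX ∷ XX) = Allₚ.map⁺ (All.map (\ { (ne , b0) -> (\ e -> ne (Zₚ.+-injective e)) , ne-neg x b0 }) (All-zip xX X0)) ∷ ap X0 XX

   neg : List ℕ -> List ℤ
   neg = map (\ i -> Z.- + i)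

   signs-splits : ∀ (f : List ℤ -> Carrier) -> (∀ {xs ys} -> xs ↭ ys -> f xs ≈ f ys) -> ∀ X ->
    ∑ (signs (map +_ X)) f ≈ ∑ (splits X) (\ ij -> f (neg (ij .fst) ++ map +_ (ij .snd)))
   signs-splits f inv [] = refl
   signs-splits f inv (x ∷ X) = begin
    ∑ (signs (+ x ∷ map +_ X)) f ≈⟨ trans (∑-signs (+ x) (map +_ X)) (∑-+ (signs (map +_ X))) ⟩
    ∑ (signs (map +_ X)) (\ v -> f (+ x ∷ v)) + ∑ (signs (map +_ X)) (\ v -> f ((Z.- + x) ∷ v))
     ≈⟨ +-cong (signs-splits (\ v -> f (+ x ∷ v)) (\ q -> inv (prep _ q)) X) (signs-splits (\ v -> f ((Z.- + x) ∷ v)) (\ q -> inv (prep _ q)) X) ⟩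
    ∑ (splits X) (\ ij -> f (+ x ∷ (neg (ij .fst) ++ map +_ (ij .snd)))) + ∑ (splits X) (\ ij -> f ((Z.- + x) ∷ (neg (ij .fst) ++ map +_ (ij .snd))))
     ≈⟨ trans (+-comm _ _) (+-congˡ (∑-cong (splits X) (\ ij -> inv (↭-sym (Permₚ.shift (+ x) (neg (ij .fst)) (map +_ (ij .snd))))))) ⟩
    ∑ (splits X) (\ ij -> f ((Z.- + x) ∷ (neg (ij .fst) ++ map +_ (ij .snd)))) + ∑ (splits X) (\ ij -> f (neg (ij .fst) ++ (+ x ∷ map +_ (ij .snd)))) ≈⟨ ∑-splits x X ⟨
    ∑ (splits (x ∷ X)) (\ ij -> f (neg (ij .fst) ++ map +_ (ij .snd))) ∎

   private
    cross-arr : ∀ I J -> cross (neg I) (map +_ J) ≈ arr I J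
    cross-arr I J = trans (∏-map _ I) (∏-cong I (\ i -> trans (∏-map +_ J) (∏-cong J (\ j -> ≈-cong G (Zₚ.+-comm (Z.- + i) (+ j))))))

    Φ : List ℕ -> Carrier
    Φ J = wt H (map +_ J)

    -- A sum over sign vectors, written with I as the set of inverted letters and an arbitrary
    -- weight k on I.
    S : (List ℕ -> Carrier) -> List ℕ -> Carrier
    S k X = ∑ (splits X) (\ ij -> k (ij .fst) * (arr (ij .fst) (ij .snd) * Φ (ij .snd)))

    S-signs : ∀ φ -> (∀ k -> φ (+ k) ≈ H (+ k)) -> ∀ X -> ∑ (signs (map +_ X)) (wt φ) ≈ S (\ I -> wt φ (neg I)) X
    S-signs φ pos X = trans (signs-splits (wt φ) (wt-↭ φ) X) (∑-cong (splits X) (\ { (I , J) ->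
     trans (wt-++ φ (neg I) (map +_ J)) (*-congˡ (*-cong (cross-arr I J) (*-congʳ (trans (∏-map +_ J) (trans (∏-cong J pos) (sym (∏-map +_ J))))))) }))

    S-cong : ∀ {k k′} X -> (∀ I -> All (_≢ 0) I -> k I ≈ k′ I) -> All (_≢ 0) X -> S k X ≈ S k′ X
    S-cong X e n = ∑-cong-All (splits-↭ X) (\ { (I , J) q -> *-congʳ (e I (Allₚ.++⁻ˡ I (Permₚ.All-resp-↭ (↭-sym q) n))) })

    ρ : List ℕ -> Carrier
    ρ X = ∑ (splits X) (\ ab -> xs (ab .fst) * arr (ab .fst) (ab .snd) * Φ (ab .fst))

    -- The operation in `Fsum` that prepends a column acts on such a sum: inverted letters pick up
    -- their product x_I, and the operation itself falls on Φ of the remaining ones, which yields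
    -- `ρ`.
    transfer : ∀ k X -> ∑ (splits X) (\ ab -> xs (ab .fst) * arr (ab .fst) (ab .snd) * S k (ab .fst)) ≈
     ∑ (splits X) (\ ij -> (xs (ij .fst) * k (ij .fst)) * (arr (ij .fst) (ij .snd) * ρ (ij .snd)))
    transfer k X = begin
     ∑ (splits X) (\ ab -> xs (ab .fst) * arr (ab .fst) (ab .snd) * S k (ab .fst))
      ≈⟨ ∑-cong (splits X) (\ { (A , B) -> trans (sym (∑-*ˡ (splits A))) (∑-cong-All (splits-↭ A) (\ { (I , J) q ->
        trans (*-congʳ (*-cong (sym (∏-split I J q)) (sym (∏-split I J q))))
         (solve 7 (\ xi xj ib jb k ij f -> ((xi :* xj) :* (ib :* jb)) :* (k :* (ij :* f)) := (xi :* k) :* ((ij :* ib) :* (xj :* jb :* f))) refl _ _ _ _ _ _ _) })) }) ⟩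
     ∑ (splits X) (\ ab -> ∑ (splits (ab .fst)) (\ ij -> F (ij .fst) (ij .snd) (ab .snd))) ≈⟨ splits-coassoc X F ⟩
     ∑ (splits X) (\ ij -> ∑ (splits (ij .snd)) (\ jb -> F (ij .fst) (jb .fst) (jb .snd)))
      ≈⟨ ∑-cong (splits X) (\ { (I , J′) -> trans (∑-cong-All (splits-↭ J′) (\ { (J , B) q -> trans (*-congˡ (*-congʳ (arr-splitʳ I J B q))) (sym (*-assoc _ _ _)) }))
        (trans (∑-*ˡ (splits J′)) (*-assoc _ _ _)) }) ⟩
     ∑ (splits X) (\ ij -> (xs (ij .fst) * k (ij .fst)) * (arr (ij .fst) (ij .snd) * ρ (ij .snd))) ∎
     where
     F : List ℕ -> List ℕ -> List ℕ -> Carrier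
     F I J B = (xs I * k I) * ((arr I J * arr I B) * (xs J * arr J B * Φ J))

    -- An odd weight that agrees with `H` on positive exponents and satisfies t^i sgn(-i) = H(-i).
    -- Through `transfer` the vanishing of the odd sum then becomes a statement about `H`.
    sgn : ℤ -> Carrier
    sgn (+ k) = H (+ k)
    sgn -[1+ k ] = - H (+ suc k)

    sgn-odd : ∀ z -> z ≢ + 0 -> sgn (Z.- z) ≈ - sgn z
    sgn-odd (+ zero) ne = ⊥-elim (ne ≡.refl)
    sgn-odd (+ suc k) _ = refl
    sgn-odd -[1+ k ] _ = solve 1 (\ a -> a := :- (:- a)) refl _

    xs-∏ : ∀ (φ ψ : ℤ -> Carrier) -> (∀ i -> i ≢ 0 -> t ^ i * φ (Z.- + i) ≈ ψ (Z.- + i)) -> ∀ {I} -> All (_≢ 0) I -> xs I * wt φ (neg I) ≈ wt ψ (neg I)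
    xs-∏ φ ψ e {I} n = trans (sym (*-assoc _ _ _)) (*-congʳ (trans (*-congˡ (∏-map _ I)) (trans (sym (∏-* I)) (trans (∏-cong-All n e) (sym (∏-map _ I))))))

    sgn-step : ∀ i -> i ≢ 0 -> t ^ i * sgn (Z.- + i) ≈ H (Z.- + i)
    sgn-step zero ne = ⊥-elim (ne ≡.refl)
    sgn-step (suc i) ne = trans (solve 2 (\ a b -> a :* (:- b) := :- (a :* b)) refl _ _) (trans (-‿cong (t-H (suc i) ne)) (solve 1 (\ a -> :- (a :- 1ₚ) := 1ₚ :- a) refl _))

    S-H-1 : ∀ X -> Admissible X -> S (\ I -> wt H (neg I)) X ≈ 1#
    S-H-1 X ad = trans (sym (S-signs H (\ _ -> refl) X)) (trans
     (∑-cong (signs (map +_ X)) (\ zs -> *-congʳ (∏-cong zs (\ z -> solve 1 (\ a -> a := (1ₚ :+ 0ₚ) :* a :- 0ₚ) refl _))))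
     (trans (sign-sum 0# (map +_ X) (Admissible⇒Good ad)) (one (length (map +_ X)))))
     where
     one : ∀ n -> τ-prod 0# n ≈ 1#
     one zero = refl
     one (suc n) = trans (*-congˡ (one n)) (solve 1 (\ q -> (1ₚ :- 0ₚ :* q) :* 1ₚ := 1ₚ) refl _)

    S-sgn : ∀ X -> Admissible X -> S (\ I -> wt sgn (neg I)) X ≈ δ (length X) 0
    S-sgn [] _ = solve 0 ((1ₚ :* 1ₚ) :* (1ₚ :* (1ₚ :* 1ₚ)) :+ 0ₚ := 1ₚ) refl
    S-sgn (x ∷ X) ad = trans (sym (S-signs sgn (\ _ -> refl) (x ∷ X))) (odd-sum-0 sgn (+ x) (map +_ X) sgn-odd (Admissible⇒Good ad))

    S-ρ-1 : ∀ X -> Admissible X -> ∑ (splits X) (\ ij -> wt H (neg (ij .fst)) * (arr (ij .fst) (ij .snd) * ρ (ij .snd))) ≈ 1#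
    S-ρ-1 X ad = begin
     ∑ (splits X) (\ ij -> wt H (neg (ij .fst)) * (arr (ij .fst) (ij .snd) * ρ (ij .snd)))
      ≈⟨ ∑-cong-All (splits-↭ X) (\ { (I , J) q -> *-congʳ (sym (xs-∏ sgn H sgn-step (fst (fst (Admissible-↭ I J q ad))))) }) ⟩
     ∑ (splits X) (\ ij -> (xs (ij .fst) * wt sgn (neg (ij .fst))) * (arr (ij .fst) (ij .snd) * ρ (ij .snd))) ≈⟨ transfer (\ I -> wt sgn (neg I)) X ⟨
     ∑ (splits X) (\ ab -> xs (ab .fst) * arr (ab .fst) (ab .snd) * S (\ I -> wt sgn (neg I)) (ab .fst))
      ≈⟨ ∑-cong-All (splits-↭ X) (\ { (A , B) q -> trans (*-congˡ (S-sgn A (fst (Admissible-↭ A B q ad)))) (*-comm _ _) }) ⟩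
     ∑ (splits X) (\ ab -> δ (length (ab .fst)) 0 * (xs (ab .fst) * arr (ab .fst) (ab .snd))) ≈⟨ splits-δ0 X {\ A B -> xs A * arr A B} ⟩
     1# * 1# ≈⟨ *-identityˡ _ ⟩
     1# ∎

    splits-first : ∀ (X : List ℕ) {f : List ℕ -> List ℕ -> Carrier} -> All (\ ij -> length (ij .snd) < length X -> f (ij .fst) (ij .snd) ≈ 0#) (splits X) ->
     ∑ (splits X) (\ ij -> f (ij .fst) (ij .snd)) ≈ f [] X
    splits-first X {f} z = trans (∑-cong-All (All-zip z (splits-length X)) (\ { (I , J) (zz , ln) -> term I J zz ln })) (splits-δ0 X)
     where
     term : ∀ I J -> (length J < length X -> f I J ≈ 0#) -> length I N.+ length J ≡ length X -> f I J ≈ δ (length I) 0 * f I J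
     term [] J zz ln = sym (*-identityˡ _)
     term (i ∷ I) J zz ln = trans (zz (Nₚ.≤-trans (s≤s (Nₚ.m≤n+m _ (length I))) (Nₚ.≤-reflexive ln))) (sym (zeroˡ _))

    -- Prepending a column fixes Φ, the unbounded Littlewood product. Both ρ and Φ solve the same
    -- triangular system, whose right side is 1 for every alphabet: the term without inverted
    -- letters is the value at X, and all others involve smaller alphabets. `n` bounds the
    -- induction.
    ρ-Φ : ∀ n X -> length X < n -> Admissible X -> ρ X ≈ Φ X
    ρ-Φ (suc n) X (s≤s lX) ad = x-y≈0⇒x≈y (begin
     ρ X - Φ X ≈⟨ solve 2 (\ a b -> a :- b := (1ₚ :* 1ₚ) :* (1ₚ :* (a :- b))) refl _ _ ⟩
     wt H (neg []) * (arr [] X * (ρ X - Φ X)) ≈⟨ splits-first X {\ I J -> wt H (neg I) * (arr I J * (ρ J - Φ J))}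
      (All.map (\ {ij} q lt -> *-zeroʳ-≈ (*-zeroʳ-≈ (trans (+-congʳ (ρ-Φ n (ij .snd) (Nₚ.<-≤-trans lt lX) (snd (Admissible-↭ (ij .fst) (ij .snd) q ad)))) (-‿inverseʳ _)))) (splits-↭ X)) ⟨
     ∑ (splits X) (\ ij -> wt H (neg (ij .fst)) * (arr (ij .fst) (ij .snd) * (ρ (ij .snd) - Φ (ij .snd))))
      ≈⟨ ∑-cong (splits X) (\ ij -> solve 4 (\ a b c d -> a :* (b :* (c :- d)) := a :* (b :* c) :+ (:- (a :* (b :* d)))) refl _ _ _ _) ⟩
     ∑ (splits X) (\ ij -> wt H (neg (ij .fst)) * (arr (ij .fst) (ij .snd) * ρ (ij .snd)) + - (wt H (neg (ij .fst)) * (arr (ij .fst) (ij .snd) * Φ (ij .snd))))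
      ≈⟨ trans (∑-+ (splits X)) (+-cong (S-ρ-1 X ad) (trans (∑-neg (splits X)) (-‿cong (S-H-1 X ad)))) ⟩
     1# - 1# ≈⟨ -‿inverseʳ _ ⟩
     0# ∎)

    W-step : ∀ m i -> i ≢ 0 -> t ^ i * W m (Z.- + i) ≈ W (suc m) (Z.- + i)
    W-step m zero ne = ⊥-elim (ne ≡.refl)
    W-step m (suc i) _ = trans (*-left-comm _ _ _) (*-congˡ (sym (^-+ t (suc i) (m N.* suc i))))

    Fsum-S : ∀ m X -> Admissible X -> Fsum m X ≈ S (\ I -> wt (W m) (neg I)) X
    Fsum-S zero X ad = trans (sym (S-H-1 X ad)) (S-cong X (\ I n -> *-congʳ (trans (∏-map _ I) (trans (∏-cong-All n w0) (sym (∏-map _ I))))) (ad .fst))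
     where
     w0 : ∀ i -> i ≢ 0 -> H (Z.- + i) ≈ W 0 (Z.- + i)
     w0 zero ne = ⊥-elim (ne ≡.refl)
     w0 (suc i) _ = sym (*-identityʳ _)
    Fsum-S (suc m) X ad = begin
     ∑ (splits X) (\ ab -> xs (ab .fst) * arr (ab .fst) (ab .snd) * Fsum m (ab .fst))
      ≈⟨ ∑-cong-All (splits-↭ X) (\ { (A , B) q -> *-congˡ (Fsum-S m A (fst (Admissible-↭ A B q ad))) }) ⟩
     ∑ (splits X) (\ ab -> xs (ab .fst) * arr (ab .fst) (ab .snd) * S (\ I -> wt (W m) (neg I)) (ab .fst)) ≈⟨ transfer (\ I -> wt (W m) (neg I)) X ⟩
     ∑ (splits X) (\ ij -> (xs (ij .fst) * wt (W m) (neg (ij .fst))) * (arr (ij .fst) (ij .snd) * ρ (ij .snd)))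
      ≈⟨ ∑-cong-All (splits-↭ X) (\ { (I , J) q -> let ad′ = Admissible-↭ I J q ad in
        *-cong (xs-∏ (W m) (W (suc m)) (W-step m) (fst (ad′ .fst))) (*-congˡ (ρ-Φ (suc (length J)) J Nₚ.≤-refl (ad′ .snd))) }) ⟩
     S (\ I -> wt (W (suc m)) (neg I)) X ∎

   littlewood : ∀ m X -> Admissible X -> Fsum m X ≈ ∑ (signs (map +_ X)) (wt (W m))
   littlewood m X ad = trans (Fsum-S m X ad) (sym (S-signs (W m) (\ _ -> refl) X))

-- Determinants over lists and Vandermonde products.

downFrom-< : ∀ n -> All (_< n) (downFrom n)
downFrom-< zero = []
downFrom-< (suc n) = Nₚ.≤-refl ∷ All.map Nₚ.m<n⇒m<1+n (downFrom-< n)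

choices : ∀ {A B : Set} -> List B -> List A -> List (List (A × B))
choices ks [] = [] ∷ []
choices ks (a ∷ as) = concatMap (\ k -> map ((a , k) ∷_) (choices ks as)) ks

choices-fst : ∀ {A B : Set} (ks : List B) (as : List A) -> All (\ v -> map fst v ≡ as) (choices ks as)
choices-fst ks [] = ≡.refl ∷ []
choices-fst ks (a ∷ as) = go ks
 where
 go : ∀ ks′ -> All (\ v -> map fst v ≡ a ∷ as) (concatMap (\ k -> map ((a , k) ∷_) (choices ks as)) ks′)
 go [] = []
 go (k ∷ ks′) = Allₚ.++⁺ (Allₚ.map⁺ (All.map (cong (a ∷_)) (choices-fst ks as))) (go ks′)

choices-snd : ∀ {A B : Set} {Q : B -> Set} {ks : List B} -> All Q ks -> (as : List A) -> All (All (\ a -> Q (a .snd))) (choices ks as)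
choices-snd q [] = [] ∷ []
choices-snd {Q = Q} {ks} q (a ∷ as) = go q
 where
 go : ∀ {ks′} -> All Q ks′ -> All (All (\ a -> Q (a .snd))) (concatMap (\ k -> map ((a , k) ∷_) (choices ks as)) ks′)
 go [] = []
 go (p ∷ ps) = Allₚ.++⁺ (Allₚ.map⁺ (All.map (p ∷_) (choices-snd q as))) (go ps)

private module Determinants (R : CRing) where
 open Kit R
 private variable A B C : Set

 -- Signed choice of one element, as in the Laplace expansion of a determinant along a column.
 alt : List A -> (A -> List A -> Carrier) -> Carrier
 alt [] f = 0#
 alt (x ∷ xs) f = f x xs - alt xs (\ s r -> f s (x ∷ r))

 alt-cong : ∀ (xs : List A) {f g} -> (∀ s r -> s ∷ r ↭ xs -> f s r ≈ g s r) -> alt xs f ≈ alt xs g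
 alt-cong [] e = refl
 alt-cong (x ∷ xs) e = +-cong (e x xs Perm.refl) (-‿cong (alt-cong xs (\ s r q -> e s (x ∷ r) (↭-trans (swap s x Perm.refl) (prep x q)))))

 alt-*ˡ : ∀ (xs : List A) c {f} -> alt xs (\ s r -> c * f s r) ≈ c * alt xs f
 alt-*ˡ [] c = sym (zeroʳ _)
 alt-*ˡ (x ∷ xs) c = trans (+-congˡ (-‿cong (alt-*ˡ xs c))) (solve 3 (\ c a b -> c :* a :- c :* b := c :* (a :- b)) refl _ _ _)

 alt-∑ : ∀ (xs : List A) (ys : List B) {f : B -> A -> List A -> Carrier} -> alt xs (\ s r -> ∑ ys (\ y -> f y s r)) ≈ ∑ ys (\ y -> alt xs (f y))
 alt-∑ [] ys = sym (∑-0 ys (\ _ -> refl))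
 alt-∑ (x ∷ xs) ys = trans (+-congˡ (trans (-‿cong (alt-∑ xs ys)) (sym (∑-neg ys)))) (sym (∑-+ ys))

 private
  alt-- : ∀ (xs : List A) {f g} -> alt xs (\ s r -> f s r - g s r) ≈ alt xs f - alt xs g
  alt-- [] = sym (-‿inverseʳ _)
  alt-- (x ∷ xs) = trans (+-congˡ (-‿cong (alt-- xs))) (solve 4 (\ a b c d -> (a :- b) :- (c :- d) := (a :- c) :- (b :- d)) refl _ _ _ _)

  alt-0 : ∀ (xs : List A) -> alt xs (\ _ _ -> 0#) ≈ 0#
  alt-0 [] = refl
  alt-0 (x ∷ xs) = trans (+-congˡ (-‿cong (alt-0 xs))) (-‿inverseʳ _)

  alt-swap : ∀ (xs : List A) (ys : List B) {f : A -> List A -> B -> List B -> Carrier} ->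
   alt xs (\ s r -> alt ys (f s r)) ≈ alt ys (\ s′ r′ -> alt xs (\ s r -> f s r s′ r′))
  alt-swap [] ys = sym (alt-0 ys)
  alt-swap (x ∷ xs) ys = trans (+-congˡ (-‿cong (alt-swap xs ys))) (sym (alt-- ys))

 det : (A -> B -> Carrier) -> List A -> List B -> Carrier
 det M rs [] = 1#
 det M rs (c ∷ cs) = alt rs (\ s r -> M s c * det M r cs)

 det-cong : ∀ {M N : A -> B -> Carrier} -> (∀ a b -> M a b ≈ N a b) -> ∀ rs cs -> det M rs cs ≈ det N rs cs
 det-cong e rs [] = refl
 det-cong e rs (c ∷ cs) = alt-cong rs (\ s r _ -> *-cong (e s c) (det-cong e r cs))

 private
  expand-row : ∀ (M : A -> B -> Carrier) r rs cs -> length cs ≡ suc (length rs) ->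
   det M (r ∷ rs) cs ≈ alt cs (\ c cs′ -> M r c * det M rs cs′)
  expand-row M r rs (c ∷ cs) ln = +-congˡ (-‿cong (begin
   alt rs (\ s rs′ -> M s c * det M (r ∷ rs′) cs)
    ≈⟨ alt-cong rs (\ s rs′ q -> trans (*-congˡ (expand-row M r rs′ cs (≡.trans (Nₚ.suc-injective ln) (≡.sym (Permₚ.↭-length q))))) (sym (alt-*ˡ cs (M s c)))) ⟩
   alt rs (\ s rs′ -> alt cs (\ c′ cs′ -> M s c * (M r c′ * det M rs′ cs′))) ≈⟨ alt-swap rs cs ⟩
   alt cs (\ c′ cs′ -> alt rs (\ s rs′ -> M s c * (M r c′ * det M rs′ cs′)))
    ≈⟨ alt-cong cs (\ c′ cs′ _ -> trans (alt-cong rs (\ s rs′ _ -> *-left-comm _ _ _)) (alt-*ˡ rs (M r c′))) ⟩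
   alt cs (\ c′ cs′ -> M r c′ * det M rs (c ∷ cs′)) ∎))

 det-transpose : ∀ (M : A -> B -> Carrier) rs cs -> length cs ≡ length rs -> det M rs cs ≈ det (\ b a -> M a b) cs rs
 det-transpose M [] [] _ = refl
 det-transpose M (r ∷ rs) cs ln = trans (expand-row M r rs cs ln)
  (alt-cong cs (\ c cs′ q -> *-congˡ (det-transpose M rs cs′ (Nₚ.suc-injective (≡.trans (Permₚ.↭-length q) ln)))))

 det-scale : ∀ (g : A -> Carrier) (M : A -> B -> Carrier) rs cs -> length cs ≡ length rs ->
  det (\ a b -> g a * M a b) rs cs ≈ ∏ rs g * det M rs cs
 det-scale g M [] [] _ = sym (*-identityˡ _)
 det-scale g M (r ∷ rs) (c ∷ cs) ln = trans (alt-cong (r ∷ rs) (\ s r′ q -> begin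
   (g s * M s c) * det (\ a b -> g a * M a b) r′ cs ≈⟨ *-congˡ (det-scale g M r′ cs (Nₚ.suc-injective (≡.trans ln (≡.sym (Permₚ.↭-length q))))) ⟩
   (g s * M s c) * (∏ r′ g * det M r′ cs) ≈⟨ *-interchange _ _ _ _ ⟩
   (g s * ∏ r′ g) * (M s c * det M r′ cs) ≈⟨ *-congʳ (∏-↭ q) ⟩
   ∏ (r ∷ rs) g * (M s c * det M r′ cs) ∎))
  (alt-*ˡ (r ∷ rs) (∏ (r ∷ rs) g) {\ s r′ -> M s c * det M r′ cs})

 ∑-choices : ∀ (ks : List B) (a : A) as {f} -> ∑ (choices ks (a ∷ as)) f ≈ ∑ ks (\ k -> ∑ (choices ks as) (\ v -> f ((a , k) ∷ v)))
 ∑-choices ks a as = trans (∑-concatMap (\ k -> map ((a , k) ∷_) (choices ks as)) ks) (∑-cong ks (\ k -> ∑-map ((a , k) ∷_) (choices ks as)))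

 private
  choices-alt : ∀ (ks : List B) (as : List A) {f : A × B -> List (A × B) -> Carrier} ->
   ∑ (choices ks as) (\ v -> alt v f) ≈ alt as (\ s r -> ∑ ks (\ k -> ∑ (choices ks r) (f (s , k))))
  choices-alt ks [] = +-identityʳ _
  choices-alt ks (a ∷ as) {f} = begin
   ∑ (choices ks (a ∷ as)) (\ v -> alt v f) ≈⟨ ∑-choices ks a as ⟩
   ∑ ks (\ k -> ∑ (choices ks as) (\ v -> f (a , k) v - alt v (\ s r -> f s ((a , k) ∷ r))))
    ≈⟨ ∑-cong ks (\ k -> trans (∑-+ (choices ks as)) (+-congˡ (trans (∑-neg (choices ks as)) (-‿cong (choices-alt ks as))))) ⟩
   ∑ ks (\ k -> ∑ (choices ks as) (f (a , k)) - alt as (\ s r -> ∑ ks (\ k′ -> ∑ (choices ks r) (\ v -> f (s , k′) ((a , k) ∷ v)))))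
    ≈⟨ trans (∑-+ ks) (+-congˡ (trans (∑-neg ks) (-‿cong (trans (sym (alt-∑ as ks)) (alt-cong as (\ s r _ -> trans (∑-swap ks ks) (∑-cong ks (\ k′ -> sym (∑-choices ks a r))))))))) ⟩
   ∑ ks (\ k -> ∑ (choices ks as) (f (a , k))) - alt as (\ s r -> ∑ ks (\ k′ -> ∑ (choices ks (a ∷ r)) (f (s , k′)))) ∎

 det-multilinear : ∀ (ks : List B) (N : A × B -> C -> Carrier) as cs -> length cs ≡ length as ->
  det (\ a c -> ∑ ks (\ k -> N (a , k) c)) as cs ≈ ∑ (choices ks as) (\ v -> det N v cs)
 det-multilinear ks N [] [] _ = sym (+-identityʳ _)
 det-multilinear ks N as@(_ ∷ _) (c ∷ cs) ln = begin
  alt as (\ s r -> ∑ ks (\ k -> N (s , k) c) * det (\ a c -> ∑ ks (\ k -> N (a , k) c)) r cs)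
   ≈⟨ alt-cong as (\ s r q -> trans (*-congˡ (det-multilinear ks N r cs (Nₚ.suc-injective (≡.trans ln (≡.sym (Permₚ.↭-length q))))))
     (trans (sym (∑-*ʳ ks)) (∑-cong ks (\ k -> sym (∑-*ˡ (choices ks r)))))) ⟩
  alt as (\ s r -> ∑ ks (\ k -> ∑ (choices ks r) (\ v -> N (s , k) c * det N v cs))) ≈⟨ choices-alt ks as ⟨
  ∑ (choices ks as) (\ v -> det N v (c ∷ cs)) ∎

 Antisymmetric : (List A -> Carrier) -> Set _
 Antisymmetric f = ∀ pre s b r -> f (pre ++ s ∷ b ∷ r) ≈ - f (pre ++ b ∷ s ∷ r)

 open Subsets R using (∑-picks)

 -- Moving s from the front back to its place multiplies f by exactly the sign that `alt` attaches
 -- to s.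
 alt-antisym : ∀ (f : List A -> Carrier) -> Antisymmetric f -> ∀ (X : A -> List A -> Carrier) as ->
  alt as (\ s r -> X s r * f (s ∷ r)) ≈ ∑ (picks as) (\ sr -> X (sr .fst) (sr .snd)) * f as
 alt-antisym f an X [] = sym (zeroˡ _)
 alt-antisym f an X (a ∷ as) = begin
  X a as * f (a ∷ as) - alt as (\ s r -> X s (a ∷ r) * f (s ∷ a ∷ r))
   ≈⟨ +-congˡ (trans (-‿cong (trans (alt-cong as (\ s r _ -> trans (*-congˡ (an [] s a r)) (solve 2 (\ x y -> x :* (:- y) := (:- con (+ 1)) :* (x :* y)) refl _ _)))
      (alt-*ˡ as (- 1#)))) (solve 1 (\ x -> :- ((:- con (+ 1)) :* x) := x) refl _)) ⟩
  X a as * f (a ∷ as) + alt as (\ s r -> X s (a ∷ r) * f (a ∷ s ∷ r)) ≈⟨ +-congˡ (alt-antisym (\ v -> f (a ∷ v)) (\ pre -> an (a ∷ pre)) (\ s r -> X s (a ∷ r)) as) ⟩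
  X a as * f (a ∷ as) + ∑ (picks as) (\ sr -> X (sr .fst) (a ∷ sr .snd)) * f (a ∷ as) ≈⟨ distribʳ _ _ _ ⟨
  (X a as + ∑ (picks as) (\ sr -> X (sr .fst) (a ∷ sr .snd))) * f (a ∷ as) ≈⟨ *-congʳ (∑-picks a as) ⟨
  ∑ (picks (a ∷ as)) (\ sr -> X (sr .fst) (sr .snd)) * f (a ∷ as) ∎

record Nodes (R : CRing) (A : Set) : Set₁ where
 open Kit R
 field
  _#_   : A -> A -> Set
  #-sym : ∀ {a b} -> a # b -> b # a
  ξ     : A -> Carrier
  recip   : A -> A -> Carrier
  inv-ξ : ∀ {a b} -> a # b -> (ξ a - ξ b) * recip a b ≈ 1#
  f₀    : A -> Carrier
  c₀    : Carrier

-- Vandermonde determinants for Chebyshev-like polynomials of ξ, by divided differences.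
private module _ (R : CRing) where
 open Kit R
 open Subsets R
 open Determinants R
 module Vandermonde {A : Set} (𝕍 : Nodes R A) where
  open Nodes 𝕍

  -- Monic of degree j in ξ. For ξ = z + 1/z, c₀ = 0 gives the Chebyshev polynomials of the second
  -- kind and c₀ = 1 their half-angle variant.
  U : ℕ -> A -> Carrier
  U zero a = 1#
  U (suc zero) a = ξ a + c₀
  U (suc (suc j)) a = ξ a * U (suc j) a - U j a

  Δ : List A -> Carrier
  Δ [] = 1#
  Δ (a ∷ as) = f₀ a * ∏ as (\ b -> ξ a - ξ b) * Δ as

  private
   inv-neg : ∀ {a b} -> a # b -> recip b a ≈ - recip a b
   inv-neg {a} {b} ab = unit-cancel (inv-ξ (#-sym ab)) (trans (inv-ξ (#-sym ab))
    (sym (trans (solve 3 (\ x y i -> (y :- x) :* (:- i) := (x :- y) :* i) refl _ _ _) (inv-ξ ab))))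

   inv-three : ∀ {s y v} -> s # y -> s # v -> y # v -> recip s y * recip s v ≈ (recip s y - recip s v) * recip y v
   inv-three {s} {y} {v} sy sv yv = sym (begin
    (recip s y - recip s v) * recip y v ≈⟨ *-congʳ (+-cong (trans (sym (*-identityʳ _)) (*-congˡ (sym (inv-ξ sv)))) (-‿cong (trans (sym (*-identityʳ _)) (*-congˡ (sym (inv-ξ sy)))))) ⟩
    (recip s y * ((ξ s - ξ v) * recip s v) - recip s v * ((ξ s - ξ y) * recip s y)) * recip y v
     ≈⟨ solve 6 (\ a b c x y z -> (a :* ((x :- z) :* b) :- b :* ((x :- y) :* a)) :* c := (a :* b) :* ((y :- z) :* c)) refl _ _ _ _ _ _ ⟩
    (recip s y * recip s v) * ((ξ y - ξ v) * recip y v) ≈⟨ *-oneʳ-≈ (inv-ξ yv) ⟩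
    recip s y * recip s v ∎)

   picks-first : ∀ {Q : A -> Set} {X} -> All Q X -> All (\ sr -> Q (sr .fst)) (picks X)
   picks-first {X = X} a = All.map (\ q -> All.head (Permₚ.All-resp-↭ (↭-sym q) a)) (picks-↭ X)

   -- The divided difference of g at the nodes ξ of X.
   dd : (A -> Carrier) -> List A -> Carrier
   dd g X = ∑ (picks X) (\ sr -> g (sr .fst) * ∏ (sr .snd) (recip (sr .fst)))

   one : A -> Carrier
   one _ = 1#

   dd-1 : ∀ y v X -> AllPairs _#_ (y ∷ v ∷ X) -> dd one (y ∷ v ∷ X) ≈ 0#
   dd-1 y v X ((yv ∷ yX) ∷ (vX ∷ XX)) = begin
    dd one (y ∷ v ∷ X) ≈⟨ trans (∑-picks y (v ∷ X)) (+-congˡ (∑-picks v X)) ⟩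
    1# * (recip y v * ∏ X (recip y)) + (1# * (recip v y * ∏ X (recip v)) + ∑ (picks X) (\ sr -> 1# * (recip (sr .fst) y * (recip (sr .fst) v * ∏ (sr .snd) (recip (sr .fst))))))
     ≈⟨ +-congˡ (+-cong (*-congˡ (*-congʳ (inv-neg yv))) sum) ⟩
    1# * (recip y v * ∏ X (recip y)) + (1# * (- recip y v * ∏ X (recip v)) + recip y v * (Sy - Sv))
     ≈⟨ solve 5 (\ d a b s r -> 1ₚ :* (d :* a) :+ (1ₚ :* ((:- d) :* b) :+ d :* (s :- r)) := d :* ((1ₚ :* a :+ s) :- (1ₚ :* b :+ r))) refl _ _ _ _ _ ⟩
    recip y v * ((1# * ∏ X (recip y) + Sy) - (1# * ∏ X (recip v) + Sv)) ≈⟨ *-congˡ (+-cong (sym (∑-picks y X)) (-‿cong (sym (∑-picks v X)))) ⟩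
    recip y v * (dd one (y ∷ X) - dd one (v ∷ X)) ≈⟨ *-congˡ (zero-diff X yX vX XX) ⟩
    recip y v * 0# ≈⟨ zeroʳ _ ⟩
    0# ∎
    where
    Sy = ∑ (picks X) (\ sr -> 1# * (recip (sr .fst) y * ∏ (sr .snd) (recip (sr .fst))))
    Sv = ∑ (picks X) (\ sr -> 1# * (recip (sr .fst) v * ∏ (sr .snd) (recip (sr .fst))))
    sum : ∑ (picks X) (\ sr -> 1# * (recip (sr .fst) y * (recip (sr .fst) v * ∏ (sr .snd) (recip (sr .fst))))) ≈ recip y v * (Sy - Sv)
    sum = trans (∑-cong-All (All-zip (picks-first yX) (picks-first vX)) (\ { (s , r) (ys , vs) -> begin
      1# * (recip s y * (recip s v * ∏ r (recip s))) ≈⟨ solve 3 (\ a b c -> 1ₚ :* (a :* (b :* c)) := (a :* b) :* c) refl _ _ _ ⟩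
      (recip s y * recip s v) * ∏ r (recip s) ≈⟨ *-congʳ (inv-three (#-sym ys) (#-sym vs) yv) ⟩
      ((recip s y - recip s v) * recip y v) * ∏ r (recip s) ≈⟨ solve 4 (\ a b d c -> ((a :- b) :* d) :* c := d :* (1ₚ :* (a :* c) :+ (:- (1ₚ :* (b :* c))))) refl _ _ _ _ ⟩
      recip y v * (1# * (recip s y * ∏ r (recip s)) + - (1# * (recip s v * ∏ r (recip s)))) ∎ }))
     (trans (∑-*ˡ (picks X)) (*-congˡ (trans (∑-+ (picks X)) (+-congˡ (∑-neg (picks X))))))
    zero-diff : ∀ X -> All (y #_) X -> All (v #_) X -> AllPairs _#_ X -> dd one (y ∷ X) - dd one (v ∷ X) ≈ 0#
    zero-diff [] _ _ _ = -‿inverseʳ _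
    zero-diff (x ∷ X) yX vX XX = trans (+-cong (dd-1 y x X (yX ∷ XX)) (-‿cong (dd-1 v x X (vX ∷ XX)))) (-‿inverseʳ _)

   dd-ξ : ∀ g y X -> All (y #_) X -> dd (\ a -> ξ a * g a) (y ∷ X) ≈ dd g X + ξ y * dd g (y ∷ X)
   dd-ξ g y X yX = begin
    dd (\ a -> ξ a * g a) (y ∷ X) ≈⟨ ∑-picks y X ⟩
    (ξ y * g y) * ∏ X (recip y) + ∑ (picks X) (\ sr -> (ξ (sr .fst) * g (sr .fst)) * (recip (sr .fst) y * ∏ (sr .snd) (recip (sr .fst))))
     ≈⟨ +-congˡ (trans (∑-cong-All (picks-first yX) (\ { (s , r) ys -> begin
       (ξ s * g s) * (recip s y * ∏ r (recip s)) ≈⟨ solve 5 (\ x z g i c -> (x :* g) :* (i :* c) := ((x :- z) :* i) :* (g :* c) :+ z :* (g :* (i :* c))) refl _ (ξ y) _ _ _ ⟩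
       ((ξ s - ξ y) * recip s y) * (g s * ∏ r (recip s)) + ξ y * (g s * (recip s y * ∏ r (recip s))) ≈⟨ +-congʳ (*-oneˡ-≈ (inv-ξ (#-sym ys))) ⟩
       g s * ∏ r (recip s) + ξ y * (g s * (recip s y * ∏ r (recip s))) ∎ })) (trans (∑-+ (picks X)) (+-congˡ (∑-*ˡ (picks X))))) ⟩
    (ξ y * g y) * ∏ X (recip y) + (dd g X + ξ y * ∑ (picks X) (\ sr -> g (sr .fst) * (recip (sr .fst) y * ∏ (sr .snd) (recip (sr .fst)))))
     ≈⟨ solve 5 (\ z g c d s -> (z :* g) :* c :+ (d :+ z :* s) := d :+ z :* (g :* c :+ s)) refl _ _ _ _ _ ⟩
    dd g X + ξ y * (g y * ∏ X (recip y) + ∑ (picks X) (\ sr -> g (sr .fst) * (recip (sr .fst) y * ∏ (sr .snd) (recip (sr .fst))))) ≈⟨ +-congˡ (*-congˡ (∑-picks y X)) ⟨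
    dd g X + ξ y * dd g (y ∷ X) ∎

   dd-lin : ∀ g k c X -> dd (\ a -> g a + c * k a) X ≈ dd g X + c * dd k X
   dd-lin g k c X = trans (∑-cong (picks X) (\ sr -> solve 4 (\ g c k i -> (g :+ c :* k) :* i := g :* i :+ c :* (k :* i)) refl _ _ _ _)) (trans (∑-+ (picks X)) (+-congˡ (∑-*ˡ (picks X))))

   dd-cong : ∀ {g k} X -> (∀ a -> g a ≈ k a) -> dd g X ≈ dd k X
   dd-cong X e = ∑-cong (picks X) (\ sr -> *-congʳ (e _))

   -- A divided difference on j + 1 nodes reads off the coefficient of degree j, here 1, and on more
   -- nodes it annihilates degree j. The Chebyshev recurrence reduces U (j+1) to U j with one node
   -- fewer.
   dd-U : ∀ j X -> AllPairs _#_ X -> (length X ≡ suc j -> dd (U j) X ≈ 1#) × (suc j < length X -> dd (U j) X ≈ 0#)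
   dd-U zero [] _ = (\ ()) , (\ ())
   dd-U zero (a ∷ []) _ = (\ _ -> solve 0 (1ₚ :* 1ₚ :+ 0ₚ := 1ₚ) refl) , (\ { (s≤s ()) })
   dd-U zero (a ∷ b ∷ X) d = (\ ()) , (\ _ -> dd-1 a b X d)
   dd-U (suc j) [] _ = (\ ()) , (\ ())
   dd-U (suc j) (y ∷ X) (yX ∷ XX) = (\ ln -> trans (red (Nₚ.≤-reflexive (cong N.pred (≡.sym ln)))) (fst (dd-U j X XX) (Nₚ.suc-injective ln))) ,
                  (\ { (s≤s lt) -> trans (red (Nₚ.<⇒≤ lt)) (snd (dd-U j X XX) lt) })
    where
    expand : ∀ j -> suc j ≤ length X -> dd (U (suc j)) (y ∷ X) ≈ dd (U j) X + (ξ y * dd (U j) (y ∷ X) + (dd (U (suc j)) (y ∷ X) - dd (\ a -> ξ a * U j a) (y ∷ X)))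
    expand j _ = trans (solve 2 (\ a b -> a := b :+ (a :- b)) refl _ (dd (\ a -> ξ a * U j a) (y ∷ X))) (trans (+-congʳ (dd-ξ (U j) y X yX)) (+-assoc _ _ _))
    red : suc j ≤ length X -> dd (U (suc j)) (y ∷ X) ≈ dd (U j) X
    red le = trans (expand j le) (trans (+-congˡ (trans (+-cong (*-zeroʳ-≈ (snd (dd-U j (y ∷ X) (yX ∷ XX)) (s≤s le))) (rest j le)) (+-identityˡ _))) (+-identityʳ _))
     where
     rest : ∀ j -> suc j ≤ length X -> dd (U (suc j)) (y ∷ X) - dd (\ a -> ξ a * U j a) (y ∷ X) ≈ 0#
     rest zero le = trans (+-congʳ (trans (dd-cong (y ∷ X) (\ a -> solve 2 (\ x c -> x :+ c := x :* 1ₚ :+ c :* 1ₚ) refl _ _)) (dd-lin (\ a -> ξ a * 1#) one c₀ (y ∷ X))))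
      (trans (solve 3 (\ a c b -> (a :+ c :* b) :- a := c :* b) refl _ _ _) (*-zeroʳ-≈ (snd (dd-U zero (y ∷ X) (yX ∷ XX)) (s≤s le))))
     rest (suc j) le = trans (+-congʳ (trans (dd-cong (y ∷ X) (\ a -> solve 2 (\ x u -> x :- u := x :+ (:- 1ₚ) :* u) refl _ _)) (dd-lin (\ a -> ξ a * U (suc j) a) (U j) (- 1#) (y ∷ X))))
      (trans (solve 3 (\ a c b -> (a :+ c :* b) :- a := c :* b) refl _ _ _) (*-zeroʳ-≈ (snd (dd-U j (y ∷ X) (yX ∷ XX)) (Nₚ.<-trans (Nₚ.n<1+n _) (s≤s le)))))

   Δ-antisym : Antisymmetric Δ
   Δ-antisym [] s b r = solve 7 (\ fs fb x y P Q D -> (fs :* ((x :- y) :* P)) :* ((fb :* Q) :* D) := :- ((fb :* ((y :- x) :* Q)) :* ((fs :* P) :* D))) refl _ _ _ _ _ _ _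
   Δ-antisym (a ∷ pre) s b r = trans (*-cong (*-congˡ (∏-↭ (Permₚ.++⁺ˡ pre (swap s b Perm.refl)))) (Δ-antisym pre s b r)) (solve 2 (\ a b -> a :* (:- b) := :- (a :* b)) refl _ _)

   ∏-inv : ∀ s r -> All (s #_) r -> ∏ r (\ b -> ξ s - ξ b) * ∏ r (recip s) ≈ 1#
   ∏-inv s [] [] = *-identityˡ _
   ∏-inv s (b ∷ r) (sb ∷ sr) = trans (*-interchange _ _ _ _) (trans (*-cong (inv-ξ sb) (∏-inv s r sr)) (*-identityˡ _))

  -- Expansion along the column of highest degree, which `downFrom` lists first: the minors are
  -- smaller Vandermonde products, and antisymmetry of Δ turns the signed sum into the divided
  -- difference of U n on n + 1 nodes.
  vandermonde : ∀ n X -> length X ≡ n -> AllPairs _#_ X -> det (\ a j -> f₀ a * U j a) X (downFrom n) ≈ Δ X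
  vandermonde zero [] _ _ = refl
  vandermonde (suc n) X ln d = begin
   alt X (\ s r -> (f₀ s * U n s) * det (\ a j -> f₀ a * U j a) r (downFrom n))
    ≈⟨ alt-cong X (\ s r q -> let d′ = AllPairs-↭ #-sym (↭-sym q) d in begin
      (f₀ s * U n s) * det (\ a j -> f₀ a * U j a) r (downFrom n) ≈⟨ *-congˡ (vandermonde n r (Nₚ.suc-injective (≡.trans (Permₚ.↭-length q) ln)) (AllPairs.tail d′)) ⟩
      -- Inserting ∏ (ξ s - ξ b) and its inverse completes Δ r to Δ (s ∷ r).
      (f₀ s * U n s) * Δ r ≈⟨ trans (sym (*-identityʳ _)) (*-congˡ (sym (∏-inv s r (AllPairs.head d′)))) ⟩
      ((f₀ s * U n s) * Δ r) * (∏ r (\ b -> ξ s - ξ b) * ∏ r (recip s)) ≈⟨ solve 5 (\ f u D x i -> ((f :* u) :* D) :* (x :* i) := (u :* i) :* (f :* x :* D)) refl _ _ _ _ _ ⟩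
      (U n s * ∏ r (recip s)) * Δ (s ∷ r) ∎) ⟩
   alt X (\ s r -> (U n s * ∏ r (recip s)) * Δ (s ∷ r)) ≈⟨ alt-antisym Δ Δ-antisym (\ s r -> U n s * ∏ r (recip s)) X ⟩
   dd (U n) X * Δ X ≈⟨ *-congʳ (fst (dd-U n X d) ln) ⟩
   1# * Δ X ≈⟨ *-identityˡ _ ⟩
   Δ X ∎

-- Quotient rings and localisation at t.

module Quotient (R : CRing) (_~_ : Rel (CommutativeRing.Carrier R) 0ℓ) (eqv : IsEquivalence _~_)
 (≈⇒~ : ∀ {a b} -> CommutativeRing._≈_ R a b -> a ~ b)
 (+-cong~ : ∀ {a b c d} -> a ~ b -> c ~ d -> CommutativeRing._+_ R a c ~ CommutativeRing._+_ R b d)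
 (*-cong~ : ∀ {a b c d} -> a ~ b -> c ~ d -> CommutativeRing._*_ R a c ~ CommutativeRing._*_ R b d)
 (neg-cong~ : ∀ {a b} -> a ~ b -> CommutativeRing.-_ R a ~ CommutativeRing.-_ R b) where
 open CommutativeRing R

 quotientRing : CRing
 quotientRing = toRing (record
  { Carrier = Carrier ; _≈_ = _~_ ; _+_ = _+_ ; _*_ = _*_ ; -_ = -_ ; 0# = 0# ; 1# = 1#
  ; isEquivalence = eqv ; +-cong = +-cong~ ; *-cong = *-cong~ ; neg-cong = neg-cong~
  ; +-assoc = \ a b c -> ≈⇒~ (+-assoc a b c) ; +-comm = \ a b -> ≈⇒~ (+-comm a b) ; +-identityˡ = \ a -> ≈⇒~ (+-identityˡ a) ; +-inverseˡ = \ a -> ≈⇒~ (-‿inverseˡ a)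
  ; *-assoc = \ a b c -> ≈⇒~ (*-assoc a b c) ; *-comm = \ a b -> ≈⇒~ (*-comm a b) ; *-identityˡ = \ a -> ≈⇒~ (*-identityˡ a) ; distribʳ = \ a b c -> ≈⇒~ (distribʳ a b c) })

 projection : Hom R quotientRing
 projection = record
  { ⟦_⟧ = id ; ⟦⟧-cong = ≈⇒~ ; ⟦⟧-+ = \ _ _ -> ≈⇒~ refl ; ⟦⟧-* = \ _ _ -> ≈⇒~ refl ; ⟦⟧-neg = \ _ -> ≈⇒~ refl ; ⟦⟧-0 = ≈⇒~ refl ; ⟦⟧-1 = ≈⇒~ refl }

module Localisation (R : CRing) (t : CommutativeRing.Carrier R)
 (t-cancel : ∀ {a b} -> CommutativeRing._≈_ R (CommutativeRing._*_ R t a) (CommutativeRing._*_ R t b) -> CommutativeRing._≈_ R a b) where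
 open Kit R

 record Frac : Set where
  constructor _/t^_
  field
   num : Carrier
   ord : ℕ
 open Frac

 -- Plain cross-multiplication without an auxiliary power of t; it is transitive because t can be
 -- cancelled.
 record _≃_ (x y : Frac) : Set where
  constructor frac
  field
   eq : t ^ ord y * num x ≈ t ^ ord x * num y
 open _≃_

 t^-cancel : ∀ n {a b} -> t ^ n * a ≈ t ^ n * b -> a ≈ b
 t^-cancel zero e = trans (sym (*-identityˡ _)) (trans e (*-identityˡ _))
 t^-cancel (suc n) e = t^-cancel n (t-cancel (trans (sym (*-assoc _ _ _)) (trans e (*-assoc _ _ _))))

 private
  _⊞_ _⊠_ : Frac -> Frac -> Frac
  (a /t^ k) ⊞ (b /t^ l) = (t ^ l * a + t ^ k * b) /t^ (k N.+ l)
  (a /t^ k) ⊠ (b /t^ l) = (a * b) /t^ (k N.+ l)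

  ⊟_ : Frac -> Frac
  ⊟ (a /t^ k) = (- a) /t^ k

  ≃-trans : ∀ {x y z} -> x ≃ y -> y ≃ z -> x ≃ z
  ≃-trans {a /t^ k} {b /t^ l} {c /t^ m} (frac e) (frac e′) = frac (t^-cancel l (begin
   t ^ l * (t ^ m * a) ≈⟨ *-left-comm _ _ _ ⟩
   t ^ m * (t ^ l * a) ≈⟨ *-congˡ e ⟩
   t ^ m * (t ^ k * b) ≈⟨ *-left-comm _ _ _ ⟩
   t ^ k * (t ^ m * b) ≈⟨ *-congˡ e′ ⟩
   t ^ k * (t ^ l * c) ≈⟨ *-left-comm _ _ _ ⟩
   t ^ l * (t ^ k * c) ∎))

  ≃-refl : ∀ {x} -> x ≃ x
  ≃-refl = frac refl

  ≃-sym : ∀ {x y} -> x ≃ y -> y ≃ x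
  ≃-sym (frac e) = frac (sym e)

  ⊞-cong : ∀ {x y u v} -> x ≃ y -> u ≃ v -> (x ⊞ u) ≃ (y ⊞ v)
  ⊞-cong {a /t^ k} {a′ /t^ k′} {b /t^ l} {b′ /t^ l′} (frac e) (frac e′) = frac (begin
   t ^ (k′ N.+ l′) * (t ^ l * a + t ^ k * b) ≈⟨ *-congʳ (^-+ t k′ l′) ⟩
   (t ^ k′ * t ^ l′) * (t ^ l * a + t ^ k * b)
    ≈⟨ solve 6 (\ k l k′ l′ a b -> (k′ :* l′) :* (l :* a :+ k :* b) := (l :* l′) :* (k′ :* a) :+ (k :* k′) :* (l′ :* b)) refl _ _ _ _ _ _ ⟩
   (t ^ l * t ^ l′) * (t ^ k′ * a) + (t ^ k * t ^ k′) * (t ^ l′ * b) ≈⟨ +-cong (*-congˡ e) (*-congˡ e′) ⟩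
   (t ^ l * t ^ l′) * (t ^ k * a′) + (t ^ k * t ^ k′) * (t ^ l * b′)
    ≈⟨ solve 6 (\ k l k′ l′ a b -> (l :* l′) :* (k :* a) :+ (k :* k′) :* (l :* b) := (k :* l) :* (l′ :* a :+ k′ :* b)) refl _ _ _ _ _ _ ⟩
   (t ^ k * t ^ l) * (t ^ l′ * a′ + t ^ k′ * b′) ≈⟨ *-congʳ (^-+ t k l) ⟨
   t ^ (k N.+ l) * (t ^ l′ * a′ + t ^ k′ * b′) ∎)

  ⊠-cong : ∀ {x y u v} -> x ≃ y -> u ≃ v -> (x ⊠ u) ≃ (y ⊠ v)
  ⊠-cong {a /t^ k} {a′ /t^ k′} {b /t^ l} {b′ /t^ l′} (frac e) (frac e′) = frac (begin
   t ^ (k′ N.+ l′) * (a * b) ≈⟨ trans (*-congʳ (^-+ t k′ l′)) (*-interchange _ _ _ _) ⟩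
   (t ^ k′ * a) * (t ^ l′ * b) ≈⟨ *-cong e e′ ⟩
   (t ^ k * a′) * (t ^ l * b′) ≈⟨ trans (*-congʳ (^-+ t k l)) (*-interchange _ _ _ _) ⟨
   t ^ (k N.+ l) * (a′ * b′) ∎)

  same : ∀ {a b k l} -> k ≡ l -> a ≈ b -> (a /t^ k) ≃ (b /t^ l)
  same ≡.refl e = frac (*-congˡ e)

  ⊞-assoc : ∀ x y z -> ((x ⊞ y) ⊞ z) ≃ (x ⊞ (y ⊞ z))
  ⊞-assoc (a /t^ k) (b /t^ l) (c /t^ m) = same (Nₚ.+-assoc k l m) (begin
   t ^ m * (t ^ l * a + t ^ k * b) + t ^ (k N.+ l) * c ≈⟨ +-congˡ (*-congʳ (^-+ t k l)) ⟩
   t ^ m * (t ^ l * a + t ^ k * b) + (t ^ k * t ^ l) * c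
    ≈⟨ solve 6 (\ k l m a b c -> m :* (l :* a :+ k :* b) :+ (k :* l) :* c := (l :* m) :* a :+ k :* (m :* b :+ l :* c)) refl _ _ _ _ _ _ ⟩
   (t ^ l * t ^ m) * a + t ^ k * (t ^ m * b + t ^ l * c) ≈⟨ +-congʳ (*-congʳ (^-+ t l m)) ⟨
   t ^ (l N.+ m) * a + t ^ k * (t ^ m * b + t ^ l * c) ∎)

  ⊞-comm : ∀ x y -> (x ⊞ y) ≃ (y ⊞ x)
  ⊞-comm (a /t^ k) (b /t^ l) = same (Nₚ.+-comm k l) (+-comm _ _)

  distribʳ′ : ∀ x y z -> ((y ⊞ z) ⊠ x) ≃ ((y ⊠ x) ⊞ (z ⊠ x))
  distribʳ′ (c /t^ m) (a /t^ k) (b /t^ l) = frac (begin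
   t ^ ((k N.+ m) N.+ (l N.+ m)) * ((t ^ l * a + t ^ k * b) * c)
    ≈⟨ *-congʳ (trans (^-+ t (k N.+ m) (l N.+ m)) (*-cong (^-+ t k m) (^-+ t l m))) ⟩
   ((t ^ k * t ^ m) * (t ^ l * t ^ m)) * ((t ^ l * a + t ^ k * b) * c)
    ≈⟨ solve 6 (\ k l m a b c -> ((k :* m) :* (l :* m)) :* ((l :* a :+ k :* b) :* c) := ((k :* l) :* m) :* ((l :* m) :* (a :* c) :+ (k :* m) :* (b :* c))) refl _ _ _ _ _ _ ⟩
   ((t ^ k * t ^ l) * t ^ m) * ((t ^ l * t ^ m) * (a * c) + (t ^ k * t ^ m) * (b * c))
    ≈⟨ *-cong (trans (^-+ t (k N.+ l) m) (*-congʳ (^-+ t k l))) (+-cong (*-congʳ (^-+ t l m)) (*-congʳ (^-+ t k m))) ⟨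
   t ^ ((k N.+ l) N.+ m) * (t ^ (l N.+ m) * (a * c) + t ^ (k N.+ m) * (b * c)) ∎)

  ⊠-comm : ∀ x y -> (x ⊠ y) ≃ (y ⊠ x)
  ⊠-comm (a /t^ k) (b /t^ l) = same (Nₚ.+-comm k l) (*-comm _ _)

  ⊞-inverse : ∀ x -> ((⊟ x) ⊞ x) ≃ (0# /t^ 0)
  ⊞-inverse (a /t^ k) = frac (solve 3 (\ q z k -> 1ₚ :* (z :* (:- q) :+ z :* q) := k :* 0ₚ) refl _ _ _)

  ⊞-identityˡ : ∀ x -> ((0# /t^ 0) ⊞ x) ≃ x
  ⊞-identityˡ (a /t^ k) = frac (solve 2 (\ k a -> k :* (k :* 0ₚ :+ 1ₚ :* a) := k :* a) refl _ _)

 locRing : CRing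
 locRing = toRing (record
  { Carrier = Frac ; _≈_ = _≃_ ; _+_ = _⊞_ ; _*_ = _⊠_ ; -_ = ⊟_ ; 0# = 0# /t^ 0 ; 1# = 1# /t^ 0
  ; isEquivalence = record { refl = ≃-refl ; sym = ≃-sym ; trans = ≃-trans }
  ; +-cong = ⊞-cong ; *-cong = ⊠-cong
  ; neg-cong = \ { {a /t^ k} {b /t^ l} (frac e) -> frac (trans (solve 2 (\ x a -> x :* (:- a) := :- (x :* a)) refl _ _) (trans (-‿cong e) (solve 2 (\ x a -> :- (x :* a) := x :* (:- a)) refl _ _))) }
  ; +-assoc = ⊞-assoc ; +-comm = ⊞-comm ; +-identityˡ = ⊞-identityˡ ; +-inverseˡ = ⊞-inverse
  ; *-assoc = \ { (a /t^ k) (b /t^ l) (c /t^ m) -> same (Nₚ.+-assoc k l m) (*-assoc _ _ _) }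
  ; *-comm = ⊠-comm ; *-identityˡ = \ { (a /t^ k) -> same ≡.refl (*-identityˡ _) } ; distribʳ = distribʳ′ })

 embed : Hom R locRing
 embed = record
  { ⟦_⟧ = _/t^ 0
  ; ⟦⟧-cong = same ≡.refl
  ; ⟦⟧-+ = \ a b -> same ≡.refl (solve 2 (\ a b -> a :+ b := 1ₚ :* a :+ 1ₚ :* b) refl _ _)
  ; ⟦⟧-* = \ a b -> same ≡.refl refl
  ; ⟦⟧-neg = \ a -> same ≡.refl refl
  ; ⟦⟧-0 = same ≡.refl refl
  ; ⟦⟧-1 = same ≡.refl refl }

 embed-injective : ∀ {a b} -> (a /t^ 0) ≃ (b /t^ 0) -> a ≈ b
 embed-injective (frac e) = trans (sym (*-identityˡ _)) (trans e (*-identityˡ _))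

 private
  mono′ : ℕ -> ℕ -> Frac
  mono′ m n = (t ^ m) /t^ n

  mono′-suc : ∀ m n -> mono′ (suc m) (suc n) ≃ mono′ m n
  mono′-suc m n = frac (solve 3 (\ a b t -> a :* (t :* b) := (t :* a) :* b) refl _ _ _)

 τ : ℤ -> Frac
 τ (+ n) = mono′ n 0
 τ -[1+ n ] = mono′ 0 (suc n)

 private
  τ-⊖ : ∀ m n -> τ (m Z.⊖ n) ≃ mono′ m n
  τ-⊖ m zero = ≃-refl
  τ-⊖ zero (suc n) = ≃-refl
  τ-⊖ (suc m) (suc n) = ≃-trans (same′ (cong τ (Zₚ.[1+m]⊖[1+n]≡m⊖n m n))) (≃-trans (τ-⊖ m n) (≃-sym (mono′-suc m n)))
   where
   same′ : ∀ {x y} -> x ≡ y -> x ≃ y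
   same′ ≡.refl = ≃-refl

 τ-+ : ∀ a b -> τ (a Z.+ b) ≃ CommutativeRing._*_ locRing (τ a) (τ b)
 τ-+ (+ m) (+ n) = same ≡.refl (^-+ t m n)
 τ-+ (+ m) -[1+ n ] = ≃-trans (τ-⊖ m (suc n)) (same ≡.refl (sym (*-identityʳ _)))
 τ-+ -[1+ m ] (+ n) = ≃-trans (τ-⊖ n (suc m)) (same (≡.sym (Nₚ.+-identityʳ (suc m))) (sym (*-identityˡ _)))
 τ-+ -[1+ m ] -[1+ n ] = same (cong suc (≡.sym (Nₚ.+-suc m n))) (sym (*-identityˡ _))

-- Arithmetic progressions of exponents and the collapse of sign sums along them.

private module Progressions (s : ℤ) where

 ap : ℤ -> ℕ -> List ℤ
 ap a zero = []
 ap a (suc l) = a ∷ ap (a Z.+ s) l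

 flip : ℤ -> ℕ -> ℕ -> List ℤ
 flip a l zero = ap a l
 flip a zero (suc j) = []
 flip a (suc l) (suc j) = Z.- a ∷ flip (a Z.+ s) l j

 neg : List ℤ -> List ℤ
 neg = map (\ z -> Z.- z)

 private
  step-lem : ∀ a b s -> (a Z.+ s) Z.+ s Z.* b ≡ a Z.+ s Z.* (+ 1 Z.+ b)
  step-lem = Z-solve
  zero-lem : ∀ a s -> a ≡ a Z.+ s Z.* + 0
  zero-lem = Z-solve

 at : ℤ -> ℕ -> ℤ
 at a k = a Z.+ s Z.* + k

 at-0 : ∀ a -> at a 0 ≡ a
 at-0 a = ≡.sym (zero-lem a s)

 at-suc : ∀ a k -> at (a Z.+ s) k ≡ at a (suc k)
 at-suc a k = step-lem a (+ k) s

 ap-++ : ∀ a k l -> ap a (k N.+ l) ≡ ap a k ++ ap (at a k) l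
 ap-++ a zero l = cong (\ z -> ap z l) (zero-lem a s)
 ap-++ a (suc k) l = cong (a ∷_) (≡.trans (ap-++ (a Z.+ s) k l) (cong (\ z -> ap (a Z.+ s) k ++ ap z l) (at-suc a k)))

 flip-++ : ∀ a j k -> flip a (j N.+ k) j ≡ neg (ap a j) ++ ap (at a j) k
 flip-++ a zero k = cong (\ z -> ap z k) (zero-lem a s)
 flip-++ a (suc j) k = cong (Z.- a ∷_) (≡.trans (flip-++ (a Z.+ s) j k) (cong (\ z -> neg (ap (a Z.+ s) j) ++ ap z k) (at-suc a j)))

 ap-snoc : ∀ a l -> ap a (suc l) ≡ ap a l ++ at a l ∷ []
 ap-snoc a l = ≡.trans (cong (ap a) (Nₚ.+-comm 1 l)) (ap-++ a l 1)

 neg-ap : ∀ a j -> neg (ap a j) ↭ ap (s Z.- at a j) j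
 neg-ap a zero = Perm.refl
 neg-ap a (suc j) = ↭-trans (prep (Z.- a) (neg-ap (a Z.+ s) j)) (↭-trans (Permₚ.∷↭∷ʳ _ _) (Perm.↭-reflexive (≡.sym eq)))
  where
  lem : ∀ a j s -> (s Z.- (a Z.+ s Z.* (+ 1 Z.+ j))) Z.+ s Z.* j ≡ Z.- a
  lem = Z-solve
  eq : ap (s Z.- at a (suc j)) (suc j) ≡ ap (s Z.- at (a Z.+ s) j) j ++ (Z.- a) ∷ []
  eq = ≡.trans (ap-snoc (s Z.- at a (suc j)) j) (cong₂ (\ x y -> ap (s Z.- x) j ++ y ∷ []) (≡.sym (at-suc a j)) (lem a (+ j) s))

 flip-↭ : ∀ a j k -> flip a (j N.+ k) j ↭ ap (s Z.- at a j) j ++ ap (at a j) k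
 flip-↭ a j k = ↭-trans (Perm.↭-reflexive (flip-++ a j k)) (Permₚ.++⁺ʳ _ (neg-ap a j))

 ap-All : ∀ {Q : ℤ -> Set} a l -> (∀ k -> k < l -> Q (at a k)) -> All Q (ap a l)
 ap-All a zero q = []
 ap-All {Q} a (suc l) q = subst Q (at-0 a) (q 0 (s≤s z≤n)) ∷ ap-All (a Z.+ s) l (\ k k<l -> subst Q (≡.sym (at-suc a k)) (q (suc k) (s≤s k<l)))

 length-ap : ∀ a l -> length (ap a l) ≡ l
 length-ap a zero = ≡.refl
 length-ap a (suc l) = cong suc (length-ap (a Z.+ s) l)

signs-abs : ∀ (R : CRing) (zs : List ℤ) {f} -> let open Kit R in
 ∑ (signs (map (\ z -> + Z.∣ z ∣) zs)) f ≈ ∑ (signs zs) f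
signs-abs R [] = Kit.refl R
signs-abs R (z ∷ zs) {f} = trans (split (+ Z.∣ z ∣) (map (\ z -> + Z.∣ z ∣) zs)) (trans (+-cong (signs-abs R zs) (signs-abs R zs)) (trans (both z) (sym (split z zs))))
 where
 open Kit R
 split : ∀ z zs -> ∑ (signs (z ∷ zs)) f ≈ ∑ (signs zs) (\ v -> f (z ∷ v)) + ∑ (signs zs) (\ v -> f ((Z.- z) ∷ v))
 split z zs = trans (∑-++ (map (z ∷_) (signs zs)) (map ((Z.- z) ∷_) (signs zs))) (+-cong (∑-map (z ∷_) (signs zs)) (∑-map ((Z.- z) ∷_) (signs zs)))
 both : ∀ z -> ∑ (signs zs) (\ v -> f (+ Z.∣ z ∣ ∷ v)) + ∑ (signs zs) (\ v -> f ((Z.- + Z.∣ z ∣) ∷ v)) ≈ ∑ (signs zs) (\ v -> f (z ∷ v)) + ∑ (signs zs) (\ v -> f ((Z.- z) ∷ v))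
 both (+ n) = refl
 both -[1+ n ] = +-comm _ _

private module _ (R : CRing) where
 open Kit R
 open Determinants R using (∑-choices)
 module _ (𝔾 : Geom R) where
  open Geom 𝔾
  open Geometric R 𝔾
  open Divisible R t
  module ClassSums (P : ℕ) (P≢0 : P ≢ 0) where
   open SignSums R 𝔾 (t ^ P)
   open Progressions (+ P)

   -- An unflipped exponent e followed by its flipped successor -(e + P) has sum -P, and G(-P) = 0
   -- because p t^(-P) = 1. This is the source of the collapse.
   Vanishing : (List ℤ -> Carrier) -> Set
   Vanishing f = ∀ us e vs -> f (us ++ e ∷ Z.- (e Z.+ + P) ∷ vs) ≈ 0#

   private
    ∑-signs-++ : ∀ X Y {f : List ℤ -> Carrier} -> ∑ (signs (X ++ Y)) f ≈ ∑ (signs X) (\ x -> ∑ (signs Y) (\ y -> f (x ++ y)))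
    ∑-signs-++ [] Y = sym (+-identityʳ _)
    ∑-signs-++ (x ∷ X) Y {f} = begin
     ∑ (signs (x ∷ X ++ Y)) f ≈⟨ trans (∑-signs x (X ++ Y)) (∑-signs-++ X Y) ⟩
     ∑ (signs X) (\ v -> ∑ (signs Y) (\ y -> f (x ∷ v ++ y) + f (Z.- x ∷ v ++ y))) ≈⟨ ∑-cong (signs X) (\ v -> ∑-+ (signs Y)) ⟩
     ∑ (signs X) (\ v -> ∑ (signs Y) (\ y -> f (x ∷ v ++ y)) + ∑ (signs Y) (\ y -> f (Z.- x ∷ v ++ y))) ≈⟨ ∑-signs x X ⟨
     ∑ (signs (x ∷ X)) (\ v -> ∑ (signs Y) (\ y -> f (v ++ y))) ∎

    stay : ∀ f -> Vanishing f -> ∀ a l -> ∑ (signs (ap (a Z.+ + P) l)) (\ v -> f (a ∷ v)) ≈ f (a ∷ ap (a Z.+ + P) l)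
    stay f van a zero = +-identityʳ _
    stay f van a (suc l) = begin
     ∑ (signs ((a Z.+ + P) ∷ ap ((a Z.+ + P) Z.+ + P) l)) (\ v -> f (a ∷ v)) ≈⟨ trans (∑-signs (a Z.+ + P) X) (∑-+ (signs X)) ⟩
     ∑ (signs X) (\ v -> f (a ∷ (a Z.+ + P) ∷ v)) + ∑ (signs X) (\ v -> f (a ∷ Z.- (a Z.+ + P) ∷ v))
      ≈⟨ +-cong (stay (\ v -> f (a ∷ v)) (\ us -> van (a ∷ us)) (a Z.+ + P) l) (∑-0 (signs X) (\ v -> van [] a v)) ⟩
     f (a ∷ (a Z.+ + P) ∷ X) + 0# ≈⟨ +-identityʳ _ ⟩
     f (a ∷ (a Z.+ + P) ∷ X) ∎
     where X = ap ((a Z.+ + P) Z.+ + P) l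

    collapse₁ : ∀ f -> Vanishing f -> ∀ a l -> ∑ (signs (ap a l)) f ≈ ∑ (upTo (suc l)) (\ j -> f (flip a l j))
    collapse₁ f van a zero = refl
    collapse₁ f van a (suc l) = begin
     ∑ (signs (a ∷ ap (a Z.+ + P) l)) f ≈⟨ trans (∑-signs a X) (∑-+ (signs X)) ⟩
     ∑ (signs X) (\ v -> f (a ∷ v)) + ∑ (signs X) (\ v -> f (Z.- a ∷ v))
      ≈⟨ +-cong (stay f van a l) (collapse₁ (\ v -> f (Z.- a ∷ v)) (\ us -> van (Z.- a ∷ us)) (a Z.+ + P) l) ⟩
     f (ap a (suc l)) + ∑ (upTo (suc l)) (\ j -> f (Z.- a ∷ flip (a Z.+ + P) l j))
      ≈⟨ +-congˡ (trans (∑-applyUpTo id (suc l)) (sym (∑-applyUpTo suc (suc l)))) ⟩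
     ∑ (upTo (suc (suc l))) (\ j -> f (flip a (suc l) j)) ∎
     where X = ap (a Z.+ + P) l

   -- In a surviving sign vector no unflipped member of a class is followed by a flipped one, so
   -- each class is described by the length of its flipped initial segment.
   collapse : ∀ f -> Vanishing f -> ∀ l {A : Set} (base : A -> ℤ) as -> ∑ (signs (concat (map (\ a -> ap (base a) l) as))) f ≈
    ∑ (choices (upTo (suc l)) as) (\ v -> f (concat (map (\ aj -> flip (base (aj .fst)) l (aj .snd)) v)))
   collapse f van l base [] = refl
   collapse f van l {A} base (a ∷ as) = begin
    ∑ (signs (ap (base a) l ++ X)) f ≈⟨ ∑-signs-++ (ap (base a) l) X ⟩
    ∑ (signs (ap (base a) l)) (\ x -> ∑ (signs X) (\ y -> f (x ++ y)))
     ≈⟨ ∑-cong (signs (ap (base a) l)) (\ x -> collapse (\ y -> f (x ++ y)) (\ us e vs -> trans (≈-cong f (≡.sym (Lₚ.++-assoc x us _))) (van (x ++ us) e vs)) l base as) ⟩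
    ∑ (signs (ap (base a) l)) (\ x -> ∑ (choices (upTo (suc l)) as) (\ v -> f (x ++ C v)))
     ≈⟨ ∑-swap (signs (ap (base a) l)) (choices (upTo (suc l)) as) ⟩
    ∑ (choices (upTo (suc l)) as) (\ v -> ∑ (signs (ap (base a) l)) (\ x -> f (x ++ C v)))
     ≈⟨ ∑-cong (choices (upTo (suc l)) as) (\ v -> collapse₁ (\ x -> f (x ++ C v))
       (\ us e vs -> trans (≈-cong f (Lₚ.++-assoc us _ (C v))) (van us e (vs ++ C v))) (base a) l) ⟩
    ∑ (choices (upTo (suc l)) as) (\ v -> ∑ (upTo (suc l)) (\ j -> f (flip (base a) l j ++ C v))) ≈⟨ ∑-swap (choices (upTo (suc l)) as) (upTo (suc l)) ⟩
    ∑ (upTo (suc l)) (\ j -> ∑ (choices (upTo (suc l)) as) (\ v -> f (flip (base a) l j ++ C v))) ≈⟨ ∑-choices (upTo (suc l)) a as ⟨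
    ∑ (choices (upTo (suc l)) (a ∷ as)) (\ v -> f (C v)) ∎
    where
    X = concat (map (\ a -> ap (base a) l) as)
    C : List (A × ℕ) -> List ℤ
    C v = concat (map (\ aj -> flip (base (aj .fst)) l (aj .snd)) v)

   private
    G-P : G (Z.- + P) ≈ 0#
    G-P = trans (+-congˡ (*-congˡ (H-neg (+ P) (\ e -> P≢0 (Zₚ.+-injective e)))))
     (trans (solve 2 (\ p h -> p :+ (1ₚ :- p) :* (1ₚ :- h) := 1ₚ :- (1ₚ :- p) :* h) refl _ _) (trans (+-congˡ (-‿cong (H-inv P P≢0))) (-‿inverseʳ _)))

    pairs-vanish : Vanishing pairs
    pairs-vanish [] e vs = *-zeroˡ-≈ (*-zeroˡ-≈ (trans (≈-cong G (lem e (+ P))) G-P))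
     where
     lem : ∀ e P -> e Z.+ Z.- (e Z.+ P) ≡ Z.- P
     lem = Z-solve
    pairs-vanish (u ∷ us) e vs = *-zeroʳ-≈ (pairs-vanish us e vs)

   wt-vanish : ∀ φ -> Vanishing (wt φ)
   wt-vanish φ us e vs = *-zeroʳ-≈ (pairs-vanish us e vs)

   module _ {A B : Set} (Q : A -> Set) (Bad : B -> Set) where

    choices-restrict : ∀ M (ks₁ ks ks₂ : List B) -> All Bad ks₁ -> All Bad ks₂ -> ∀ as -> All Q as -> ∀ {f : List (A × B) -> Carrier} ->
     (∀ us a k vs -> Q a -> Bad k -> Div M (f (us ++ (a , k) ∷ vs))) ->
     Div M (∑ (choices (ks₁ ++ ks ++ ks₂) as) f - ∑ (choices ks as) f)
    choices-restrict M ks₁ ks ks₂ b₁ b₂ [] _ z = Div-resp (sym (-‿inverseʳ _)) (Div-0 M)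
    choices-restrict M ks₁ ks ks₂ b₁ b₂ (a ∷ as) (qa ∷ qas) {f} z = Div-resp (sym (begin
     ∑ (choices ks′ (a ∷ as)) f - ∑ (choices ks (a ∷ as)) f ≈⟨ +-cong (trans (∑-choices ks′ a as) (trans (∑-++ ks₁ (ks ++ ks₂)) (+-congˡ (∑-++ ks ks₂)))) (-‿cong (∑-choices ks a as)) ⟩
     (∑ ks₁ g + (∑ ks g + ∑ ks₂ g)) - ∑ ks g′ ≈⟨ solve 4 (\ a b c d -> (a :+ (b :+ c)) :- d := (a :+ c) :+ (b :- d)) refl _ _ _ _ ⟩
     (∑ ks₁ g + ∑ ks₂ g) + (∑ ks g - ∑ ks g′) ≈⟨ +-congˡ (trans (+-congˡ (sym (∑-neg ks))) (sym (∑-+ ks))) ⟩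
     (∑ ks₁ g + ∑ ks₂ g) + ∑ ks (\ k -> g k - g′ k) ∎))
     (Div-+ (Div-+ (bad b₁) (bad b₂)) (Div-∑ ks (\ k -> choices-restrict M ks₁ ks ks₂ b₁ b₂ as qas (\ us -> z ((a , k) ∷ us)))))
     where
     ks′ = ks₁ ++ ks ++ ks₂
     g g′ : B -> Carrier
     g k = ∑ (choices ks′ as) (\ v -> f ((a , k) ∷ v))
     g′ k = ∑ (choices ks as) (\ v -> f ((a , k) ∷ v))
     bad : ∀ {ks} -> All Bad ks -> Div M (∑ ks g)
     bad [] = Div-0 M
     bad (b ∷ bs) = Div-+ (Div-∑ (choices ks′ as) (\ v -> z [] a _ v qa b)) (bad bs)

-- Integer power series, truncation, and sequences with coefficientwise limits.

ℤR : CRing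
ℤR = Zₚ.+-*-commutativeRing

private module FS = PowerSeries ℤR

FR : CRing
FR = FS.psRing

sumTo-front : ∀ f n -> sumTo f (suc n) ≡ f 0 Z.+ sumTo (\ k -> f (suc k)) n
sumTo-front f zero = ≡.trans (Zₚ.+-identityˡ (f 0)) (≡.sym (Zₚ.+-identityʳ (f 0)))
sumTo-front f (suc n) = ≡.trans (cong (\ z -> z Z.+ f (suc n)) (sumTo-front f n)) (Zₚ.+-assoc (f 0) _ _)

⊛-mul : ∀ f g k -> (f ⊛ g) k ≡ FS.mul f g k
⊛-mul f g zero = Zₚ.+-identityˡ _
⊛-mul f g (suc k) = ≡.trans (sumTo-front (\ i -> f i Z.* g (suc k ∸ i)) (suc k)) (cong (\ z -> f 0 Z.* g (suc k) Z.+ z) (⊛-mul (\ i -> f (suc i)) g k))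

oneS-1 : ∀ k -> oneS k ≡ FS.1ₛ k
oneS-1 zero = ≡.refl
oneS-1 (suc k) = ≡.refl

mono-X^ : ∀ e k -> mono e k ≡ Kit._^_ FR FS.Xₛ e k
mono-X^ e k = ≡.sym (FS.X^ e k)

private
 ≡ᵇ-refl : ∀ n -> (n ≡ᵇ n) ≡ true
 ≡ᵇ-refl zero = ≡.refl
 ≡ᵇ-refl (suc n) = ≡ᵇ-refl n

 ≢⇒≡ᵇ : ∀ m n -> m ≢ n -> (m ≡ᵇ n) ≡ false
 ≢⇒≡ᵇ zero zero ne = ⊥-elim (ne ≡.refl)
 ≢⇒≡ᵇ zero (suc n) ne = ≡.refl
 ≢⇒≡ᵇ (suc m) zero ne = ≡.refl
 ≢⇒≡ᵇ (suc m) (suc n) ne = ≢⇒≡ᵇ m n (\ e -> ne (cong suc e))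

 invUpTo-inv : ∀ f k i -> i ≤ k -> invUpTo f k i ≡ inv f i
 invUpTo-inv f zero zero _ = ≡.refl
 invUpTo-inv f (suc k) i i≤ with i N.≟ suc k
 ... | yes ≡.refl = ≡.refl
 ... | no ne = ≡.trans (cong (\ b -> if b then Z.- sumTo (\ j -> f (suc j) Z.* invUpTo f k (k ∸ j)) (suc k) else invUpTo f k i) (≢⇒≡ᵇ i (suc k) ne))
         (invUpTo-inv f k i (Nₚ.≤-pred (Nₚ.≤∧≢⇒< i≤ ne)))

 sumTo-cong : ∀ {f g} n -> (∀ k -> k < n -> f k ≡ g k) -> sumTo f n ≡ sumTo g n
 sumTo-cong zero e = ≡.refl
 sumTo-cong (suc n) e = cong₂ Z._+_ (sumTo-cong n (\ k k<n -> e k (Nₚ.m<n⇒m<1+n k<n))) (e n Nₚ.≤-refl)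

 inv-suc : ∀ f k -> inv f (suc k) ≡ Z.- FS.mul (FS.tail f) (inv f) k
 inv-suc f k = ≡.trans unfold (cong (\ z -> Z.- z) (≡.trans (sumTo-cong (suc k) (\ j _ -> cong (f (suc j) Z.*_) (invUpTo-inv f k (k ∸ j) (Nₚ.m∸n≤m k j)))) (⊛-mul (FS.tail f) (inv f) k)))
  where
  unfold : inv f (suc k) ≡ Z.- sumTo (\ j -> f (suc j) Z.* invUpTo f k (k ∸ j)) (suc k)
  unfold = cong (\ b -> if b then Z.- sumTo (\ j -> f (suc j) Z.* invUpTo f k (k ∸ j)) (suc k) else invUpTo f k (suc k)) (≡ᵇ-refl k)

mul-inv : ∀ f -> f 0 ≡ + 1 -> ∀ k -> FS.mul f (inv f) k ≡ FS.1ₛ k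
mul-inv f e zero = ≡.trans (Zₚ.*-identityʳ _) e
mul-inv f e (suc k) = ≡.trans (cong₂ (\ a b -> a Z.* b Z.+ FS.mul (FS.tail f) (inv f) k) e (inv-suc f k))
 (≡.trans (cong (\ z -> z Z.+ FS.mul (FS.tail f) (inv f) k) (Zₚ.*-identityˡ (Z.- FS.mul (FS.tail f) (inv f) k))) (Zₚ.+-inverseˡ (FS.mul (FS.tail f) (inv f) k)))

F𝔾 : Geom FR
F𝔾 = record
 { t = FS.Xₛ
 ; geo = \ k -> inv (1# - FS.Xₛ ^ suc k)
 ; geo-inv = \ k -> mul-inv (1# - FS.Xₛ ^ suc k) ≡.refl }
 where open Kit FR

private module Truncated (M : ℕ) where
 open CommutativeRing FR using (Carrier)

 record _~_ (f g : Carrier) : Set where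
  constructor below
  field
   agree : ∀ k -> k < M -> f k ≡ g k
 open _~_ public

 ~-isEquivalence : IsEquivalence _~_
 ~-isEquivalence = record
  { refl = below (\ _ _ -> ≡.refl) ; sym = \ e -> below (\ k k<M -> ≡.sym (agree e k k<M)) ; trans = \ e e′ -> below (\ k k<M -> ≡.trans (agree e k k<M) (agree e′ k k<M)) }

 open Quotient FR _~_
  ~-isEquivalence
  (\ e -> below (\ k _ -> e k))
  (\ e e′ -> below (\ k k<M -> cong₂ Z._+_ (agree e k k<M) (agree e′ k k<M)))
  (\ e e′ -> below (\ k k<M -> FS.mul-cong-≤ k (\ j j≤k -> agree e j (Nₚ.≤-<-trans j≤k k<M)) (\ j j≤k -> agree e′ j (Nₚ.≤-<-trans j≤k k<M))))
  (\ e -> below (\ k k<M -> cong (\ z -> Z.- z) (agree e k k<M)))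
  public renaming (quotientRing to TR; projection to truncate)

 ^-truncate : ∀ a k -> Kit._^_ TR a k ≡ Kit._^_ FR a k
 ^-truncate a zero = ≡.refl
 ^-truncate a (suc k) = cong (FS.mul a) (^-truncate a k)

 t^-vanish : ∀ {k} -> M ≤ k -> Kit._≈_ TR (Kit._^_ FR FS.Xₛ k) (Kit.0# TR)
 t^-vanish {k} M≤k = below (\ j j<M -> ≡.trans (FS.X^ k j) (Kit.δ-≢ ℤR (Nₚ.<⇒≢ (Nₚ.<-≤-trans j<M M≤k))))

 open Divisible FR FS.Xₛ using (Div; _,_)

 Div⇒0 : ∀ {k a} -> M ≤ k -> Div k a -> Kit._≈_ TR a (Kit.0# TR)
 Div⇒0 {k} {a} M≤k (c , e) = trans (Hom.⟦⟧-cong truncate e) (trans (*-congʳ (t^-vanish M≤k)) (zeroˡ c))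
  where open Kit TR using (trans; *-congʳ; zeroˡ; *-zeroˡ-≈)

-- Sequences of power series up to eventual agreement of every coefficient.
private module Sequences where
 private module FK = CommutativeRing FR using (Carrier; _≈_; _+_; _*_; -_; 0#; 1#; refl; +-assoc; +-comm; +-identityˡ; -‿inverseˡ; *-assoc; *-comm; *-identityˡ; distribʳ)

 record _~_ (a b : ℕ -> FK.Carrier) : Set where
  constructor eventually
  field
   from  : ℕ -> ℕ
   agree : ∀ M K -> from M ≤ K -> Truncated._~_ M (a K) (b K)
 open _~_ public

 pointwise : ∀ {a b} -> (∀ K -> a K FK.≈ b K) -> a ~ b
 pointwise e = eventually (\ _ -> 0) (\ M K _ -> Truncated.below (\ k _ -> e K k))

 private
  lift₂ : ∀ {a b c d} {op : FK.Carrier -> FK.Carrier -> FK.Carrier} ->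
   (∀ M {x y u v} -> Truncated._~_ M x y -> Truncated._~_ M u v -> Truncated._~_ M (op x u) (op y v)) ->
   a ~ b -> c ~ d -> (\ K -> op (a K) (c K)) ~ (\ K -> op (b K) (d K))
  lift₂ f e e′ = eventually (\ M -> from e M N.⊔ from e′ M) (\ M K le ->
   f M (agree e M K (Nₚ.≤-trans (Nₚ.m≤m⊔n _ _) le)) (agree e′ M K (Nₚ.≤-trans (Nₚ.m≤n⊔m _ _) le)))

 seqRing : CRing
 seqRing = toRing (record
  { Carrier = ℕ -> FK.Carrier ; _≈_ = _~_ ; _+_ = \ a b K -> a K FK.+ b K ; _*_ = \ a b K -> a K FK.* b K ; -_ = \ a K -> FK.- a K ; 0# = \ _ -> FK.0# ; 1# = \ _ -> FK.1#
  ; isEquivalence = record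
   { refl = pointwise (\ _ -> FK.refl)
   ; sym = \ e -> eventually (from e) (\ M K le -> CommutativeRing.sym (Truncated.TR M) (agree e M K le))
   ; trans = \ e e′ -> eventually (\ M -> from e M N.⊔ from e′ M) (\ M K le -> CommutativeRing.trans (Truncated.TR M)
     (agree e M K (Nₚ.≤-trans (Nₚ.m≤m⊔n _ _) le)) (agree e′ M K (Nₚ.≤-trans (Nₚ.m≤n⊔m _ _) le))) }
  ; +-cong = lift₂ (\ M -> CommutativeRing.+-cong (Truncated.TR M)) ; *-cong = lift₂ (\ M -> CommutativeRing.*-cong (Truncated.TR M))
  ; neg-cong = \ e -> eventually (from e) (\ M K le -> CommutativeRing.-‿cong (Truncated.TR M) (agree e M K le))
  ; +-assoc = \ a b c -> pointwise (\ K -> FK.+-assoc (a K) (b K) (c K)) ; +-comm = \ a b -> pointwise (\ K -> FK.+-comm (a K) (b K))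
  ; +-identityˡ = \ a -> pointwise (\ K -> FK.+-identityˡ (a K)) ; +-inverseˡ = \ a -> pointwise (\ K -> FK.-‿inverseˡ (a K))
  ; *-assoc = \ a b c -> pointwise (\ K -> FK.*-assoc (a K) (b K) (c K)) ; *-comm = \ a b -> pointwise (\ K -> FK.*-comm (a K) (b K))
  ; *-identityˡ = \ a -> pointwise (\ K -> FK.*-identityˡ (a K)) ; distribʳ = \ a b c -> pointwise (\ K -> FK.distribʳ (a K) (b K) (c K)) })

 constant : Hom FR seqRing
 constant = record
  { ⟦_⟧ = \ f _ -> f ; ⟦⟧-cong = \ e -> pointwise (\ _ -> e) ; ⟦⟧-+ = \ _ _ -> pointwise (\ _ -> FK.refl) ; ⟦⟧-* = \ _ _ -> pointwise (\ _ -> FK.refl)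
  ; ⟦⟧-neg = \ _ -> pointwise (\ _ -> FK.refl) ; ⟦⟧-0 = pointwise (\ _ -> FK.refl) ; ⟦⟧-1 = pointwise (\ _ -> FK.refl) }

 t-cancel : ∀ {a b} -> (\ K -> FS.Xₛ FK.* a K) ~ (\ K -> FS.Xₛ FK.* b K) -> a ~ b
 -- One more coefficient is asked of the hypothesis, since multiplication by t shifts the index.
 t-cancel {a} {b} e = eventually (\ M -> from e (suc M)) (\ M K le -> Truncated.below (\ k k<M ->
  ≡.trans (≡.sym (FS.mul-X-suc (a K) k)) (≡.trans (Truncated.agree (agree e (suc M) K le) (suc k) (s≤s k<M)) (FS.mul-X-suc (b K) k))))

open Sequences using (seqRing) public

private module Loc = Localisation seqRing (\ _ -> FS.Xₛ) Sequences.t-cancel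

SR : CRing
SR = Loc.locRing

-- Limits of sequences in R, taken in a ring S where t is invertible.
record LimitRing (R : CRing) (𝔾 : Geom R) (S : CRing) : Set₁ where
 private
  module R = Kit R
  module S = Kit S
 open Geom 𝔾
 open Divisible R t using (Div)
 field
  lim           : (ℕ -> R.Carrier) -> S.Carrier
  lim-pointwise : ∀ {a b} -> (∀ K -> a K R.≈ b K) -> lim a S.≈ lim b
  lim-+         : ∀ a b -> lim (\ K -> a K R.+ b K) S.≈ lim a S.+ lim b
  lim-*         : ∀ a b -> lim (\ K -> a K R.* b K) S.≈ lim a S.* lim b
  lim-neg       : ∀ a -> lim (\ K -> R.- a K) S.≈ S.- lim a
  lim-0         : lim (\ _ -> R.0#) S.≈ S.0#
  lim-1         : lim (\ _ -> R.1#) S.≈ S.1#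
  τ             : ℤ -> S.Carrier
  τ-0           : τ (+ 0) S.≈ S.1#
  τ-+           : ∀ a b -> τ (a Z.+ b) S.≈ τ a S.* τ b
  τ-^           : ∀ k -> τ (+ k) S.≈ lim (\ _ -> t R.^ k)
  -- The interchange of limits: for each M, both sequences are compared modulo t^M with auxiliary
  -- ones that have equal limits. The fixed windows of the sign sums supply these.
  lim-approx    : ∀ {a b} (from : ℕ -> ℕ) (c d : ℕ -> ℕ -> R.Carrier) -> (∀ M -> lim (c M) S.≈ lim (d M)) ->
          (∀ M K -> Div M (a (K N.+ from M) R.- c M K)) -> (∀ M K -> Div M (b (K N.+ from M) R.- d M K)) -> lim a S.≈ lim b

-- Limits of the weights along arithmetic progressions.

private module _ (R S : CRing) where
 open Kit S
 private module R = Kit R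
 module _ (𝔾 : Geom R) where
  private module FG = Geometric R 𝔾
  open Geom 𝔾 using (t; geo-inv)
  open Divisible R t
  module Limits (𝕃 : LimitRing R 𝔾 S) where
   open LimitRing 𝕃 public


   record Tends (g : ℤ -> R.Carrier) : Set where
    constructor tends
    field
     near-1 : ∀ M k -> M ≤ k -> Div M (g (+ k) R.- R.1#)
   open Tends public

   Tends-H : Tends FG.H
   Tends-H = tends go
    where
    go : ∀ M k -> M ≤ k -> Div M (FG.H (+ k) R.- R.1#)
    go zero k _ = _ , R.sym (R.*-identityˡ _)
    go (suc M) zero ()
    go (suc M) (suc k) le = Div-≤ le (Div-resp (FG.t-H (suc k) (\ ())) (_ , R.refl))

   private
    near-* : ∀ {M a b} -> Div M (a R.- R.1#) -> Div M (b R.- R.1#) -> Div M (a R.* b R.- R.1#)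
    near-* {a = a} {b} da db = Div-resp (R.solve 2 (\ a b -> (a R.:- R.1ₚ) R.:* b R.:+ (b R.:- R.1ₚ) R.:= a R.:* b R.:- R.1ₚ) R.refl a b) (Div-+ (Div-*ʳ b da) db)

   Tends-* : ∀ {g h} -> Tends g -> Tends h -> Tends (\ e -> g e R.* h e)
   Tends-* tg th = tends (\ M k le -> near-* (near-1 tg M k le) (near-1 th M k le))

   -- Length and exponents may both vary with K. Once every exponent is at least M, each factor and
   -- hence the product is 1 modulo t^M.
   Tends-∏ : ∀ {g} -> Tends g -> ∀ (len from : ℕ -> ℕ) (e : ℕ -> ℕ -> ℤ) ->
    (∀ M K k -> from M ≤ K -> + M Z.≤ e K k) -> lim (\ K -> R.∏< (len K) (\ k -> g (e K k))) ≈ 1#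
   Tends-∏ {g} tg len from e big = trans (lim-approx {b = \ _ -> R.1#} from (\ _ _ -> R.1#) (\ _ _ -> R.1#) (\ _ -> refl)
    (\ M K -> products (len (K N.+ from M)) (\ k -> large M (e (K N.+ from M) k) (big M (K N.+ from M) k (Nₚ.m≤n+m (from M) K)))) (\ M K -> Div-resp (R.sym (R.-‿inverseʳ _)) (Div-0 M))) lim-1
    where
    large : ∀ M z -> + M Z.≤ z -> Div M (g z R.- R.1#)
    large M (+ k) (Z.+≤+ le) = near-1 tg M k le
    products : ∀ {M} l {f} -> (∀ k -> Div M (f k R.- R.1#)) -> Div M (R.∏< l f R.- R.1#)
    products {M} zero d = Div-resp (R.sym (R.-‿inverseʳ _)) (Div-0 M)
    products (suc l) d = near-* (d 0) (products l (\ k -> d (suc k)))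

   ι : R.Carrier -> Carrier
   ι f = lim (\ _ -> f)

   ι-cong : ∀ {f g} -> f R.≈ g -> ι f ≈ ι g
   ι-cong e = lim-pointwise (\ _ -> e)

   H : ℤ -> Carrier
   H e = ι (FG.H e)

   τ-inverse : ∀ e -> τ e * τ (Z.- e) ≈ 1#
   τ-inverse e = trans (sym (τ-+ e (Z.- e))) (trans (≈-cong τ (Zₚ.+-inverseʳ e)) τ-0)

   private
    inv-pos : ∀ k -> (1# - τ (+ suc k)) * H (+ suc k) ≈ 1#
    inv-pos k = begin
     (1# - τ (+ suc k)) * H (+ suc k) ≈⟨ *-congʳ (+-cong (sym lim-1) (trans (-‿cong (τ-^ (suc k))) (sym (lim-neg _)))) ⟩
     (ι R.1# + ι (R.- (t R.^ suc k))) * H (+ suc k) ≈⟨ trans (*-congʳ (sym (lim-+ _ _))) (sym (lim-* _ _)) ⟩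
     ι ((R.1# R.- t R.^ suc k) R.* FG.H (+ suc k)) ≈⟨ ι-cong (geo-inv k) ⟩
     ι R.1# ≈⟨ lim-1 ⟩
     1# ∎

   H-inv : ∀ e -> e ≢ + 0 -> (1# - τ e) * H e ≈ 1#
   H-inv (+ zero) ne = ⊥-elim (ne ≡.refl)
   H-inv (+ suc k) _ = inv-pos k
   H-inv -[1+ k ] _ = begin
    (1# - τ -[1+ k ]) * H -[1+ k ] ≈⟨ *-congˡ (trans (lim-+ _ _) (+-cong lim-1 (lim-neg _))) ⟩
    (1# - n) * (1# - g) ≈⟨ solve 3 (\ n g q -> (1ₚ :- n) :* (1ₚ :- g) := (n :* q) :+ (1ₚ :- (n :* q)) :- n :+ (n :* ((1ₚ :- q) :* g) :- (1ₚ :- n :* q) :* g :+ (n :* g) :- n :* g)) refl n g q ⟩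
    (n * q) + (1# - n * q) - n + (n * ((1# - q) * g) - (1# - n * q) * g + n * g - n * g)
     ≈⟨ +-cong (+-congʳ (+-cong nq (+-congˡ (-‿cong nq)))) (+-congʳ (+-congʳ (+-cong (*-congˡ (inv-pos k)) (-‿cong (*-congʳ (+-congˡ (-‿cong nq))))))) ⟩
    1# + (1# - 1#) - n + (n * 1# - (1# - 1#) * g + n * g - n * g) ≈⟨ solve 2 (\ n g -> 1ₚ :+ (1ₚ :- 1ₚ) :- n :+ (n :* 1ₚ :- (1ₚ :- 1ₚ) :* g :+ n :* g :- n :* g) := 1ₚ) refl n g ⟩
    1# ∎
    where
    n = τ -[1+ k ]
    q = τ (+ suc k)
    g = H (+ suc k)
    nq : n * q ≈ 1#
    nq = τ-inverse -[1+ k ]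

   H-neg : ∀ e -> e ≢ + 0 -> H (Z.- e) ≈ - (τ e * H e)
   H-neg e ne = unit-cancel (H-inv (Z.- e) (neg≢0 ne)) (begin
    (1# - τ (Z.- e)) * H (Z.- e) ≈⟨ H-inv (Z.- e) (neg≢0 ne) ⟩
    1# ≈⟨ H-inv e ne ⟨
    (1# - τ e) * H e ≈⟨ solve 3 (\ a b h -> (1ₚ :- a) :* h := (b :- a) :* h :+ (1ₚ :- b) :* h) refl _ (τ e * τ (Z.- e)) _ ⟩
    (τ e * τ (Z.- e) - τ e) * H e + (1# - τ e * τ (Z.- e)) * H e ≈⟨ +-congˡ (*-zeroˡ-≈ (trans (+-congˡ (-‿cong (τ-inverse e))) (-‿inverseʳ _))) ⟩
    (τ e * τ (Z.- e) - τ e) * H e + 0# ≈⟨ solve 3 (\ a b h -> (a :* b :- a) :* h :+ 0ₚ := (1ₚ :- b) :* (:- (a :* h))) refl _ _ _ ⟩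
    (1# - τ (Z.- e)) * - (τ e * H e) ∎)

   module Products (P : ℕ) (P≢0 : P ≢ 0) where
    open Progressions (+ P) public

    at-large : ∀ M a K -> M N.+ Z.∣ a ∣ ≤ K -> + M Z.≤ at a K
    at-large M a K le = Zₚ.≤-trans (Zₚ.≤-reflexive (lem (+ M) (+ Z.∣ a ∣)))
     (Zₚ.+-mono-≤ (neg-abs a) (Zₚ.≤-trans (Z.+≤+ le) (Zₚ.≤-trans (Z.+≤+ (mul-ge P P≢0)) (Zₚ.≤-reflexive (Zₚ.pos-* P K)))))
     where
     lem : ∀ m a -> m ≡ Z.- a Z.+ (m Z.+ a)
     lem = Z-solve
     neg-abs : ∀ a -> Z.- (+ Z.∣ a ∣) Z.≤ a
     neg-abs (+ n) = Zₚ.≤-trans Zₚ.neg-≤-pos Zₚ.≤-refl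
     neg-abs -[1+ n ] = Zₚ.≤-refl
     mul-ge : ∀ P -> P ≢ 0 -> K ≤ P N.* K
     mul-ge zero ne = ⊥-elim (ne ≡.refl)
     mul-ge (suc P) _ = Nₚ.m≤m+n K (P N.* K)

    at-+ : ∀ a b k l -> at a k Z.+ at b l ≡ at (a Z.+ b) (k N.+ l)
    at-+ a b k l = lem a b (+ P) (+ k) (+ l)
     where
     lem : ∀ a b P k l -> (a Z.+ P Z.* k) Z.+ (b Z.+ P Z.* l) ≡ (a Z.+ b) Z.+ P Z.* (k Z.+ l)
     lem = Z-solve

    fprod : (ℤ -> R.Carrier) -> ℤ -> Carrier
    fprod g a = lim (\ K -> R.∏< K (\ k -> g (at a k)))

    private
     term-1 : ∀ {g} -> Tends g -> ∀ a c -> lim (\ K -> g (at a (K N.+ c))) ≈ 1#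
     term-1 {g} tg a c = trans (lim-pointwise (\ K -> R.sym (R.*-identityʳ _)))
      (Tends-∏ tg (\ _ -> 1) (\ M -> M N.+ Z.∣ a ∣) (\ K _ -> at a (K N.+ c)) (\ M K _ le -> at-large M a (K N.+ c) (Nₚ.≤-trans le (Nₚ.m≤m+n K c))))

    fprod-shift : ∀ {g} -> Tends g -> ∀ a c -> lim (\ K -> R.∏< (K N.+ c) (\ k -> g (at a k))) ≈ fprod g a
    fprod-shift {g} tg a zero = lim-pointwise (\ K -> R.≈-cong (\ n -> R.∏< n (\ k -> g (at a k))) (Nₚ.+-identityʳ K))
    fprod-shift {g} tg a (suc c) = begin
     lim (\ K -> R.∏< (K N.+ suc c) (\ k -> g (at a k)))
      ≈⟨ lim-pointwise (\ K -> R.trans (R.≈-cong (\ n -> R.∏< n (\ k -> g (at a k))) (Nₚ.+-suc K c)) (R.∏<-snoc (K N.+ c))) ⟩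
     lim (\ K -> R.∏< (K N.+ c) (\ k -> g (at a k)) R.* g (at a (K N.+ c))) ≈⟨ lim-* _ _ ⟩
     lim (\ K -> R.∏< (K N.+ c) (\ k -> g (at a k))) * lim (\ K -> g (at a (K N.+ c))) ≈⟨ *-cong (fprod-shift tg a c) (term-1 tg a c) ⟩
     fprod g a * 1# ≈⟨ *-identityʳ _ ⟩
     fprod g a ∎

    fprod-rec : ∀ {g} -> Tends g -> ∀ a -> fprod g a ≈ ι (g a) * fprod g (a Z.+ + P)
    fprod-rec {g} tg a = trans (sym (fprod-shift tg a 1)) (trans (lim-pointwise (\ K -> R.trans (R.≈-cong (\ n -> R.∏< n (\ k -> g (at a k))) (Nₚ.+-comm K 1))
     (R.*-cong (R.≈-cong g (at-0 a)) (R.∏<-cong K (\ k -> R.≈-cong g (≡.sym (at-suc a k))))))) (lim-* _ _))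

    ∏-ap : ∀ (g : ℤ -> R.Carrier) a l -> R.∏ (ap a l) g R.≈ R.∏< l (\ k -> g (at a k))
    ∏-ap g a zero = R.refl
    ∏-ap g a (suc l) = R.*-cong (R.≈-cong g (≡.sym (at-0 a))) (R.trans (∏-ap g (a Z.+ + P) l) (R.∏<-cong l (\ k -> R.≈-cong g (at-suc a k))))

    open SignSums R 𝔾 (t R.^ P) using (G; pairs; wt; cross; wt-++)

    private
     p = t R.^ P

    -- With p = t^P, G e is (1 - t^(e+P))/(1 - t^e), so products of G in steps of P telescope.
    G-H : ∀ e -> e ≢ + 0 -> e Z.+ + P ≢ + 0 -> G e R.* FG.H (e Z.+ + P) R.≈ FG.H e
    G-H e e0 eP0 = R.begin
     (p R.+ (R.1# R.- p) R.* FG.H e) R.* b R.≈⟨ R.solve 3 (\ p a b -> (p R.:+ (R.1ₚ R.:- p) R.:* a) R.:* b R.:= p R.:* b R.:+ (R.1ₚ R.:- p) R.:* (a R.:* b)) R.refl _ _ _ ⟩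
     p R.* b R.+ (R.1# R.- p) R.* (FG.H e R.* b) R.≈⟨ R.+-congˡ (R.*-congˡ (R.trans (FG.H-three e (e Z.+ + P) e0 eP0 e≢) (R.+-cong (R.*-congʳ (R.≈-cong FG.H (lem₁ e (+ P))))
       (R.*-congʳ (R.trans (R.≈-cong FG.H (lem₂ e (+ P))) (FG.H-neg (+ P) P0)))))) ⟩
     p R.* b R.+ (R.1# R.- p) R.* (FG.H (+ P) R.* FG.H e R.+ (R.1# R.- FG.H (+ P)) R.* b)
      R.≈⟨ R.solve 4 (\ p a b c -> p R.:* b R.:+ (R.1ₚ R.:- p) R.:* (c R.:* a R.:+ (R.1ₚ R.:- c) R.:* b) R.:= ((R.1ₚ R.:- p) R.:* c) R.:* (a R.:- b) R.:+ b) R.refl _ _ _ _ ⟩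
     ((R.1# R.- p) R.* FG.H (+ P)) R.* (FG.H e R.- b) R.+ b R.≈⟨ R.+-congʳ (R.*-congʳ (FG.H-inv P P≢0)) ⟩
     R.1# R.* (FG.H e R.- b) R.+ b R.≈⟨ R.solve 2 (\ a b -> R.1ₚ R.:* (a R.:- b) R.:+ b R.:= a) R.refl _ _ ⟩
     FG.H e R.∎
     where
     b = FG.H (e Z.+ + P)
     P0 : + P ≢ + 0
     P0 q = P≢0 (Zₚ.+-injective q)
     lem₁ : ∀ e P -> (e Z.+ P) Z.- e ≡ P
     lem₁ = Z-solve
     lem₂ : ∀ e P -> e Z.- (e Z.+ P) ≡ Z.- P
     lem₂ = Z-solve
     e≢ : e ≢ e Z.+ + P
     e≢ q = P0 (≡.trans (≡.sym (lem₁ e (+ P))) (≡.trans (cong (\ z -> z Z.- e) (≡.sym q)) (Zₚ.+-inverseʳ e)))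

    private
     telescope : ∀ a z l -> (∀ k -> at a k Z.+ z ≢ + 0) -> R.∏ (ap a l) (\ y -> G (y Z.+ z)) R.* FG.H (at a l Z.+ z) R.≈ FG.H (a Z.+ z)
     telescope a z zero _ = R.trans (R.*-identityˡ _) (R.≈-cong (\ y -> FG.H (y Z.+ z)) (at-0 a))
     telescope a z (suc l) nz = R.trans (R.*-assoc _ _ _) (R.trans (R.*-congˡ (R.trans (R.*-congˡ (R.≈-cong (\ y -> FG.H (y Z.+ z)) (≡.sym (at-suc a l))))
      (R.trans (telescope (a Z.+ + P) z l (\ k -> subst (\ y -> y Z.+ z ≢ + 0) (≡.sym (at-suc a k)) (nz (suc k)))) (R.≈-cong FG.H (lem a z (+ P))))))
      (G-H (a Z.+ z) (subst (\ y -> y Z.+ z ≢ + 0) (at-0 a) (nz 0)) (subst (_≢ + 0) (≡.trans (cong (Z._+ z) (≡.trans (≡.sym (at-suc a 0)) (at-0 (a Z.+ + P)))) (lem a z (+ P))) (nz 1))))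
      where
      lem : ∀ a z P -> (a Z.+ P) Z.+ z ≡ (a Z.+ z) Z.+ P
      lem = Z-solve

     product-1 : ∀ (len : ℕ -> ℕ) (e : ℕ -> ℕ -> ℤ) (A : ℤ) -> (∀ K k -> ∃[ j ] (e K k ≡ at A j × K ≤ j)) ->
      lim (\ K -> R.∏< (len K) (\ k -> FG.H (e K k))) ≈ 1#
     product-1 len e A big = Tends-∏ Tends-H len (\ M -> M N.+ Z.∣ A ∣) e (\ M K k le -> lemma M K le (big K k))
      where
      lemma : ∀ M K -> M N.+ Z.∣ A ∣ ≤ K -> ∀ {x} -> ∃[ j ] (x ≡ at A j × K ≤ j) -> + M Z.≤ x
      lemma M K le (j , ≡.refl , K≤j) = at-large M A j (Nₚ.≤-trans le K≤j)

    NZ⁺ : ℤ -> Set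
    NZ⁺ e = ∀ k -> at e k ≢ + 0

    -- For each member of the second progression the product along the first one telescopes to a
    -- single factor H, up to boundary factors whose exponents grow with K.
    cross-limit : ∀ a a′ c c′ -> NZ⁺ (a Z.+ a′) -> lim (\ K -> cross (ap a (K N.+ c)) (ap a′ (K N.+ c′))) ≈ fprod FG.H (a Z.+ a′)
    cross-limit a a′ c c′ nz = begin
     lim (\ K -> cross (ap a (K N.+ c)) (ap a′ (K N.+ c′))) ≈⟨ trans (sym (*-identityʳ _)) (*-congˡ (sym boundary)) ⟩
     lim (\ K -> cross (ap a (K N.+ c)) (ap a′ (K N.+ c′))) * lim (\ K -> R.∏< (K N.+ c′) (\ k -> FG.H (at a (K N.+ c) Z.+ at a′ k))) ≈⟨ lim-* _ _ ⟨
     lim (\ K -> cross (ap a (K N.+ c)) (ap a′ (K N.+ c′)) R.* R.∏< (K N.+ c′) (\ k -> FG.H (at a (K N.+ c) Z.+ at a′ k)))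
      ≈⟨ lim-pointwise (\ K -> exact (K N.+ c) (K N.+ c′)) ⟩
     lim (\ K -> R.∏< (K N.+ c′) (\ k -> FG.H (at (a Z.+ a′) k))) ≈⟨ fprod-shift Tends-H (a Z.+ a′) c′ ⟩
     fprod FG.H (a Z.+ a′) ∎
     where
     exact : ∀ l l′ -> cross (ap a l) (ap a′ l′) R.* R.∏< l′ (\ k -> FG.H (at a l Z.+ at a′ k)) R.≈ R.∏< l′ (\ k -> FG.H (at (a Z.+ a′) k))
     exact l l′ = R.trans (R.*-congʳ (R.trans (R.∏-swap (ap a l) (ap a′ l′)) (∏-ap _ a′ l′))) (R.trans (R.sym (R.∏<-* l′)) (R.∏<-cong l′ (\ k ->
      R.trans (telescope a (at a′ k) l (\ j -> subst (_≢ + 0) (≡.sym (at-+ a a′ j k)) (nz (j N.+ k)))) (R.≈-cong FG.H (≡.trans (cong (Z._+ at a′ k) (≡.sym (at-0 a))) (at-+ a a′ 0 k))))))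
     boundary : lim (\ K -> R.∏< (K N.+ c′) (\ k -> FG.H (at a (K N.+ c) Z.+ at a′ k))) ≈ 1#
     boundary = product-1 (\ K -> K N.+ c′) (\ K k -> at a (K N.+ c) Z.+ at a′ k) (a Z.+ a′)
      (\ K k -> (K N.+ c) N.+ k , at-+ a a′ (K N.+ c) k , Nₚ.≤-trans (Nₚ.m≤m+n K c) (Nₚ.m≤m+n (K N.+ c) k))

    dbl : ℤ -> ℤ
    dbl z = (z Z.+ z) Z.+ + P

    Tends-dbl : Tends (\ z -> FG.H (dbl z))
    Tends-dbl = tends (\ M k le -> near-1 Tends-H M _ (Nₚ.≤-trans le (Nₚ.≤-trans (Nₚ.m≤m+n k k) (Nₚ.m≤m+n (k N.+ k) P))))

    -- The interaction of a member b with all later members telescopes to H(2b + P); the boundary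
    -- factors at the far end tend to 1.
    pairs-limit : ∀ a (len : ℕ -> ℕ) -> (∀ K -> K ≤ len K) -> NZ⁺ (a Z.+ a) -> lim (\ K -> pairs (ap a (len K))) ≈ lim (\ K -> R.∏< (len K) (\ k -> FG.H (dbl (at a k))))
    pairs-limit a len big nz = begin
     lim (\ K -> pairs (ap a (len K))) ≈⟨ trans (sym (*-identityʳ _)) (*-congˡ (sym boundary)) ⟩
     lim (\ K -> pairs (ap a (len K))) * lim (\ K -> R.∏< (len K) (\ k -> FG.H (at a k Z.+ at a (len K)))) ≈⟨ lim-* _ _ ⟨
     lim (\ K -> pairs (ap a (len K)) R.* R.∏< (len K) (\ k -> FG.H (at a k Z.+ at a (len K)))) ≈⟨ lim-pointwise (\ K -> exact a (len K) nz) ⟩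
     lim (\ K -> R.∏< (len K) (\ k -> FG.H (dbl (at a k)))) ∎
     where
     boundary : lim (\ K -> R.∏< (len K) (\ k -> FG.H (at a k Z.+ at a (len K)))) ≈ 1#
     boundary = product-1 len (\ K k -> at a k Z.+ at a (len K)) (a Z.+ a)
      (\ K k -> k N.+ len K , at-+ a a k (len K) , Nₚ.≤-trans (big K) (Nₚ.m≤n+m (len K) k))
     shift₂ : ∀ a k -> at ((a Z.+ + P) Z.+ (a Z.+ + P)) k ≡ at (a Z.+ a) (suc (suc k))
     shift₂ a k = lem a (+ P) (+ k)
      where
      lem : ∀ a P k -> ((a Z.+ P) Z.+ (a Z.+ P)) Z.+ P Z.* k ≡ (a Z.+ a) Z.+ P Z.* (+ 1 Z.+ (+ 1 Z.+ k))
      lem = Z-solve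
     shift₁ : ∀ a k -> at (a Z.+ + P) k Z.+ a ≡ at (a Z.+ a) (suc k)
     shift₁ a k = lem a (+ P) (+ k)
      where
      lem : ∀ a P k -> ((a Z.+ P) Z.+ P Z.* k) Z.+ a ≡ (a Z.+ a) Z.+ P Z.* (+ 1 Z.+ k)
      lem = Z-solve
     exact : ∀ a l -> NZ⁺ (a Z.+ a) -> pairs (ap a l) R.* R.∏< l (\ k -> FG.H (at a k Z.+ at a l)) R.≈ R.∏< l (\ k -> FG.H (dbl (at a k)))
     exact a zero _ = R.*-identityˡ _
     exact a (suc l) nz = R.begin
      (R.∏ X (\ y -> G (a Z.+ y)) R.* pairs X) R.* (FG.H (at a 0 Z.+ at a (suc l)) R.* R.∏< l (\ k -> FG.H (at a (suc k) Z.+ at a (suc l))))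
       R.≈⟨ R.*-interchange _ _ _ _ ⟩
      (R.∏ X (\ y -> G (a Z.+ y)) R.* FG.H (at a 0 Z.+ at a (suc l))) R.* (pairs X R.* R.∏< l (\ k -> FG.H (at a (suc k) Z.+ at a (suc l))))
       R.≈⟨ R.*-cong (R.*-cong (R.∏-cong X (\ y -> R.≈-cong G (Zₚ.+-comm a y))) (R.≈-cong FG.H (≡.trans (cong₂ Z._+_ (at-0 a) (≡.sym (at-suc a l))) (Zₚ.+-comm a _))))
         (R.*-congˡ (R.∏<-cong l (\ k -> R.≈-cong FG.H (cong₂ Z._+_ (≡.sym (at-suc a k)) (≡.sym (at-suc a l)))))) ⟩
      (R.∏ X (\ y -> G (y Z.+ a)) R.* FG.H (at (a Z.+ + P) l Z.+ a)) R.* (pairs X R.* R.∏< l (\ k -> FG.H (at (a Z.+ + P) k Z.+ at (a Z.+ + P) l)))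
       R.≈⟨ R.*-cong (telescope (a Z.+ + P) a l (\ k -> subst (_≢ + 0) (≡.sym (shift₁ a k)) (nz (suc k)))) (exact (a Z.+ + P) l (\ k -> subst (_≢ + 0) (≡.sym (shift₂ a k)) (nz (suc (suc k))))) ⟩
      FG.H ((a Z.+ + P) Z.+ a) R.* R.∏< l (\ k -> FG.H (dbl (at (a Z.+ + P) k)))
       R.≈⟨ R.*-cong (R.≈-cong FG.H (≡.trans (lem a (+ P)) (cong dbl (≡.sym (at-0 a))))) (R.∏<-cong l (\ k -> R.≈-cong (\ z -> FG.H (dbl z)) (at-suc a k))) ⟩
      R.∏< (suc l) (\ k -> FG.H (dbl (at a k))) R.∎
      where
      X = ap (a Z.+ + P) l
      lem : ∀ a P -> (a Z.+ P) Z.+ a ≡ (a Z.+ a) Z.+ P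
      lem = Z-solve

    -- The weight of a single letter together with the telescoped interaction with the rest of its
    -- own progression.
    dressed : (ℤ -> R.Carrier) -> ℤ -> R.Carrier
    dressed φ z = φ z R.* FG.H (dbl z)

    wt-limit : ∀ φ -> Tends (dressed φ) -> ∀ a c -> NZ⁺ (a Z.+ a) -> lim (\ K -> wt φ (ap a (K N.+ c))) ≈ fprod (dressed φ) a
    wt-limit φ tφ a c nz = begin
     lim (\ K -> R.∏ (ap a (K N.+ c)) φ R.* pairs (ap a (K N.+ c))) ≈⟨ trans (lim-* _ _) (*-cong (lim-pointwise (\ K -> ∏-ap φ a (K N.+ c))) (pairs-limit a (N._+ c) (\ K -> Nₚ.m≤m+n K c) nz)) ⟩
     lim (\ K -> R.∏< (K N.+ c) (\ k -> φ (at a k))) * lim (\ K -> R.∏< (K N.+ c) (\ k -> FG.H (dbl (at a k)))) ≈⟨ lim-* _ _ ⟨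
     lim (\ K -> R.∏< (K N.+ c) (\ k -> φ (at a k)) R.* R.∏< (K N.+ c) (\ k -> FG.H (dbl (at a k)))) ≈⟨ lim-pointwise (\ K -> R.sym (R.∏<-* (K N.+ c))) ⟩
     lim (\ K -> R.∏< (K N.+ c) (\ k -> dressed φ (at a k))) ≈⟨ fprod-shift tφ a c ⟩
     fprod (dressed φ) a ∎

-- Theta functions, shift laws, and the expansion into a determinant.

private module _ (R S : CRing) where
 open Kit S
 private module R = Kit R
 module _ (𝔾 : Geom R) (𝕃 : LimitRing R 𝔾 S) where
  open Limits R S 𝔾 𝕃
  private module FG = Geometric R 𝔾
  module Theta (h : ℕ) (h≢0 : h ≢ 0) where

   P : ℕ
   P = h N.+ h

   P≢0 : P ≢ 0
   P≢0 e = h≢0 (Nₚ.m+n≡0⇒m≡0 h e)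

   open Products P P≢0 public
   open SignSums R 𝔾 (Geom.t 𝔾 R.^ P) using (wt; cross; wt-++; wt-↭) public

   -- Not a multiple of P. The condition survives shifts by P and keeps the factors 1 - t^e away
   -- from zero.
   record NZ (e : ℤ) : Set where
    constructor nz-intro
    field
     away : ∀ k -> e Z.+ + P Z.* k ≢ + 0
   open NZ public

   NZ-shift : ∀ {e} r -> NZ e -> NZ (e Z.+ + P Z.* r)
   NZ-shift {e} r nz = nz-intro (\ k q -> away nz (r Z.+ k) (≡.trans (lem e (+ P) r k) q))
    where
    lem : ∀ e P r k -> e Z.+ P Z.* (r Z.+ k) ≡ (e Z.+ P Z.* r) Z.+ P Z.* k
    lem = Z-solve

   NZ-neg : ∀ {e} -> NZ e -> NZ (Z.- e)
   NZ-neg {e} nz = nz-intro (\ k q -> away nz (Z.- k) (≡.trans (lem e (+ P) k) (cong (\ z -> Z.- z) q)))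
    where
    lem : ∀ e P k -> e Z.+ P Z.* (Z.- k) ≡ Z.- (Z.- e Z.+ P Z.* k)
    lem = Z-solve

   NZ⇒≢0 : ∀ {e} -> NZ e -> e ≢ + 0
   NZ⇒≢0 {e} nz q = away nz (+ 0) (≡.trans (lem e (+ P)) q)
    where
    lem : ∀ e P -> e Z.+ P Z.* + 0 ≡ e
    lem = Z-solve

   NZ⁺-P : ∀ {e} -> NZ e -> NZ⁺ (+ P Z.+ e)
   NZ⁺-P {e} nz k q = away nz (+ 1 Z.+ + k) (≡.trans (lem e (+ P) (+ k)) q)
    where
    lem : ∀ e P k -> e Z.+ P Z.* (+ 1 Z.+ k) ≡ (P Z.+ e) Z.+ P Z.* k
    lem = Z-solve

   NZ⁺P : NZ⁺ (+ P)
   NZ⁺P k q = P≢0 (Nₚ.m+n≡0⇒m≡0 P (Zₚ.+-injective (≡.trans (cong (\ z -> + P Z.+ z) (Zₚ.pos-* P k)) q)))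

   -- The reciprocal of θ(t^e;t^P) without its factor 1 - t^e; dropping that factor makes it even in
   -- e.
   U : ℤ -> Carrier
   U e = fprod FG.H (+ P Z.+ e) * fprod FG.H (+ P Z.- e)

   U-even : ∀ e -> U (Z.- e) ≈ U e
   U-even e = trans (*-congˡ (≈-cong (\ z -> fprod FG.H (+ P Z.+ z)) (Zₚ.neg-involutive e))) (*-comm _ _)

   -- This is 1/θ(t^e;t^P).
   û : ℤ -> Carrier
   û e = U e * H e

   û-step : ∀ e -> NZ e -> û (e Z.+ + P) ≈ - (τ e * û e)
   û-step e nz = begin
    (fprod FG.H (+ P Z.+ (e Z.+ + P)) * fprod FG.H (+ P Z.- (e Z.+ + P))) * H (e Z.+ + P)
     ≈⟨ *-cong (*-cong (≈-cong (fprod FG.H) (lem₁ e (+ P))) (trans (≈-cong (fprod FG.H) (lem₂ e (+ P))) (trans (fprod-rec Tends-H (Z.- e)) (*-congˡ (≈-cong (fprod FG.H) (lem₃ e (+ P)))))))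
       (≈-cong H (Zₚ.+-comm e (+ P))) ⟩
    (fprod FG.H ((+ P Z.+ e) Z.+ + P) * (H (Z.- e) * fprod FG.H (+ P Z.- e))) * H (+ P Z.+ e)
     ≈⟨ solve 4 (\ a b c d -> (a :* (b :* c)) :* d := ((d :* a) :* c) :* b) refl _ _ _ _ ⟩
    ((H (+ P Z.+ e) * fprod FG.H ((+ P Z.+ e) Z.+ + P)) * fprod FG.H (+ P Z.- e)) * H (Z.- e)
     ≈⟨ *-cong (*-congʳ (sym (fprod-rec Tends-H (+ P Z.+ e)))) (H-neg e (NZ⇒≢0 nz)) ⟩
    U e * - (τ e * H e) ≈⟨ solve 3 (\ a b c -> a :* (:- (b :* c)) := :- (b :* (a :* c))) refl _ _ _ ⟩
    - (τ e * û e) ∎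
    where
    lem₁ : ∀ e P -> P Z.+ (e Z.+ P) ≡ (P Z.+ e) Z.+ P
    lem₁ = Z-solve
    lem₂ : ∀ e P -> P Z.- (e Z.+ P) ≡ Z.- e
    lem₂ = Z-solve
    lem₃ : ∀ e P -> Z.- e Z.+ P ≡ P Z.- e
    lem₃ = Z-solve

   -- In the product over b + b′ and b - b′ the shift factors of 1/θ combine so that b′ drops out.
   -- The shift law in each argument therefore involves that argument alone, and the Gaussian
   -- factors separate.
   Û₂ : ℤ -> ℤ -> Carrier
   Û₂ b b′ = τ b * (û (b Z.+ b′) * û (b Z.- b′))

   Û₂-step : ∀ b b′ -> NZ (b Z.+ b′) -> NZ (b Z.- b′) -> Û₂ (b Z.+ + P) b′ ≈ τ (+ 2 Z.* (b Z.+ + h)) * Û₂ b b′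
   Û₂-step b b′ nz nz′ = begin
    τ (b Z.+ + P) * (û ((b Z.+ + P) Z.+ b′) * û ((b Z.+ + P) Z.- b′))
     ≈⟨ *-congˡ (*-cong (trans (≈-cong û (lem₁ b b′ (+ P))) (û-step (b Z.+ b′) nz)) (trans (≈-cong û (lem₂ b b′ (+ P))) (û-step (b Z.- b′) nz′))) ⟩
    τ (b Z.+ + P) * (- (τ (b Z.+ b′) * û (b Z.+ b′)) * - (τ (b Z.- b′) * û (b Z.- b′)))
     ≈⟨ solve 5 (\ a b c d e -> a :* ((:- (b :* c)) :* (:- (d :* e))) := (a :* (b :* d)) :* (c :* e)) refl _ _ _ _ _ ⟩
    (τ (b Z.+ + P) * (τ (b Z.+ b′) * τ (b Z.- b′))) * (û (b Z.+ b′) * û (b Z.- b′))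
     ≈⟨ *-congʳ (trans (*-congˡ (sym (τ-+ _ _))) (trans (sym (τ-+ _ _)) (trans (≈-cong τ (lem₃ b b′ (+ h))) (τ-+ _ _)))) ⟩
    (τ (+ 2 Z.* (b Z.+ + h)) * τ b) * (û (b Z.+ b′) * û (b Z.- b′)) ≈⟨ *-assoc _ _ _ ⟩
    τ (+ 2 Z.* (b Z.+ + h)) * Û₂ b b′ ∎
    where
    lem₁ : ∀ b b′ P -> (b Z.+ P) Z.+ b′ ≡ (b Z.+ b′) Z.+ P
    lem₁ = Z-solve
    lem₂ : ∀ b b′ P -> (b Z.+ P) Z.- b′ ≡ (b Z.- b′) Z.+ P
    lem₂ = Z-solve
    lem₃ : ∀ b b′ h -> (b Z.+ (h Z.+ h)) Z.+ ((b Z.+ b′) Z.+ (b Z.- b′)) ≡ + 2 Z.* (b Z.+ h) Z.+ b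
    lem₃ = Z-solve

   Û₂-swap : ∀ b b′ -> NZ (b Z.- b′) -> Û₂ b b′ ≈ - Û₂ b′ b
   Û₂-swap b b′ nz = begin
    τ b * (û (b Z.+ b′) * (U (b Z.- b′) * H (b Z.- b′)))
     ≈⟨ *-congˡ (*-cong (≈-cong û (Zₚ.+-comm b b′)) (*-cong (trans (≈-cong U (lem b b′)) (U-even (b′ Z.- b))) (trans (≈-cong H (lem b b′)) (H-neg (b′ Z.- b) (\ q -> NZ⇒≢0 nz (≡.trans (lem b b′) (cong (\ z -> Z.- z) q))))))) ⟩
    τ b * (û (b′ Z.+ b) * (U (b′ Z.- b) * - (τ (b′ Z.- b) * H (b′ Z.- b))))
     ≈⟨ solve 5 (\ a u v s k -> a :* (u :* (v :* (:- (s :* k)))) := :- ((a :* s) :* (u :* (v :* k)))) refl _ _ _ _ _ ⟩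
    - ((τ b * τ (b′ Z.- b)) * (û (b′ Z.+ b) * û (b′ Z.- b))) ≈⟨ -‿cong (*-congʳ (trans (sym (τ-+ _ _)) (≈-cong τ (lem′ b b′)))) ⟩
    - Û₂ b′ b ∎
    where
    lem : ∀ b b′ -> b Z.- b′ ≡ Z.- (b′ Z.- b)
    lem = Z-solve
    lem′ : ∀ b b′ -> b Z.+ (b′ Z.- b) ≡ b′
    lem′ = Z-solve

   sh : ℤ -> ℤ -> ℤ
   sh b r = b Z.+ + P Z.* r

   quad : ℤ -> ℤ -> ℤ
   quad b r = b Z.* r Z.+ + h Z.* (r Z.* r)

   -- A function with a first-order shift law in steps of P picks up a Gaussian factor.
   quasi-periodic : ∀ (f : ℤ -> Carrier) c b -> (∀ r -> f (Z.suc r) ≈ τ (c Z.* (sh b r Z.+ + h)) * f r) -> ∀ r -> f r ≈ τ (c Z.* quad b r) * f (+ 0)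
   quasi-periodic f c b step = go
    where
    zero-exp : ∀ b h c -> c Z.* (b Z.* + 0 Z.+ h Z.* (+ 0 Z.* + 0)) ≡ + 0
    zero-exp = Z-solve
    add : ∀ b h c r -> c Z.* ((b Z.+ (h Z.+ h) Z.* r) Z.+ h) Z.+ c Z.* (b Z.* r Z.+ h Z.* (r Z.* r)) ≡ c Z.* (b Z.* (+ 1 Z.+ r) Z.+ h Z.* ((+ 1 Z.+ r) Z.* (+ 1 Z.+ r)))
    add = Z-solve
    sub : ∀ b h c r -> Z.- (c Z.* ((b Z.+ (h Z.+ h) Z.* r) Z.+ h)) Z.+ c Z.* (b Z.* (+ 1 Z.+ r) Z.+ h Z.* ((+ 1 Z.+ r) Z.* (+ 1 Z.+ r))) ≡ c Z.* (b Z.* r Z.+ h Z.* (r Z.* r))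
    sub = Z-solve
    Q : ℤ -> Set
    Q r = f r ≈ τ (c Z.* quad b r) * f (+ 0)
    base₀ : Q (+ 0)
    base₀ = sym (*-oneˡ-≈ (trans (≈-cong τ (zero-exp b (+ h) c)) τ-0))
    up : ∀ r -> Q r -> Q (Z.suc r)
    up r q = trans (step r) (trans (*-congˡ q) (trans (sym (*-assoc _ _ _)) (*-congʳ (trans (sym (τ-+ _ _)) (≈-cong τ (add b (+ h) c r))))))
    down : ∀ r -> Q (Z.suc r) -> Q r
    down r q = begin
     f r ≈⟨ trans (sym (*-identityˡ _)) (*-congʳ (sym (trans (*-comm _ _) (τ-inverse s)))) ⟩
     (τ (Z.- s) * τ s) * f r ≈⟨ trans (*-assoc _ _ _) (*-congˡ (trans (sym (step r)) q)) ⟩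
     τ (Z.- s) * (τ (c Z.* quad b (Z.suc r)) * f (+ 0)) ≈⟨ trans (sym (*-assoc _ _ _)) (*-congʳ (trans (sym (τ-+ _ _)) (≈-cong τ (sub b (+ h) c r)))) ⟩
     τ (c Z.* quad b r) * f (+ 0) ∎
     where s = c Z.* (sh b r Z.+ + h)
    go : ∀ r -> Q r
    go (+ zero) = base₀
    go (+ suc n) = up (+ n) (go (+ n))
    go -[1+ zero ] = down -[1+ 0 ] base₀
    go -[1+ suc n ] = down -[1+ suc n ] (go -[1+ n ])

   sh-suc : ∀ b r -> sh b (Z.suc r) ≡ sh b r Z.+ + P
   sh-suc b r = lem b (+ P) r
    where
    lem : ∀ b P r -> b Z.+ P Z.* (+ 1 Z.+ r) ≡ (b Z.+ P Z.* r) Z.+ P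
    lem = Z-solve

   sh-0 : ∀ b -> sh b (+ 0) ≡ b
   sh-0 b = lem b (+ P)
    where
    lem : ∀ b P -> b Z.+ P Z.* + 0 ≡ b
    lem = Z-solve

   sh-apart : ∀ b b′ r r′ -> NZ (b Z.+ b′) -> NZ (b Z.- b′) -> NZ (sh b r Z.+ sh b′ r′) × NZ (sh b r Z.- sh b′ r′)
   sh-apart b b′ r r′ nz nz′ = subst NZ (lem b b′ (+ P) r r′) (NZ-shift (r Z.+ r′) nz) , subst NZ (lem′ b b′ (+ P) r r′) (NZ-shift (r Z.- r′) nz′)
    where
    lem : ∀ b b′ P r r′ -> (b Z.+ b′) Z.+ P Z.* (r Z.+ r′) ≡ (b Z.+ P Z.* r) Z.+ (b′ Z.+ P Z.* r′)
    lem = Z-solve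
    lem′ : ∀ b b′ P r r′ -> (b Z.- b′) Z.+ P Z.* (r Z.- r′) ≡ (b Z.+ P Z.* r) Z.- (b′ Z.+ P Z.* r′)
    lem′ = Z-solve

   sh-double : ∀ b r -> NZ (b Z.+ b) -> NZ (sh b r Z.+ sh b r)
   sh-double b r nz = subst NZ (lem b (+ P) r) (NZ-shift (r Z.+ r) nz)
    where
    lem : ∀ b P r -> (b Z.+ b) Z.+ P Z.* (r Z.+ r) ≡ (b Z.+ P Z.* r) Z.+ (b Z.+ P Z.* r)
    lem = Z-solve

   NZ-swap : ∀ b b′ -> NZ (b Z.+ b′) × NZ (b Z.- b′) -> NZ (b′ Z.+ b) × NZ (b′ Z.- b)
   NZ-swap b b′ (nz , nz′) = subst NZ (Zₚ.+-comm b b′) nz , subst NZ (lem b b′) (NZ-neg nz′)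
    where
    lem : ∀ b b′ -> Z.- (b Z.- b′) ≡ b′ Z.- b
    lem = Z-solve

   Û₂-quad : ∀ b b′ -> NZ (b Z.+ b′) -> NZ (b Z.- b′) -> ∀ r r′ -> Û₂ (sh b r) (sh b′ r′) ≈ τ (+ 2 Z.* quad b r) * τ (+ 2 Z.* quad b′ r′) * Û₂ b b′
   Û₂-quad b b′ nz nz′ r r′ = begin
    Û₂ (sh b r) (sh b′ r′) ≈⟨ left b (sh b′ r′) r (subst (\ z -> NZ (z Z.+ sh b′ r′)) (sh-0 b) (fst (sh-apart b b′ (+ 0) r′ nz nz′))) (subst (\ z -> NZ (z Z.- sh b′ r′)) (sh-0 b) (snd (sh-apart b b′ (+ 0) r′ nz nz′))) ⟩
    τ (+ 2 Z.* quad b r) * Û₂ b (sh b′ r′) ≈⟨ *-congˡ right ⟩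
    τ (+ 2 Z.* quad b r) * (τ (+ 2 Z.* quad b′ r′) * Û₂ b b′) ≈⟨ *-assoc _ _ _ ⟨
    τ (+ 2 Z.* quad b r) * τ (+ 2 Z.* quad b′ r′) * Û₂ b b′ ∎
    where
    left : ∀ b b′ r -> NZ (b Z.+ b′) -> NZ (b Z.- b′) -> Û₂ (sh b r) b′ ≈ τ (+ 2 Z.* quad b r) * Û₂ b b′
    left b b′ r nz nz′ = trans (quasi-periodic (\ r -> Û₂ (sh b r) b′) (+ 2) b step r) (*-congˡ (≈-cong (\ z -> Û₂ z b′) (sh-0 b)))
     where
     step : ∀ r -> Û₂ (sh b (Z.suc r)) b′ ≈ τ (+ 2 Z.* (sh b r Z.+ + h)) * Û₂ (sh b r) b′
     step r = trans (≈-cong (\ z -> Û₂ z b′) (sh-suc b r))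
      (Û₂-step (sh b r) b′ (subst (\ z -> NZ (sh b r Z.+ z)) (sh-0 b′) (fst (sh-apart b b′ r (+ 0) nz nz′))) (subst (\ z -> NZ (sh b r Z.- z)) (sh-0 b′) (snd (sh-apart b b′ r (+ 0) nz nz′))))
    right : Û₂ b (sh b′ r′) ≈ τ (+ 2 Z.* quad b′ r′) * Û₂ b b′
    right = trans (Û₂-swap b (sh b′ r′) (subst (\ z -> NZ (z Z.- sh b′ r′)) (sh-0 b) (snd (sh-apart b b′ (+ 0) r′ nz nz′))))
     (trans (-‿cong (left b′ b r′ (fst (NZ-swap b b′ (nz , nz′))) (snd (NZ-swap b b′ (nz , nz′)))))
      (trans (solve 2 (\ a b -> :- (a :* b) := a :* (:- b)) refl _ _) (*-congˡ (sym (Û₂-swap b b′ nz′)))))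

   ξ : ℤ -> Carrier
   ξ b = τ b + τ (Z.- b)

   ξ⁻¹ : ℤ -> ℤ -> Carrier
   ξ⁻¹ a b = τ a * (H (a Z.+ b) * H (a Z.- b))

   ξ-inv : ∀ a b -> NZ (a Z.+ b) -> NZ (a Z.- b) -> (ξ a - ξ b) * ξ⁻¹ a b ≈ 1#
   ξ-inv a b nz nz′ = begin
    ((τ a + τ (Z.- a)) - (τ b + τ (Z.- b))) * (τ a * (x * y)) ≈⟨ solve 6 (\ a a′ b b′ x y -> ((a :+ a′) :- (b :+ b′)) :* (a :* (x :* y)) := ((a :* a′) :- a :* b :- a :* b′ :+ a :* a) :* (x :* y)) refl _ _ _ _ _ _ ⟩
    (τ a * τ (Z.- a) - τ a * τ b - τ a * τ (Z.- b) + τ a * τ a) * (x * y)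
     ≈⟨ *-congʳ (+-cong (+-cong (+-cong (τ-inverse a) (-‿cong (sym (τ-+ a b)))) (-‿cong (sym (τ-+ a (Z.- b))))) (trans (sym (τ-+ a a)) (trans (≈-cong τ (lem a b)) (τ-+ _ _)))) ⟩
    (1# - τ (a Z.+ b) - τ (a Z.- b) + τ (a Z.+ b) * τ (a Z.- b)) * (x * y) ≈⟨ solve 4 (\ s d x y -> (1ₚ :- s :- d :+ s :* d) :* (x :* y) := ((1ₚ :- s) :* x) :* ((1ₚ :- d) :* y)) refl _ _ _ _ ⟩
    ((1# - τ (a Z.+ b)) * x) * ((1# - τ (a Z.- b)) * y) ≈⟨ trans (*-cong (H-inv _ (NZ⇒≢0 nz)) (H-inv _ (NZ⇒≢0 nz′))) (*-identityˡ _) ⟩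
    1# ∎
    where
    x = H (a Z.+ b)
    y = H (a Z.- b)
    lem : ∀ a b -> a Z.+ a ≡ (a Z.+ b) Z.+ (a Z.- b)
    lem = Z-solve

   U₂ : ℤ -> ℤ -> Carrier
   U₂ b b′ = U (b Z.+ b′) * U (b Z.- b′)

   -- Since t^a (ξ a - ξ b) = (1 - t^(a+b))(1 - t^(a-b)), the interaction of two classes is a
   -- quasi-periodic factor times a difference of nodes; the latter builds the Vandermonde product.
   U₂-ξ : ∀ a b -> NZ (a Z.+ b) -> NZ (a Z.- b) -> U₂ a b ≈ Û₂ a b * (ξ a - ξ b)
   U₂-ξ a b nz nz′ = begin
    U (a Z.+ b) * U (a Z.- b) ≈⟨ trans (sym (*-identityʳ _)) (*-congˡ (sym (ξ-inv a b nz nz′))) ⟩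
    (U (a Z.+ b) * U (a Z.- b)) * ((ξ a - ξ b) * (τ a * (H (a Z.+ b) * H (a Z.- b))))
     ≈⟨ solve 6 (\ u v x s p q -> (u :* v) :* (x :* (s :* (p :* q))) := (s :* ((u :* p) :* (v :* q))) :* x) refl _ _ _ _ _ _ ⟩
    Û₂ a b * (ξ a - ξ b) ∎

   module Self (φ : ℤ -> R.Carrier) (tφ : Tends (dressed φ)) where

    -- The limiting weight of one class: its two progressions, starting at h - b and h + b, and the
    -- interaction between them.
    self : ℤ -> Carrier
    self b = fprod (dressed φ) (+ h Z.- b) * (fprod FG.H (+ P) * fprod (dressed φ) (+ h Z.+ b))

    -- Replacing b by b + P removes the first member h + b of one progression and puts its negative
    -- at the start of the other. Everything else stays the same.
    self-step : ∀ b -> self (b Z.+ + P) * ι (dressed φ (+ h Z.+ b)) ≈ ι (dressed φ (Z.- (+ h Z.+ b))) * self b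
    self-step b = begin
     (fprod w (+ h Z.- (b Z.+ + P)) * (c * fprod w (+ h Z.+ (b Z.+ + P)))) * ι (w (+ h Z.+ b))
      ≈⟨ *-congʳ (*-cong (trans (≈-cong (fprod w) (lem₁ b (+ h))) (trans (fprod-rec tφ _) (*-congˡ (≈-cong (fprod w) (lem₂ b (+ h)))))) (*-congˡ (≈-cong (fprod w) (lem₃ b (+ h))))) ⟩
     ((ι (w (Z.- (+ h Z.+ b))) * fprod w (+ h Z.- b)) * (c * fprod w ((+ h Z.+ b) Z.+ + P))) * ι (w (+ h Z.+ b))
      ≈⟨ solve 5 (\ a f c g z -> ((a :* f) :* (c :* g)) :* z := a :* (f :* (c :* (z :* g)))) refl _ _ _ _ _ ⟩
     ι (w (Z.- (+ h Z.+ b))) * (fprod w (+ h Z.- b) * (c * (ι (w (+ h Z.+ b)) * fprod w ((+ h Z.+ b) Z.+ + P))))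
      ≈⟨ *-congˡ (*-congˡ (*-congˡ (sym (fprod-rec tφ _)))) ⟩
     ι (w (Z.- (+ h Z.+ b))) * self b ∎
     where
     w = dressed φ
     c = fprod FG.H (+ P)
     lem₁ : ∀ b h -> h Z.- (b Z.+ (h Z.+ h)) ≡ Z.- (h Z.+ b)
     lem₁ = Z-solve
     lem₂ : ∀ b h -> Z.- (h Z.+ b) Z.+ (h Z.+ h) ≡ h Z.- b
     lem₂ = Z-solve
     lem₃ : ∀ b h -> h Z.+ (b Z.+ (h Z.+ h)) ≡ (h Z.+ b) Z.+ (h Z.+ h)
     lem₃ = Z-solve

    -- A class after a flip. The offsets c and c′ record how unevenly the flip cuts the class; they
    -- leave the limit unchanged.
    Zs : ℤ -> ℕ -> ℕ -> ℕ -> List ℤ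
    Zs b c c′ K = ap (+ h Z.- b) (K N.+ c) ++ ap (+ h Z.+ b) (K N.+ c′)

    self-limit : ∀ b c c′ -> NZ (b Z.+ b) -> lim (\ K -> wt φ (Zs b c c′ K)) ≈ self b
    self-limit b c c′ nz = begin
     lim (\ K -> wt φ (Zs b c c′ K)) ≈⟨ trans (lim-pointwise (\ K -> wt-++ φ (ap (+ h Z.- b) (K N.+ c)) (ap (+ h Z.+ b) (K N.+ c′)))) (trans (lim-* _ _) (*-congˡ (lim-* _ _))) ⟩
     lim (\ K -> wt φ (ap (+ h Z.- b) (K N.+ c))) * (lim (\ K -> cross (ap (+ h Z.- b) (K N.+ c)) (ap (+ h Z.+ b) (K N.+ c′))) * lim (\ K -> wt φ (ap (+ h Z.+ b) (K N.+ c′))))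
      ≈⟨ *-cong (wt-limit φ tφ _ c (subst NZ⁺ (lem₁ b (+ h)) (NZ⁺-P (NZ-neg nz))))
        (*-cong (trans (cross-limit _ _ c c′ (subst NZ⁺ (lem₃ b (+ h)) NZ⁺P)) (≈-cong (fprod FG.H) (≡.sym (lem₃ b (+ h)))))
         (wt-limit φ tφ _ c′ (subst NZ⁺ (lem₂ b (+ h)) (NZ⁺-P nz)))) ⟩
     self b ∎
     where
     lem₁ : ∀ b h -> (h Z.+ h) Z.+ Z.- (b Z.+ b) ≡ (h Z.- b) Z.+ (h Z.- b)
     lem₁ = Z-solve
     lem₂ : ∀ b h -> (h Z.+ h) Z.+ (b Z.+ b) ≡ (h Z.+ b) Z.+ (h Z.+ b)
     lem₂ = Z-solve
     lem₃ : ∀ b h -> h Z.+ h ≡ (h Z.- b) Z.+ (h Z.+ b)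
     lem₃ = Z-solve

    cross-Zs : ∀ b c c′ b₂ d d′ -> NZ (b Z.+ b₂) -> NZ (b Z.- b₂) -> lim (\ K -> cross (Zs b c c′ K) (Zs b₂ d d′ K)) ≈ U₂ b b₂
    cross-Zs b c c′ b₂ d d′ nz nz′ = begin
     lim (\ K -> cross (Zs b c c′ K) (Zs b₂ d d′ K))
      ≈⟨ lim-pointwise (\ K -> R.trans (R.∏-++ (ap (+ h Z.- b) (K N.+ c)) (ap (+ h Z.+ b) (K N.+ c′))) (R.*-cong (split (ap (+ h Z.- b) (K N.+ c)) K) (split (ap (+ h Z.+ b) (K N.+ c′)) K))) ⟩
     lim (\ K -> (A K R.* B K) R.* (C K R.* E K)) ≈⟨ trans (lim-* _ _) (*-cong (lim-* _ _) (lim-* _ _)) ⟩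
     (lim A * lim B) * (lim C * lim E)
      ≈⟨ *-cong (*-cong (trans (cross-limit _ _ c d (subst NZ⁺ (l₁ b b₂ (+ h)) (NZ⁺-P (NZ-neg nz)))) (≈-cong (fprod FG.H) (≡.sym (l₁ b b₂ (+ h)))))
               (trans (cross-limit _ _ c d′ (subst NZ⁺ (l₂ b b₂ (+ h)) (NZ⁺-P (NZ-neg nz′)))) (≈-cong (fprod FG.H) (≡.sym (l₂ b b₂ (+ h))))))
           (*-cong (trans (cross-limit _ _ c′ d (subst NZ⁺ (l₃ b b₂ (+ h)) (NZ⁺-P nz′))) (≈-cong (fprod FG.H) (≡.sym (l₃ b b₂ (+ h)))))
               (trans (cross-limit _ _ c′ d′ (subst NZ⁺ (l₄ b b₂ (+ h)) (NZ⁺-P nz))) (≈-cong (fprod FG.H) (≡.sym (l₄ b b₂ (+ h)))))) ⟩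
     (fprod FG.H (+ P Z.- (b Z.+ b₂)) * fprod FG.H (+ P Z.- (b Z.- b₂))) * (fprod FG.H (+ P Z.+ (b Z.- b₂)) * fprod FG.H (+ P Z.+ (b Z.+ b₂)))
      ≈⟨ solve 4 (\ a b c d -> (a :* b) :* (c :* d) := (d :* a) :* (c :* b)) refl _ _ _ _ ⟩
     U₂ b b₂ ∎
     where
     A B C E : ℕ -> R.Carrier
     A K = cross (ap (+ h Z.- b) (K N.+ c)) (ap (+ h Z.- b₂) (K N.+ d))
     B K = cross (ap (+ h Z.- b) (K N.+ c)) (ap (+ h Z.+ b₂) (K N.+ d′))
     C K = cross (ap (+ h Z.+ b) (K N.+ c′)) (ap (+ h Z.- b₂) (K N.+ d))
     E K = cross (ap (+ h Z.+ b) (K N.+ c′)) (ap (+ h Z.+ b₂) (K N.+ d′))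
     split : ∀ X K -> cross X (Zs b₂ d d′ K) R.≈ cross X (ap (+ h Z.- b₂) (K N.+ d)) R.* cross X (ap (+ h Z.+ b₂) (K N.+ d′))
     split X K = R.trans (R.∏-cong X (\ x -> R.∏-++ (ap (+ h Z.- b₂) (K N.+ d)) (ap (+ h Z.+ b₂) (K N.+ d′)))) (R.∏-* X)
     l₁ : ∀ b b₂ h -> (h Z.+ h) Z.+ Z.- (b Z.+ b₂) ≡ (h Z.- b) Z.+ (h Z.- b₂)
     l₁ = Z-solve
     l₂ : ∀ b b₂ h -> (h Z.+ h) Z.+ Z.- (b Z.- b₂) ≡ (h Z.- b) Z.+ (h Z.+ b₂)
     l₂ = Z-solve
     l₃ : ∀ b b₂ h -> (h Z.+ h) Z.+ (b Z.- b₂) ≡ (h Z.+ b) Z.+ (h Z.- b₂)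
     l₃ = Z-solve
     l₄ : ∀ b b₂ h -> (h Z.+ h) Z.+ (b Z.+ b₂) ≡ (h Z.+ b) Z.+ (h Z.+ b₂)
     l₄ = Z-solve

private module _ (R S : CRing) where
 open Kit S
 private module R = Kit R
 module _ (𝔾 : Geom R) (𝕃 : LimitRing R 𝔾 S) where
  open Limits R S 𝔾 𝕃 hiding (module Products)
  module ThetaDeterminant (h : ℕ) (h≢0 : h ≢ 0) where
   open Theta R S 𝔾 𝕃 h h≢0

   -- Representatives of n residue classes modulo P. The conditions make all letters of these
   -- classes nonzero and distinct up to sign.
   record Classes (n : ℕ) : Set where
    field
     β     : ℕ -> ℤ
     β≢0   : ∀ {i} -> i < n -> NZ (+ h Z.+ β i)
     self# : ∀ {i} -> i < n -> NZ (β i Z.+ β i)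
     apart : ∀ {i j} -> j < i -> i < n -> NZ (β i Z.+ β j) × NZ (β i Z.- β j)

   half-diff : ℤ -> Carrier
   half-diff e = τ e - τ (Z.- e)

   half-diff⁻¹ : ℤ -> Carrier
   half-diff⁻¹ e = τ (Z.- e) * H (Z.- (e Z.+ e))

   half-diff-inv : ∀ e -> e Z.+ e ≢ + 0 -> half-diff⁻¹ e * half-diff e ≈ 1#
   half-diff-inv e e0 = begin
    (τ (Z.- e) * H (Z.- (e Z.+ e))) * (τ e - τ (Z.- e)) ≈⟨ solve 3 (\ a b c -> (a :* c) :* (b :- a) := (b :* a :- a :* a) :* c) refl _ _ _ ⟩
    (τ e * τ (Z.- e) - τ (Z.- e) * τ (Z.- e)) * H (Z.- (e Z.+ e)) ≈⟨ *-congʳ (+-cong (τ-inverse e) (-‿cong (trans (sym (τ-+ _ _)) (≈-cong τ (≡.sym (Zₚ.neg-distrib-+ e e)))))) ⟩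
    (1# - τ (Z.- (e Z.+ e))) * H (Z.- (e Z.+ e)) ≈⟨ H-inv _ (neg≢0 e0) ⟩
    1# ∎

   module _ (φ : ℤ -> R.Carrier) (tφ : Tends (dressed φ)) where
    open Self φ tφ
    module _ {n : ℕ} (𝒞 : Classes n) where
     open Classes 𝒞
     -- Dividing `self` by `half-diff` of `half` makes it quasi-periodic. The exponent `half` is the
     -- shifted representative b in one application and b/2 in the other; accordingly `c₀` is 0 or
     -- 1. The number `c` is the resulting weight of the Gaussian.
     module Expansion (half : ℕ -> ℤ -> ℤ) (c₀ : Carrier) (c : ℤ)
       (half≢0 : ∀ {i} -> i < n -> ∀ r -> half i r Z.+ half i r ≢ + 0)
       (half-step : ∀ i r -> half-diff (half i r Z.+ sh (β i) r) ≈ half-diff (half i r) * (ξ (sh (β i) r) + c₀))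
       (step : ∀ {i} -> i < n -> ∀ r -> self (sh (β i) (Z.suc r)) * half-diff⁻¹ (half i (Z.suc r)) ≈ τ (c Z.* (sh (β i) r Z.+ + h)) * (self (sh (β i) r) * half-diff⁻¹ (half i r))) where

      Tm : List ℤ -> Carrier
      Tm [] = 1#
      Tm (b ∷ bs) = self b * (∏ bs (U₂ b) * Tm bs)

      ŝ : ℕ -> Carrier
      ŝ i = self (sh (β i) (+ 0)) * half-diff⁻¹ (half i (+ 0))

      self-law : ∀ {i} -> i < n -> ∀ r -> self (sh (β i) r) ≈ (τ (c Z.* quad (β i) r) * ŝ i) * half-diff (half i r)
      self-law {i} i<n r = begin
       self (sh (β i) r) ≈⟨ trans (sym (*-identityʳ _)) (trans (*-congˡ (sym (half-diff-inv (half i r) (half≢0 i<n r)))) (sym (*-assoc _ _ _))) ⟩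
       (self (sh (β i) r) * half-diff⁻¹ (half i r)) * half-diff (half i r) ≈⟨ *-congʳ (quasi-periodic (\ r -> self (sh (β i) r) * half-diff⁻¹ (half i r)) c (β i) (step i<n) r) ⟩
       (τ (c Z.* quad (β i) r) * ŝ i) * half-diff (half i r) ∎

      -- Collects everything that does not depend on the shifts. It is never evaluated.
      T̂ : List ℕ -> Carrier
      T̂ [] = 1#
      T̂ (i ∷ is) = ŝ i * (∏ is (\ j -> Û₂ (β i) (β j)) * T̂ is)

      infix 4 _⋕_ _#_
      _⋕_ : ℤ -> ℤ -> Set
      b ⋕ b′ = NZ (b Z.+ b′) × NZ (b Z.- b′)

      _#_ : ℕ -> ℕ -> Set
      i # j = β i ⋕ β j

      downFrom-# : AllPairs _#_ (downFrom n)
      downFrom-# = go n Nₚ.≤-refl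
       where
       go : ∀ k -> k ≤ n -> AllPairs _#_ (downFrom k)
       go zero _ = []
       go (suc k) k<n = All.map (\ j<k -> apart j<k k<n) (downFrom-< k) ∷ go k (Nₚ.<⇒≤ k<n)

      private
       lim-∑ : ∀ {A : Set} (xs : List A) {f : A -> ℕ -> R.Carrier} -> lim (\ K -> R.∑ xs (\ x -> f x K)) ≈ ∑ xs (\ x -> lim (f x))
       lim-∑ [] = lim-0
       lim-∑ (x ∷ xs) = trans (lim-+ _ _) (+-congˡ (lim-∑ xs))

       lim-∏ : ∀ {A : Set} (xs : List A) {f : A -> ℕ -> R.Carrier} -> lim (\ K -> R.∏ xs (\ x -> f x K)) ≈ ∏ xs (\ x -> lim (f x))
       lim-∏ [] = lim-1
       lim-∏ (x ∷ xs) = trans (lim-* _ _) (*-congˡ (lim-∏ xs))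

       cross-concat : ∀ {A : Set} X (Z : A -> List ℤ) v -> cross X (concat (map Z v)) R.≈ R.∏ v (\ a -> cross X (Z a))
       cross-concat X Z [] = R.∏-1 X (\ _ -> R.refl)
       cross-concat X Z (a ∷ v) = R.trans (R.∏-cong X (\ x -> R.∏-++ (Z a) (concat (map Z v)))) (R.trans (R.∏-* X) (R.*-congˡ (cross-concat X Z v)))

      wt-Zs : ∀ {A : Set} (b : A -> ℤ) (c c′ : A -> ℕ) v -> All (\ a -> NZ (b a Z.+ b a)) v -> AllPairs (\ a a′ -> b a ⋕ b a′) v ->
       lim (\ K -> wt φ (concat (map (\ a -> Zs (b a) (c a) (c′ a) K) v))) ≈ Tm (map b v)
      wt-Zs b c c′ [] [] [] = trans (lim-pointwise (\ K -> R.*-identityˡ _)) lim-1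
      wt-Zs b c c′ (a ∷ v) (sa ∷ sv) (aa ∷ av) = begin
       lim (\ K -> wt φ (Z K a ++ concat (map (Z K) v))) ≈⟨ lim-pointwise (\ K -> R.trans (wt-++ φ (Z K a) (concat (map (Z K) v))) (R.*-congˡ (R.*-congʳ (cross-concat (Z K a) (Z K) v)))) ⟩
       lim (\ K -> wt φ (Z K a) R.* (R.∏ v (\ a′ -> cross (Z K a) (Z K a′)) R.* wt φ (concat (map (Z K) v)))) ≈⟨ trans (lim-* _ _) (*-congˡ (trans (lim-* _ _) (*-congʳ (lim-∏ v)))) ⟩
       lim (\ K -> wt φ (Z K a)) * (∏ v (\ a′ -> lim (\ K -> cross (Z K a) (Z K a′))) * lim (\ K -> wt φ (concat (map (Z K) v))))
        ≈⟨ *-cong (self-limit (b a) (c a) (c′ a) sa) (*-cong (trans (∏-cong-All aa (\ a′ (p , q) -> cross-Zs (b a) (c a) (c′ a) (b a′) (c a′) (c′ a′) p q)) (sym (∏-map b v))) (wt-Zs b c c′ v sv av)) ⟩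
       Tm (map b (a ∷ v)) ∎
       where
       Z : ℕ -> _ -> List ℤ
       Z K a = Zs (b a) (c a) (c′ a) K

      private module Window (Rw : ℕ) where

       offset : ℕ -> ℤ
       offset o = + o Z.- + Rw

       val : ℕ × ℕ -> ℤ
       val (i , o) = sh (β i) (offset o)

       private
        Q e : ℕ × ℕ -> ℤ
        Q (i , o) = quad (β i) (offset o)
        e (i , o) = half i (offset o)

        nodes : Nodes S (ℕ × ℕ)
        nodes = record
         { _#_ = \ a b -> a .fst # b .fst
         ; #-sym = \ {a} {b} -> NZ-swap (β (a .fst)) (β (b .fst))
         ; ξ = \ a -> ξ (val a)
         ; recip = \ a b -> ξ⁻¹ (val a) (val b)
         ; inv-ξ = \ { {i , o} {j , o′} (p , q) -> ξ-inv _ _ (fst (sh-apart (β i) (β j) (offset o) (offset o′) p q)) (snd (sh-apart (β i) (β j) (offset o) (offset o′) p q)) }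
         ; f₀ = \ a -> half-diff (e a) ; c₀ = c₀ }

        module V = Vandermonde S nodes
        open Determinants S

        hd-three : ∀ x b -> half-diff (x Z.+ b) ≈ ξ b * half-diff x - half-diff (x Z.- b)
        hd-three x b = begin
         τ (x Z.+ b) - τ (Z.- (x Z.+ b)) ≈⟨ +-cong (τ-+ x b) (-‿cong (trans (≈-cong τ (Zₚ.neg-distrib-+ x b)) (τ-+ _ _))) ⟩
         τ x * τ b - τ (Z.- x) * τ (Z.- b) ≈⟨ solve 4 (\ x y b d -> x :* b :- y :* d := (b :+ d) :* (x :- y) :- (x :* d :- y :* b)) refl _ _ _ _ ⟩
         ξ b * half-diff x - (τ x * τ (Z.- b) - τ (Z.- x) * τ b) ≈⟨ +-congˡ (-‿cong (+-cong (sym (τ-+ _ _)) (-‿cong (trans (sym (τ-+ _ _)) (≈-cong τ (lem x b)))))) ⟩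
         ξ b * half-diff x - half-diff (x Z.- b) ∎
         where
         lem : ∀ x b -> Z.- x Z.+ b ≡ Z.- (x Z.- b)
         lem = Z-solve

        -- The Chebyshev recurrence solved by the addition rule: multiplied by the odd factor, U j
        -- becomes a single difference of two powers of t. This makes the matrix entries theta
        -- series.
        U-closed : ∀ j a -> half-diff (e a) * V.U j a ≈ half-diff (e a Z.+ + j Z.* val a)
        U-closed zero a = trans (*-identityʳ _) (≈-cong half-diff (lem (e a) (val a)))
         where
         lem : ∀ e b -> e ≡ e Z.+ + 0 Z.* b
         lem = Z-solve
        U-closed (suc zero) a = trans (sym (half-step (a .fst) (offset (a .snd)))) (≈-cong half-diff (lem (e a) (val a)))
         where
         lem : ∀ e b -> e Z.+ b ≡ e Z.+ + 1 Z.* b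
         lem = Z-solve
        U-closed (suc (suc j)) a = begin
         half-diff (e a) * (ξ (val a) * V.U (suc j) a - V.U j a) ≈⟨ solve 4 (\ f x u v -> f :* (x :* u :- v) := x :* (f :* u) :- f :* v) refl _ _ _ _ ⟩
         ξ (val a) * (half-diff (e a) * V.U (suc j) a) - half-diff (e a) * V.U j a ≈⟨ +-cong (*-congˡ (U-closed (suc j) a)) (-‿cong (trans (U-closed j a) (≈-cong half-diff (lem₁ (e a) (val a) (+ j))))) ⟩
         ξ (val a) * half-diff (e a Z.+ + suc j Z.* val a) - half-diff ((e a Z.+ + suc j Z.* val a) Z.- val a) ≈⟨ hd-three _ (val a) ⟨
         half-diff ((e a Z.+ + suc j Z.* val a) Z.+ val a) ≈⟨ ≈-cong half-diff (lem₂ (e a) (val a) (+ j)) ⟩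
         half-diff (e a Z.+ + suc (suc j) Z.* val a) ∎
         where
         lem₁ : ∀ e b j -> e Z.+ j Z.* b ≡ (e Z.+ (+ 1 Z.+ j) Z.* b) Z.- b
         lem₁ = Z-solve
         lem₂ : ∀ e b j -> (e Z.+ (+ 1 Z.+ j) Z.* b) Z.+ b ≡ e Z.+ (+ 1 Z.+ (+ 1 Z.+ j)) Z.* b
         lem₂ = Z-solve

       -- The Gaussian weight of a class among l of them: c from the class itself and 2 from each of
       -- the other l - 1.
       N : ℕ -> ℤ
       N l = c Z.+ + 2 Z.* + l Z.- + 2

       private
        τ-repeat : ∀ {A : Set} x y (as : List A) -> τ x * ∏ as (\ _ -> τ y) ≈ τ (x Z.+ + length as Z.* y)
        τ-repeat x y [] = trans (*-identityʳ _) (≈-cong τ (lem x y))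
         where
         lem : ∀ x y -> x ≡ x Z.+ + 0 Z.* y
         lem = Z-solve
        τ-repeat x y (a ∷ as) = trans (solve 3 (\ a b c -> a :* (b :* c) := (a :* c) :* b) refl _ _ _) (trans (*-congʳ (τ-repeat x y as)) (trans (sym (τ-+ _ _)) (≈-cong τ (lem x y (+ length as)))))
         where
         lem : ∀ x y l -> (x Z.+ l Z.* y) Z.+ y ≡ x Z.+ (+ 1 Z.+ l) Z.* y
         lem = Z-solve

        Tm-expand : ∀ v -> All (\ a -> a .fst < n) v -> AllPairs (\ a b -> a .fst # b .fst) v ->
         Tm (map val v) ≈ (∏ v (\ a -> τ (N (length v) Z.* Q a)) * T̂ (map fst v)) * V.Δ v
        Tm-expand [] _ _ = solve 0 (1ₚ := (1ₚ :* 1ₚ) :* 1ₚ) refl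
        Tm-expand (a@(i , o) ∷ v) (i<n ∷ v<n) (av ∷ vv) = begin
         self (val a) * (∏ (map val v) (U₂ (val a)) * Tm (map val v))
          ≈⟨ *-cong (self-law i<n (offset o)) (*-cong (trans (∏-map val v) (∏-cong-All av pair)) (Tm-expand v v<n vv)) ⟩
         ((τ (c Z.* Q a) * ŝ i) * f) * (∏ v (\ b -> ((τ (+ 2 Z.* Q a) * τ (+ 2 Z.* Q b)) * Û₂ (β i) (β (b .fst))) * (ξ (val a) - ξ (val b))) * ((∏ v (\ b -> τ (N (length v) Z.* Q b)) * T̂ (map fst v)) * V.Δ v))
          ≈⟨ *-congˡ (*-congʳ (trans (∏-* v) (*-congʳ (trans (∏-* v) (*-congʳ (∏-* v)))))) ⟩
         ((τ (c Z.* Q a) * ŝ i) * f) * ((((∏ v (\ _ -> τ (+ 2 Z.* Q a)) * ∏ v (\ b -> τ (+ 2 Z.* Q b))) * ∏ v (\ b -> Û₂ (β i) (β (b .fst)))) * D) * ((∏ v (\ b -> τ (N (length v) Z.* Q b)) * T̂ (map fst v)) * V.Δ v))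
          ≈⟨ solve 10 (\ a s f p q u d w t v -> ((a :* s) :* f) :* ((((p :* q) :* u) :* d) :* ((w :* t) :* v)) := (((a :* p) :* (q :* w)) :* (s :* (u :* t))) :* (f :* d :* v)) refl _ _ _ _ _ _ _ _ _ _ ⟩
         (((τ (c Z.* Q a) * ∏ v (\ _ -> τ (+ 2 Z.* Q a))) * (∏ v (\ b -> τ (+ 2 Z.* Q b)) * ∏ v (\ b -> τ (N (length v) Z.* Q b)))) * (ŝ i * (∏ v (\ b -> Û₂ (β i) (β (b .fst))) * T̂ (map fst v)))) * (f * D * V.Δ v)
          ≈⟨ *-congʳ (*-cong (*-cong (trans (τ-repeat _ _ v) (≈-cong τ (lem₁ c (+ length v) (Q a)))) (trans (sym (∏-* v)) (∏-cong v (\ b -> trans (sym (τ-+ _ _)) (≈-cong τ (lem₂ c (+ length v) (Q b)))))))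
            (*-congˡ (*-congʳ (sym (∏-map fst v))))) ⟩
         (∏ (a ∷ v) (\ b -> τ (N (suc (length v)) Z.* Q b)) * T̂ (map fst (a ∷ v))) * V.Δ (a ∷ v) ∎
         where
         f = half-diff (e a)
         D = ∏ v (\ b -> ξ (val a) - ξ (val b))
         lem₁ : ∀ c l q -> c Z.* q Z.+ l Z.* (+ 2 Z.* q) ≡ (c Z.+ + 2 Z.* (+ 1 Z.+ l) Z.- + 2) Z.* q
         lem₁ = Z-solve
         lem₂ : ∀ c l q -> + 2 Z.* q Z.+ (c Z.+ + 2 Z.* l Z.- + 2) Z.* q ≡ (c Z.+ + 2 Z.* (+ 1 Z.+ l) Z.- + 2) Z.* q
         lem₂ = Z-solve
         pair : ∀ b -> i # b .fst -> U₂ (val a) (val b) ≈ ((τ (+ 2 Z.* Q a) * τ (+ 2 Z.* Q b)) * Û₂ (β i) (β (b .fst))) * (ξ (val a) - ξ (val b))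
         pair (j , o′) (p , q) = trans (U₂-ξ _ _ (s .fst) (s .snd)) (*-congʳ (Û₂-quad (β i) (β j) p q (offset o) (offset o′)))
          where s = sh-apart (β i) (β j) (offset o) (offset o′) p q

       ks : List ℕ
       ks = upTo (suc (Rw N.+ Rw))

       private
        AllPairs-map⁻ : ∀ {A B : Set} {f : A -> B} {_~_ : B -> B -> Set} xs -> AllPairs _~_ (map f xs) -> AllPairs (\ a b -> f a ~ f b) xs
        AllPairs-map⁻ [] [] = []
        AllPairs-map⁻ (x ∷ xs) (p ∷ ps) = Allₚ.map⁻ p ∷ AllPairs-map⁻ xs ps

        indices : ∀ {v : List (ℕ × ℕ)} -> map fst v ≡ downFrom n -> All (\ a -> a .fst < n) v × AllPairs (\ a b -> a .fst # b .fst) v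
        indices {v} eq = Allₚ.map⁻ (subst (All (_< n)) (≡.sym eq) (downFrom-< n)) , AllPairs-map⁻ v (subst (AllPairs _#_) (≡.sym eq) downFrom-#)

       weight : ℕ × ℕ -> Carrier
       weight a = τ (N n Z.* Q a)

       matrix : ℕ -> ℕ -> Carrier
       matrix i j = ∑ ks (\ o -> τ (N n Z.* quad (β i) (offset o)) * half-diff (half i (offset o) Z.+ + j Z.* sh (β i) (offset o)))

       -- The Vandermonde product is a determinant whose row i depends only on the shift of class i.
       -- By multilinearity the sum over all shifts moves into the rows.
       ∑-Tm : ∑ (choices ks (downFrom n)) (\ v -> Tm (map val v)) ≈ T̂ (downFrom n) * det matrix (downFrom n) (downFrom n)
       ∑-Tm = begin
        ∑ (choices ks (downFrom n)) (\ v -> Tm (map val v)) ≈⟨ ∑-cong-All (choices-fst ks (downFrom n)) term ⟩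
        ∑ (choices ks (downFrom n)) (\ v -> T̂ (downFrom n) * det entry v (downFrom n)) ≈⟨ ∑-*ˡ (choices ks (downFrom n)) ⟩
        T̂ (downFrom n) * ∑ (choices ks (downFrom n)) (\ v -> det entry v (downFrom n)) ≈⟨ *-congˡ (det-multilinear ks entry (downFrom n) (downFrom n) ≡.refl) ⟨
        T̂ (downFrom n) * det matrix (downFrom n) (downFrom n) ∎
        where
        entry : ℕ × ℕ -> ℕ -> Carrier
        entry a j = weight a * half-diff (e a Z.+ + j Z.* val a)
        term : ∀ v -> map fst v ≡ downFrom n -> Tm (map val v) ≈ T̂ (downFrom n) * det entry v (downFrom n)
        term v eq = begin
         Tm (map val v) ≈⟨ Tm-expand v (fst (indices eq)) (snd (indices eq)) ⟩
         (∏ v (\ a -> τ (N (length v) Z.* Q a)) * T̂ (map fst v)) * V.Δ v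
          ≈⟨ *-cong (*-cong (∏-cong v (\ a -> ≈-cong (\ l -> τ (N l Z.* Q a)) len)) (≈-cong T̂ eq)) (sym (V.vandermonde n v len (snd (indices eq)))) ⟩
         (∏ v weight * T̂ (downFrom n)) * det (\ a j -> half-diff (e a) * V.U j a) v (downFrom n) ≈⟨ solve 3 (\ a b c -> (a :* b) :* c := b :* (a :* c)) refl _ _ _ ⟩
         T̂ (downFrom n) * (∏ v weight * det (\ a j -> half-diff (e a) * V.U j a) v (downFrom n)) ≈⟨ *-congˡ (sym (det-scale weight _ v (downFrom n) (≡.trans (Lₚ.length-downFrom n) (≡.sym len)))) ⟩
         T̂ (downFrom n) * det (\ a j -> weight a * (half-diff (e a) * V.U j a)) v (downFrom n) ≈⟨ *-congˡ (det-cong (\ a j -> *-congˡ (U-closed j a)) v (downFrom n)) ⟩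
         T̂ (downFrom n) * det entry v (downFrom n) ∎
         where
         len : length v ≡ n
         len = ≡.trans (≡.sym (Lₚ.length-map fst v)) (≡.trans (cong length eq) (Lₚ.length-downFrom n))

       window-sum : ℕ -> R.Carrier
       window-sum K = R.∑ (choices ks (downFrom n)) (\ v -> wt φ (concat (map (\ a -> Zs (val a) (a .snd) ((Rw N.+ Rw) ∸ snd a) K) v)))

       window-limit : lim window-sum ≈ T̂ (downFrom n) * det matrix (downFrom n) (downFrom n)
       window-limit = trans (lim-∑ (choices ks (downFrom n))) (trans (∑-cong-All (choices-fst ks (downFrom n)) (\ v eq ->
        wt-Zs val snd (\ a -> (Rw N.+ Rw) ∸ snd a) v
         (All.map (\ { {i , o} i<n -> sh-double (β i) (offset o) (self# i<n) }) (fst (indices eq)))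
         (AllPairs.map (\ { {i , o} {j , o′} (p , q) -> sh-apart (β i) (β j) (offset o) (offset o′) p q }) (snd (indices eq))))) ∑-Tm)

      window-sum : ℕ -> ℕ -> R.Carrier
      window-sum = Window.window-sum

      matrix : ℕ -> ℕ -> ℕ -> Carrier
      matrix = Window.matrix

      window-limit : ∀ w -> lim (window-sum w) ≈ T̂ (downFrom n) * Determinants.det S (matrix w) (downFrom n) (downFrom n)
      window-limit = Window.window-limit

      term : ℕ -> R.Carrier
      term L = wt φ (concat (map (\ i -> ap (+ h Z.- β i) L ++ ap (+ h Z.+ β i) L) (downFrom n)))

      term-limit : ∀ c -> lim (\ K -> term (K N.+ c)) ≈ Tm (map β (downFrom n))
      term-limit c = wt-Zs β (\ _ -> c) (\ _ -> c) (downFrom n) (All.map self# (downFrom-< n)) downFrom-#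

      -- A window of width 0 contains only the shift r = 0. So the centred term carries the same
      -- constant `T̂` as the full sum, which allows it to cancel later.
      Tm-det : Tm (map β (downFrom n)) ≈ T̂ (downFrom n) * Determinants.det S (matrix 0) (downFrom n) (downFrom n)
      Tm-det = trans (sym (trans (single (downFrom n)) (≈-cong Tm (≡.trans (≡.sym (Lₚ.map-∘ (downFrom n))) (Lₚ.map-cong (\ i -> sh-0 (β i)) (downFrom n)))))) (Window.∑-Tm 0)
       where
       single : ∀ as {f : List (ℕ × ℕ) -> Carrier} -> ∑ (choices (0 ∷ []) as) f ≈ f (map (_, 0) as)
       single [] = +-identityʳ _
       single (a ∷ as) = trans (Determinants.∑-choices S (0 ∷ []) a as) (trans (+-identityʳ _) (single as))

private module _ (R S : CRing) where
 module NonZero (𝔾 : Geom R) (𝕃 : LimitRing R 𝔾 S) (h : ℕ) (h≢0 : h ≢ 0) where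
  open Theta R S 𝔾 𝕃 h h≢0 using (P; NZ; nz-intro)

  NZ-between : ∀ e -> 0 < e -> e < P -> NZ (+ e)
  NZ-between e 0<e e<P = nz-intro go
   where
   lem : ∀ e P k -> e ≡ (e Z.+ P Z.* (Z.- k)) Z.+ P Z.* k
   lem = Z-solve
   go : ∀ k -> + e Z.+ + P Z.* k ≢ + 0
   go (+ k) q = Nₚ.<⇒≢ 0<e (≡.sym (Nₚ.m+n≡0⇒m≡0 e (Zₚ.+-injective (≡.trans (cong (\ z -> + e Z.+ z) (Zₚ.pos-* P k)) q))))
   go -[1+ k ] q = Nₚ.<⇒≱ e<P (Nₚ.≤-trans (Nₚ.m≤m*n P (suc k)) (Nₚ.≤-reflexive (Zₚ.+-injective (≡.sym (≡.trans (lem (+ e) (+ P) (+ suc k))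
    (≡.trans (cong (\ z -> z Z.+ + P Z.* + suc k) q) (≡.trans (Zₚ.+-identityˡ _) (≡.sym (Zₚ.pos-* P (suc k))))))))))

  NZ-apart : ∀ a b -> b < a -> a < h -> NZ (+ a Z.+ + b) × NZ (+ a Z.- + b)
  NZ-apart a b b<a a<h = NZ-between (a N.+ b) (Nₚ.≤-trans (Nₚ.≤-trans (s≤s z≤n) b<a) (Nₚ.m≤m+n a b)) (Nₚ.+-mono-< a<h (Nₚ.<-trans b<a a<h)) ,
   subst NZ (≡.sym (≡.trans (Zₚ.m-n≡m⊖n a b) (Zₚ.⊖-≥ (Nₚ.<⇒≤ b<a)))) (NZ-between (a ∸ b) (Nₚ.m<n⇒0<n∸m b<a) (Nₚ.≤-<-trans (Nₚ.m∸n≤m a b) (Nₚ.<-≤-trans a<h (Nₚ.m≤m+n h h))))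

  open ThetaDeterminant R S 𝔾 𝕃 h h≢0 using (Classes)

  monotone-classes : ∀ n (β : ℕ -> ℕ) -> (∀ {i} -> i < n -> 0 < β i × β i < h) -> (∀ {i j} -> j < i -> β j < β i) -> Classes n
  monotone-classes n β bounds mono = record
   { β = \ i -> + β i
   ; β≢0 = \ {i} i<n -> NZ-between (h N.+ β i) (Nₚ.≤-trans (fst (bounds i<n)) (Nₚ.m≤n+m (β i) h)) (Nₚ.+-monoʳ-< h (snd (bounds i<n)))
   ; self# = \ {i} i<n -> NZ-between (β i N.+ β i) (Nₚ.≤-trans (fst (bounds i<n)) (Nₚ.m≤m+n (β i) (β i))) (Nₚ.+-mono-< (snd (bounds i<n)) (snd (bounds i<n)))
   ; apart = \ {i} {j} j<i i<n -> NZ-apart (β i) (β j) (mono j<i) (snd (bounds i<n)) }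

-- The two instances of the expansion: classes modulo 4n and classes modulo 2κ.

private module _ (R S : CRing) where
 open Kit S
 private module R = Kit R
 module _ (𝔾 : Geom R) (𝕃 : LimitRing R 𝔾 S) where
  open Limits R S 𝔾 𝕃 hiding (module Products)
  private module FG = Geometric R 𝔾
  open Geom 𝔾
  module LittlewoodSide (m n : ℕ) (h≢0 : 2 N.* n ≢ 0) where
   h = 2 N.* n
   open Theta R S 𝔾 𝕃 h h≢0 using (P; P≢0; NZ; away; NZ⇒≢0; NZ-shift; sh; sh-suc; sh-double; dbl; dressed; Tends-dbl; ξ; module Self)
   open ThetaDeterminant R S 𝔾 𝕃 h h≢0 using (Classes; module Classes; half-diff; half-diff⁻¹)
   open Littlewood R 𝔾 P P≢0 using (W)

   -- The odd numbers below 2n; up to sign these are all odd residues modulo 4n.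
   classes : Classes n
   classes = NonZero.monotone-classes R S 𝔾 𝕃 h h≢0 n (\ i -> suc (2 N.* i)) (\ i<n -> s≤s z≤n , Nₚ.≤-trans (Nₚ.≤-reflexive (lem _)) (Nₚ.*-monoʳ-≤ 2 i<n)) (\ j<i -> s≤s (Nₚ.*-monoʳ-< 2 j<i))
    where
    lem : ∀ i -> 2 N.+ 2 N.* i ≡ 2 N.* (1 N.+ i)
    lem = N-solve

   Tends-W : Tends (dressed (W m))
   Tends-W = Tends-* (tends (near-1 Tends-H)) Tends-dbl

   open Classes classes
   open Self (W m) Tends-W

   private
    ι-W-neg : ∀ k -> ι (W m -[1+ k ]) ≈ H -[1+ k ] * τ (+ m Z.* + suc k)
    ι-W-neg k = trans (lim-* _ _) (*-congˡ (trans (sym (τ-^ (m N.* suc k))) (≈-cong τ (Zₚ.pos-* m (suc k)))))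

    W-unit : ∀ z -> z ≢ + 0 -> ∃[ u ] (ι (W m z) * u ≈ 1#)
    W-unit (+ k) ne = 1# - τ (+ k) , trans (*-comm _ _) (H-inv (+ k) ne)
    W-unit -[1+ k ] ne = τ (Z.- (+ m Z.* + suc k)) * (1# - τ -[1+ k ]) , (begin
     ι (W m -[1+ k ]) * (τ (Z.- e) * (1# - τ -[1+ k ])) ≈⟨ *-congʳ (ι-W-neg k) ⟩
     (H -[1+ k ] * τ e) * (τ (Z.- e) * (1# - τ -[1+ k ])) ≈⟨ solve 4 (\ a b c d -> (a :* b) :* (c :* d) := (b :* c) :* (d :* a)) refl _ _ _ _ ⟩
     (τ e * τ (Z.- e)) * ((1# - τ -[1+ k ]) * H -[1+ k ]) ≈⟨ trans (*-cong (τ-inverse e) (H-inv _ ne)) (*-identityˡ _) ⟩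
     1# ∎)
     where e = + m Z.* + suc k

    -- With x = t^z this is W(1/x) = -x^(m+1) W(x); it contributes m + 1 to the Gaussian weight.
    W-reflect : ∀ z -> z ≢ + 0 -> ι (W m (Z.- z)) ≈ - (τ ((+ m Z.+ + 1) Z.* z) * ι (W m z))
    W-reflect (+ zero) ne = ⊥-elim (ne ≡.refl)
    W-reflect (+ suc k) ne = begin
     ι (W m -[1+ k ]) ≈⟨ trans (ι-W-neg k) (*-congʳ (H-neg (+ suc k) ne)) ⟩
     - (τ (+ suc k) * H (+ suc k)) * τ (+ m Z.* + suc k) ≈⟨ solve 3 (\ a b c -> (:- (a :* b)) :* c := :- ((c :* a) :* b)) refl _ _ _ ⟩
     - ((τ (+ m Z.* + suc k) * τ (+ suc k)) * H (+ suc k)) ≈⟨ -‿cong (*-congʳ (trans (sym (τ-+ _ _)) (≈-cong τ (lem (+ m) (+ suc k))))) ⟩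
     - (τ ((+ m Z.+ + 1) Z.* + suc k) * H (+ suc k)) ∎
     where
     lem : ∀ m z -> m Z.* z Z.+ z ≡ (m Z.+ + 1) Z.* z
     lem = Z-solve
    W-reflect z@(-[1+ k ]) ne = begin
     H (+ suc k) ≈⟨ H-neg z ne ⟩
     - (τ z * H z) ≈⟨ -‿cong (*-congʳ (trans (≈-cong τ (lem (+ m) (+ suc k))) (τ-+ _ _))) ⟩
     - ((τ ((+ m Z.+ + 1) Z.* z) * τ (+ m Z.* + suc k)) * H z) ≈⟨ -‿cong (trans (*-assoc _ _ _) (*-congˡ (trans (*-comm _ _) (sym (ι-W-neg k))))) ⟩
     - (τ ((+ m Z.+ + 1) Z.* z) * ι (W m z)) ∎
     where
     lem : ∀ m k -> Z.- k ≡ (m Z.+ + 1) Z.* (Z.- k) Z.+ m Z.* k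
     lem = Z-solve

    -- The weight m + 3 is made up of m + 1 from `W-reflect` and 2 from the double-letter factors
    -- together with the division by `half-diff`.
    self-quasi : ∀ b -> NZ (b Z.+ b) -> NZ (+ h Z.+ b) -> self (b Z.+ + P) * half-diff⁻¹ (b Z.+ + P) ≈ τ (+ (m N.+ 3) Z.* (b Z.+ + h)) * (self b * half-diff⁻¹ b)
    self-quasi b nz nz′ = unit-cancel (snd (W-unit z (NZ⇒≢0 nz′))) (begin
     w * (self (b Z.+ + P) * (τ (Z.- d) * H (Z.- (d Z.+ d)))) ≈⟨ *-congˡ (*-congˡ (*-congˡ (H-neg (d Z.+ d) (NZ⇒≢0 (subst NZ (lem₀ b (+ P)) (NZ-shift (+ 2) nz)))))) ⟩
     w * (self (b Z.+ + P) * (τ (Z.- d) * - (τ (d Z.+ d) * H (d Z.+ d)))) ≈⟨ solve 5 (\ w s a b x -> w :* (s :* (a :* (:- (b :* x)))) := :- ((a :* b) :* (s :* (w :* x)))) refl _ _ _ _ _ ⟩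
     - ((τ (Z.- d) * τ (d Z.+ d)) * (self (b Z.+ + P) * (w * H (d Z.+ d))))
      ≈⟨ -‿cong (*-congˡ (trans (*-congˡ (trans (*-congˡ (≈-cong H (lem₁ b (+ h)))) (sym (lim-* _ _)))) (trans (self-step b) (*-congʳ (trans (lim-* _ _) (*-cong (W-reflect z (NZ⇒≢0 nz′)) (≈-cong H (lem₂ b (+ h))))))))) ⟩
     - ((τ (Z.- d) * τ (d Z.+ d)) * ((- (τ ((+ m Z.+ + 1) Z.* z) * w) * H (Z.- (b Z.+ b))) * self b))
      ≈⟨ solve 6 (\ a b c w x s -> :- ((a :* b) :* (((:- (c :* w)) :* x) :* s)) := w :* (((a :* b) :* c) :* (s :* x))) refl _ _ _ _ _ _ ⟩
     w * (((τ (Z.- d) * τ (d Z.+ d)) * τ ((+ m Z.+ + 1) Z.* z)) * (self b * H (Z.- (b Z.+ b))))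
      ≈⟨ *-congˡ (*-congʳ (trans (*-congʳ (sym (τ-+ _ _))) (trans (sym (τ-+ _ _)) (trans (≈-cong τ (lem₃ b (+ h) (+ m))) (τ-+ _ _))))) ⟩
     w * ((τ ((+ m Z.+ + 3) Z.* (b Z.+ + h)) * τ (Z.- b)) * (self b * H (Z.- (b Z.+ b)))) ≈⟨ *-congˡ (solve 4 (\ a b s x -> (a :* b) :* (s :* x) := a :* (s :* (b :* x))) refl _ _ _ _) ⟩
     w * (τ ((+ m Z.+ + 3) Z.* (b Z.+ + h)) * (self b * half-diff⁻¹ b)) ∎)
     where
     z = + h Z.+ b
     d = b Z.+ + P
     w = ι (W m z)
     lem₀ : ∀ b P -> (b Z.+ b) Z.+ P Z.* + 2 ≡ (b Z.+ P) Z.+ (b Z.+ P)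
     lem₀ = Z-solve
     lem₁ : ∀ b h -> (b Z.+ (h Z.+ h)) Z.+ (b Z.+ (h Z.+ h)) ≡ ((h Z.+ b) Z.+ (h Z.+ b)) Z.+ (h Z.+ h)
     lem₁ = Z-solve
     lem₂ : ∀ b h -> (Z.- (h Z.+ b) Z.+ Z.- (h Z.+ b)) Z.+ (h Z.+ h) ≡ Z.- (b Z.+ b)
     lem₂ = Z-solve
     lem₃ : ∀ b h m -> (Z.- (b Z.+ (h Z.+ h)) Z.+ ((b Z.+ (h Z.+ h)) Z.+ (b Z.+ (h Z.+ h)))) Z.+ (m Z.+ + 1) Z.* (h Z.+ b) ≡ (m Z.+ + 3) Z.* (b Z.+ h) Z.+ Z.- b
     lem₃ = Z-solve

    -- The factorisation a^2 - b^2 = (a - b)(a + b) makes c₀ = 0 on this side.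
    square-diff : ∀ e -> half-diff (e Z.+ e) ≈ half-diff e * (ξ e + 0#)
    square-diff e = trans (+-cong (τ-+ e e) (-‿cong (trans (≈-cong τ (Zₚ.neg-distrib-+ e e)) (τ-+ _ _)))) (solve 2 (\ a b -> a :* a :- b :* b := (a :- b) :* (a :+ b :+ 0ₚ)) refl _ _)

   private
    half≢0 : ∀ {i} -> i < n -> ∀ r -> sh (β i) r Z.+ sh (β i) r ≢ + 0
    half≢0 {i} i<n r = NZ⇒≢0 (sh-double (β i) r (self# i<n))

    step : ∀ {i} -> i < n -> ∀ r -> self (sh (β i) (Z.suc r)) * half-diff⁻¹ (sh (β i) (Z.suc r)) ≈ τ (+ (m N.+ 3) Z.* (sh (β i) r Z.+ + h)) * (self (sh (β i) r) * half-diff⁻¹ (sh (β i) r))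
    step {i} i<n r = trans (≈-cong (\ b -> self b * half-diff⁻¹ b) (sh-suc (β i) r))
     (self-quasi (sh (β i) r) (sh-double (β i) r (self# i<n)) (subst NZ (Zₚ.+-assoc (+ h) (β i) (+ P Z.* r)) (NZ-shift r (β≢0 i<n))))

   open ThetaDeterminant.Expansion R S 𝔾 𝕃 h h≢0 (W m) Tends-W classes (\ i r -> sh (β i) r) 0# (+ (m N.+ 3)) half≢0 (\ i r -> square-diff (sh (β i) r)) step public
    using (Tm; T̂; term; term-limit; Tm-det; window-sum; matrix; window-limit)

-- With h = 1/(1-x), k = 1/(1-xu) and l = 1/(1-(xu)²): (1+u)h - u = (1+xu)h.
dressed-identity : ∀ (R : CRing) {x u h k l} -> let open Kit R in (1# - x) * h ≈ 1# -> (1# - x * u) * k ≈ 1# -> (1# - (x * u) * (x * u)) * l ≈ 1# -> ((1# + u) * h - u) * l ≈ h * k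
dressed-identity R {x} {u} {h} {k} {l} eh ek el = begin
 ((1# + u) * h - u) * l ≈⟨ *-congʳ (trans (+-congˡ (-‿cong (trans (sym (*-identityʳ u)) (*-congˡ (sym eh))))) (solve 3 (\ u h x -> (1ₚ :+ u) :* h :- u :* ((1ₚ :- x) :* h) := h :* (1ₚ :+ x :* u)) refl u h x)) ⟩
 (h * (1# + x * u)) * l ≈⟨ trans (*-assoc _ _ _) (*-congˡ (unit-cancel ek (trans (trans (solve 2 (\ y l -> (1ₚ :- y) :* ((1ₚ :+ y) :* l) := (1ₚ :- y :* y) :* l) refl (x * u) l) el) (sym ek)))) ⟩
 h * k ∎
 where open Kit R

private module _ (R S : CRing) where
 open Kit S
 private module R = Kit R
 module _ (𝔾 : Geom R) (𝕃 : LimitRing R 𝔾 S) where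
  open Limits R S 𝔾 𝕃 hiding (module Products)
  private module FG = Geometric R 𝔾
  open Geom 𝔾
  open Divisible R t using (Div-resp; Div-*ˡ)
  module SignSide (κ n : ℕ) (κ≢0 : κ ≢ 0) (2n<κ : 2 N.* n < κ) where
   open Theta R S 𝔾 𝕃 κ κ≢0 using (P; P≢0; NZ; away; NZ⇒≢0; NZ-shift; sh; sh-suc; sh-double; dbl; dressed; Tends-dbl; ξ; module Self)
   open ThetaDeterminant R S 𝔾 𝕃 κ κ≢0 using (Classes; module Classes; half-diff; half-diff⁻¹)
   open SignSums R 𝔾 (t R.^ P) using (φτ)

   -- The even numbers 2, 4, ..., 2n, all below κ. There are n of them, to match the size of the
   -- other determinant, and they are even so that `half` is an integer.
   classes : Classes n
   classes = NonZero.monotone-classes R S 𝔾 𝕃 κ κ≢0 n (\ i -> suc i N.+ suc i) (\ i<n -> s≤s z≤n , Nₚ.≤-<-trans (Nₚ.≤-trans (Nₚ.+-mono-≤ i<n i<n) (Nₚ.≤-reflexive (lem n))) 2n<κ)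
    (\ j<i -> Nₚ.+-mono-< (s≤s j<i) (s≤s j<i))
    where
    lem : ∀ n -> n N.+ n ≡ 2 N.* n
    lem = N-solve

   φ : ℤ -> R.Carrier
   φ = φτ (t R.^ κ)

   Tends-φ : Tends (dressed φ)
   Tends-φ = Tends-* (tends (\ M k le -> Div-resp (R.solve 2 (\ u h -> (R.1ₚ R.:+ u) R.:* (h R.:- R.1ₚ) R.:= ((R.1ₚ R.:+ u) R.:* h R.:- u) R.:- R.1ₚ) R.refl _ _) (Div-*ˡ (R.1# R.+ t R.^ κ) (near-1 Tends-H M k le))))
    Tends-dbl

   open Classes classes
   open Self φ Tends-φ

   -- Half of the shifted representative; it is integral because both the representative and the
   -- period 2κ are even.
   half : ℕ -> ℤ -> ℤ
   half i r = + suc i Z.+ + κ Z.* r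

   -- The choice τ = t^κ makes the numerator 1 + t^(z+κ) cancel against the double-letter
   -- denominator 1 - t^(2z+2κ), so that the dressed weight becomes a product of two simple factors.
   ι-dressed : ∀ z -> z ≢ + 0 -> z Z.+ + κ ≢ + 0 -> ι (dressed φ z) ≈ H z * H (z Z.+ + κ)
   ι-dressed z z0 zκ0 = trans (trans (lim-* _ _) (*-congʳ (trans (lim-+ _ _) (+-cong (trans (lim-* _ _) (*-congʳ (trans (lim-+ _ _) (+-cong lim-1 (sym (τ-^ κ)))))) (trans (lim-neg _) (-‿cong (sym (τ-^ κ))))))))
    (dressed-identity S (H-inv z z0) (trans (*-congʳ (+-congˡ (-‿cong (sym (τ-+ z (+ κ)))))) (H-inv x zκ0))
     (trans (*-cong (+-congˡ (-‿cong (trans (*-cong (sym (τ-+ z (+ κ))) (sym (τ-+ z (+ κ)))) (sym (τ-+ x x))))) (≈-cong H (lem z (+ κ)))) (H-inv (x Z.+ x) (dbl≢0 x zκ0))))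
    where
    x = z Z.+ + κ
    lem : ∀ z h -> (z Z.+ z) Z.+ (h Z.+ h) ≡ (z Z.+ h) Z.+ (z Z.+ h)
    lem = Z-solve
    dbl≢0 : ∀ x -> x ≢ + 0 -> x Z.+ x ≢ + 0
    dbl≢0 (+ zero) ne _ = ne ≡.refl

   private
    self-quasi : ∀ e -> let b = e Z.+ e in NZ b -> NZ (+ κ Z.+ b) -> self (b Z.+ + P) * half-diff⁻¹ (e Z.+ + κ) ≈ τ (+ 2 Z.* (b Z.+ + κ)) * (self b * half-diff⁻¹ e)
    self-quasi e nz nz′ = unit-cancel (trans (*-comm _ _) (H-inv z (NZ⇒≢0 nz′))) (begin
     w * (self d * (τ (Z.- f) * H (Z.- (f Z.+ f)))) ≈⟨ *-congˡ (*-congˡ (*-congˡ (trans (≈-cong (\ y -> H (Z.- y)) (lem₁ e (+ κ))) (H-neg d d≢0)))) ⟩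
     w * (self d * (τ (Z.- f) * - (τ d * H d))) ≈⟨ solve 5 (\ w s a b x -> w :* (s :* (a :* (:- (b :* x)))) := :- ((a :* b) :* (s :* (w :* x)))) refl _ _ _ _ _ ⟩
     - ((τ (Z.- f) * τ d) * (self d * (w * H d)))
      ≈⟨ -‿cong (*-congˡ (trans (*-congˡ (trans (*-congˡ (≈-cong H (lem₂ b (+ κ)))) (sym (ι-dressed z (NZ⇒≢0 nz′) (subst (_≢ + 0) (lem₂ b (+ κ)) d≢0)))))
         (trans (self-step b) (*-congʳ (trans (ι-dressed (Z.- z) (neg≢0 (NZ⇒≢0 nz′)) (subst (_≢ + 0) (lem₃ b (+ κ)) (neg≢0 (NZ⇒≢0 nz)))) (*-cong (H-neg z (NZ⇒≢0 nz′)) (≈-cong H (≡.sym (lem₃ b (+ κ)))))))))) ⟩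
     - ((τ (Z.- f) * τ d) * ((- (τ z * w) * H (Z.- b)) * self b)) ≈⟨ solve 6 (\ a b c w x s -> :- ((a :* b) :* (((:- (c :* w)) :* x) :* s)) := w :* (((a :* b) :* c) :* (s :* x))) refl _ _ _ _ _ _ ⟩
     w * (((τ (Z.- f) * τ d) * τ z) * (self b * H (Z.- b))) ≈⟨ *-congˡ (*-congʳ (trans (*-congʳ (sym (τ-+ _ _))) (trans (sym (τ-+ _ _)) (trans (≈-cong τ (lem₄ e (+ κ))) (τ-+ _ _))))) ⟩
     w * ((τ (+ 2 Z.* (b Z.+ + κ)) * τ (Z.- e)) * (self b * H (Z.- b))) ≈⟨ *-congˡ (solve 4 (\ a b s x -> (a :* b) :* (s :* x) := a :* (s :* (b :* x))) refl _ _ _ _) ⟩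
     w * (τ (+ 2 Z.* (b Z.+ + κ)) * (self b * half-diff⁻¹ e)) ∎)
     where
     b = e Z.+ e
     z = + κ Z.+ b
     f = e Z.+ + κ
     d = b Z.+ + P
     w = H z
     d≢0 : d ≢ + 0
     d≢0 q = away nz (+ 1) (≡.trans (cong (\ y -> b Z.+ y) (Zₚ.*-identityʳ (+ P))) q)
     lem₁ : ∀ e h -> (e Z.+ h) Z.+ (e Z.+ h) ≡ (e Z.+ e) Z.+ (h Z.+ h)
     lem₁ = Z-solve
     lem₂ : ∀ b h -> b Z.+ (h Z.+ h) ≡ (h Z.+ b) Z.+ h
     lem₂ = Z-solve
     lem₃ : ∀ b h -> Z.- b ≡ Z.- (h Z.+ b) Z.+ h
     lem₃ = Z-solve
     lem₄ : ∀ e h -> (Z.- (e Z.+ h) Z.+ ((e Z.+ e) Z.+ (h Z.+ h))) Z.+ (h Z.+ (e Z.+ e)) ≡ + 2 Z.* ((e Z.+ e) Z.+ h) Z.+ Z.- e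
     lem₄ = Z-solve

    halves : ∀ i r -> half i r Z.+ half i r ≡ sh (β i) r
    halves i r = lem (+ suc i) (+ κ) r
     where
     lem : ∀ i k r -> (i Z.+ k Z.* r) Z.+ (i Z.+ k Z.* r) ≡ (i Z.+ i) Z.+ (k Z.+ k) Z.* r
     lem = Z-solve

    half-suc : ∀ i r -> half i (Z.suc r) ≡ half i r Z.+ + κ
    half-suc i r = lem (+ suc i) (+ κ) r
     where
     lem : ∀ i k r -> i Z.+ k Z.* (+ 1 Z.+ r) ≡ (i Z.+ k Z.* r) Z.+ k
     lem = Z-solve

    NZ-β : ∀ {i} -> i < n -> ∀ r -> NZ (sh (β i) r)
    NZ-β {i} i<n r = NZ-shift r (NonZero.NZ-between R S 𝔾 𝕃 κ κ≢0 (suc i N.+ suc i) (s≤s z≤n)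
     (Nₚ.<-≤-trans (Nₚ.≤-<-trans (Nₚ.≤-trans (Nₚ.+-mono-≤ i<n i<n) (Nₚ.≤-reflexive (lem n))) 2n<κ) (Nₚ.m≤m+n κ κ)))
     where
     lem : ∀ n -> n N.+ n ≡ 2 N.* n
     lem = N-solve

    -- The factorisation a^3 - b^3 = (a - b)(a^2 + b^2 + ab), where ab = 1, is the origin of c₀ = 1
    -- on this side.
    cube-diff : ∀ e b -> e Z.+ e ≡ b -> half-diff (e Z.+ b) ≈ half-diff e * (ξ b + 1#)
    cube-diff e b ≡.refl = trans (+-cong (trans (τ-+ e _) (*-congˡ (τ-+ e e))) (-‿cong (trans (≈-cong τ (Zₚ.neg-distrib-+ e (e Z.+ e))) (trans (τ-+ _ _) (*-congˡ neg2)))))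
     (trans (solve 2 (\ a b -> a :* (a :* a) :- b :* (b :* b) := (a :- b) :* (a :* a :+ b :* b :+ a :* b)) refl _ _) (*-congˡ (+-cong (+-cong (sym (τ-+ e e)) (sym neg2)) (τ-inverse e))))
     where
     neg2 : τ (Z.- (e Z.+ e)) ≈ τ (Z.- e) * τ (Z.- e)
     neg2 = trans (≈-cong τ (Zₚ.neg-distrib-+ e e)) (τ-+ _ _)

   private
    half≢0 : ∀ {i} -> i < n -> ∀ r -> half i r Z.+ half i r ≢ + 0
    half≢0 {i} i<n r = subst (_≢ + 0) (≡.sym (halves i r)) (NZ⇒≢0 (NZ-β i<n r))

    step : ∀ {i} -> i < n -> ∀ r -> self (sh (β i) (Z.suc r)) * half-diff⁻¹ (half i (Z.suc r)) ≈ τ (+ 2 Z.* (sh (β i) r Z.+ + κ)) * (self (sh (β i) r) * half-diff⁻¹ (half i r))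
    step {i} i<n r = trans (*-cong (≈-cong self (≡.trans (sh-suc (β i) r) (cong (\ b -> b Z.+ + P) (≡.sym (halves i r))))) (≈-cong half-diff⁻¹ (half-suc i r)))
     (trans (self-quasi (half i r) (subst NZ (≡.sym (halves i r)) (NZ-β i<n r)) (subst NZ (≡.trans (Zₚ.+-assoc (+ κ) (β i) (+ P Z.* r)) (cong (\ b -> + κ Z.+ b) (≡.sym (halves i r)))) (NZ-shift r (β≢0 i<n))))
      (≈-cong (\ b -> τ (+ 2 Z.* (b Z.+ + κ)) * (self b * half-diff⁻¹ (half i r))) (halves i r)))

   open ThetaDeterminant.Expansion R S 𝔾 𝕃 κ κ≢0 φ Tends-φ classes half 1# (+ 2) half≢0 (\ i r -> cube-diff (half i r) (sh (β i) r) (halves i r)) step public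
    using (Tm; T̂; term; term-limit; Tm-det; window-sum; matrix; window-limit)

-- Finite alphabets built from classes, and approximation of their sign sums by windows.

private module _ (R : CRing) where
 open Kit R
 module _ (S : CRing) (𝔾 : Geom R) (𝕃 : LimitRing R 𝔾 S) where
  open Geom 𝔾
  open Divisible R t
  module ClassLetters (h : ℕ) (h≢0 : h ≢ 0) where
   open Theta R S 𝔾 𝕃 h h≢0 using (P; P≢0; NZ; away; sh; ap; flip; at; neg; at-0; at-suc; ap-++; flip-++; flip-↭; ap-All; length-ap; wt; wt-↭; NZ⇒≢0; NZ-shift)
   open ThetaDeterminant R S 𝔾 𝕃 h h≢0 using (Classes; module Classes)

   -- Chosen so that member L of the progression is h + b. Of 2L members the first L lie below it,
   -- and flipping exactly these produces the ascending progression from h - b.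
   base : ℤ -> ℕ -> ℤ
   base b L = (+ h Z.+ b) Z.- + P Z.* + L

   letters : (ℕ -> ℤ) -> ℕ -> ℕ -> List ℤ
   letters β n L = concat (map (\ i -> ap (base (β i) L) (L N.+ L)) (downFrom n))

   at-base : ∀ b L k -> at (base b L) k ≡ (+ h Z.+ b) Z.+ + P Z.* (+ k Z.- + L)
   at-base b L k = lem (+ h Z.+ b) (+ P) (+ L) (+ k)
    where
    lem : ∀ c P L k -> (c Z.- P Z.* L) Z.+ P Z.* k ≡ c Z.+ P Z.* (k Z.- L)
    lem = Z-solve

   module _ {n : ℕ} (𝒞 : Classes n) where
    open Classes 𝒞

    letters-Good : ∀ L -> Good (letters β n L)
    letters-Good L = good
     (Allₚ.concat⁺ (Allₚ.map⁺ (All.map (\ {i} i<n -> ap-All _ (L N.+ L) (\ k _ -> subst (_≢ + 0) (≡.sym (at-base (β i) L k)) (NZ⇒≢0 (NZ-shift _ (β≢0 i<n))))) (downFrom-< n))))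
     (AllPairsₚ.concat⁺ (Allₚ.map⁺ (All.map within (downFrom-< n))) (AllPairsₚ.map⁺ (between n Nₚ.≤-refl)))
     where
     sum≢0 : ∀ b b′ -> NZ (b Z.+ b′) -> ∀ j k -> at (base b L) j ≢ Z.- at (base b′ L) k
     sum≢0 b b′ nz j k q = away nz (+ 1 Z.+ ((+ j Z.- + L) Z.+ (+ k Z.- + L)))
      (≡.trans (lem b b′ (+ h) (+ j Z.- + L) (+ k Z.- + L)) (≡.trans (cong₂ Z._+_ (≡.trans (≡.sym (at-base b L j)) q) (≡.sym (at-base b′ L k))) (Zₚ.+-inverseˡ (at (base b′ L) k))))
      where
      lem : ∀ b b′ h j k -> (b Z.+ b′) Z.+ (h Z.+ h) Z.* (+ 1 Z.+ (j Z.+ k)) ≡ ((h Z.+ b) Z.+ (h Z.+ h) Z.* j) Z.+ ((h Z.+ b′) Z.+ (h Z.+ h) Z.* k)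
      lem = Z-solve
     diff≢0 : ∀ b b′ -> NZ (b Z.- b′) -> ∀ j k -> at (base b L) j ≢ at (base b′ L) k
     diff≢0 b b′ nz j k q = away nz ((+ j Z.- + L) Z.- (+ k Z.- + L))
      (≡.trans (lem b b′ (+ h) (+ j Z.- + L) (+ k Z.- + L)) (≡.trans (cong₂ Z._-_ (≡.trans (≡.sym (at-base b L j)) q) (≡.sym (at-base b′ L k))) (Zₚ.+-inverseʳ (at (base b′ L) k))))
      where
      lem : ∀ b b′ h j k -> (b Z.- b′) Z.+ (h Z.+ h) Z.* (j Z.- k) ≡ ((h Z.+ b) Z.+ (h Z.+ h) Z.* j) Z.- ((h Z.+ b′) Z.+ (h Z.+ h) Z.* k)
      lem = Z-solve
     ap-AllPairs : ∀ {Q : ℤ -> ℤ -> Set} a l -> (∀ j k -> j < k -> Q (at a j) (at a k)) -> AllPairs Q (ap a l)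
     ap-AllPairs a zero q = []
     ap-AllPairs {Q} a (suc l) q = ap-All (a Z.+ + P) l (\ k _ -> subst₂′ (at-0 a) (≡.sym (at-suc a k)) (q 0 (suc k) (s≤s z≤n))) ∷
      ap-AllPairs (a Z.+ + P) l (\ j k j<k -> subst₂′ (≡.sym (at-suc a j)) (≡.sym (at-suc a k)) (q (suc j) (suc k) (s≤s j<k)))
      where
      subst₂′ : ∀ {x x′ y y′} -> x ≡ x′ -> y ≡ y′ -> Q x y -> Q x′ y′
      subst₂′ ≡.refl ≡.refl q = q
     within : ∀ {i} -> i < n -> AllPairs _⟂_ (ap (base (β i) L) (L N.+ L))
     within {i} i<n = ap-AllPairs _ _ (\ j k j<k -> (\ q -> Nₚ.<⇒≢ j<k (Zₚ.+-injective (Zₚ.*-cancelˡ-≡ (+ P) (+ j) (+ k) {{N.≢-nonZero P≢0}} (≡.trans (cancel (base (β i) L) (+ P Z.* + j)) (≡.trans (cong (\ z -> z Z.- base (β i) L) q) (≡.sym (cancel (base (β i) L) (+ P Z.* + k)))))))) , sum≢0 (β i) (β i) (self# i<n) j k)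
      where
      cancel : ∀ x y -> y ≡ (x Z.+ y) Z.- x
      cancel = Z-solve
     between : ∀ k -> k ≤ n -> AllPairs (\ i j -> All (\ x -> All (x ⟂_) (ap (base (β j) L) (L N.+ L))) (ap (base (β i) L) (L N.+ L))) (downFrom k)
     between zero _ = []
     between (suc k) k<n = All.map (\ {j} j<k -> ap-All _ _ (\ x _ -> ap-All _ _ (\ y _ -> diff≢0 (β k) (β j) (snd (apart j<k k<n)) x y , sum≢0 (β k) (β j) (fst (apart j<k k<n)) x y))) (downFrom-< k)
      ∷ between k (Nₚ.<⇒≤ k<n)

   module Approximation (φ : ℤ -> Carrier) (φ-Div : ∀ k -> Div 1 (φ -[1+ k ])) (β : ℕ -> ℕ) (n : ℕ) (β<h : ∀ {i} -> i < n -> β i < h) where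
    open ClassSums R 𝔾 P P≢0
    open Determinants R using (∑-choices)

    private
     Negative : ℤ -> Set
     Negative z = ∃[ k ] (z ≡ -[1+ k ])

     Div-negatives : ∀ {zs} -> All Negative zs -> Div (length zs) (∏ zs φ)
     Div-negatives [] = _ , sym (*-identityˡ _)
     Div-negatives ((k , ≡.refl) ∷ ns) = Div-* (φ-Div k) (Div-negatives ns)

     module _ (K M : ℕ) where
      L l : ℕ
      L = K N.+ M
      l = L N.+ L

      low : ∀ {i} -> i < n -> ∀ k -> k < L -> Negative (at (base (+ β i) L) k)
      low {i} i<n k k<L = (h ∸ suc (β i)) N.+ P N.* (L ∸ suc k) , ≡.trans (at-base (+ β i) L k)
       (≡.trans (cong₂ (\ x y -> (+ h Z.+ + β i) Z.+ (+ h Z.+ x) Z.* (+ k Z.- y)) (cong +_ (≡.sym eh)) (cong +_ (≡.sym eL)))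
       (≡.trans (lem (+ h) (+ β i) (+ d) (+ k) (+ e))
       (≡.trans (cong (\ x -> Z.- (+ 1 Z.+ (+ d Z.+ (+ h Z.+ x) Z.* + e))) (cong +_ eh))
        (cong (\ x -> Z.- (+ 1 Z.+ (+ d Z.+ x))) (≡.sym (Zₚ.pos-* P e))))))
       where
       d = h ∸ suc (β i)
       e = L ∸ suc k
       eh : suc (β i) N.+ d ≡ h
       eh = Nₚ.m+[n∸m]≡n (β<h i<n)
       eL : suc k N.+ e ≡ L
       eL = Nₚ.m+[n∸m]≡n k<L
       lem : ∀ h b d k e -> (h Z.+ b) Z.+ (h Z.+ ((+ 1 Z.+ b) Z.+ d)) Z.* (k Z.- ((+ 1 Z.+ k) Z.+ e)) ≡ Z.- (+ 1 Z.+ (d Z.+ (h Z.+ ((+ 1 Z.+ b) Z.+ d)) Z.* e))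
       lem = Z-solve

      high : ∀ i q -> Negative (Z.- at (at (base (+ β i) L) L) q)
      high i q = N.pred h N.+ (β i N.+ P N.* q) , ≡.trans (cong (\ z -> Z.- z) (≡.trans (lem (+ h) (+ β i) (+ P) (+ L) (+ q)) (cong (\ x -> + h Z.+ (+ β i Z.+ x)) (≡.sym (Zₚ.pos-* P q)))))
       (cong (\ x -> Z.- (+ (x N.+ (β i N.+ P N.* q)))) (≡.sym (Nₚ.suc-pred h {{N.≢-nonZero h≢0}})))
       where
       lem : ∀ h b P L q -> (((h Z.+ b) Z.- P Z.* L) Z.+ P Z.* L) Z.+ P Z.* q ≡ h Z.+ (b Z.+ P Z.* q)
       lem = Z-solve

      -- Flip lengths that leave at least M negative exponents in the class. With fewer than K
      -- flips, M negative members stay unflipped; with at least L + M flips, M positive members are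
      -- flipped. Each negative exponent costs a factor t.
      Bad : ℕ -> Set
      Bad j = (j < K) ⊎ (∃[ e ] (j ≡ L N.+ (M N.+ e) × j ≤ l))

      Div-first : ∀ a e -> All Negative (ap a M) -> Div M (∏ (ap a (M N.+ e)) φ)
      Div-first a e ns = Div-resp (sym (trans (≈-cong (\ zs -> ∏ zs φ) (ap-++ a M e)) (∏-++ (ap a M) (ap (at a M) e)))) (Div-*ʳ _ (subst (\ k -> Div k (∏ (ap a M) φ)) (length-ap a M) (Div-negatives ns)))

      Div-neg-first : ∀ a e -> All Negative (neg (ap a M)) -> Div M (∏ (neg (ap a (M N.+ e))) φ)
      Div-neg-first a e ns = Div-resp (sym (trans (≈-cong (\ zs -> ∏ zs φ) (≡.trans (cong neg (ap-++ a M e)) (Lₚ.map-++ (\ z -> Z.- z) (ap a M) (ap (at a M) e)))) (∏-++ (neg (ap a M)) (neg (ap (at a M) e)))))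
       (Div-*ʳ _ (subst (\ k -> Div k (∏ (neg (ap a M)) φ)) (≡.trans (Lₚ.length-map _ (ap a M)) (length-ap a M)) (Div-negatives ns)))

      flip-split : ∀ a j -> j ≤ l -> flip a l j ≡ neg (ap a j) ++ ap (at a j) (l ∸ j)
      flip-split a j j≤l = ≡.trans (cong (\ x -> flip a x j) (≡.sym (Nₚ.m+[n∸m]≡n j≤l))) (flip-++ a j (l ∸ j))

      bad-Div : ∀ {i} -> i < n -> ∀ j -> Bad j -> Div M (∏ (flip (base (+ β i) L) l j) φ)
      bad-Div {i} i<n j (inj₁ j<K) = Div-resp (sym (trans (≈-cong (\ zs -> ∏ zs φ) (flip-split a j j≤l)) (∏-++ (neg (ap a j)) _)))
       (Div-*ˡ _ (subst (\ x -> Div M (∏ (ap (at a j) x) φ)) (Nₚ.m+[n∸m]≡n M≤) (Div-first (at a j) _ (ap-All (at a j) M (\ q q<M -> subst Negative (≡.sym (at-at q)) (low i<n (j N.+ q) (Nₚ.+-mono-< j<K q<M)))))))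
       where
       a = base (+ β i) L
       j≤l : j ≤ l
       j≤l = Nₚ.≤-trans (Nₚ.<⇒≤ j<K) (Nₚ.≤-trans (Nₚ.m≤m+n K M) (Nₚ.m≤m+n L L))
       M≤ : M ≤ l ∸ j
       M≤ = Nₚ.m+n≤o⇒n≤o 0 (Nₚ.≤-trans (Nₚ.≤-reflexive (≡.sym (Nₚ.m+n∸m≡n j M))) (Nₚ.∸-monoˡ-≤ j (Nₚ.≤-trans (Nₚ.+-monoˡ-≤ M (Nₚ.<⇒≤ j<K)) (Nₚ.m≤m+n L L))))
       at-at : ∀ q -> at (at a j) q ≡ at a (j N.+ q)
       at-at q = lem a (+ P) (+ j) (+ q)
        where
        lem : ∀ a P j q -> (a Z.+ P Z.* j) Z.+ P Z.* q ≡ a Z.+ P Z.* (j Z.+ q)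
        lem = Z-solve
      bad-Div {i} i<n j (inj₂ (e , ≡.refl , j≤l)) = Div-resp (sym (trans (≈-cong (\ zs -> ∏ zs φ) (flip-split a j j≤l)) (∏-++ (neg (ap a j)) _)))
       (Div-*ʳ _ (Div-resp (sym (trans (≈-cong (\ zs -> ∏ zs φ) (≡.trans (cong neg (ap-++ a L (M N.+ e))) (Lₚ.map-++ (\ z -> Z.- z) (ap a L) _))) (∏-++ (neg (ap a L)) _)))
        (Div-*ˡ _ (Div-neg-first (at a L) e (Allₚ.map⁺ (ap-All (at a L) M (\ q _ -> high i q)))))))
       where
       a = base (+ β i) L

      flips : List (ℕ × ℕ) -> List ℤ
      flips v = concat (map (\ a -> flip (base (+ β (a .fst)) L) l (a .snd)) v)

      flips-Div : ∀ us i j vs -> i < n -> Bad j -> Div M (wt φ (flips (us ++ (i , j) ∷ vs)))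
      flips-Div us i j vs i<n bad = Div-*ʳ _ (go us)
       where
       go : ∀ us -> Div M (∏ (flips (us ++ (i , j) ∷ vs)) φ)
       go [] = Div-resp (sym (∏-++ (flip (base (+ β i) L) l j) (flips vs))) (Div-*ʳ _ (bad-Div i<n j bad))
       go ((i′ , j′) ∷ us) = Div-resp (sym (∏-++ (flip (base (+ β i′) L) l j′) _)) (Div-*ˡ _ (go us))

      upTo-++ : ∀ (f : ℕ -> ℕ) a b -> applyUpTo f (a N.+ b) ≡ applyUpTo f a ++ applyUpTo (\ k -> f (a N.+ k)) b
      upTo-++ f zero b = ≡.refl
      upTo-++ f (suc a) b = cong (f 0 ∷_) (upTo-++ (\ k -> f (suc k)) a b)

      reindex : ∀ (g : ℕ -> ℕ) ks as {f : List (ℕ × ℕ) -> Carrier} -> ∑ (choices (map g ks) as) f ≈ ∑ (choices ks as) (\ v -> f (map (\ a -> a .fst , g (a .snd)) v))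
      reindex g ks [] = refl
      reindex g ks (a ∷ as) = trans (∑-choices (map g ks) a as) (trans (∑-map g ks) (trans (∑-cong ks (\ k -> reindex g ks as)) (sym (∑-choices ks a as))))

      window : List ℕ
      window = upTo (suc (M N.+ M))

      upTo-window : upTo (suc l) ≡ upTo K ++ map (K N.+_) window ++ applyUpTo (\ k -> K N.+ (suc (M N.+ M) N.+ k)) K
      upTo-window = ≡.trans (cong upTo (lem K M)) (≡.trans (upTo-++ id K _) (cong (upTo K ++_) (≡.trans (upTo-++ (K N.+_) (suc (M N.+ M)) K) (cong (_++ applyUpTo (\ k -> K N.+ (suc (M N.+ M) N.+ k)) K) (≡.sym (Lₚ.map-upTo (K N.+_) (suc (M N.+ M))))))))
       where
       lem : ∀ K M -> 1 N.+ ((K N.+ M) N.+ (K N.+ M)) ≡ K N.+ ((1 N.+ (M N.+ M)) N.+ K)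
       lem = N-solve

      bad-high : ∀ {k} -> k < K -> Bad (K N.+ (suc (M N.+ M) N.+ k))
      bad-high {k} k<K = inj₂ (suc k , lem K M k , Nₚ.≤-trans (Nₚ.≤-reflexive (lem₂ K M k)) (Nₚ.≤-trans (Nₚ.+-monoʳ-≤ (K N.+ (M N.+ M)) k<K) (Nₚ.≤-reflexive (lem₃ K M))))
       where
       lem : ∀ K M k -> K N.+ ((1 N.+ (M N.+ M)) N.+ k) ≡ (K N.+ M) N.+ (M N.+ (1 N.+ k))
       lem = N-solve
       lem₂ : ∀ K M k -> K N.+ ((1 N.+ (M N.+ M)) N.+ k) ≡ K N.+ (M N.+ M) N.+ (1 N.+ k)
       lem₂ = N-solve
       lem₃ : ∀ K M -> K N.+ (M N.+ M) N.+ K ≡ (K N.+ M) N.+ (K N.+ M)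
       lem₃ = N-solve

      -- Flipping K + o members instead of the symmetric number L = K + M moves the class by o - M
      -- periods. The window of flip lengths thus becomes a symmetric range of shifts.
      Zw : ℕ × ℕ -> List ℤ
      Zw (i , o) = ap (+ h Z.- sh (+ β i) (+ o Z.- + M)) (K N.+ o) ++ ap (+ h Z.+ sh (+ β i) (+ o Z.- + M)) (K N.+ ((M N.+ M) ∸ o))

      flip-Zw : ∀ i o -> o ≤ M N.+ M -> flip (base (+ β i) L) l (K N.+ o) ↭ Zw (i , o)
      flip-Zw i o o≤ = ↭-trans (Perm.↭-reflexive (cong (\ x -> flip a x (K N.+ o)) (≡.trans (≡.trans (lem K M) (cong (\ x -> K N.+ (K N.+ x)) (≡.sym (Nₚ.m+[n∸m]≡n o≤)))) (lem′ K o _))))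
       (↭-trans (flip-↭ a (K N.+ o) (K N.+ ((M N.+ M) ∸ o))) (Perm.↭-reflexive (cong₂ (\ x y -> ap x (K N.+ o) ++ ap y (K N.+ ((M N.+ M) ∸ o))) (at₁ (+ h) (+ β i) (+ K) (+ M) (+ o)) (at₂ (+ h) (+ β i) (+ K) (+ M) (+ o)))))
       where
       a = base (+ β i) L
       lem : ∀ K M -> (K N.+ M) N.+ (K N.+ M) ≡ K N.+ (K N.+ (M N.+ M))
       lem = N-solve
       lem′ : ∀ K o x -> K N.+ (K N.+ (o N.+ x)) ≡ (K N.+ o) N.+ (K N.+ x)
       lem′ = N-solve
       at₁ : ∀ h b K M o -> (h Z.+ h) Z.- (((h Z.+ b) Z.- (h Z.+ h) Z.* (K Z.+ M)) Z.+ (h Z.+ h) Z.* (K Z.+ o)) ≡ h Z.- (b Z.+ (h Z.+ h) Z.* (o Z.- M))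
       at₁ = Z-solve
       at₂ : ∀ h b K M o -> ((h Z.+ b) Z.- (h Z.+ h) Z.* (K Z.+ M)) Z.+ (h Z.+ h) Z.* (K Z.+ o) ≡ h Z.+ (b Z.+ (h Z.+ h) Z.* (o Z.- M))
       at₂ = Z-solve

      flips-↭ : ∀ v -> All (\ a -> a .snd ≤ M N.+ M) v -> flips (map (\ a -> a .fst , K N.+ a .snd) v) ↭ concat (map Zw v)
      flips-↭ [] [] = Perm.refl
      flips-↭ ((i , o) ∷ v) (o≤ ∷ v≤) = Permₚ.++⁺ (flip-Zw i o o≤) (flips-↭ v v≤)

    -- Only sign vectors flipping an initial segment of each class survive, and all but finitely many of these segments are divisible by t^M.
    sign-sum-window : ∀ M K -> Div M (∑ (signs (letters (\ i -> + β i) n (K N.+ M))) (wt φ) - ∑ (choices (window K M) (downFrom n)) (\ v -> wt φ (concat (map (Zw K M) v))))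
    sign-sum-window M K = Div-resp (+-cong (sym (trans (collapse (wt φ) (wt-vanish φ) (l K M) (\ i -> base (+ β i) (L K M)) (downFrom n)) (≈-cong (\ ks -> ∑ (choices ks (downFrom n)) (\ v -> wt φ (flips K M v))) (upTo-window K M))))
      (-‿cong (trans (reindex K M (K N.+_) (window K M) (downFrom n)) (∑-cong-All (choices-snd (All.map Nₚ.≤-pred (Allₚ.all-upTo (suc (M N.+ M)))) (downFrom n)) (\ v v≤ -> wt-↭ φ (flips-↭ K M v v≤))))))
     (choices-restrict (_< n) (Bad K M) M (upTo K) (map (K N.+_) (window K M)) (applyUpTo (\ k -> K N.+ (suc (M N.+ M) N.+ k)) K)
      (All.map inj₁ (Allₚ.all-upTo K)) (Allₚ.applyUpTo⁺₁ _ K (bad-high K M)) (downFrom n) (downFrom-< n) (\ us i j vs i<n bad -> flips-Div K M us i j vs i<n bad))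

-- Duality of the two determinants and its consequence for the sums.

private module _ (R S : CRing) where
 open Kit S
 private module R = Kit R
 open Determinants S using (det; det-cong; det-transpose)
 module _ (𝔾 : Geom R) (𝕃 : LimitRing R 𝔾 S) where
  open Limits R S 𝔾 𝕃 hiding (module Products)
  private module FG = Geometric R 𝔾
  open Geom 𝔾
  open Divisible R t
  module Duality (m n : ℕ) (n≢0 : n ≢ 0) where

   κ : ℕ
   κ = m N.+ 2 N.* n N.+ 1

   h≢0 : 2 N.* n ≢ 0
   h≢0 e = n≢0 (Nₚ.m+n≡0⇒m≡0 n e)

   2n<κ : 2 N.* n < κ
   2n<κ = Nₚ.≤-trans (s≤s (Nₚ.m≤n+m (2 N.* n) m)) (Nₚ.≤-reflexive (Nₚ.+-comm 1 (m N.+ 2 N.* n)))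

   κ≢0 : κ ≢ 0
   κ≢0 e = Nₚ.<⇒≢ (Nₚ.≤-<-trans z≤n 2n<κ) (≡.sym e)

   module L = LittlewoodSide R S 𝔾 𝕃 m n h≢0
   module J = SignSide R S 𝔾 𝕃 κ n κ≢0 2n<κ

   private
    ∑<-reverse : ∀ k {f : ℕ -> Carrier} -> ∑< (suc k) f ≈ ∑< (suc k) (\ o -> f (k ∸ o))
    ∑<-reverse zero = refl
    ∑<-reverse (suc k) {f} = trans (∑<-snoc (suc k) {f}) (trans (+-comm _ _) (+-congˡ (∑<-reverse k {f})))

    symmetric : ∀ w (g : ℤ -> Carrier) -> ∑ (upTo (suc (w N.+ w))) (\ o -> g (+ o Z.- + w)) ≈ ∑ (upTo (suc (w N.+ w))) (\ o -> g (Z.- (+ o Z.- + w)))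
    symmetric w g = trans (∑-applyUpTo id (suc (w N.+ w))) (trans (∑<-reverse (w N.+ w) {\ o -> g (+ o Z.- + w)}) (trans (∑<-cong-< (suc (w N.+ w)) (\ o o< -> ≈-cong g (reflect o (Nₚ.≤-pred o<)))) (sym (∑-applyUpTo id (suc (w N.+ w))))))
     where
     lem : ∀ o d w -> o Z.+ d ≡ w Z.+ w -> d Z.- w ≡ Z.- (o Z.- w)
     lem o d w e = ≡.trans (l₁ o d w) (≡.trans (cong (\ z -> z Z.- (o Z.+ w)) e) (l₂ o w))
      where
      l₁ : ∀ o d w -> d Z.- w ≡ (o Z.+ d) Z.- (o Z.+ w)
      l₁ = Z-solve
      l₂ : ∀ o w -> (w Z.+ w) Z.- (o Z.+ w) ≡ Z.- (o Z.- w)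
      l₂ = Z-solve
     reflect : ∀ o -> o ≤ w N.+ w -> + ((w N.+ w) ∸ o) Z.- + w ≡ Z.- (+ o Z.- + w)
     reflect o o≤ = lem (+ o) (+ ((w N.+ w) ∸ o)) (+ w) (cong +_ (Nₚ.m+[n∸m]≡n o≤))

    difference : ∀ {A : Set} (os : List A) (a b : A -> ℤ) -> ∑ os (\ o -> τ (a o) * (τ (b o) - τ (Z.- b o))) ≈ ∑ os (\ o -> τ (a o Z.+ b o)) - ∑ os (\ o -> τ (a o Z.- b o))
    difference os a b = trans (∑-cong os (\ o -> trans (solve 3 (\ a b c -> a :* (b :- c) := a :* b :+ (:- (a :* c))) refl _ _ _) (+-cong (sym (τ-+ _ _)) (-‿cong (sym (τ-+ _ _))))))
     (trans (∑-+ os) (+-congˡ (∑-neg os)))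

   -- Both matrix entries are theta series with the same quadratic form.
   matrix-dual : ∀ w i j -> L.matrix w i j ≈ J.matrix w j i
   matrix-dual w i j = trans (difference os (\ o -> a₁ (r o)) (\ o -> b₁ (r o))) (trans (+-cong
     (∑-cong os (\ o -> ≈-cong τ (plus (+ i) (+ j) (+ n) (+ m) (r o))))
     -- The subtracted halves agree only after r is replaced by -r; the window is symmetric, so this
     -- permutes the terms.
     (-‿cong (trans (∑-cong os (\ o -> ≈-cong τ (minus (+ i) (+ j) (+ n) (+ m) (r o)))) (sym (symmetric w (\ r -> τ (a₂ r Z.- b₂ r)))))))
    (sym (difference os (\ o -> a₂ (r o)) (\ o -> b₂ (r o)))))
    where
    os = upTo (suc (w N.+ w))
    r : ℕ -> ℤ
    r o = + o Z.- + w
    h = 2 N.* n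
    a₁ b₁ a₂ b₂ : ℤ -> ℤ
    a₁ r = (+ (m N.+ 3) Z.+ + 2 Z.* + n Z.- + 2) Z.* (+ suc (2 N.* i) Z.* r Z.+ + h Z.* (r Z.* r))
    b₁ r = (+ suc (2 N.* i) Z.+ + (h N.+ h) Z.* r) Z.+ + j Z.* (+ suc (2 N.* i) Z.+ + (h N.+ h) Z.* r)
    a₂ r = (+ 2 Z.+ + 2 Z.* + n Z.- + 2) Z.* (+ (suc j N.+ suc j) Z.* r Z.+ + κ Z.* (r Z.* r))
    b₂ r = (+ suc j Z.+ + κ Z.* r) Z.+ + i Z.* (+ (suc j N.+ suc j) Z.+ + (κ N.+ κ) Z.* r)
    plus : ∀ i j n m r ->
     ((m Z.+ + 3) Z.+ + 2 Z.* n Z.- + 2) Z.* ((+ 1 Z.+ (i Z.+ (i Z.+ + 0))) Z.* r Z.+ (n Z.+ (n Z.+ + 0)) Z.* (r Z.* r)) Z.+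
     (((+ 1 Z.+ (i Z.+ (i Z.+ + 0))) Z.+ ((n Z.+ (n Z.+ + 0)) Z.+ (n Z.+ (n Z.+ + 0))) Z.* r) Z.+ j Z.* ((+ 1 Z.+ (i Z.+ (i Z.+ + 0))) Z.+ ((n Z.+ (n Z.+ + 0)) Z.+ (n Z.+ (n Z.+ + 0))) Z.* r))
     ≡ (+ 2 Z.+ + 2 Z.* n Z.- + 2) Z.* (((+ 1 Z.+ j) Z.+ (+ 1 Z.+ j)) Z.* r Z.+ ((m Z.+ (n Z.+ (n Z.+ + 0))) Z.+ + 1) Z.* (r Z.* r)) Z.+
     (((+ 1 Z.+ j) Z.+ ((m Z.+ (n Z.+ (n Z.+ + 0))) Z.+ + 1) Z.* r) Z.+ i Z.* (((+ 1 Z.+ j) Z.+ (+ 1 Z.+ j)) Z.+ (((m Z.+ (n Z.+ (n Z.+ + 0))) Z.+ + 1) Z.+ ((m Z.+ (n Z.+ (n Z.+ + 0))) Z.+ + 1)) Z.* r))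
    plus = Z-solve
    minus : ∀ i j n m r ->
     ((m Z.+ + 3) Z.+ + 2 Z.* n Z.- + 2) Z.* ((+ 1 Z.+ (i Z.+ (i Z.+ + 0))) Z.* r Z.+ (n Z.+ (n Z.+ + 0)) Z.* (r Z.* r)) Z.-
     (((+ 1 Z.+ (i Z.+ (i Z.+ + 0))) Z.+ ((n Z.+ (n Z.+ + 0)) Z.+ (n Z.+ (n Z.+ + 0))) Z.* r) Z.+ j Z.* ((+ 1 Z.+ (i Z.+ (i Z.+ + 0))) Z.+ ((n Z.+ (n Z.+ + 0)) Z.+ (n Z.+ (n Z.+ + 0))) Z.* r))
     ≡ (+ 2 Z.+ + 2 Z.* n Z.- + 2) Z.* (((+ 1 Z.+ j) Z.+ (+ 1 Z.+ j)) Z.* (Z.- r) Z.+ ((m Z.+ (n Z.+ (n Z.+ + 0))) Z.+ + 1) Z.* ((Z.- r) Z.* (Z.- r))) Z.-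
     (((+ 1 Z.+ j) Z.+ ((m Z.+ (n Z.+ (n Z.+ + 0))) Z.+ + 1) Z.* (Z.- r)) Z.+ i Z.* (((+ 1 Z.+ j) Z.+ (+ 1 Z.+ j)) Z.+ (((m Z.+ (n Z.+ (n Z.+ + 0))) Z.+ + 1) Z.+ ((m Z.+ (n Z.+ (n Z.+ + 0))) Z.+ + 1)) Z.* (Z.- r)))
    minus = Z-solve

   private
    det-dual : ∀ w -> det (L.matrix w) (downFrom n) (downFrom n) ≈ det (J.matrix w) (downFrom n) (downFrom n)
    det-dual w = trans (det-cong (matrix-dual w) (downFrom n) (downFrom n)) (det-transpose (\ i j -> J.matrix w j i) (downFrom n) (downFrom n) ≡.refl)

    -- Each side is the product of both constants `T̂`, a determinant of width M and one of width 0.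
    -- For every width the two matrices are transposes of each other.
    balance : ∀ M -> lim (\ K -> L.window-sum M K R.* J.term (K N.+ M)) ≈ lim (\ K -> J.window-sum M K R.* L.term (K N.+ M))
    balance M = begin
     lim (\ K -> L.window-sum M K R.* J.term (K N.+ M)) ≈⟨ trans (lim-* _ _) (*-cong (L.window-limit M) (trans (J.term-limit M) J.Tm-det)) ⟩
     (L.T̂ (downFrom n) * DL M) * (J.T̂ (downFrom n) * DJ 0) ≈⟨ *-cong (*-congˡ (det-dual M)) (*-congˡ (sym (det-dual 0))) ⟩
     (L.T̂ (downFrom n) * DJ M) * (J.T̂ (downFrom n) * DL 0) ≈⟨ solve 4 (\ a b c d -> (a :* b) :* (c :* d) := (c :* b) :* (a :* d)) refl _ _ _ _ ⟩
     (J.T̂ (downFrom n) * DJ M) * (L.T̂ (downFrom n) * DL 0) ≈⟨ trans (lim-* _ _) (*-cong (J.window-limit M) (trans (L.term-limit M) L.Tm-det)) ⟨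
     lim (\ K -> J.window-sum M K R.* L.term (K N.+ M)) ∎
     where
     DL DJ : ℕ -> Carrier
     DL w = det (L.matrix w) (downFrom n) (downFrom n)
     DJ w = det (J.matrix w) (downFrom n) (downFrom n)

   open Theta R S 𝔾 𝕃 (2 N.* n) h≢0 using () renaming (P to P₁; P≢0 to P₁≢0)
   open Theta R S 𝔾 𝕃 κ κ≢0 using () renaming (P to P₂)
   module CL = ClassLetters R S 𝔾 𝕃 (2 N.* n) h≢0 using (base; letters; letters-Good; module Approximation)
   module CJ = ClassLetters R S 𝔾 𝕃 κ κ≢0 using (base; letters; letters-Good; module Approximation)
   open HallLittlewood R (FG.ℕ-alphabet P₁ P₁≢0) using (Fsum; Distinct)
   open SignSums R 𝔾 (t R.^ P₂) using (φτ; τ-prod; sign-sum)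
   private
    module LW = Littlewood R 𝔾 P₁ P₁≢0

   X : ℕ -> List ℤ
   X = CL.letters (\ i -> + suc (2 N.* i)) n

   Y : ℕ -> List ℤ
   Y = CJ.letters (\ i -> + (suc i N.+ suc i)) n

   F : ℕ -> R.Carrier
   F L = Fsum m (map Z.∣_∣ (X L))

   -- The closed form (t^κ;t^(2κ)) of the second sign sum, with as many factors as there are
   -- letters.
   C : ℕ -> R.Carrier
   C L = τ-prod (t R.^ κ) (length (Y L))

   private
    ∣∣-distinct : ∀ a b -> a ⟂ b -> Z.∣ a ∣ ≢ Z.∣ b ∣
    ∣∣-distinct (+ _) (+ _) (p , _) e = p (cong +_ e)
    ∣∣-distinct (+ _) -[1+ _ ] (_ , q) e = q (cong +_ e)
    ∣∣-distinct -[1+ _ ] (+ _) (_ , q) e = q (cong (\ x -> Z.- (+ x)) e)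
    ∣∣-distinct -[1+ _ ] -[1+ _ ] (p , _) e = p (cong (\ x -> Z.- (+ x)) e)

   X-admissible : ∀ L -> LW.Admissible (map Z.∣_∣ (X L))
   X-admissible L = Allₚ.map⁺ (All.map (\ ne e -> ne (Zₚ.∣i∣≡0⇒i≡0 e)) (Good.nonzero g)) , AllPairsₚ.map⁺ (AllPairs.map (\ {a} {b} -> ∣∣-distinct a b) (Good.apart g))
    where g = CL.letters-Good L.classes L

   private
    H-Div : ∀ k -> Div 1 (FG.H -[1+ k ])
    H-Div k = Div-resp (R.solve 1 (\ g -> (R.:- R.1ₚ) R.:* (g R.:- R.1ₚ) R.:= R.1ₚ R.:- g) R.refl (geo k))
     (Div-*ˡ (R.- R.1#) (Div-≤ {suc k} (s≤s z≤n) (Div-resp (FG.t-H (suc k) (\ ())) (_ , R.refl))))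

    -- The Littlewood identity concerns the positive letters |z|. Sign changes of |z| and of z give
    -- the same set of vectors, so the sum may be taken over classes that contain negative
    -- exponents.
    F-approx : ∀ M K -> Div M (F (K N.+ M) R.- L.window-sum M K)
    F-approx M K = Div-resp (R.+-congʳ (R.sym (R.trans (LW.littlewood m (map Z.∣_∣ (X (K N.+ M))) (X-admissible (K N.+ M)))
      (R.trans (R.≈-cong (\ zs -> R.∑ (signs zs) (wt (LW.W m))) (≡.sym (Lₚ.map-∘ (X (K N.+ M))))) (signs-abs R (X (K N.+ M)))))))
     (CL.Approximation.sign-sum-window (LW.W m) (\ k -> Div-*ʳ _ (H-Div k)) (\ i -> suc (2 N.* i)) n bound M K)
     where
     open SignSums R 𝔾 (t R.^ P₁) using (wt)
     bound : ∀ {i} -> i < n -> suc (2 N.* i) < 2 N.* n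
     bound {i} i<n = Nₚ.≤-trans (Nₚ.≤-reflexive (lem i)) (Nₚ.*-monoʳ-≤ 2 i<n)
      where
      lem : ∀ i -> 2 N.+ 2 N.* i ≡ 2 N.* (1 N.+ i)
      lem = N-solve

    C-approx : ∀ M K -> Div M (C (K N.+ M) R.- J.window-sum M K)
    C-approx M K = Div-resp (R.+-congʳ (sign-sum (t R.^ κ) (Y (K N.+ M)) (CJ.letters-Good J.classes (K N.+ M))))
     (CJ.Approximation.sign-sum-window J.φ φ-Div (\ i -> suc i N.+ suc i) n bound M K)
     where
     φ-Div : ∀ k -> Div 1 (J.φ -[1+ k ])
     φ-Div k = Div-+ (Div-*ˡ (R.1# R.+ t R.^ κ) (H-Div k)) (Div-resp (R.solve 1 (\ u -> (R.:- R.1ₚ) R.:* u R.:= R.:- u) R.refl (t R.^ κ))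
      (Div-*ˡ (R.- R.1#) (Div-≤ (Nₚ.≤-trans (s≤s z≤n) 2n<κ) (Div-resp (R.*-identityʳ (t R.^ κ)) (R.1# , R.refl)))))
     bound : ∀ {i} -> i < n -> suc i N.+ suc i < κ
     bound i<n = Nₚ.≤-<-trans (Nₚ.≤-trans (Nₚ.+-mono-≤ i<n i<n) (Nₚ.≤-reflexive (lem n))) 2n<κ
      where
      lem : ∀ n -> n N.+ n ≡ 2 N.* n
      lem = N-solve

   -- For every M both sums agree modulo t^M with their windows. Multiplied by the centred term of
   -- the opposite side, these have equal limits by `balance`.
   duality : lim (\ L -> F L R.* J.term L) ≈ lim (\ L -> C L R.* L.term L)
   duality = lim-approx id (\ M K -> L.window-sum M K R.* J.term (K N.+ M)) (\ M K -> J.window-sum M K R.* L.term (K N.+ M)) balance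
    (\ M K -> Div-resp (factor _ _ _) (Div-*ʳ (J.term (K N.+ M)) (F-approx M K)))
    (\ M K -> Div-resp (factor _ _ _) (Div-*ʳ (L.term (K N.+ M)) (C-approx M K)))
    where
    factor : ∀ a b c -> (a R.- b) R.* c R.≈ a R.* c R.- b R.* c
    factor a b c = R.solve 3 (\ a b c -> (a R.:- b) R.:* c R.:= a R.:* c R.:- b R.:* c) R.refl a b c

-- Evaluation of the centred terms as infinite products.

private module _ (R S : CRing) where
 open Kit S
 private module R = Kit R
 module InfiniteProducts (𝔾 : Geom R) (𝕃 : LimitRing R 𝔾 S) where
  open Limits R S 𝔾 𝕃
  private
   module FG = Geometric R 𝔾

  -- 1 / (t^α ; t^β)_∞
  rpoch : ℕ -> ℕ -> Carrier
  rpoch α β = lim (\ K -> R.∏< K (\ k -> FG.H (+ (α N.+ β N.* k))))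

  pos-at : ∀ α β k -> + (α N.+ β N.* k) ≡ + α Z.+ + β Z.* + k
  pos-at α β k = cong (\ z -> + α Z.+ z) (Zₚ.pos-* β k)

  rpoch-len : ∀ α β -> β ≢ 0 -> (len : ℕ -> ℕ) -> (∀ K -> K ≤ len K) -> lim (\ K -> R.∏< (len K) (\ k -> FG.H (+ (α N.+ β N.* k)))) ≈ rpoch α β
  rpoch-len α β β≢0 len big = begin
   lim (\ K -> R.∏< (len K) f) ≈⟨ lim-pointwise (\ K -> R.trans (R.≈-cong (\ l -> R.∏< l f) (≡.sym (Nₚ.m+[n∸m]≡n (big K)))) (R.∏<-++ K (len K ∸ K))) ⟩
   lim (\ K -> R.∏< K f R.* R.∏< (len K ∸ K) (\ k -> f (K N.+ k))) ≈⟨ lim-* _ _ ⟩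
   rpoch α β * lim (\ K -> R.∏< (len K ∸ K) (\ k -> f (K N.+ k)))
    ≈⟨ *-congˡ (Tends-∏ Tends-H (\ K -> len K ∸ K) id (\ K k -> + (α N.+ β N.* (K N.+ k))) (\ M K k M≤K -> Z.+≤+ (Nₚ.≤-trans M≤K (Nₚ.≤-trans (Nₚ.m≤m+n K k) (Nₚ.≤-trans (Nₚ.m≤n*m (K N.+ k) β {{N.≢-nonZero β≢0}}) (Nₚ.m≤n+m (β N.* (K N.+ k)) α)))))) ⟩
   rpoch α β * 1# ≈⟨ *-identityʳ _ ⟩
   rpoch α β ∎
   where
   f : ℕ -> R.Carrier
   f k = FG.H (+ (α N.+ β N.* k))

  rpoch-rec : ∀ α β -> β ≢ 0 -> rpoch α β ≈ H (+ α) * rpoch (α N.+ β) β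
  rpoch-rec α β β≢0 = trans (sym (rpoch-len α β β≢0 suc (\ K -> Nₚ.n≤1+n K))) (trans (lim-* _ _) (*-cong (ι-cong (R.≈-cong (\ z -> FG.H (+ z)) (lem₀ α β)))
   (lim-pointwise (\ K -> R.∏<-cong K (\ k -> R.≈-cong (\ z -> FG.H (+ z)) (lem α β k))))))
   where
   lem₀ : ∀ α β -> α N.+ β N.* 0 ≡ α
   lem₀ = N-solve
   lem : ∀ α β k -> α N.+ β N.* (1 N.+ k) ≡ (α N.+ β) N.+ β N.* k
   lem = N-solve

  rpoch-recs : ∀ α β -> β ≢ 0 -> ∀ l -> rpoch α β ≈ ∏< l (\ k -> H (+ (α N.+ β N.* k))) * rpoch (α N.+ β N.* l) β
  rpoch-recs α β β≢0 zero = trans (≈-cong (\ z -> rpoch z β) (lem α β)) (sym (*-identityˡ _))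
   where
   lem : ∀ α β -> α ≡ α N.+ β N.* 0
   lem = N-solve
  rpoch-recs α β β≢0 (suc l) = begin
   rpoch α β ≈⟨ rpoch-recs α β β≢0 l ⟩
   ∏< l (\ k -> H (+ (α N.+ β N.* k))) * rpoch (α N.+ β N.* l) β ≈⟨ *-congˡ (trans (rpoch-rec (α N.+ β N.* l) β β≢0) (*-congˡ (≈-cong (\ z -> rpoch z β) (lem α β l)))) ⟩
   ∏< l (\ k -> H (+ (α N.+ β N.* k))) * (H (+ (α N.+ β N.* l)) * rpoch (α N.+ β N.* suc l) β) ≈⟨ trans (sym (*-assoc _ _ _)) (*-congʳ (sym (∏<-snoc l))) ⟩
   ∏< (suc l) (\ k -> H (+ (α N.+ β N.* k))) * rpoch (α N.+ β N.* suc l) β ∎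
   where
   lem : ∀ α β l -> (α N.+ β N.* l) N.+ β ≡ α N.+ β N.* (1 N.+ l)
   lem = N-solve

  rpoch-merge : ∀ α β -> β ≢ 0 -> rpoch α (β N.+ β) * rpoch (α N.+ β) (β N.+ β) ≈ rpoch α β
  rpoch-merge α β β≢0 = trans (sym (lim-* _ _)) (trans (lim-pointwise (\ K -> R.sym (R.trans (even-odd K) (R.*-cong
    (R.∏<-cong K (\ k -> R.≈-cong (\ z -> FG.H (+ z)) (lem α β k))) (R.∏<-cong K (\ k -> R.≈-cong (\ z -> FG.H (+ z)) (lem′ α β k)))))))
   (rpoch-len α β β≢0 (\ K -> K N.+ K) (\ K -> Nₚ.m≤m+n K K)))
   where
   lem : ∀ α β k -> α N.+ β N.* (k N.+ k) ≡ α N.+ (β N.+ β) N.* k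
   lem = N-solve
   lem′ : ∀ α β k -> α N.+ β N.* (1 N.+ (k N.+ k)) ≡ (α N.+ β) N.+ (β N.+ β) N.* k
   lem′ = N-solve
   even-odd : ∀ K {f} -> R.∏< (K N.+ K) f R.≈ R.∏< K (\ k -> f (k N.+ k)) R.* R.∏< K (\ k -> f (suc (k N.+ k)))
   even-odd zero = R.sym (R.*-identityˡ _)
   even-odd (suc K) {f} = R.trans (R.*-congˡ (R.≈-cong (\ l -> R.∏< l (\ k -> f (suc k))) (Nₚ.+-suc K K))) (R.trans (R.*-congˡ (R.*-congˡ (even-odd K)))
    (R.trans (R.solve 4 (\ a b c d -> a R.:* (b R.:* (c R.:* d)) R.:= (a R.:* c) R.:* (b R.:* d)) R.refl _ _ _ _)
     (R.*-cong (R.*-congˡ (R.∏<-cong K (\ k -> R.≈-cong (\ z -> f (suc z)) (≡.sym (Nₚ.+-suc k k))))) (R.*-congˡ (R.∏<-cong K (\ k -> R.≈-cong (\ z -> f (suc (suc z))) (≡.sym (Nₚ.+-suc k k))))))))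

  module _ {β : ℕ} (β≢0 : β ≢ 0) where
   open Products β β≢0 using (fprod; at)

   fprod-rpoch : ∀ α -> fprod FG.H (+ α) ≈ rpoch α β
   fprod-rpoch α = lim-pointwise (\ K -> R.∏<-cong K (\ k -> R.≈-cong FG.H (≡.sym (pos-at α β k))))

private module _ (R S : CRing) where
 open Kit S
 private module R = Kit R
 module _ (𝔾 : Geom R) (𝕃 : LimitRing R 𝔾 S) where
  open Limits R S 𝔾 𝕃
  open InfiniteProducts R S 𝔾 𝕃
  private module FG = Geometric R 𝔾
  open Geom 𝔾
  module LittlewoodTerm (m n : ℕ) (h≢0 : 2 N.* n ≢ 0) where
   private
    module L = LittlewoodSide R S 𝔾 𝕃 m n h≢0 using (term)
    module Θ = Theta R S 𝔾 𝕃 (2 N.* n) h≢0 using (P; P≢0; ap; ap-snoc; G-H; wt-↭)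
    h = 2 N.* n
   open Products 2 (\ ()) using (ap; at; at-0; at-suc; ap-++; ap-snoc; ∏-ap; NZ⁺; dbl) renaming (pairs-limit to pairs₂-limit; G-H to G₂-H; ap-All to ap₂-All)
   open Littlewood R 𝔾 Θ.P Θ.P≢0 using (W)
   open SignSums R 𝔾 (t R.^ Θ.P) using (G; pairs)
   open SignSums R 𝔾 (t R.^ 2) using () renaming (G to G₂; pairs to pairs₂)

   private
    β : ℕ -> ℤ
    β i = + suc (2 N.* i)

    block : ℤ -> ℕ -> List ℤ
    block c n = concat (map (\ i -> (c Z.- β i) ∷ (c Z.+ β i) ∷ []) (downFrom n))

    block-↭ : ∀ c n -> block c n ↭ ap (c Z.- (+ 2 Z.* + n Z.- + 1)) (2 N.* n)
    block-↭ c zero = Perm.refl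
    block-↭ c (suc n) = ↭-trans (prep _ (↭-trans (Permₚ.∷↭∷ʳ (c Z.+ β n) (block c n)) (Permₚ.++⁺ʳ _ (block-↭ c n)))) (Perm.↭-reflexive (≡.sym eq))
     where
     l₁ : ∀ c n -> c Z.- (+ 2 Z.* (+ 1 Z.+ n) Z.- + 1) ≡ c Z.- (+ 1 Z.+ (n Z.+ (n Z.+ + 0)))
     l₁ = Z-solve
     l₂ : ∀ c n -> (c Z.- (+ 2 Z.* (+ 1 Z.+ n) Z.- + 1)) Z.+ + 2 ≡ c Z.- (+ 2 Z.* n Z.- + 1)
     l₂ = Z-solve
     l₃ : ∀ c n -> (c Z.- (+ 2 Z.* n Z.- + 1)) Z.+ + 2 Z.* (n Z.+ (n Z.+ + 0)) ≡ c Z.+ (+ 1 Z.+ (n Z.+ (n Z.+ + 0)))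
     l₃ = Z-solve
     l₄ : ∀ n -> 2 N.* (1 N.+ n) ≡ 1 N.+ (1 N.+ 2 N.* n)
     l₄ = N-solve
     eq : ap (c Z.- (+ 2 Z.* + suc n Z.- + 1)) (2 N.* suc n) ≡ (c Z.- β n) ∷ (ap (c Z.- (+ 2 Z.* + n Z.- + 1)) (2 N.* n) ++ (c Z.+ β n) ∷ [])
     eq = ≡.trans (cong (ap _) (l₄ n)) (cong₂ _∷_ (l₁ c (+ n)) (≡.trans (cong (\ z -> ap z (suc (2 N.* n))) (l₂ c (+ n))) (≡.trans (ap-snoc _ (2 N.* n)) (cong (\ z -> ap (c Z.- (+ 2 Z.* + n Z.- + 1)) (2 N.* n) ++ z ∷ []) (l₃ c (+ n))))))

    Cat : ℕ -> List ℕ -> List ℤ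
    Cat L is = concat (map (\ i -> Θ.ap (+ h Z.- β i) L ++ Θ.ap (+ h Z.+ β i) L) is)

    interchange : ∀ (a b c d : List ℤ) -> (a ++ b) ++ (c ++ d) ↭ (a ++ c) ++ (b ++ d)
    interchange a b c d = ↭-trans (Perm.↭-reflexive (Lₚ.++-assoc a b (c ++ d))) (↭-trans (Permₚ.++⁺ˡ a (↭-trans (Perm.↭-reflexive (≡.sym (Lₚ.++-assoc b c d)))
     (↭-trans (Permₚ.++⁺ʳ d (Permₚ.++-comm b c)) (Perm.↭-reflexive (Lₚ.++-assoc c b d))))) (Perm.↭-reflexive (≡.sym (Lₚ.++-assoc a c (b ++ d)))))

    Cat-suc : ∀ L is -> Cat (suc L) is ↭ Cat L is ++ concat (map (\ i -> ((+ h Z.+ + Θ.P Z.* + L) Z.- β i) ∷ ((+ h Z.+ + Θ.P Z.* + L) Z.+ β i) ∷ []) is)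
    Cat-suc L [] = Perm.refl
    Cat-suc L (i ∷ is) = ↭-trans (Permₚ.++⁺ one (Cat-suc L is)) (interchange (Θ.ap (+ h Z.- β i) L ++ Θ.ap (+ h Z.+ β i) L) _ (Cat L is) _)
     where
     l₁ : ∀ h b p -> (h Z.- b) Z.+ p ≡ (h Z.+ p) Z.- b
     l₁ = Z-solve
     l₂ : ∀ h b p -> (h Z.+ b) Z.+ p ≡ (h Z.+ p) Z.+ b
     l₂ = Z-solve
     one : Θ.ap (+ h Z.- β i) (suc L) ++ Θ.ap (+ h Z.+ β i) (suc L) ↭ (Θ.ap (+ h Z.- β i) L ++ Θ.ap (+ h Z.+ β i) L) ++ (((+ h Z.+ + Θ.P Z.* + L) Z.- β i) ∷ ((+ h Z.+ + Θ.P Z.* + L) Z.+ β i) ∷ [])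
     one = ↭-trans (Perm.↭-reflexive (cong₂ _++_ (≡.trans (Θ.ap-snoc _ L) (cong (\ z -> Θ.ap (+ h Z.- β i) L ++ z ∷ []) (l₁ (+ h) (β i) (+ Θ.P Z.* + L)))) (≡.trans (Θ.ap-snoc _ L) (cong (\ z -> Θ.ap (+ h Z.+ β i) L ++ z ∷ []) (l₂ (+ h) (β i) (+ Θ.P Z.* + L))))))
      (interchange (Θ.ap (+ h Z.- β i) L) _ (Θ.ap (+ h Z.+ β i) L) _)

   -- The residues 2n ± (2i+1) with i < n are all odd residues modulo 4n, so the centred term runs
   -- through the first 2nL odd numbers.
   classes-↭ : ∀ L -> Cat L (downFrom n) ↭ ap (+ 1) (L N.* h)
   classes-↭ zero = Perm.↭-reflexive (empty (downFrom n))
    where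
    empty : ∀ is -> Cat 0 is ≡ []
    empty [] = ≡.refl
    empty (i ∷ is) = empty is
   classes-↭ (suc L) = ↭-trans (Cat-suc L (downFrom n)) (↭-trans (Permₚ.++⁺ (classes-↭ L) (block-↭ (+ h Z.+ + Θ.P Z.* + L) n))
    (Perm.↭-reflexive (≡.sym (≡.trans (cong (ap (+ 1)) (Nₚ.+-comm h (L N.* h))) (≡.trans (ap-++ (+ 1) (L N.* h) h) (cong (\ z -> ap (+ 1) (L N.* h) ++ ap z h) (≡.trans (cong (\ z -> + 1 Z.+ + 2 Z.* z) (Zₚ.pos-* L h)) (lem (+ n) (+ L)))))))))
    where
    lem : ∀ n L -> + 1 Z.+ + 2 Z.* (L Z.* (n Z.+ (n Z.+ + 0))) ≡ ((n Z.+ (n Z.+ + 0)) Z.+ ((n Z.+ (n Z.+ + 0)) Z.+ (n Z.+ (n Z.+ + 0))) Z.* L) Z.- (+ 2 Z.* n Z.- + 1)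
    lem = Z-solve

   private
    -- Because P = 2h, the quotient (1 - t^(e+P))/(1 - t^e) is a telescoping product of h quotients
    -- in steps of 2. For step 2 the odd letters form one progression, and `pairs₂-limit` applies.
    G-factor : ∀ e -> 0 < e -> G (+ e) R.≈ R.∏< h (\ s -> G₂ (+ (e N.+ 2 N.* s)))
    G-factor e 0<e = R.unit-cancel {d = R.1# R.- t R.^ (e N.+ Θ.P)} (R.trans (R.*-comm _ _) (FG.H-inv (e N.+ Θ.P) eP≢0)) (R.begin
     FG.H (+ (e N.+ Θ.P)) R.* G (+ e) R.≈⟨ R.trans (R.*-comm _ _) (Θ.G-H (+ e) (pos≢0 0<e) (\ q -> eP≢0 (Zₚ.+-injective q))) ⟩
     FG.H (+ e) R.≈⟨ chain h ⟨
     R.∏< h (\ s -> G₂ (+ (e N.+ 2 N.* s))) R.* FG.H (+ (e N.+ 2 N.* h)) R.≈⟨ R.trans (R.*-congˡ (R.≈-cong (\ z -> FG.H (+ (e N.+ z))) (lem h))) (R.*-comm _ _) ⟩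
     FG.H (+ (e N.+ Θ.P)) R.* R.∏< h (\ s -> G₂ (+ (e N.+ 2 N.* s))) R.∎)
     where
     pos≢0 : ∀ {x} -> 0 < x -> + x ≢ + 0
     pos≢0 lt q = Nₚ.<⇒≢ lt (≡.sym (Zₚ.+-injective q))
     eP≢0 : e N.+ Θ.P ≢ 0
     eP≢0 q = Nₚ.<⇒≢ 0<e (≡.sym (Nₚ.m+n≡0⇒m≡0 e q))
     lem : ∀ h -> 2 N.* h ≡ h N.+ h
     lem = N-solve
     lem₂ : ∀ e k -> (e N.+ 2 N.* k) N.+ 2 ≡ e N.+ 2 N.* (1 N.+ k)
     lem₂ = N-solve
     chain : ∀ k -> R.∏< k (\ s -> G₂ (+ (e N.+ 2 N.* s))) R.* FG.H (+ (e N.+ 2 N.* k)) R.≈ FG.H (+ e)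
     chain zero = R.trans (R.*-identityˡ _) (R.≈-cong (\ z -> FG.H (+ z)) (Nₚ.+-identityʳ e))
     chain (suc k) = R.trans (R.*-congʳ (R.∏<-snoc k)) (R.trans (R.*-assoc _ _ _) (R.trans (R.*-congˡ (R.trans (R.*-congˡ (R.≈-cong (\ z -> FG.H (+ z)) (≡.sym (lem₂ e k))))
      (G₂-H (+ (e N.+ 2 N.* k)) (pos≢0 (Nₚ.<-≤-trans 0<e (Nₚ.m≤m+n e _))) (pos≢0 (Nₚ.<-≤-trans 0<e (Nₚ.≤-trans (Nₚ.m≤m+n e (2 N.* k)) (Nₚ.m≤m+n (e N.+ 2 N.* k) 2))))))) (chain k)))

    Positive : ℤ -> Set
    Positive z = ∃[ k ] (z ≡ + suc k)

    shift : ℕ -> List ℤ -> List ℤ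
    shift s = map (\ z -> z Z.+ + s)

    -- Raising the sum of two letters by 2s amounts to raising each letter by s.
    pairs-factor : ∀ zs -> All Positive zs -> pairs zs R.≈ R.∏< h (\ s -> pairs₂ (shift s zs))
    pairs-factor [] [] = R.sym (R.∏<-1 h (\ _ _ -> R.refl))
    pairs-factor (z ∷ zs) ((k , ≡.refl) ∷ pos) = R.trans (R.*-cong (R.trans (R.∏-cong-All pos factor) (∏-∏< zs)) (pairs-factor zs pos))
     (R.trans (R.sym (R.∏<-* h)) (R.∏<-cong h (\ s -> R.*-congʳ (R.sym (R.∏-map (\ z -> z Z.+ + s) zs)))))
     where
     lem : ∀ x y s -> (x Z.+ y) Z.+ + 2 Z.* s ≡ (x Z.+ s) Z.+ (y Z.+ s)
     lem = Z-solve
     factor : ∀ y -> Positive y -> G (z Z.+ y) R.≈ R.∏< h (\ s -> G₂ ((z Z.+ + s) Z.+ (y Z.+ + s)))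
     factor y (l , ≡.refl) = R.trans (G-factor (suc k N.+ suc l) (s≤s z≤n)) (R.∏<-cong h (\ s -> R.≈-cong G₂ (≡.trans (pos-at (suc k N.+ suc l) 2 s) (lem (+ suc k) (+ suc l) (+ s)))))
     ∏-∏< : ∀ {f : ℕ -> ℤ -> R.Carrier} ys -> R.∏ ys (\ y -> R.∏< h (\ s -> f s y)) R.≈ R.∏< h (\ s -> R.∏ ys (f s))
     ∏-∏< [] = R.sym (R.∏<-1 h (\ _ _ -> R.refl))
     ∏-∏< (y ∷ ys) = R.trans (R.*-congˡ (∏-∏< ys)) (R.sym (R.∏<-* h))

    shift-ap : ∀ s a l -> shift s (ap a l) ≡ ap (a Z.+ + s) l
    shift-ap s a zero = ≡.refl
    shift-ap s a (suc l) = cong (a Z.+ + s ∷_) (≡.trans (shift-ap s (a Z.+ + 2) l) (cong (\ z -> ap z l) (lem a (+ s))))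
     where
     lem : ∀ a s -> (a Z.+ + 2) Z.+ s ≡ (a Z.+ s) Z.+ + 2
     lem = Z-solve

    N : ℕ -> ℕ
    N L = L N.* h

    N-big : ∀ L -> L ≤ N L
    N-big L = Nₚ.m≤m*n L h {{N.≢-nonZero h≢0}}

    lim-∏< : ∀ l {f : ℕ -> ℕ -> R.Carrier} -> lim (\ K -> R.∏< l (\ s -> f s K)) ≈ ∏< l (\ s -> lim (f s))
    lim-∏< zero = lim-1
    lim-∏< (suc l) = trans (lim-* _ _) (*-congˡ (lim-∏< l))

    odd-pairs : ∀ s -> lim (\ L -> pairs₂ (ap (+ suc s) (N L))) ≈ rpoch (4 N.+ 2 N.* s) 4
    odd-pairs s = trans (pairs₂-limit (+ suc s) N N-big (\ k q -> contra (≡.trans (pos-at (suc s N.+ suc s) 2 k) q)))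
     (trans (lim-pointwise (\ L -> R.∏<-cong (N L) (\ k -> R.≈-cong FG.H (≡.trans (lem (+ s) (+ k)) (≡.sym (pos-at (4 N.+ 2 N.* s) 4 k)))))) (rpoch-len (4 N.+ 2 N.* s) 4 (\ ()) N N-big))
     where
     contra : ∀ {x} -> + suc x ≢ + 0
     contra ()
     lem : ∀ s k -> (((+ 1 Z.+ s) Z.+ + 2 Z.* k) Z.+ ((+ 1 Z.+ s) Z.+ + 2 Z.* k)) Z.+ + 2 ≡ (+ 4 Z.+ (s Z.+ (s Z.+ + 0))) Z.+ + 4 Z.* k
     lem = Z-solve

   -- The letters themselves give 1/(t;t^2)_∞. The s-th shifted pair product gives
   -- 1/(t^(4+2s);t^4)_∞, and the cases s = 2l and s = 2l + 1 merge into step 2.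
   term-value : lim L.term ≈ rpoch 1 2 * ∏< n (\ l -> rpoch (4 N.+ 4 N.* l) 2)
   term-value = begin
    lim L.term ≈⟨ lim-pointwise (\ L -> R.trans (Θ.wt-↭ (W m) (classes-↭ L)) (R.*-cong (R.trans (∏-ap (W m) (+ 1) (N L)) (R.∏<-cong (N L) (\ k -> R.≈-cong (W m) (≡.sym (pos-at 1 2 k)))))
      (R.trans (pairs-factor (ap (+ 1) (N L)) (ap₂-All (+ 1) (N L) (\ k _ -> 2 N.* k , ≡.sym (pos-at 1 2 k)))) (R.∏<-cong h (\ s -> R.≈-cong pairs₂ (shift-ap s (+ 1) (N L))))))) ⟩
    lim (\ L -> R.∏< (N L) (\ k -> FG.H (+ (1 N.+ 2 N.* k))) R.* R.∏< h (\ s -> pairs₂ (ap (+ suc s) (N L)))) ≈⟨ trans (lim-* _ _) (*-cong (rpoch-len 1 2 (\ ()) N N-big) (lim-∏< h)) ⟩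
    rpoch 1 2 * ∏< h (\ s -> lim (\ L -> pairs₂ (ap (+ suc s) (N L)))) ≈⟨ *-congˡ (trans (∏<-cong h odd-pairs) (double n)) ⟩
    rpoch 1 2 * ∏< n (\ l -> rpoch (4 N.+ 4 N.* l) 2) ∎
    where
    double : ∀ n -> ∏< (2 N.* n) (\ s -> rpoch (4 N.+ 2 N.* s) 4) ≈ ∏< n (\ l -> rpoch (4 N.+ 4 N.* l) 2)
    double zero = refl
    double (suc n) = trans (≈-cong (\ k -> ∏< k (\ s -> rpoch (4 N.+ 2 N.* s) 4)) (l₄ n)) (trans (∏<-snoc (suc (2 N.* n)) {\ s -> rpoch (4 N.+ 2 N.* s) 4}) (trans (*-congʳ (∏<-snoc (2 N.* n) {\ s -> rpoch (4 N.+ 2 N.* s) 4}))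
     (trans (*-assoc _ _ _) (trans (*-cong (double n) (trans (*-cong (≈-cong (\ z -> rpoch z 4) (l₁ n)) (≈-cong (\ z -> rpoch z 4) (l₂ n))) (rpoch-merge (4 N.+ 4 N.* n) 2 (\ ())))) (sym (∏<-snoc n {\ l -> rpoch (4 N.+ 4 N.* l) 2}))))))
     where
     l₄ : ∀ n -> 2 N.* (1 N.+ n) ≡ 1 N.+ (1 N.+ 2 N.* n)
     l₄ = N-solve
     l₁ : ∀ n -> 4 N.+ 2 N.* (2 N.* n) ≡ 4 N.+ 4 N.* n
     l₁ = N-solve
     l₂ : ∀ n -> 4 N.+ 2 N.* (1 N.+ 2 N.* n) ≡ (4 N.+ 4 N.* n) N.+ 2
     l₂ = N-solve

-- The two sides of the product formula, with f α β in place of (t^α ; t^β)_∞ and P = 2κ.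
private module ProductSides (R : CRing) (f : ℕ -> ℕ -> CommutativeRing.Carrier R) where
 open Kit R

 θ : ℕ -> ℕ -> Carrier
 θ α β = f α β * f (β ∸ α) β

 θ₂ : ℕ -> ℕ -> ℕ -> Carrier
 θ₂ P j i = θ (2 N.* (suc j ∸ suc i)) P * θ (2 N.* (suc i N.+ suc j)) P

 numerator : ℕ -> ℕ -> ℕ -> Carrier
 numerator κ P n = f P P ^ (n ∸ 1) * f κ κ * ∏< n (\ i -> θ (2 N.* suc i) κ) * ∏< n (\ j -> ∏< j (θ₂ P j))

 denominator : ℕ -> Carrier
 denominator n = f 2 2 ^ (n ∸ 1) * f 1 1

private module _ (R : CRing) where
 open Kit R
 module InverseSides (f g : ℕ -> ℕ -> Carrier) (inverse : ∀ α β -> 0 < α -> f α β * g α β ≈ 1#) where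
  private
   module f = ProductSides R f
   module g = ProductSides R g

   one : ∀ {a b c d} -> a * b ≈ 1# -> c * d ≈ 1# -> (a * c) * (b * d) ≈ 1#
   one {a} {b} {c} {d} e e′ = trans (solve 4 (\ a b c d -> (a :* c) :* (b :* d) := (a :* b) :* (c :* d)) refl a b c d) (trans (*-cong e e′) (*-identityˡ _))

   one^ : ∀ {a b} -> a * b ≈ 1# -> ∀ n -> a ^ n * b ^ n ≈ 1#
   one^ e zero = *-identityˡ _
   one^ e (suc n) = one e (one^ e n)

   one< : ∀ n {x y : ℕ -> Carrier} -> (∀ k -> k < n -> x k * y k ≈ 1#) -> ∏< n x * ∏< n y ≈ 1#
   one< n e = trans (sym (∏<-* n)) (∏<-1 n e)

   θ-one : ∀ α β -> 0 < α -> α < β -> f.θ α β * g.θ α β ≈ 1#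
   θ-one α β 0<α α<β = one (inverse α β 0<α) (inverse (β ∸ α) β (Nₚ.m<n⇒0<n∸m α<β))

  numerator-inverse : ∀ κ n -> 2 N.* n < κ -> f.numerator κ (κ N.+ κ) n * g.numerator κ (κ N.+ κ) n ≈ 1#
  numerator-inverse κ n 2n<κ = one (one (one (one^ (inverse P P (Nₚ.≤-trans 0<κ (Nₚ.m≤m+n κ κ))) (n ∸ 1)) (inverse κ κ 0<κ)) (one< n (\ i i<n -> θ-one _ κ (s≤s z≤n) (Nₚ.≤-<-trans (Nₚ.*-monoʳ-≤ 2 i<n) 2n<κ))))
   (one< n (\ j j<n -> one< j (\ i i<j -> one
    (θ-one _ P (Nₚ.*-monoʳ-< 2 (Nₚ.m<n⇒0<n∸m (s≤s i<j))) (Nₚ.≤-<-trans (Nₚ.*-monoʳ-≤ 2 (Nₚ.≤-trans (Nₚ.m∸n≤m (suc j) (suc i)) j<n)) (Nₚ.<-≤-trans 2n<κ (Nₚ.m≤m+n κ κ))))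
    (θ-one _ P (s≤s z≤n) (Nₚ.≤-<-trans (Nₚ.≤-trans (Nₚ.*-monoʳ-≤ 2 (Nₚ.+-mono-≤ (Nₚ.≤-trans i<j (Nₚ.<⇒≤ j<n)) j<n)) (Nₚ.≤-reflexive (lem n))) (Nₚ.+-mono-< 2n<κ 2n<κ))))))
   where
   P = κ N.+ κ
   0<κ : 0 < κ
   0<κ = Nₚ.≤-<-trans z≤n 2n<κ
   lem : ∀ n -> 2 N.* (n N.+ n) ≡ 2 N.* n N.+ 2 N.* n
   lem = N-solve

  denominator-inverse : ∀ n -> f.denominator n * g.denominator n ≈ 1#
  denominator-inverse n = one (one^ (inverse 2 2 (s≤s z≤n)) (n ∸ 1)) (inverse 1 1 (s≤s z≤n))

private module _ (R S : CRing) where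
 open Kit S
 private module R = Kit R
 module _ (𝔾 : Geom R) (𝕃 : LimitRing R 𝔾 S) where
  open Limits R S 𝔾 𝕃
  open InfiniteProducts R S 𝔾 𝕃
  private module FG = Geometric R 𝔾
  open Geom 𝔾
  module ProductFormula (m n : ℕ) (n≢0 : n ≢ 0) where
   open Duality R S 𝔾 𝕃 m n n≢0 using (κ; κ≢0; 2n<κ; h≢0; F; C; Y; duality; module CJ; module L; module J)
   private
    module J₀ = Theta R S 𝔾 𝕃 κ κ≢0 using (P≢0; U; U₂; dressed; at; fprod; ap; length-ap; module Self)
    P = κ N.+ κ
    P≢0 : P ≢ 0
    P≢0 = J₀.P≢0
   open SignSums R 𝔾 (t R.^ P) using (τ-prod)
   open J₀ using (U; U₂; dressed; at; fprod; length-ap)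
   open ProductSides S rpoch using (θ; θ₂; numerator; denominator)
   private
    open J₀.Self J.φ J.Tends-φ using (self)

    +≢0 : ∀ {x} -> 0 < x -> x ≢ 0
    +≢0 lt ≡.refl = Nₚ.<⇒≢ lt ≡.refl

    dressed-φ : ∀ z -> 0 < z -> dressed J.φ (+ z) R.≈ FG.H (+ z) R.* FG.H (+ (z N.+ κ))
    dressed-φ z 0<z = dressed-identity R (FG.H-inv z (+≢0 0<z)) (R.trans (R.*-congʳ (R.+-congˡ (R.-‿cong (R.sym (R.^-+ t z κ))))) (FG.H-inv (z N.+ κ) zκ≢0))
     (R.trans (R.*-cong (R.+-congˡ (R.-‿cong (R.trans (R.*-cong (R.sym (R.^-+ t z κ)) (R.sym (R.^-+ t z κ))) (R.sym (R.^-+ t (z N.+ κ) (z N.+ κ)))))) (R.≈-cong (\ x -> FG.H (+ x)) (lem z κ)))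
      (FG.H-inv ((z N.+ κ) N.+ (z N.+ κ)) (\ e -> zκ≢0 (Nₚ.m+n≡0⇒m≡0 (z N.+ κ) e))))
     where
     zκ≢0 : z N.+ κ ≢ 0
     zκ≢0 e = +≢0 0<z (Nₚ.m+n≡0⇒m≡0 z e)
     lem : ∀ z κ -> (z N.+ z) N.+ (κ N.+ κ) ≡ (z N.+ κ) N.+ (z N.+ κ)
     lem = N-solve

    fprod-dressed : ∀ z -> 0 < z -> fprod (dressed J.φ) (+ z) ≈ rpoch z κ
    fprod-dressed z 0<z = begin
     fprod (dressed J.φ) (+ z) ≈⟨ lim-pointwise (\ K -> R.trans (R.∏<-cong K (\ k -> R.trans (R.≈-cong (dressed J.φ) (≡.sym (pos-at z P k)))
       (R.trans (dressed-φ (z N.+ P N.* k) (Nₚ.≤-trans 0<z (Nₚ.m≤m+n z _))) (R.*-congˡ (R.≈-cong (\ x -> FG.H (+ x)) (lem z κ k)))))) (R.∏<-* K)) ⟩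
     lim (\ K -> R.∏< K (\ k -> FG.H (+ (z N.+ P N.* k))) R.* R.∏< K (\ k -> FG.H (+ ((z N.+ κ) N.+ P N.* k)))) ≈⟨ lim-* _ _ ⟩
     rpoch z P * rpoch (z N.+ κ) P ≈⟨ rpoch-merge z κ κ≢0 ⟩
     rpoch z κ ∎
     where
     lem : ∀ z κ k -> (z N.+ (κ N.+ κ) N.* k) N.+ κ ≡ (z N.+ κ) N.+ (κ N.+ κ) N.* k
     lem = N-solve

    sub-pos : ∀ {a b} -> b ≤ a -> + a Z.- + b ≡ + (a ∸ b)
    sub-pos {a} {b} b≤a = ≡.trans (Zₚ.m-n≡m⊖n a b) (Zₚ.⊖-≥ b≤a)

    self-value : ∀ b -> 0 < b -> b < κ -> self (+ b) * H (+ b) ≈ θ b κ * rpoch P P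
    self-value b 0<b b<κ = begin
     (fprod (dressed J.φ) (+ κ Z.- + b) * (fprod FG.H (+ P) * fprod (dressed J.φ) (+ (κ N.+ b)))) * H (+ b)
      ≈⟨ *-congʳ (*-cong (trans (≈-cong (fprod (dressed J.φ)) (sub-pos (Nₚ.<⇒≤ b<κ))) (fprod-dressed (κ ∸ b) (Nₚ.m<n⇒0<n∸m b<κ)))
        (*-cong (fprod-rpoch P≢0 P) (trans (fprod-dressed (κ N.+ b) (Nₚ.≤-trans 0<b (Nₚ.m≤n+m b κ))) (≈-cong (\ z -> rpoch z κ) (Nₚ.+-comm κ b))))) ⟩
     (rpoch (κ ∸ b) κ * (rpoch P P * rpoch (b N.+ κ) κ)) * H (+ b) ≈⟨ solve 4 (\ a p r h -> (a :* (p :* r)) :* h := ((h :* r) :* a) :* p) refl _ _ _ _ ⟩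
     ((H (+ b) * rpoch (b N.+ κ) κ) * rpoch (κ ∸ b) κ) * rpoch P P ≈⟨ *-congʳ (*-congʳ (rpoch-rec b κ κ≢0)) ⟨
     θ b κ * rpoch P P ∎

    U-value : ∀ e -> e ≤ P -> U (+ e) * H (+ e) ≈ θ e P
    U-value e e≤P = begin
     (fprod FG.H (+ (P N.+ e)) * fprod FG.H (+ P Z.- + e)) * H (+ e)
      ≈⟨ *-congʳ (*-cong (trans (fprod-rpoch P≢0 (P N.+ e)) (≈-cong (\ z -> rpoch z P) (Nₚ.+-comm P e))) (trans (≈-cong (fprod FG.H) (sub-pos e≤P)) (fprod-rpoch P≢0 (P ∸ e)))) ⟩
     (rpoch (e N.+ P) P * rpoch (P ∸ e) P) * H (+ e) ≈⟨ trans (solve 3 (\ a b h -> (a :* b) :* h := (h :* a) :* b) refl _ _ _) (*-congʳ (sym (rpoch-rec e P P≢0))) ⟩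
     θ e P ∎

    dif sm : ℕ -> ℕ -> ℕ
    dif j i = 2 N.* (suc j ∸ suc i)
    sm j i = 2 N.* (suc i N.+ suc j)

    -- The finitely many factors 1/(1 - t^e) that `self` and `U₂` lack to be reciprocal theta
    -- functions, collected for class j.
    hf : ℕ -> Carrier
    hf j = H (+ (2 N.* suc j)) * ∏< j (\ i -> H (+ dif j i) * H (+ sm j i))

    β : ℕ -> ℤ
    β j = + (suc j N.+ suc j)

    double : ∀ j -> suc j N.+ suc j ≡ 2 N.* suc j
    double j = lem (suc j)
     where
     lem : ∀ j -> j N.+ j ≡ 2 N.* j
     lem = N-solve

    2j≤P : ∀ {j} -> j ≤ n -> 2 N.* j ≤ P
    2j≤P j≤n = Nₚ.≤-trans (Nₚ.*-monoʳ-≤ 2 j≤n) (Nₚ.≤-trans (Nₚ.<⇒≤ 2n<κ) (Nₚ.m≤m+n κ κ))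

    U₂-value : ∀ j i -> i < j -> j < n -> U₂ (β j) (β i) * (H (+ dif j i) * H (+ sm j i)) ≈ θ₂ P j i
    U₂-value j i i<j j<n = begin
     (U (β j Z.+ β i) * U (β j Z.- β i)) * (H (+ dif j i) * H (+ sm j i)) ≈⟨ *-congʳ (*-cong (≈-cong U (cong +_ (lem (suc j) (suc i)))) (≈-cong U diff)) ⟩
     (U (+ sm j i) * U (+ dif j i)) * (H (+ dif j i) * H (+ sm j i)) ≈⟨ solve 4 (\ a b c d -> (a :* b) :* (c :* d) := (b :* c) :* (a :* d)) refl _ _ _ _ ⟩
     (U (+ dif j i) * H (+ dif j i)) * (U (+ sm j i) * H (+ sm j i)) ≈⟨ *-cong (U-value (dif j i) (2j≤P (Nₚ.≤-trans (Nₚ.m∸n≤m (suc j) (suc i)) j<n))) (U-value (sm j i)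
       (Nₚ.≤-trans (Nₚ.≤-trans (Nₚ.*-monoʳ-≤ 2 (Nₚ.+-mono-≤ (Nₚ.≤-trans i<j (Nₚ.<⇒≤ j<n)) j<n)) (Nₚ.≤-reflexive (lem′ n))) (Nₚ.+-mono-≤ (Nₚ.<⇒≤ 2n<κ) (Nₚ.<⇒≤ 2n<κ)))) ⟩
     θ₂ P j i ∎
     where
     lem : ∀ j i -> (j N.+ j) N.+ (i N.+ i) ≡ 2 N.* (i N.+ j)
     lem = N-solve
     lem′ : ∀ n -> 2 N.* (n N.+ n) ≡ 2 N.* n N.+ 2 N.* n
     lem′ = N-solve
     diff : β j Z.- β i ≡ + dif j i
     diff = ≡.trans (sub-pos (Nₚ.+-mono-≤ (Nₚ.<⇒≤ (s≤s i<j)) (Nₚ.<⇒≤ (s≤s i<j)))) (cong +_ (≡.trans (cong₂ _∸_ (double j) (double i)) (≡.sym (Nₚ.*-distribˡ-∸ 2 (suc j) (suc i)))))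

    ∏-downFrom : ∀ k {f : ℕ -> Carrier} -> ∏ (downFrom k) f ≈ ∏< k f
    ∏-downFrom zero = refl
    ∏-downFrom (suc k) = trans (*-congˡ (∏-downFrom k)) (trans (*-comm _ _) (sym (∏<-snoc k)))

    factor : ℕ -> Carrier
    factor j = (θ (2 N.* suc j) κ * rpoch P P) * ∏< j (θ₂ P j)

    Tm-value : ∀ k -> k ≤ n -> J.Tm (map β (downFrom k)) * ∏< k hf ≈ ∏< k factor
    Tm-value zero _ = *-identityˡ _
    Tm-value (suc k) k<n = begin
     (self (β k) * (∏ (map β (downFrom k)) (U₂ (β k)) * J.Tm (map β (downFrom k)))) * ∏< (suc k) hf
      ≈⟨ *-cong (*-cong (≈-cong (\ z -> self (+ z)) (double k)) (*-congʳ (trans (∏-map β (downFrom k)) (∏-downFrom k)))) (∏<-snoc k) ⟩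
     (self (+ (2 N.* suc k)) * (∏< k (\ i -> U₂ (β k) (β i)) * J.Tm (map β (downFrom k)))) * (∏< k hf * (H (+ (2 N.* suc k)) * ∏< k (\ i -> H (+ dif k i) * H (+ sm k i))))
      ≈⟨ solve 6 (\ s u m f h q -> (s :* (u :* m)) :* (f :* (h :* q)) := (m :* f) :* ((s :* h) :* (u :* q))) refl _ _ _ _ _ _ ⟩
     (J.Tm (map β (downFrom k)) * ∏< k hf) * ((self (+ (2 N.* suc k)) * H (+ (2 N.* suc k))) * (∏< k (\ i -> U₂ (β k) (β i)) * ∏< k (\ i -> H (+ dif k i) * H (+ sm k i))))
      ≈⟨ *-cong (Tm-value k (Nₚ.<⇒≤ k<n)) (*-cong (self-value (2 N.* suc k) (s≤s z≤n) (Nₚ.≤-<-trans (Nₚ.*-monoʳ-≤ 2 k<n) 2n<κ)) (trans (sym (∏<-* k)) (∏<-cong-< k (\ i i<k -> U₂-value k i i<k k<n)))) ⟩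
     ∏< k factor * factor k ≈⟨ ∏<-snoc k ⟨
     ∏< (suc k) factor ∎

    ∏<-reverse : ∀ k {f : ℕ -> Carrier} -> ∏< k (\ i -> f (k ∸ suc i)) ≈ ∏< k f
    ∏<-reverse zero = refl
    ∏<-reverse (suc k) {f} = trans (*-congˡ (∏<-reverse k {f})) (trans (*-comm _ _) (sym (∏<-snoc k {f})))

    -- The exponents 2j + 2, the differences 2, ..., 2j and the sums 2j + 4, ..., 4j + 2 are
    -- together all even numbers up to 4j + 2, which is what (t^(4+4j);t^2)_∞ lacks.
    hf-value : ∀ j -> hf j * rpoch (4 N.+ 4 N.* j) 2 ≈ rpoch 2 2
    hf-value j = begin
     (H (+ (2 N.* suc j)) * ∏< j (\ i -> H (+ dif j i) * H (+ sm j i))) * r ≈⟨ *-congʳ (*-cong (≈-cong (\ z -> H (+ z)) (l₁ j)) (∏<-* j)) ⟩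
     (E j * (∏< j (\ i -> H (+ dif j i)) * ∏< j (\ i -> H (+ sm j i)))) * r ≈⟨ *-congʳ (*-left-comm _ _ _) ⟩
     (∏< j (\ i -> H (+ dif j i)) * (E j * ∏< j (\ i -> H (+ sm j i)))) * r
      ≈⟨ *-congʳ (*-cong (trans (∏<-cong-< j (\ i i<j -> ≈-cong (\ z -> H (+ z)) (dif-rev i i<j))) (∏<-reverse j {E})) (*-cong (≈-cong E (≡.sym (Nₚ.+-identityʳ j))) (∏<-cong j (\ i -> ≈-cong (\ z -> H (+ z)) (l₂ j i))))) ⟩
     (∏< j E * ∏< (suc j) (\ i -> E (j N.+ i))) * r ≈⟨ *-cong (∏<-++ j (suc j) {E}) (≈-cong (\ z -> rpoch z 2) (l₃ j)) ⟨
     ∏< (j N.+ suc j) E * rpoch (2 N.+ 2 N.* (j N.+ suc j)) 2 ≈⟨ rpoch-recs 2 2 (\ ()) (j N.+ suc j) ⟨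
     rpoch 2 2 ∎
     where
     r = rpoch (4 N.+ 4 N.* j) 2
     E : ℕ -> Carrier
     E k = H (+ (2 N.+ 2 N.* k))
     l₁ : ∀ j -> 2 N.* (1 N.+ j) ≡ 2 N.+ 2 N.* j
     l₁ = N-solve
     l₂ : ∀ j i -> 2 N.* ((1 N.+ i) N.+ (1 N.+ j)) ≡ 2 N.+ 2 N.* (j N.+ (1 N.+ i))
     l₂ = N-solve
     l₃ : ∀ j -> 2 N.+ 2 N.* (j N.+ (1 N.+ j)) ≡ 4 N.+ 4 N.* j
     l₃ = N-solve
     dif-rev : ∀ i -> i < j -> dif j i ≡ 2 N.+ 2 N.* (j ∸ suc i)
     dif-rev i i<j = ≡.trans (cong (2 N.*_) (≡.sym (Nₚ.suc-pred (j ∸ i) {{N.>-nonZero (Nₚ.m<n⇒0<n∸m i<j)}}))) (≡.trans (l₁ _) (cong (\ z -> 2 N.+ 2 N.* z) (Nₚ.pred[m∸n]≡m∸[1+n] j i)))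

    ∏<-const : ∀ k {x : Carrier} -> ∏< k (\ _ -> x) ≈ x ^ k
    ∏<-const zero = refl
    ∏<-const (suc k) = *-congˡ (∏<-const k)

    ^-pred : ∀ x -> x ^ n ≈ x ^ (n ∸ 1) * x
    ^-pred x = trans (≈-cong (x ^_) (≡.sym (Nₚ.suc-pred n {{N.≢-nonZero n≢0}}))) (*-comm _ _)

    term-denominator : lim L.term * ∏< n hf ≈ denominator n
    term-denominator = begin
     lim L.term * ∏< n hf ≈⟨ *-congʳ (LittlewoodTerm.term-value R S 𝔾 𝕃 m n h≢0) ⟩
     (rpoch 1 2 * ∏< n (\ l -> rpoch (4 N.+ 4 N.* l) 2)) * ∏< n hf ≈⟨ trans (*-assoc _ _ _) (*-congˡ (trans (*-comm _ _) (trans (sym (∏<-* n)) (trans (∏<-cong n hf-value) (trans (∏<-const n) (^-pred (rpoch 2 2))))))) ⟩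
     rpoch 1 2 * (rpoch 2 2 ^ (n ∸ 1) * rpoch 2 2) ≈⟨ trans (*-left-comm _ _ _) (*-congˡ (rpoch-merge 1 1 (\ ()))) ⟩
     denominator n ∎

    term-numerator : rpoch κ P * (lim J.term * ∏< n hf) ≈ numerator κ P n
    term-numerator = begin
     rpoch κ P * (lim J.term * ∏< n hf) ≈⟨ *-congˡ (trans (*-congʳ (trans (lim-pointwise (\ K -> R.≈-cong J.term (≡.sym (Nₚ.+-identityʳ K)))) (J.term-limit 0))) (Tm-value n Nₚ.≤-refl)) ⟩
     rpoch κ P * ∏< n factor ≈⟨ *-congˡ (trans (∏<-* n) (*-congʳ (trans (∏<-* n) (*-congˡ (trans (∏<-const n) (^-pred (rpoch P P))))))) ⟩
     rpoch κ P * ((∏< n (\ i -> θ (2 N.* suc i) κ) * (rpoch P P ^ (n ∸ 1) * rpoch P P)) * ∏< n (\ j -> ∏< j (θ₂ P j)))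
      ≈⟨ solve 5 (\ k a p q b -> k :* ((a :* (p :* q)) :* b) := (p :* (k :* q)) :* a :* b) refl _ _ _ _ _ ⟩
     rpoch P P ^ (n ∸ 1) * (rpoch κ P * rpoch P P) * ∏< n (\ i -> θ (2 N.* suc i) κ) * ∏< n (\ j -> ∏< j (θ₂ P j)) ≈⟨ *-congʳ (*-congʳ (*-congˡ (rpoch-merge κ κ κ≢0))) ⟩
     numerator κ P n ∎

    length-Y : ∀ L -> length (Y L) ≡ n N.* (L N.+ L)
    length-Y L = go n
     where
     go : ∀ k -> length (concat (map (\ i -> J₀.ap (CJ.base (β i) L) (L N.+ L)) (downFrom k))) ≡ k N.* (L N.+ L)
     go zero = ≡.refl
     go (suc k) = ≡.trans (Lₚ.length-++ (J₀.ap (CJ.base (β k) L) (L N.+ L))) (cong₂ N._+_ (length-ap _ (L N.+ L)) (go k))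

    C-inverse : lim C * rpoch κ P ≈ 1#
    C-inverse = trans (*-congˡ (sym (rpoch-len κ P P≢0 (\ L -> length (Y L)) (\ L -> Nₚ.≤-trans (Nₚ.≤-trans (Nₚ.m≤m+n L L) (Nₚ.m≤n*m (L N.+ L) n {{N.≢-nonZero n≢0}})) (Nₚ.≤-reflexive (≡.sym (length-Y L)))))))
     (trans (sym (lim-* _ _)) (trans (lim-pointwise (\ L -> exact (length (Y L)))) lim-1))
     where
     exact : ∀ l -> τ-prod (t R.^ κ) l R.* R.∏< l (\ k -> FG.H (+ (κ N.+ P N.* k))) R.≈ R.1#
     exact zero = R.*-identityˡ _
     exact (suc l) = R.trans (R.*-congˡ (R.∏<-snoc l)) (R.trans (R.solve 4 (\ a b c d -> (a R.:* b) R.:* (c R.:* d) R.:= (b R.:* c) R.:* (a R.:* d)) R.refl _ _ _ _)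
      (R.trans (R.*-cong (exact l) (R.trans (R.*-congʳ (R.+-congˡ (R.-‿cong (R.trans (R.*-congˡ (R.^-^ t P l)) (R.sym (R.^-+ t κ (P N.* l))))))) (FG.H-inv (κ N.+ P N.* l) (\ e -> κ≢0 (Nₚ.m+n≡0⇒m≡0 κ e))))) (R.*-identityˡ _)))

   -- Both centred terms are multiplied by the same product of `hf`: it completes the one of the
   -- sign sum to theta functions and reduces the one of the Littlewood sum to a power of 1/(q;q)_∞
   -- and 1/(t;t)_∞. The remaining factor `rpoch κ P` cancels the closed form `C`.
   F-numerator : lim F * numerator κ P n ≈ denominator n
   F-numerator = begin
    lim F * numerator κ P n ≈⟨ *-congˡ term-numerator ⟨
    lim F * (rpoch κ P * (lim J.term * ∏< n hf)) ≈⟨ solve 4 (\ f r j h -> f :* (r :* (j :* h)) := (f :* j) :* (r :* h)) refl _ _ _ _ ⟩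
    (lim F * lim J.term) * (rpoch κ P * ∏< n hf) ≈⟨ *-congʳ (trans (sym (lim-* _ _)) (trans duality (lim-* _ _))) ⟩
    (lim C * lim L.term) * (rpoch κ P * ∏< n hf) ≈⟨ *-interchange _ _ _ _ ⟩
    (lim C * rpoch κ P) * (lim L.term * ∏< n hf) ≈⟨ trans (*-cong C-inverse term-denominator) (*-identityˡ _) ⟩
    denominator n ∎

   poch∞′ : ℕ -> ℕ -> Carrier
   poch∞′ α β = lim (\ K -> R.∏< K (\ k -> R.1# R.- t R.^ (α N.+ β N.* k)))

   private
    poch-inverse : ∀ α β -> 0 < α -> poch∞′ α β * rpoch α β ≈ 1#
    poch-inverse α β 0<α = trans (sym (lim-* _ _)) (trans (lim-pointwise (\ K -> R.trans (R.sym (R.∏<-* K)) (R.∏<-1 K (\ k _ -> FG.H-inv (α N.+ β N.* k) (\ e -> +≢0 0<α (Nₚ.m+n≡0⇒m≡0 α e)))))) lim-1)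

    module PS = ProductSides S poch∞′
    open InverseSides S poch∞′ rpoch poch-inverse

   product-formula : lim F * PS.denominator n ≈ PS.numerator κ P n
   product-formula = begin
    lim F * PS.denominator n ≈⟨ trans (sym (*-identityʳ _)) (*-congˡ (sym (numerator-inverse κ n 2n<κ))) ⟩
    (lim F * PS.denominator n) * (PS.numerator κ P n * numerator κ P n) ≈⟨ solve 4 (\ f d a b -> (f :* d) :* (a :* b) := (d :* (f :* b)) :* a) refl _ _ _ _ ⟩
    (PS.denominator n * (lim F * numerator κ P n)) * PS.numerator κ P n ≈⟨ *-congʳ (trans (*-congˡ F-numerator) (denominator-inverse n)) ⟩
    1# * PS.numerator κ P n ≈⟨ *-identityˡ _ ⟩
    PS.numerator κ P n ∎

-- Transport of the product formula to the given power series.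

private
 module FK = Kit FR using (*-assoc; *-comm; *-cong; *-congʳ; *-congˡ; *-identityʳ; *-identityˡ; +-cong; -_; -‿cong; 0#; 0ₚ; 1#; 1ₚ; Carrier; ^-+; ^-^; _*_; _-_; _:*_; _:-_; _:=_; _^_; _≈_; refl; solve; sym; trans; zeroʳ; zeroˡ; ∏<; ∏<-*; ∏<-++; ∏<-cong; ∏<-snoc; ∑; ∑-cong; ≈-cong)
 module SK = Kit SR using (_≈_; refl; sym; trans; *-congˡ)

limitRing : LimitRing FR F𝔾 SR
limitRing = record
 { lim = ⟦_⟧ ; lim-pointwise = \ e -> ⟦⟧-cong (Sequences.pointwise e)
 ; lim-+ = ⟦⟧-+ ; lim-* = ⟦⟧-* ; lim-neg = ⟦⟧-neg ; lim-0 = ⟦⟧-0 ; lim-1 = ⟦⟧-1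
 ; τ = Loc.τ ; τ-0 = SK.refl ; τ-+ = Loc.τ-+
 ; τ-^ = \ k -> ⟦⟧-cong (Kit.sym seqRing (HomProps.⟦⟧-^ Sequences.constant FS.Xₛ k))
 ; lim-approx = approx }
 where
 open Hom Loc.embed
 open Divisible FR FS.Xₛ using (Div)
 approx : ∀ {a b} (from : ℕ -> ℕ) (c d : ℕ -> ℕ -> FK.Carrier) -> (∀ M -> ⟦ c M ⟧ SK.≈ ⟦ d M ⟧) ->
  (∀ M K -> Div M (a (K N.+ from M) FK.- c M K)) -> (∀ M K -> Div M (b (K N.+ from M) FK.- d M K)) -> ⟦ a ⟧ SK.≈ ⟦ b ⟧
 approx {a} {b} from c d e da db = ⟦⟧-cong (Sequences.eventually (\ M -> Sequences.from (e′ M) M N.+ from M) agree)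
  where
  e′ : ∀ M -> Kit._≈_ seqRing (c M) (d M)
  e′ M = Loc.embed-injective (e M)
  agree : ∀ M K -> Sequences.from (e′ M) M N.+ from M ≤ K -> Truncated._~_ M (a K) (b K)
  agree M K le = subst (\ z -> a z ≈ b z) (Nₚ.m∸n+n≡m (Nₚ.m+n≤o⇒n≤o (Sequences.from (e′ M) M) {from M} le))
   (trans (close (da M K′)) (trans (Sequences.agree (e′ M) M K′ (Nₚ.≤-trans (Nₚ.≤-reflexive (≡.sym (Nₚ.m+n∸n≡m _ (from M)))) (Nₚ.∸-monoˡ-≤ (from M) le))) (sym (close (db M K′)))))
   where
   open Kit (Truncated.TR M) using (_≈_; trans; sym; x-y≈0⇒x≈y)
   K′ = K ∸ from M
   close : ∀ {x y} -> Div M (x FK.- y) -> x ≈ y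
   close dv = x-y≈0⇒x≈y (Truncated.Div⇒0 M Nₚ.≤-refl dv)

prodTo-∏< : ∀ {f g : ℕ -> FPS} n -> (∀ k -> k < n -> f k FK.≈ g k) -> prodTo f n FK.≈ FK.∏< n g
prodTo-∏< zero e = oneS-1
prodTo-∏< {f} {g} (suc n) e = FK.trans (⊛-mul (prodTo f n) (f n)) (FK.trans (FK.*-cong (prodTo-∏< n (\ k k<n -> e k (Nₚ.m<n⇒m<1+n k<n))) (e n Nₚ.≤-refl)) (FK.sym (FK.∏<-snoc n)))

powS-^ : ∀ f n -> powS f n FK.≈ f FK.^ n
powS-^ f zero = oneS-1
powS-^ f (suc n) = FK.trans (⊛-mul f (powS f n)) (FK.*-congˡ {f} (powS-^ f n))

pochF-∏< : ∀ α β K -> pochF α β K FK.≈ FK.∏< K (\ k -> FK.1# FK.- FS.Xₛ FK.^ (α N.+ β N.* k))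
pochF-∏< α β K = prodTo-∏< K (\ k _ -> FK.+-cong oneS-1 (FK.-‿cong (mono-X^ (α N.+ β N.* k))))

-- As β ≥ 1, all factors beyond index k are 1 modulo t^(k+1), so the coefficient of t^k is settled
-- after k + 1 factors.
poch∞-~ : ∀ α β -> β ≢ 0 -> Kit._≈_ seqRing (\ K -> FK.∏< K (\ k -> FK.1# FK.- FS.Xₛ FK.^ (α N.+ β N.* k))) (\ _ -> poch∞ α β)
poch∞-~ α β β≢0 = Sequences.eventually id (\ M K M≤K -> Truncated.below (\ k k<M -> ≡.trans (Truncated.agree (stable k K (Nₚ.<-≤-trans k<M M≤K)) k (Nₚ.n<1+n k)) (≡.sym (pochF-∏< α β (suc k) k))))
 where
 f : ℕ -> FPS
 f k = FK.1# FK.- FS.Xₛ FK.^ (α N.+ β N.* k)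
 stable : ∀ k K -> k < K -> Truncated._~_ (suc k) (FK.∏< K f) (FK.∏< (suc k) f)
 stable k K k<K = trans (Hom.⟦⟧-cong truncate (FK.trans (FK.≈-cong (\ l -> FK.∏< l f) (≡.sym (Nₚ.m+[n∸m]≡n k<K))) (FK.∏<-++ (suc k) (K ∸ suc k) {f})))
  (trans (*-congˡ {FK.∏< (suc k) f} (ones (K ∸ suc k) (\ j -> large (suc k N.+ j) (Nₚ.m≤m+n (suc k) j)))) (*-identityʳ (FK.∏< (suc k) f)))
  where
  open Truncated (suc k) using (TR; truncate; t^-vanish)
  open Kit TR using (_≈_; refl; trans; *-cong; *-congˡ; *-identityʳ; +-congˡ; -‿cong)
  large : ∀ j -> suc k ≤ j -> f j ≈ FK.1#
  large j le = trans (+-congˡ {FK.1#} (-‿cong (t^-vanish (Nₚ.≤-trans le (Nₚ.≤-trans (Nₚ.m≤n*m j β {{N.≢-nonZero β≢0}}) (Nₚ.m≤n+m (β N.* j) α)))))) (Hom.⟦⟧-cong truncate (FK.solve 0 (FK.1ₚ FK.:- FK.0ₚ FK.:= FK.1ₚ) FK.refl))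
  ones : ∀ l {g} -> (∀ j -> g j ≈ FK.1#) -> FK.∏< l g ≈ FK.1#
  ones zero e = refl
  ones (suc l) {g} e = trans (*-cong {g 0} {FK.1#} (e 0) (ones l (\ j -> e (suc j)))) (*-identityʳ FK.1#)

module SidesHom {R S : CRing} (ι : Hom R S) (f : ℕ -> ℕ -> CommutativeRing.Carrier S) (g : ℕ -> ℕ -> CommutativeRing.Carrier R)
  (f≈g : ∀ α β -> β ≢ 0 -> CommutativeRing._≈_ S (f α β) (Hom.⟦_⟧ ι (g α β))) where
 open Kit S
 open Hom ι
 open HomProps ι
 private
  module f = ProductSides S f
  module g = ProductSides R g

  θ-hom : ∀ α β -> β ≢ 0 -> f.θ α β ≈ ⟦ g.θ α β ⟧
  θ-hom α β β≢0 = trans (*-cong (f≈g α β β≢0) (f≈g (β ∸ α) β β≢0)) (sym (⟦⟧-* _ _))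

  ^-hom : ∀ α β -> β ≢ 0 -> ∀ k -> f α β ^ k ≈ ⟦ Kit._^_ R (g α β) k ⟧
  ^-hom α β β≢0 k = trans (^-cong k (f≈g α β β≢0)) (sym (⟦⟧-^ _ k))

 numerator-hom : ∀ κ P n -> κ ≢ 0 -> P ≢ 0 -> f.numerator κ P n ≈ ⟦ g.numerator κ P n ⟧
 numerator-hom κ P n κ≢0 P≢0 = trans (*-cong (trans (*-cong (trans (*-cong (^-hom P P P≢0 (n ∸ 1)) (f≈g κ κ κ≢0)) (sym (⟦⟧-* _ _))) (trans (∏<-cong n (\ i -> θ-hom (2 N.* suc i) κ κ≢0)) (sym (⟦⟧-∏< n)))) (sym (⟦⟧-* _ _)))
  (trans (∏<-cong n (\ j -> trans (∏<-cong j (\ i -> trans (*-cong (θ-hom _ P P≢0) (θ-hom _ P P≢0)) (sym (⟦⟧-* _ _)))) (sym (⟦⟧-∏< j)))) (sym (⟦⟧-∏< n)))) (sym (⟦⟧-* _ _))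

 denominator-hom : ∀ n -> f.denominator n ≈ ⟦ g.denominator n ⟧
 denominator-hom n = trans (*-cong (^-hom 2 2 (\ ()) (n ∸ 1)) (f≈g 1 1 (\ ()))) (sym (⟦⟧-* _ _))

private module FormulaFPS (m n : ℕ) (n≢0 : n ≢ 0) where
 open Duality FR SR F𝔾 limitRing m n n≢0 using (κ; κ≢0; F)
 open ProductFormula FR SR F𝔾 limitRing m n n≢0 using (product-formula; poch∞′)
 open Hom Loc.embed

 private
  module G = ProductSides FR poch∞

  ι : Hom FR SR
  ι = record
   { ⟦_⟧ = \ f -> ⟦ (\ _ -> f) ⟧ ; ⟦⟧-cong = \ e -> ⟦⟧-cong (Sequences.pointwise (\ _ -> e)) ; ⟦⟧-+ = \ a b -> ⟦⟧-+ (\ _ -> a) (\ _ -> b)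
   ; ⟦⟧-* = \ a b -> ⟦⟧-* (\ _ -> a) (\ _ -> b) ; ⟦⟧-neg = \ a -> ⟦⟧-neg (\ _ -> a) ; ⟦⟧-0 = ⟦⟧-0 ; ⟦⟧-1 = ⟦⟧-1 }

  open SidesHom ι poch∞′ poch∞ (\ α β β≢0 -> ⟦⟧-cong (poch∞-~ α β β≢0))

  P≢0 : κ N.+ κ ≢ 0
  P≢0 e = κ≢0 (Nₚ.m+n≡0⇒m≡0 κ e)

  in-seq : Kit._≈_ seqRing (\ L -> F L FK.* G.denominator n) (\ _ -> G.numerator κ (κ N.+ κ) n)
  in-seq = Loc.embed-injective (SK.trans (⟦⟧-* F (\ _ -> G.denominator n)) (SK.trans (SK.*-congˡ {⟦ F ⟧} (SK.sym (denominator-hom n))) (SK.trans product-formula (numerator-hom κ (κ N.+ κ) n κ≢0 P≢0))))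

  num den : FPS
  num = powS (poch∞ (2 N.* κ) (2 N.* κ)) (n ∸ 1) ⊛ poch∞ κ κ ⊛ prodTo (\ i -> theta (2 N.* suc i) κ) n
    ⊛ prodTo (\ j -> prodTo (\ i -> theta (2 N.* (suc j ∸ suc i)) (2 N.* κ) ⊛ theta (2 N.* (suc i N.+ suc j)) (2 N.* κ)) j) n
  den = powS (poch∞ 2 2) (n ∸ 1) ⊛ poch∞ 1 1

  ⊛-cong : ∀ {a b c d} -> a FK.≈ b -> c FK.≈ d -> a ⊛ c FK.≈ b FK.* d
  ⊛-cong {a} {b} {c} {d} e e′ = FK.trans (⊛-mul a c) (FK.*-cong {a} {b} e e′)

  num-≈ : num FK.≈ G.numerator κ (κ N.+ κ) n
  num-≈ = FK.trans (⊛-cong (⊛-cong (⊛-cong (powS-^ _ (n ∸ 1)) FK.refl) (prodTo-∏< n (\ i _ -> ⊛-mul _ _))) (prodTo-∏< n (\ j _ -> prodTo-∏< j (\ i _ -> ⊛-cong (⊛-mul _ _) (⊛-mul _ _)))))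
   (FK.≈-cong (\ P -> G.numerator κ P n) (lem κ))
   where
   lem : ∀ κ -> 2 N.* κ ≡ κ N.+ κ
   lem = N-solve

  den-≈ : den FK.≈ G.denominator n
  den-≈ = ⊛-cong (powS-^ _ (n ∸ 1)) FK.refl

  den-0 : den 0 ≡ + 1
  den-0 = cong (\ z -> + 0 Z.+ z Z.* + 1) (pow-0 (n ∸ 1))
   where
   pow-0 : ∀ k -> powS (poch∞ 2 2) k 0 ≡ + 1
   pow-0 zero = ≡.refl
   pow-0 (suc k) = cong (\ z -> + 0 Z.+ + 1 Z.* z) (pow-0 k)

 F-rhs : ∃[ from ] (∀ M L -> from M ≤ L -> Truncated._~_ M (F L) (rhsSeries m n))
 F-rhs = Sequences.from in-seq , \ M L le -> divide M L (Sequences.agree in-seq M L le)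
  where
  divide : ∀ M L -> Truncated._~_ M (F L FK.* G.denominator n) (G.numerator κ (κ N.+ κ) n) -> Truncated._~_ M (F L) (rhsSeries m n)
  divide M L e = trans (proj FL) (trans (*-congʳ {inv den} e) (proj (FK.trans (FK.*-congʳ {inv den} (FK.sym num-≈)) (FK.sym (⊛-mul num (inv den))))))
   where
   open Kit (Truncated.TR M) using (_≈_; trans; *-congʳ)
   proj : ∀ {a b} -> a FK.≈ b -> a ≈ b
   proj = Hom.⟦⟧-cong (Truncated.truncate M)
   FL : F L FK.≈ (F L FK.* G.denominator n) FK.* inv den
   FL = FK.sym (FK.trans (FK.*-assoc (F L) (G.denominator n) (inv den)) (FK.trans (FK.*-congˡ {F L} (FK.trans (FK.*-congʳ {inv den} (FK.sym den-≈)) (mul-inv den den-0))) (FK.*-identityʳ (F L))))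

-- From the families of the theorem to branching polynomials: weights and exponents.

above : ℕ -> (ℕ -> ℕ -> ℕ) -> ℕ -> ℕ -> ℕ
above K g zero j = K
above K g (suc i) j = g i j

private module _ (R : CRing) where
 open Kit R
 module _ (p : Carrier) where
  open QBinomial R p
  module Families (D N : ℕ) (D<N : D < N) where
   open Branching R p D N D<N

   fams : (C M : ℕ) -> List (Vec (Vec ℕ C) M)
   fams C M = allVecs (allVecs (upTo N) C) M

   private
    ∑-allVecs : ∀ {A : Set} (xs : List A) L {f : Vec A (suc L) -> Carrier} -> ∑ (allVecs xs (suc L)) f ≈ ∑ xs (\ x -> ∑ (allVecs xs L) (\ v -> f (x ∷ v)))
    ∑-allVecs xs L = trans (∑-concatMap (\ x -> map (x ∷_) (allVecs xs L)) xs) (∑-cong xs (\ x -> ∑-map (x ∷_) (allVecs xs L)))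

    peel : ∀ C M {f : Vec (Vec ℕ (suc C)) M -> Carrier} -> ∑ (fams (suc C) M) f ≈ ∑ (box M) (\ v -> ∑ (fams C M) (\ s -> f (Vec.zipWith _∷_ v s)))
    peel C zero = sym (+-identityʳ _)
    peel C (suc M) {f} = begin
     ∑ (fams (suc C) (suc M)) f ≈⟨ trans (∑-allVecs (allVecs (upTo N) (suc C)) M) (∑-allVecs (upTo N) C) ⟩
     ∑ (upTo N) (\ x -> ∑ (allVecs (upTo N) C) (\ r -> ∑ (fams (suc C) M) (\ s -> f ((x ∷ r) ∷ s)))) ≈⟨ ∑-cong (upTo N) (\ x -> trans (∑-cong (allVecs (upTo N) C) (\ r -> peel C M)) (∑-swap (allVecs (upTo N) C) (box M))) ⟩
     ∑ (upTo N) (\ x -> ∑ (box M) (\ v -> ∑ (allVecs (upTo N) C) (\ r -> ∑ (fams C M) (\ s -> f ((x ∷ r) ∷ Vec.zipWith _∷_ v s)))))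
      ≈⟨ trans (∑-allVecs (upTo N) M) (∑-cong (upTo N) (\ x -> ∑-cong (box M) (\ v -> ∑-allVecs (allVecs (upTo N) C) M))) ⟨
     ∑ (box (suc M)) (\ v -> ∑ (fams C (suc M)) (\ s -> f (Vec.zipWith _∷_ v s))) ∎

   col : ∀ {C M} -> Vec (Vec ℕ C) M -> ℕ -> Vec ℕ M
   col s j = Vec.map (\ r -> nth (toList r) j) s

   private
    col-0 : ∀ {C M} (v : Vec ℕ M) (s : Vec (Vec ℕ C) M) -> col (Vec.zipWith _∷_ v s) 0 ≡ v
    col-0 [] [] = ≡.refl
    col-0 (x ∷ v) (r ∷ s) = cong (x ∷_) (col-0 v s)

    col-suc : ∀ {C M} (v : Vec ℕ M) (s : Vec (Vec ℕ C) M) j -> col (Vec.zipWith _∷_ v s) (suc j) ≡ col s j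
    col-suc [] [] j = ≡.refl
    col-suc (x ∷ v) (r ∷ s) j = cong (nth (toList r) j ∷_) (col-suc v s j)

   weight : (ℕ -> Carrier) -> ∀ {C M} -> Vec (Vec ℕ C) M -> Carrier
   weight y {C} s = ∏< C (\ j -> PD (y j) D (col s j) (col s (suc j)))

   -- A family is a chain of columns s^(0), s^(1), ... with one branching step between neighbours.
   -- The chain ends in the empty partition because reading past the last column yields 0.
   ∑-RD : ∀ C y M {f : Vec ℕ M -> Carrier} -> ∑ (box M) (\ v -> f v * RD (applyUpTo y C) v) ≈ ∑ (fams C M) (\ s -> f (col s 0) * weight y s)
   ∑-RD zero y M {f} = trans (∑-δ₀ M) (trans (sym (*-identityʳ _)) (sym (empty M {f})))
    where
    empty : ∀ M {f : Vec ℕ M -> Carrier} -> ∑ (fams 0 M) (\ s -> f (col s 0) * 1#) ≈ f (Vec.replicate M 0) * 1#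
    empty zero = +-identityʳ _
    empty (suc M) {f} = trans (∑-allVecs ([] ∷ []) M) (trans (+-identityʳ _) (empty M {\ v -> f (0 ∷ v)}))
   ∑-RD (suc C) y M {f} = begin
    ∑ (box M) (\ v -> f v * ∑ (box M) (\ μ -> PD (y 0) D v μ * RD (applyUpTo (\ j -> y (suc j)) C) μ))
     ≈⟨ ∑-cong (box M) (\ v -> trans (sym (∑-*ˡ (box M))) (trans (∑-cong (box M) (\ μ -> sym (*-assoc _ _ _))) (∑-RD C (\ j -> y (suc j)) M {\ μ -> f v * PD (y 0) D v μ}))) ⟩
    ∑ (box M) (\ v -> ∑ (fams C M) (\ s -> (f v * PD (y 0) D v (col s 0)) * weight (\ j -> y (suc j)) s))
     ≈⟨ ∑-cong (box M) (\ v -> ∑-cong (fams C M) (\ s -> trans (*-assoc _ _ _) (*-cong (≈-cong f (≡.sym (col-0 v s)))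
       (*-cong (≡⇒≈ (cong₂ (PD (y 0) D) (≡.sym (col-0 v s)) (≡.sym (col-suc v s 0)))) (∏<-cong C (\ j -> ≡⇒≈ (cong₂ (PD (y (suc j)) D) (≡.sym (col-suc v s j)) (≡.sym (col-suc v s (suc j)))))))))) ⟩
    ∑ (box M) (\ v -> ∑ (fams C M) (\ s -> f (col (Vec.zipWith _∷_ v s) 0) * weight y (Vec.zipWith _∷_ v s))) ≈⟨ peel C M ⟨
    ∑ (fams (suc C) M) (\ s -> f (col s 0) * weight y s) ∎

   private
    get-col : ∀ {C M} (s : Vec (Vec ℕ C) M) i j -> nth (toList (col s j)) i ≡ get s i j
    get-col [] i j = ≡.refl
    get-col (r ∷ s) zero j = ≡.refl
    get-col (r ∷ s) (suc i) j = get-col s i j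

    prev : ∀ {M} -> ℕ -> Vec ℕ M -> ℕ -> ℕ
    prev d v zero = d
    prev d v (suc i) = nth (toList v) i

    PD-∏< : ∀ y {M} d (v μ : Vec ℕ M) -> PD y d v μ ≈ ∏< M (\ i -> bb (prev d v i) (nth (toList v) i) (nth (toList μ) i) * yp y (nth (toList v) i ∸ nth (toList μ) i))
    PD-∏< y d [] [] = refl
    PD-∏< y {suc M} d (l ∷ v) (c ∷ μ) = *-congˡ (trans (PD-∏< y l v μ) (∏<-cong M (\ { zero -> refl ; (suc i) -> refl })))

   weight-get : ∀ y {C M} (s : Vec (Vec ℕ C) M) -> weight y s ≈
    ∏< C (\ j -> ∏< M (\ i -> bb (above D (get s) i j) (get s i j) (get s i (suc j)) * yp (y j) (get s i j ∸ get s i (suc j))))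
   weight-get y {C} {M} s = ∏<-cong C (\ j -> trans (PD-∏< (y j) D (col s j) (col s (suc j))) (∏<-cong M (\ i ->
     *-cong (≡⇒≈ (cong₂ (\ (d , a) c -> bb d a c) (cong₂ _,_ (up j i) (get-col s i j)) (get-col s i (suc j)))) (≡⇒≈ (cong₂ (\ a c -> yp (y j) (a ∸ c)) (get-col s i j) (get-col s i (suc j)))))))
    where
    up : ∀ j i -> prev D (col s j) i ≡ above D (get s) i j
    up j zero = ≡.refl
    up j (suc i) = get-col s i j

private module _ (R : CRing) where
 open Kit R
 module _ (p : Carrier) where
  open QBinomial R p
  module Arrays (K : ℕ) (g : ℕ -> ℕ -> ℕ) (M C : ℕ) (row-0 : ∀ j -> g M j ≡ 0) (col-0 : ∀ i -> g i C ≡ 0) where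

   private
    up : ℕ -> ℕ -> ℕ
    up = above K g

   ∏bb : Carrier
   ∏bb = ∏< C (\ j -> ∏< M (\ i -> bb (up i j) (g i j) (g i (suc j))))

   private
    bb-qf : ∀ {d a c} -> c ≤ a -> a ≤ d -> bb d a c * (qf (a ∸ c) * qf (d ∸ a)) ≈ qf (d ∸ c)
    bb-qf {d} {a} {c} c≤a a≤d = begin
     bb d a c * (qf (a ∸ c) * qf (d ∸ a)) ≈⟨ *-congʳ (≡⇒≈ (≡.trans (cong₂ (\ x y -> bb x y c) (≡.sym (Nₚ.m∸n+n≡m (Nₚ.≤-trans c≤a a≤d))) (≡.sym (Nₚ.m+[n∸m]≡n c≤a))) (≡.trans (bb-shift (d ∸ c) (a ∸ c) c) (cong (\ x -> qbin x (a ∸ c)) (≡.sym total))))) ⟩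
     qbin ((a ∸ c) N.+ (d ∸ a)) (a ∸ c) * (qf (a ∸ c) * qf (d ∸ a)) ≈⟨ qbin-qf (a ∸ c) (d ∸ a) ⟩
     qf ((a ∸ c) N.+ (d ∸ a)) ≈⟨ ≈-cong qf total ⟩
     qf (d ∸ c) ∎
     where
     total : (a ∸ c) N.+ (d ∸ a) ≡ d ∸ c
     total = ≡.trans (Nₚ.+-comm (a ∸ c) (d ∸ a)) (≡.trans (≡.sym (Nₚ.+-∸-assoc (d ∸ a) c≤a)) (cong (_∸ c) (Nₚ.m∸n+n≡m a≤d)))

   module _ (qf-unit : ∀ k -> ∃[ u ] (qf k * u ≈ 1#)) (down : ∀ i j -> i < M -> j < C -> g (suc i) j ≤ g i j) (left : ∀ i j -> i < M -> j < C -> g i (suc j) ≤ g i j) (top : ∀ j -> g 0 j ≤ K) where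
    private
     S U V : ℕ -> ℕ -> Carrier
     S j i = qf (g i j ∸ g i (suc j))
     U j i = qf (g i j ∸ g (suc i) j)
     V j i = qf (g i j ∸ g (suc i) (suc j))

     w : ℕ -> Carrier
     w j = qf (K ∸ g 0 j)

     le-up : ∀ i j -> i < M -> j < C -> g i j ≤ up i j
     le-up zero j _ _ = top j
     le-up (suc i) j i<M j<C = down i j (Nₚ.<⇒≤ i<M) j<C

     column : ∀ j -> j < C -> ∏< M (\ i -> bb (up i j) (g i j) (g i (suc j))) * (∏< M (S j) * (w j * ∏< M (U j))) ≈ w (suc j) * ∏< M (V j)
     column j j<C = begin
      B * (∏< M (S j) * ∏< (suc M) u) ≈⟨ *-congˡ (*-congˡ (∏<-snoc M)) ⟩
      B * (∏< M (S j) * (∏< M u * u M)) ≈⟨ solve 4 (\ a b c d -> a :* (b :* (c :* d)) := (a :* (b :* c)) :* d) refl _ _ _ _ ⟩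
      (B * (∏< M (S j) * ∏< M u)) * u M ≈⟨ *-cong (trans (*-congˡ (sym (∏<-* M))) (trans (sym (∏<-* M)) (∏<-cong-< M (\ i i<M -> bb-qf (left i j i<M j<C) (le-up i j i<M j<C)))))
        (≈-cong (\ z -> qf (up M j ∸ z)) (≡.trans (row-0 j) (≡.sym (row-0 (suc j))))) ⟩
      ∏< M v * v M ≈⟨ ∏<-snoc M ⟨
      w (suc j) * ∏< M (V j) ∎
      where
      B = ∏< M (\ i -> bb (up i j) (g i j) (g i (suc j)))
      u v : ℕ -> Carrier
      u i = qf (up i j ∸ g i j)
      v i = qf (up i j ∸ g i (suc j))

     ∏-unit : ∀ n (f : ℕ -> ℕ) -> ∃[ u ] (∏< n (\ j -> qf (f j)) * u ≈ 1#)
     ∏-unit zero f = 1# , *-identityˡ _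
     ∏-unit (suc n) f = fst (qf-unit (f 0)) * fst (∏-unit n (f ∘ suc)) ,
      trans (*-interchange _ _ _ _) (trans (*-cong (snd (qf-unit (f 0))) (snd (∏-unit n (f ∘ suc)))) (*-identityˡ _))

    -- Each binomial is a quotient of three q-factorials. The factors between the upper bound K and
    -- the top row telescope from column to column; what remains beside the quotient in the theorem
    -- is (p;p)_K/(p;p)_(K - g 0 0), which tends to 1.
    bb-quotient : ∏bb * (∏< M (\ i -> ∏< C (\ j -> qf (g i j ∸ g i (suc j)) * qf (g i (suc j) ∸ g (suc i) (suc j)))) * ∏< M (\ i -> qf (g i 0 ∸ g (suc i) 0))) * qf (K ∸ g 0 0)
     ≈ ∏< M (\ i -> ∏< C (\ j -> qf (g i j ∸ g (suc i) (suc j)))) * qf K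
    bb-quotient = begin
     ∏bb * (∏< M (\ i -> ∏< C (\ j -> S j i * U (suc j) i)) * ∏< M (U 0)) * w 0 ≈⟨ *-congʳ (*-congˡ den) ⟩
     ∏bb * (sS * sU) * w 0 ≈⟨ unit-cancel (snd (∏-unit C (\ j -> K ∸ g 0 (suc j)))) (begin
      -- The unit `sw` is inserted so that `column`, which turns w j into w (j+1), can be applied to
      -- all columns at once; it is cancelled afterwards.
      sw * (∏bb * (sS * sU) * w 0) ≈⟨ solve 5 (\ a b c d e -> a :* (b :* (c :* d) :* e) := (b :* (c :* d)) :* (e :* a)) refl _ _ _ _ _ ⟩
      (∏bb * (sS * sU)) * ∏< (suc C) w ≈⟨ *-congˡ (∏<-snoc C) ⟩
      (∏bb * (sS * sU)) * (∏< C w * w C) ≈⟨ solve 5 (\ b s u x y -> (b :* (s :* u)) :* (x :* y) := (b :* (s :* (x :* u))) :* y) refl _ _ _ _ _ ⟩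
      (∏bb * (sS * (∏< C w * sU))) * w C ≈⟨ *-congʳ (trans (*-congˡ (trans (*-congˡ (sym (∏<-* C))) (sym (∏<-* C)))) (trans (sym (∏<-* C)) (trans (∏<-cong-< C column) (∏<-* C)))) ⟩
      (sw * ∏< C (\ j -> ∏< M (V j))) * w C ≈⟨ trans (*-assoc _ _ _) (*-congˡ (*-cong (∏<-swap C M) (≈-cong (\ z -> qf (K ∸ z)) (col-0 0)))) ⟩
      sw * (∏< M (\ i -> ∏< C (\ j -> V j i)) * qf K) ∎) ⟩
     ∏< M (\ i -> ∏< C (\ j -> V j i)) * qf K ∎
     where
     sw = ∏< C (\ j -> w (suc j))
     sS = ∏< C (\ j -> ∏< M (S j))
     sU = ∏< C (\ j -> ∏< M (U j))
     den : ∏< M (\ i -> ∏< C (\ j -> S j i * U (suc j) i)) * ∏< M (U 0) ≈ sS * sU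
     den = begin
      ∏< M (\ i -> ∏< C (\ j -> S j i * U (suc j) i)) * ∏< M (U 0) ≈⟨ *-congʳ (trans (∏<-swap M C) (trans (∏<-cong C (\ j -> ∏<-* M)) (∏<-* C))) ⟩
      (sS * ∏< C (\ j -> ∏< M (U (suc j)))) * ∏< M (U 0) ≈⟨ trans (*-assoc _ _ _) (*-congˡ (*-comm _ _)) ⟩
      sS * ∏< (suc C) (\ j -> ∏< M (U j)) ≈⟨ *-congˡ (trans (∏<-snoc C) (*-oneʳ-≈ (∏<-1 M (\ i _ -> ≡⇒≈ (cong₂ (\ a b -> qf (a ∸ b)) (col-0 i) (col-0 (suc i))))))) ⟩
      sS * sU ∎

   private
    ∏<-zero : ∀ n k {f : ℕ -> Carrier} -> k < n -> f k ≈ 0# -> ∏< n f ≈ 0#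
    ∏<-zero (suc n) zero _ e = trans (*-congʳ e) (zeroˡ _)
    ∏<-zero (suc n) (suc k) (s≤s k<n) e = *-zeroʳ-≈ (∏<-zero n k k<n e)

   -- A violated inequality puts a binomial out of range. A violation between rows i and i + 1 shows
   -- in row i + 1, which lies inside the array because the row below the last is zero.
   bb-zero : ∀ i j -> i < M -> j < C -> (g i j < g (suc i) j) ⊎ (g i j < g i (suc j)) -> ∏bb ≈ 0#
   bb-zero i j i<M j<C (inj₂ lt) = ∏<-zero C j j<C (∏<-zero M i i<M (bb-a<c (up i j) lt))
   bb-zero i j i<M j<C (inj₁ lt) = ∏<-zero C j j<C (∏<-zero M (suc i) (Nₚ.≤∧≢⇒< i<M (\ { ≡.refl -> Nₚ.n≮0 (subst (g i j <_) (row-0 j) lt) })) (bb-d<a (g (suc i) (suc j)) lt))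

private
 sumℕ-+ : ∀ f h n -> sumℕ (\ j -> f j N.+ h j) n ≡ sumℕ f n N.+ sumℕ h n
 sumℕ-+ f h zero = ≡.refl
 sumℕ-+ f h (suc n) = ≡.trans (cong (N._+ (f n N.+ h n)) (sumℕ-+ f h n)) (lem (sumℕ f n) (sumℕ h n) (f n) (h n))
  where
  lem : ∀ a b c d -> (a N.+ b) N.+ (c N.+ d) ≡ (a N.+ c) N.+ (b N.+ d)
  lem = N-solve

 double-tri : ∀ d -> + 2 Z.* + tri d ≡ + d Z.* + d Z.- + d
 double-tri zero = ≡.refl
 double-tri (suc d) = ≡.trans (lem₁ (+ d) (+ tri d)) (≡.trans (cong (\ z -> + 2 Z.* + d Z.+ z) (double-tri d)) (lem₂ (+ d)))
  where
  lem₁ : ∀ d x -> + 2 Z.* (d Z.+ x) ≡ + 2 Z.* d Z.+ + 2 Z.* x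
  lem₁ = Z-solve
  lem₂ : ∀ d -> + 2 Z.* d Z.+ (d Z.* d Z.- d) ≡ (+ 1 Z.+ d) Z.* (+ 1 Z.+ d) Z.- (+ 1 Z.+ d)
  lem₂ = Z-solve

private module RowEnergy (C : ℕ) (h : ℕ -> ℕ) (left : ∀ j -> j < C -> h (suc j) ≤ h j) where

 -- The t-exponent of y^d p^(d(d-1)/2) for y = t^(2j+1) and p = t^(2C), where d is the drop from
 -- position j to j + 1.
 e : ℕ -> ℕ
 e j = suc (2 N.* j) N.* (h j ∸ h (suc j)) N.+ 2 N.* C N.* tri (h j ∸ h (suc j))

 -- Summation by parts turns Σ (2j+1)(h_j - h_{j+1}) into h_0 + 2 Σ h_{j+1}.
 partial : ∀ c -> c ≤ C -> + sumℕ e c ≡ + C Z.* sumTo (\ a -> sq (+ h a Z.- + h (suc a))) c Z.- + C Z.* (+ h 0 Z.- + h c) Z.+ ((+ h 0 Z.+ + 2 Z.* + sumℕ (\ j -> h (suc j)) c) Z.- (+ 2 Z.* + c Z.+ + 1) Z.* + h c)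
 partial zero _ = lem (+ C) (+ h 0)
  where
  lem : ∀ C h -> + 0 ≡ C Z.* + 0 Z.- C Z.* (h Z.- h) Z.+ ((h Z.+ + 2 Z.* + 0) Z.- (+ 2 Z.* + 0 Z.+ + 1) Z.* h)
  lem = Z-solve
 partial (suc c) c<C = ≡.trans (cong₂ Z._+_ (partial c (Nₚ.<⇒≤ c<C)) row)
  (lem (+ C) (sumTo (\ a -> sq (+ h a Z.- + h (suc a))) c) (+ h 0) (+ h c) (+ h (suc c)) (+ sumℕ (\ j -> h (suc j)) c) (+ c))
  where
  d = h c ∸ h (suc c)
  d-eq : + d ≡ + h c Z.- + h (suc c)
  d-eq = ≡.sym (≡.trans (Zₚ.m-n≡m⊖n (h c) (h (suc c))) (Zₚ.⊖-≥ (left c c<C)))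
  l₁ : ∀ C x -> + 2 Z.* C Z.* x ≡ C Z.* (+ 2 Z.* x)
  l₁ = Z-solve
  row : + e c ≡ (+ 1 Z.+ + 2 Z.* + c) Z.* (+ h c Z.- + h (suc c)) Z.+ + C Z.* (sq (+ h c Z.- + h (suc c)) Z.- (+ h c Z.- + h (suc c)))
  row = cong₂ Z._+_ (≡.trans (Zₚ.pos-* (suc (2 N.* c)) d) (cong₂ Z._*_ (cong (\ z -> + 1 Z.+ z) (Zₚ.pos-* 2 c)) d-eq))
   (≡.trans (Zₚ.pos-* (2 N.* C) (tri d)) (≡.trans (cong (Z._* + tri d) (Zₚ.pos-* 2 C)) (≡.trans (l₁ (+ C) (+ tri d)) (cong (\ z -> + C Z.* z) (≡.trans (double-tri d) (cong (\ z -> z Z.* z Z.- z) d-eq))))))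
  lem : ∀ C Q h0 x y s c -> (C Z.* Q Z.- C Z.* (h0 Z.- x) Z.+ ((h0 Z.+ + 2 Z.* s) Z.- (+ 2 Z.* c Z.+ + 1) Z.* x)) Z.+ ((+ 1 Z.+ + 2 Z.* c) Z.* (x Z.- y) Z.+ C Z.* ((x Z.- y) Z.* (x Z.- y) Z.- (x Z.- y)))
   ≡ C Z.* (Q Z.+ (x Z.- y) Z.* (x Z.- y)) Z.- C Z.* (h0 Z.- y) Z.+ ((h0 Z.+ + 2 Z.* (s Z.+ y)) Z.- (+ 2 Z.* (+ 1 Z.+ c) Z.+ + 1) Z.* y)
  lem = Z-solve

 row-expo : h C ≡ 0 -> ∀ C₁ -> C ≡ suc C₁ -> Z.- (+ C Z.* + h 0) Z.+ + 2 Z.* + sumℕ (\ j -> h (suc j)) C₁ Z.+ + C Z.* sumTo (\ a -> sq (+ h a Z.- + h (suc a))) C Z.+ + h 0 ≡ + sumℕ e C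
 row-expo hC C₁ eq = ≡.sym (≡.trans (partial C Nₚ.≤-refl) (≡.trans (cong₂ (\ z S -> + C Z.* Q Z.- + C Z.* (+ h 0 Z.- + z) Z.+ ((+ h 0 Z.+ + 2 Z.* + S) Z.- (+ 2 Z.* + C Z.+ + 1) Z.* + z)) hC sums)
  (lem (+ C) Q (+ h 0) (+ sumℕ (\ j -> h (suc j)) C₁))))
  where
  Q = sumTo (\ a -> sq (+ h a Z.- + h (suc a))) C
  sums : sumℕ (\ j -> h (suc j)) C ≡ sumℕ (\ j -> h (suc j)) C₁
  sums = ≡.trans (cong (sumℕ (\ j -> h (suc j))) eq) (≡.trans (cong (sumℕ (\ j -> h (suc j)) C₁ N.+_) (≡.trans (cong h (≡.sym eq)) hC)) (Nₚ.+-identityʳ _))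
  lem : ∀ C Q h s -> C Z.* Q Z.- C Z.* (h Z.- + 0) Z.+ ((h Z.+ + 2 Z.* s) Z.- (+ 2 Z.* C Z.+ + 1) Z.* + 0) ≡ Z.- (C Z.* h) Z.+ + 2 Z.* s Z.+ C Z.* Q Z.+ h
  lem = Z-solve

 row-≥ : h C ≡ 0 -> h 0 ≤ sumℕ e C
 row-≥ hC = Nₚ.≤-trans (go C Nₚ.≤-refl) (Nₚ.≤-reflexive (≡.trans (cong (sumℕ e C N.+_) hC) (Nₚ.+-identityʳ _)))
  where
  go : ∀ c -> c ≤ C -> h 0 ≤ sumℕ e c N.+ h c
  go zero _ = Nₚ.≤-refl
  go (suc c) c<C = Nₚ.≤-trans (go c (Nₚ.<⇒≤ c<C)) (Nₚ.≤-trans (Nₚ.+-monoʳ-≤ (sumℕ e c) (Nₚ.≤-trans (Nₚ.≤-reflexive (≡.sym (Nₚ.m∸n+n≡m (left c c<C))))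
   (Nₚ.+-monoˡ-≤ (h (suc c)) (Nₚ.≤-trans (Nₚ.m≤n*m (h c ∸ h (suc c)) (suc (2 N.* c))) (Nₚ.m≤m+n _ (2 N.* C N.* tri (h c ∸ h (suc c)))))))) (Nₚ.≤-reflexive (≡.sym (Nₚ.+-assoc (sumℕ e c) (e c) (h (suc c))))))

private module Energy (C C₁ : ℕ) (C-suc : C ≡ suc C₁) (g : ℕ -> ℕ -> ℕ) (col-0 : ∀ i -> g i C ≡ 0) where

 e : ℕ -> ℕ -> ℕ
 e i j = suc (2 N.* j) N.* (g i j ∸ g i (suc j)) N.+ 2 N.* C N.* tri (g i j ∸ g i (suc j))

 energy : ℕ -> ℕ
 energy M = sumℕ (\ j -> sumℕ (\ i -> e i j) M) C

 expo-energy : ∀ M -> (∀ i j -> i < M -> j < C -> g i (suc j) ≤ g i j) ->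
  Z.- (+ C Z.* + sumℕ (\ i -> g i 0) M) Z.+ + 2 Z.* (+ sumℕ (\ j -> sumℕ (\ i -> g i (suc j)) M) C₁)
  Z.+ + C Z.* sumTo (\ i -> sumTo (\ a -> sq (+ g i a Z.- + g i (suc a))) C) M Z.+ + sumℕ (\ i -> g i 0) M ≡ + energy M
 expo-energy zero _ = ≡.trans (cong₂ (\ a b -> Z.- (+ C Z.* + 0) Z.+ + 2 Z.* + a Z.+ + C Z.* + 0 Z.+ + b) (zeros C₁) ≡.refl) (≡.trans (lem (+ C)) (cong +_ (≡.sym (zeros C))))
  where
  zeros : ∀ n -> sumℕ (\ _ -> 0) n ≡ 0
  zeros zero = ≡.refl
  zeros (suc n) = ≡.trans (Nₚ.+-identityʳ _) (zeros n)
  lem : ∀ C -> Z.- (C Z.* + 0) Z.+ + 2 Z.* + 0 Z.+ C Z.* + 0 Z.+ + 0 ≡ + 0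
  lem = Z-solve
 expo-energy (suc M) left = ≡.trans (cong (\ z -> Z.- (+ C Z.* + (A N.+ g M 0)) Z.+ + 2 Z.* + z Z.+ + C Z.* (Q Z.+ q) Z.+ + (A N.+ g M 0)) (sumℕ-+ (\ j -> sumℕ (\ i -> g i (suc j)) M) (\ j -> g M (suc j)) C₁))
  (≡.trans (lem (+ C) (+ A) (+ g M 0) (+ sumℕ (\ j -> sumℕ (\ i -> g i (suc j)) M) C₁) (+ sumℕ (\ j -> g M (suc j)) C₁) Q q)
   (≡.trans (cong₂ Z._+_ (expo-energy M (\ i j i<M -> left i j (Nₚ.m<n⇒m<1+n i<M))) (RowEnergy.row-expo C (g M) (\ j -> left M j Nₚ.≤-refl) (col-0 M) C₁ C-suc))
    (cong +_ (≡.sym (sumℕ-+ (\ j -> sumℕ (\ i -> e i j) M) (e M) C)))))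
  where
  A = sumℕ (\ i -> g i 0) M
  Q = sumTo (\ i -> sumTo (\ a -> sq (+ g i a Z.- + g i (suc a))) C) M
  q = sumTo (\ a -> sq (+ g M a Z.- + g M (suc a))) C
  lem : ∀ C A a B b Q q -> Z.- (C Z.* (A Z.+ a)) Z.+ + 2 Z.* (B Z.+ b) Z.+ C Z.* (Q Z.+ q) Z.+ (A Z.+ a) ≡ (Z.- (C Z.* A) Z.+ + 2 Z.* B Z.+ C Z.* Q Z.+ A) Z.+ (Z.- (C Z.* a) Z.+ + 2 Z.* b Z.+ C Z.* q Z.+ a)
  lem = Z-solve

 -- Families with a large entry s_1^(0) begin at a high power of t. This makes the truncation to a
 -- box harmless.
 energy-≥ : ∀ M -> 1 ≤ M -> (∀ j -> j < C -> g 0 (suc j) ≤ g 0 j) -> g 0 0 ≤ energy M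
 energy-≥ M 1≤M left = Nₚ.≤-trans (RowEnergy.row-≥ C (g 0) left (col-0 0)) (sum-mono C (\ j -> first M 1≤M (\ i -> e i j)))
  where
  sum-mono : ∀ n {f h : ℕ -> ℕ} -> (∀ j -> f j ≤ h j) -> sumℕ f n ≤ sumℕ h n
  sum-mono zero le = z≤n
  sum-mono (suc n) le = Nₚ.+-mono-≤ (sum-mono n le) (le n)
  first : ∀ M -> 1 ≤ M -> ∀ f -> f 0 ≤ sumℕ f M
  first (suc zero) _ f = Nₚ.≤-refl
  first (suc (suc M)) _ f = Nₚ.≤-trans (first (suc M) (s≤s z≤n) f) (Nₚ.m≤m+n _ (f (suc M)))

private module OddLetters (R S : CRing) (𝔾 : Geom R) (𝕃 : LimitRing R 𝔾 S) (m n : ℕ) (n≢0 : n ≢ 0) where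
 open Duality R S 𝔾 𝕃 m n n≢0 using (X; h≢0; module CL)
 open LittlewoodTerm R S 𝔾 𝕃 m n h≢0 using (classes-↭)
 open Theta R S 𝔾 𝕃 (2 N.* n) h≢0 using (P; ap; flip; at; flip-↭)
 open Progressions (+ 2) using () renaming (ap to ap₂)
 private
  h = 2 N.* n
  β : ℕ -> ℤ
  β i = + suc (2 N.* i)

  abs-flip : ∀ a l j -> map Z.∣_∣ (flip a l j) ≡ map Z.∣_∣ (ap a l)
  abs-flip a l zero = ≡.refl
  abs-flip a zero (suc j) = ≡.refl
  abs-flip a (suc l) (suc j) = cong₂ _∷_ (Zₚ.∣-i∣≡∣i∣ a) (abs-flip (a Z.+ + P) l j)

  one : ∀ b L -> map Z.∣_∣ (ap (CL.base b L) (L N.+ L)) ↭ map Z.∣_∣ (ap (+ h Z.- b) L ++ ap (+ h Z.+ b) L)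
  one b L = ↭-trans (Perm.↭-reflexive (≡.sym (abs-flip (CL.base b L) (L N.+ L) L))) (Permₚ.map⁺ Z.∣_∣ (↭-trans (flip-↭ (CL.base b L) L L)
   (Perm.↭-reflexive (cong₂ (\ x y -> ap x L ++ ap y L) (l₁ (+ h) b (+ L)) (l₂ (+ h) b (+ P Z.* + L))))))
   where
   l₁ : ∀ h b L -> (h Z.+ h) Z.- (((h Z.+ b) Z.- (h Z.+ h) Z.* L) Z.+ (h Z.+ h) Z.* L) ≡ h Z.- b
   l₁ = Z-solve
   l₂ : ∀ h b q -> ((h Z.+ b) Z.- q) Z.+ q ≡ h Z.+ b
   l₂ = Z-solve

  all : ∀ L is -> map Z.∣_∣ (concat (map (\ i -> ap (CL.base (β i) L) (L N.+ L)) is)) ↭ map Z.∣_∣ (concat (map (\ i -> ap (+ h Z.- β i) L ++ ap (+ h Z.+ β i) L) is))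
  all L [] = Perm.refl
  all L (i ∷ is) = ↭-trans (Perm.↭-reflexive (Lₚ.map-++ Z.∣_∣ (ap (CL.base (β i) L) (L N.+ L)) _)) (↭-trans (Permₚ.++⁺ (one (β i) L) (all L is)) (Perm.↭-reflexive (≡.sym (Lₚ.map-++ Z.∣_∣ (ap (+ h Z.- β i) L ++ ap (+ h Z.+ β i) L) _))))

  odds : ∀ k l -> map Z.∣_∣ (ap₂ (+ suc (2 N.* k)) l) ≡ applyUpTo (\ j -> suc (2 N.* (k N.+ j))) l
  odds k zero = ≡.refl
  odds k (suc l) = cong₂ _∷_ (cong (\ z -> suc (2 N.* z)) (≡.sym (Nₚ.+-identityʳ k))) (≡.trans (cong (\ z -> map Z.∣_∣ (ap₂ (+ z) l)) (lem k)) (≡.trans (odds (suc k) l) (shift l (\ j -> cong (\ z -> suc (2 N.* z)) (≡.sym (Nₚ.+-suc k j))))))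
   where
   lem : ∀ k -> (1 N.+ 2 N.* k) N.+ 2 ≡ 1 N.+ 2 N.* (1 N.+ k)
   lem = N-solve
   shift : ∀ l {f g : ℕ -> ℕ} -> (∀ j -> f j ≡ g j) -> applyUpTo f l ≡ applyUpTo g l
   shift zero e = ≡.refl
   shift (suc l) e = cong₂ _∷_ (e 0) (shift l (\ j -> e (suc j)))

 -- Flipping does not change absolute values, and flipping the first L members of each class makes
 -- all exponents positive; the classes then fill the odd numbers.
 letters-↭ : ∀ L -> map Z.∣_∣ (X L) ↭ applyUpTo (\ j -> suc (2 N.* j)) (L N.* h)
 letters-↭ L = ↭-trans (all L (downFrom n)) (↭-trans (Permₚ.map⁺ Z.∣_∣ (classes-↭ L)) (Perm.↭-reflexive (odds 0 (L N.* h))))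

private module _ (U : CRing) where
 open Kit U
 module OddProducts (q : Carrier) (z : ℕ -> Carrier) (C : ℕ) (shift : ∀ i -> q * z i ≈ z (2 N.* C N.+ i)) where
  open QBinomial U q using (poch; poch-cong)
  private
   poch-∏< : ∀ k i -> poch (z i) k ≈ ∏< k (\ j -> 1# + z (i N.+ 2 N.* C N.* j))
   poch-∏< zero i = refl
   poch-∏< (suc k) i = *-cong (+-congˡ (≈-cong z (l₁ C i))) (trans (poch-cong k (shift i)) (trans (poch-∏< k (2 N.* C N.+ i)) (∏<-cong k (\ j -> +-congˡ (≈-cong z (l₂ C i j))))))
    where
    l₁ : ∀ C i -> i ≡ i N.+ 2 N.* C N.* 0
    l₁ = N-solve
    l₂ : ∀ C i j -> (2 N.* C N.+ i) N.+ 2 N.* C N.* j ≡ i N.+ 2 N.* C N.* (1 N.+ j)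
    l₂ = N-solve

   blocks : ∀ D {f : ℕ -> Carrier} -> ∏< (D N.* C) f ≈ ∏< D (\ j -> ∏< C (\ a -> f (j N.* C N.+ a)))
   blocks zero = refl
   blocks (suc D) {f} = trans (∏<-++ C (D N.* C) {f}) (*-congˡ (trans (blocks D) (∏<-cong D (\ j -> ∏<-cong C (\ a -> ≈-cong f (≡.sym (Nₚ.+-assoc C (j N.* C) a)))))))

  -- Factor j of the Pochhammer symbol of the letter 2a + 1 has exponent 2a + 1 + 2Cj, and division
  -- with remainder by C reaches every odd number exactly once.
  odd-product : ∀ D -> ∏< C (\ a -> poch (z (suc (2 N.* a))) D) ≈ ∏< (D N.* C) (\ k -> 1# + z (suc (2 N.* k)))
  odd-product D = trans (∏<-cong C (\ a -> poch-∏< D (suc (2 N.* a)))) (trans (∏<-swap C D) (trans (∏<-cong D (\ j -> ∏<-cong C (\ a -> +-congˡ (≈-cong z (lem C a j))))) (sym (blocks D))))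
   where
   lem : ∀ C a j -> (1 N.+ 2 N.* a) N.+ 2 N.* C N.* j ≡ 1 N.+ 2 N.* (j N.* C N.+ a)
   lem = N-solve

-- Modulo t^M the box sum of the branching polynomials is the sum F L over the odd letters.
private module TruncatedSum (m n : ℕ) (n≢0 : n ≢ 0) (M L K : ℕ) (M≤L : M ≤ L) (K-big : L N.* (2 N.* n) N.+ (M N.+ L) ≤ K) where
 open Duality FR SR F𝔾 limitRing m n n≢0 using (F; X; h≢0; X-admissible)
 open OddLetters FR SR F𝔾 limitRing m n n≢0 using (letters-↭)
 open Truncated M using (TR; truncate; ^-truncate; t^-vanish)
 open Kit TR using (_≈_; _^_; 0#; trans; sym; ≡⇒≈; ≈-cong; ∑; ∑-cong; begin_; step-≈-⟩; step-≈-⟨; _∎)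
 private
  C = 2 N.* n
  P = C N.+ C
  P≢0 : P ≢ 0
  P≢0 e = h≢0 (Nₚ.m+n≡0⇒m≡0 C e)
  𝔸 = Geometric.ℕ-alphabet FR F𝔾 P P≢0
  𝔸T = HomProps.mapAlphabet truncate 𝔸
  module FH = HallLittlewood FR 𝔸 using (Pf; ∑-Pf)
  module FB = Branching FR (FS.Xₛ FK.^ P) K (suc K) Nₚ.≤-refl using (box; RD)
  module UN = Uniqueness TR 𝔸T K (suc K) Nₚ.≤-refl using (RD≈Pf)
  module TS = PowerSeries TR using (psRing; const; constHom; Xₛ)
  module TU = Kit TS.psRing using (Carrier; _≈_; _+_; _*_; 1#; trans; sym; refl; *-congˡ; *-left-comm; ∏; ∏-map; ∏-applyUpTo; ∏-↭)
  open Hom truncate using (⟦_⟧; ⟦⟧-cong)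
  open HomProps truncate using (⟦⟧-∑; ⟦⟧-RD; ⟦⟧-Pf)

 y : ℕ -> FK.Carrier
 y j = FS.Xₛ FK.^ suc (2 N.* j)

 private
  xs : List ℕ
  xs = map Z.∣_∣ (X L)

  length-xs : length xs ≤ K
  length-xs = Nₚ.≤-trans (Nₚ.≤-reflexive (≡.trans (Permₚ.↭-length (letters-↭ L)) (Lₚ.length-applyUpTo _ (L N.* C)))) (Nₚ.≤-trans (Nₚ.m≤m+n _ (M N.+ L)) K-big)

  p-vanish : (FS.Xₛ FK.^ P) ^ L ≈ 0#
  p-vanish = trans (≡⇒≈ (^-truncate (FS.Xₛ FK.^ P) L)) (trans (⟦⟧-cong (FK.^-^ FS.Xₛ P L)) (t^-vanish (Nₚ.≤-trans M≤L (Nₚ.m≤n*m L P {{N.≢-nonZero P≢0}}))))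

  t-vanish : FS.Xₛ ^ M ≈ 0#
  t-vanish = trans (≡⇒≈ (^-truncate FS.Xₛ M)) (t^-vanish Nₚ.≤-refl)

  z : ℕ -> TU.Carrier
  z i = TS.Xₛ TU.* TS.const (FS.Xₛ FK.^ i)

  z-shift : ∀ i -> TS.const (FS.Xₛ FK.^ P) TU.* z i TU.≈ z (2 N.* C N.+ i)
  z-shift i = TU.trans (TU.*-left-comm _ _ _) (TU.*-congˡ {TS.Xₛ} (TU.trans (TU.sym (Hom.⟦⟧-* TS.constHom (FS.Xₛ FK.^ P) (FS.Xₛ FK.^ i)))
   (Hom.⟦⟧-cong TS.constHom (⟦⟧-cong (FK.trans (FK.sym (FK.^-+ FS.Xₛ P i)) (FK.≈-cong (\ q -> FS.Xₛ FK.^ (q N.+ i)) (lem C)))))))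
   where
   lem : ∀ C -> C N.+ C ≡ 2 N.* C
   lem = N-solve

  -- Because p^L = 0 modulo t^M, Pochhammer symbols with L factors suffice, and their 2nL factors
  -- are exactly the letters of `F L`.
  generating : TU.∏ (map TS.const (map ⟦_⟧ (applyUpTo y C))) (\ w -> QBinomial.poch TS.psRing (TS.const (FS.Xₛ FK.^ P)) (TS.Xₛ TU.* w) L) TU.≈ TU.∏ xs (\ i -> TU.1# TU.+ z i)
  generating = TU.trans (TU.∏-map TS.const (map ⟦_⟧ (applyUpTo y C))) (TU.trans (TU.∏-map ⟦_⟧ (applyUpTo y C)) (TU.trans (TU.∏-applyUpTo y C)
   (TU.trans (OddProducts.odd-product TS.psRing (TS.const (FS.Xₛ FK.^ P)) z C z-shift L) (TU.trans (TU.sym (TU.∏-applyUpTo (\ k -> suc (2 N.* k)) (L N.* C))) (TU.∏-↭ (↭-sym (letters-↭ L)))))))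

  y-Div : All (Divisible.Div TR FS.Xₛ 1) (map ⟦_⟧ (applyUpTo y C))
  y-Div = Allₚ.map⁺ (Allₚ.applyUpTo⁺₂ y C (\ j -> (FS.Xₛ FK.^ (2 N.* j)) Divisible., ⟦⟧-cong (FK.*-congʳ {FS.Xₛ FK.^ (2 N.* j)} (FK.sym (FK.*-identityʳ FS.Xₛ)))))

 box-sum : FK.∑ (FB.box m) (FB.RD (applyUpTo y C)) ≈ F L
 box-sum = begin
  FK.∑ (FB.box m) (FB.RD (applyUpTo y C)) ≈⟨ ⟦⟧-∑ (FB.box m) ⟩
  ∑ (FB.box m) (FB.RD (applyUpTo y C)) ≈⟨ ∑-cong (FB.box m) (\ v -> trans (⟦⟧-RD (FS.Xₛ FK.^ P) K (suc K) Nₚ.≤-refl (applyUpTo y C) v)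
    (trans (UN.RD≈Pf {FS.Xₛ} L M p-vanish t-vanish (Nₚ.≤-trans (Nₚ.m≤n+m (M N.+ L) (L N.* C)) K-big) y-Div {xs} (snd (X-admissible L)) length-xs generating v) (sym (⟦⟧-Pf 𝔸 v xs)))) ⟩
  ∑ (FB.box m) (\ v -> FH.Pf v xs) ≈⟨ ⟦⟧-∑ (FB.box m) ⟨
  FK.∑ (FB.box m) (\ v -> FH.Pf v xs) ≈⟨ ⟦⟧-cong (FH.∑-Pf K (suc K) Nₚ.≤-refl m xs (s≤s length-xs)) ⟩
  F L ∎

private
 module ZK = Kit ℤR using (∑; ∑-0-All; ∑-cong-All; δ-≢)

 Unital : FPS -> Set
 Unital f = f 0 ≡ + 1

 Unital-* : ∀ f g -> Unital f -> Unital g -> Unital (f FK.* g)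
 Unital-* f g e e′ = cong₂ Z._*_ e e′

 Unital-∏< : ∀ n {f : ℕ -> FPS} -> (∀ k -> Unital (f k)) -> Unital (FK.∏< n f)
 Unital-∏< zero u = ≡.refl
 Unital-∏< (suc n) u = cong₂ Z._*_ (u 0) (Unital-∏< n (\ k -> u (suc k)))

 pick : FPS -> ℤ -> ℤ
 pick f (+ r) = f r
 pick f -[1+ _ ] = + 0

 shiftCoeff-pick : ∀ f e k -> shiftCoeff f e k ≡ pick f (k Z.- e)
 shiftCoeff-pick f e k with k Z.- e
 ... | + _ = ≡.refl
 ... | -[1+ _ ] = ≡.refl

 shift-coeff : ∀ E B r -> (FS.Xₛ FK.^ E FK.* B) r ≡ pick B (+ r Z.- + E)
 shift-coeff E B r = ≡.trans (go E r) (cong (pick B) (≡.sym (Zₚ.m-n≡m⊖n r E)))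
  where
  go : ∀ E r -> (FS.Xₛ FK.^ E FK.* B) r ≡ pick B (r Z.⊖ E)
  go zero r = FK.*-identityˡ B r
  go (suc E) zero = ≡.trans (FK.*-assoc FS.Xₛ (FS.Xₛ FK.^ E) B 0) (Zₚ.*-zeroˡ ((FS.Xₛ FK.^ E FK.* B) 0))
  go (suc E) (suc r) = ≡.trans (FK.*-assoc FS.Xₛ (FS.Xₛ FK.^ E) B (suc r)) (≡.trans (FS.mul-X-suc (FS.Xₛ FK.^ E FK.* B) r) (≡.trans (go E r) (cong (pick B) (≡.sym (Zₚ.[1+m]⊖[1+n]≡m⊖n r E)))))

 ∑-filter : ∀ {A : Set} (v : A -> Bool) (f : A -> ℤ) xs -> sumList (map f (filter (\ s -> v s Bool.≟ true) xs)) ≡ ZK.∑ xs (\ s -> if v s then f s else + 0)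
 ∑-filter v f [] = ≡.refl
 ∑-filter v f (x ∷ xs) with v x
 ... | true = cong (\ z -> f x Z.+ z) (∑-filter v f xs)
 ... | false = ≡.trans (∑-filter v f xs) (≡.sym (Zₚ.+-identityˡ _))

 allL-true : ∀ (q : ℕ -> Bool) (f : ℕ -> ℕ) n -> allL q (applyUpTo f n) ≡ true -> ∀ i -> i < n -> q (f i) ≡ true
 allL-true q f (suc n) e i i<n with q (f 0) in eq
 allL-true q f (suc n) e zero _ | true = eq
 allL-true q f (suc n) e (suc i) (s≤s i<n) | true = allL-true q (f ∘ suc) n e i i<n

 allL-false : ∀ (q : ℕ -> Bool) (f : ℕ -> ℕ) n -> allL q (applyUpTo f n) ≡ false -> ∃[ i ] (i < n × q (f i) ≡ false)
 allL-false q f (suc n) e with q (f 0) in eq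
 ... | false = 0 , s≤s z≤n , eq
 ... | true with allL-false q (f ∘ suc) n e
 ...   | i , i<n , e′ = suc i , s≤s i<n , e′

 ∧-true : ∀ a b -> (a ∧ b) ≡ true -> a ≡ true × b ≡ true
 ∧-true true true _ = ≡.refl , ≡.refl

 ∧-false : ∀ a b -> (a ∧ b) ≡ false -> a ≡ false ⊎ b ≡ false
 ∧-false false b _ = inj₁ ≡.refl
 ∧-false true b e = inj₂ e

 ≤ᵇ-true : ∀ a b -> (a ≤ᵇ b) ≡ true -> a ≤ b
 ≤ᵇ-true a b e = Nₚ.≤ᵇ⇒≤ a b (subst Bool.T (≡.sym e) tt)

 ≤ᵇ-false : ∀ a b -> (a ≤ᵇ b) ≡ false -> b < a
 ≤ᵇ-false a b e = Nₚ.≰⇒> (\ le -> subst Bool.T e (Nₚ.≤⇒≤ᵇ le))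

 allVecs-All : ∀ {A : Set} {Q : A -> Set} (T : ∀ {L} -> Vec A L -> Set) -> T [] -> (∀ {L x} {v : Vec A L} -> Q x -> T v -> T (x ∷ v)) -> ∀ {xs} -> All Q xs -> ∀ L -> All (T {L}) (allVecs xs L)
 allVecs-All T t[] t∷ qs zero = t[] ∷ []
 allVecs-All {Q = Q} T t[] t∷ {xs} qs (suc L) = Allₚ.concat⁺ (Allₚ.map⁺ (All.map (\ q -> Allₚ.map⁺ (All.map (t∷ q) (allVecs-All T t[] t∷ qs L))) qs))

 famsBox-bounded : ∀ K M N -> All (\ s -> ∀ i j -> get s i j ≤ K) (famsBox K M N)
 famsBox-bounded K M N = allVecs-All (\ s -> ∀ i j -> get s i j ≤ K) (\ i j -> z≤n) (\ { q t zero j -> q j ; q t (suc i) j -> t i j })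
  (allVecs-All {Q = _≤ K} (\ v -> ∀ j -> nth (toList v) j ≤ K) (\ j -> z≤n) (\ { q t zero -> q ; q t (suc j) -> t j }) (All.map Nₚ.≤-pred (Allₚ.all-upTo (suc K))) N) M

 nth-end : ∀ {N} (v : Vec ℕ N) -> nth (toList v) N ≡ 0
 nth-end [] = ≡.refl
 nth-end (x ∷ v) = nth-end v

 get-row : ∀ {M N} (s : Fam M N) j -> get s M j ≡ 0
 get-row [] j = ≡.refl
 get-row (r ∷ s) j = get-row s j

 get-end : ∀ {M N} (s : Fam M N) i -> get s i N ≡ 0
 get-end [] i = ≡.refl
 get-end (r ∷ s) zero = nth-end r
 get-end (r ∷ s) (suc i) = get-end s i

private module ArrayTerm (m n : ℕ) (1≤m : 1 ≤ m) (n≢0 : n ≢ 0) (M D₀ K : ℕ) (M≤D₀ : M ≤ D₀) (K-big : M N.+ D₀ ≤ K) (g : ℕ -> ℕ -> ℕ) (row : ∀ j -> g m j ≡ 0) (end : ∀ i -> g i (2 N.* n) ≡ 0) (bounded : ∀ j -> g 0 j ≤ K) where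
 private
  C = 2 N.* n
  P = C N.+ C
  P′ = 2 N.* C
  p = FS.Xₛ FK.^ P
  C≢0 : C ≢ 0
  C≢0 e = n≢0 (Nₚ.m+n≡0⇒m≡0 n e)
  P≢0 : P ≢ 0
  P≢0 e = C≢0 (Nₚ.m+n≡0⇒m≡0 C e)
  P≡P′ : P ≡ P′
  P≡P′ = lem C
   where
   lem : ∀ C -> C N.+ C ≡ 2 N.* C
   lem = N-solve
 open QBinomial FR p using (qf; bb)
 open Energy C (C ∸ 1) (≡.sym (Nₚ.suc-pred C {{N.≢-nonZero C≢0}})) g end public
 open Arrays FR p K g m C row end using (∏bb; bb-quotient; bb-zero) public
 open Branching FR p K (suc K) Nₚ.≤-refl using (yp)

 y : ℕ -> FPS
 y j = FS.Xₛ FK.^ suc (2 N.* j)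

 E : ℕ
 E = energy m

 private
  ∏<-X^ : ∀ k (f : ℕ -> ℕ) -> FK.∏< k (\ j -> FS.Xₛ FK.^ f j) FK.≈ FS.Xₛ FK.^ sumℕ f k
  ∏<-X^ zero f = FK.refl
  ∏<-X^ (suc k) f = FK.trans (FK.∏<-snoc k) (FK.trans (FK.*-congʳ {FS.Xₛ FK.^ f k} (∏<-X^ k f)) (FK.sym (FK.^-+ FS.Xₛ (sumℕ f k) (f k))))

  yp-X^ : ∀ j d -> yp (y j) d FK.≈ FS.Xₛ FK.^ (suc (2 N.* j) N.* d N.+ P′ N.* tri d)
  yp-X^ j d = FK.trans (FK.*-cong {y j FK.^ d} (FK.^-^ FS.Xₛ (suc (2 N.* j)) d) (FK.trans (FK.^-^ FS.Xₛ P (tri d)) (FK.≈-cong (\ q -> FS.Xₛ FK.^ (q N.* tri d)) P≡P′))) (FK.sym (FK.^-+ FS.Xₛ (suc (2 N.* j) N.* d) (P′ N.* tri d)))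


  p^ : ∀ k -> p FK.^ k FK.≈ FS.Xₛ FK.^ (P N.* k)
  p^ = FK.^-^ FS.Xₛ P

  pp-qf : ∀ k -> pochF P′ P′ k FK.≈ qf k
  pp-qf zero = oneS-1
  pp-qf (suc k) = FK.trans (⊛-mul (pochF P′ P′ k) (oneS ⊝ mono (P′ N.+ P′ N.* k))) (FK.*-cong {pochF P′ P′ k} (pp-qf k) (FK.+-cong {oneS} oneS-1 (FK.-‿cong (FK.trans (mono-X^ (P′ N.+ P′ N.* k))
   (FK.trans (FK.≈-cong (FS.Xₛ FK.^_) (≡.trans (≡.sym (Nₚ.*-suc P′ k)) (cong (N._* suc k) (≡.sym P≡P′)))) (FK.sym (p^ (suc k))))))))

  X^-Unital : ∀ x -> x ≢ 0 -> Unital (FK.1# FK.- FS.Xₛ FK.^ x)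
  X^-Unital x x≢0 = cong (\ z -> + 1 Z.+ Z.- z) (≡.trans (FS.X^ x 0) (ZK.δ-≢ (\ e -> x≢0 (≡.sym e))))

  qf-Unital : ∀ k -> Unital (qf k)
  qf-Unital zero = ≡.refl
  qf-Unital (suc k) = Unital-* (qf k) (FK.1# FK.- p FK.^ suc k) (qf-Unital k) (≡.trans (cong (\ z -> + 1 Z.+ Z.- z) (p^ (suc k) 0)) (X^-Unital (P N.* suc k) (\ e -> P≢0 (Nₚ.m*n≡0⇒m≡0 P (suc k) e))))

  qf-unit : ∀ k -> ∃[ u ] (qf k FK.* u FK.≈ FK.1#)
  qf-unit k = inv (qf k) , mul-inv (qf k) (qf-Unital k)

  diag hor ver : ℕ -> ℕ -> ℕ
  diag i j = g i j ∸ g (suc i) (suc j)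
  hor i j = g i j ∸ g i (suc j)
  ver i j = g i j ∸ g (suc i) j

  numD denD numQ denQ : FPS
  numD = prodTo (\ i -> prodTo (\ a -> pochF P′ P′ (diag i a)) C) m
  denD = prodTo (\ i -> prodTo (\ a -> pochF P′ P′ (hor i a) ⊛ pochF P′ P′ (ver i (suc a))) C) m ⊛ prodTo (\ i -> pochF P′ P′ (ver i 0)) m
  numQ = FK.∏< m (\ i -> FK.∏< C (\ j -> qf (diag i j)))
  denQ = FK.∏< m (\ i -> FK.∏< C (\ j -> qf (hor i j) FK.* qf (ver i (suc j)))) FK.* FK.∏< m (\ i -> qf (ver i 0))

  num-≈ : numD FK.≈ numQ
  num-≈ = prodTo-∏< m (\ i _ -> prodTo-∏< C (\ j _ -> pp-qf (diag i j)))

  den-≈ : denD FK.≈ denQ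
  den-≈ = FK.trans (⊛-mul _ _) (FK.*-cong (prodTo-∏< m (\ i _ -> prodTo-∏< C (\ j _ -> FK.trans (⊛-mul (pochF P′ P′ (hor i j)) (pochF P′ P′ (ver i (suc j)))) (FK.*-cong {pochF P′ P′ (hor i j)} {qf (hor i j)} (pp-qf (hor i j)) (pp-qf (ver i (suc j)))))))
   (prodTo-∏< m (\ i _ -> pp-qf (ver i 0))))

  den-Unital : Unital denD
  den-Unital = ≡.trans (den-≈ 0) (Unital-* (FK.∏< m (\ i -> FK.∏< C (\ j -> qf (hor i j) FK.* qf (ver i (suc j))))) (FK.∏< m (\ i -> qf (ver i 0)))
   (Unital-∏< m (\ i -> Unital-∏< C (\ j -> Unital-* (qf (hor i j)) (qf (ver i (suc j))) (qf-Unital (hor i j)) (qf-Unital (ver i (suc j)))))) (Unital-∏< m (\ i -> qf-Unital (ver i 0))))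

 powers : FK.∏< C (\ j -> FK.∏< m (\ i -> yp (y j) (g i j ∸ g i (suc j)))) FK.≈ FS.Xₛ FK.^ E
 powers = FK.trans (FK.∏<-cong C (\ j -> FK.trans (FK.∏<-cong m (\ i -> yp-X^ j (g i j ∸ g i (suc j)))) (∏<-X^ m (\ i -> e i j)))) (∏<-X^ C (\ j -> sumℕ (\ i -> e i j) m))

 B : FPS
 B = numD ⊛ inv denD

 Valid : Set
 Valid = ∀ i j -> i < m -> j < C -> g (suc i) j ≤ g i j × g i (suc j) ≤ g i j

 private
  open Truncated M using (TR; truncate; t^-vanish; agree)
  module TK = Kit TR using (_≈_; _*_; trans; sym; *-cong; *-congˡ; *-congʳ; +-congˡ; -‿cong; *-identityʳ; ≡⇒≈; ≈-cong; unit-cancel; begin_; step-≈-⟩; _∎)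
  open Hom truncate using (⟦⟧-cong)

  qf-stable-T : ∀ j -> qf (D₀ N.+ j) TK.≈ qf D₀
  qf-stable-T zero = TK.≈-cong qf (Nₚ.+-identityʳ D₀)
  qf-stable-T (suc j) = TK.trans (TK.≈-cong qf (Nₚ.+-suc D₀ j)) (TK.trans (TK.*-cong {qf (D₀ N.+ j)} {qf D₀} {FK.1# FK.- p FK.^ suc (D₀ N.+ j)} {FK.1#} (qf-stable-T j)
   (TK.trans (TK.+-congˡ {FK.1#} (TK.-‿cong (TK.trans (⟦⟧-cong (p^ (suc (D₀ N.+ j)))) (t^-vanish (Nₚ.≤-trans M≤D₀ (Nₚ.≤-trans (Nₚ.m≤m+n D₀ j) (Nₚ.≤-trans (Nₚ.n≤1+n _) (Nₚ.m≤n*m (suc (D₀ N.+ j)) P {{N.≢-nonZero P≢0}}))))))))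
    (⟦⟧-cong (FK.solve 0 (FK.1ₚ FK.:- FK.0ₚ FK.:= FK.1ₚ) FK.refl)))) (TK.*-identityʳ (qf D₀)))

  qf-large : ∀ k -> D₀ ≤ k -> qf k TK.≈ qf D₀
  qf-large k le = TK.trans (TK.≈-cong qf (≡.sym (Nₚ.m+[n∸m]≡n le))) (qf-stable-T (k ∸ D₀))

  B-≈ : B FK.≈ numQ FK.* inv denD
  B-≈ = FK.trans (⊛-mul numD (inv denD)) (FK.*-congʳ {inv denD} num-≈)

  -- The surplus (p;p)_K/(p;p)_(K - g 0 0) is 1 modulo t^M, since both lengths are at least D₀ and
  -- all later factors are 1.
  bb-B : Valid -> D₀ ≤ K ∸ g 0 0 -> ∏bb TK.≈ B
  bb-B v le = TK.unit-cancel {w₀} {inv w₀} (⟦⟧-cong (mul-inv w₀ (qf-Unital (K ∸ g 0 0)))) (TK.begin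
   w₀ TK.* ∏bb TK.≈⟨ ⟦⟧-cong (FK.trans (FK.sym (FK.*-identityʳ (w₀ FK.* ∏bb))) (FK.trans (FK.*-congˡ {w₀ FK.* ∏bb} (FK.sym (FK.trans (FK.*-congʳ {inv denD} (FK.sym den-≈)) (mul-inv denD den-Unital))))
     (FK.solve 4 (\ w b d i -> (w FK.:* b) FK.:* (d FK.:* i) FK.:= (b FK.:* d FK.:* w) FK.:* i) FK.refl w₀ ∏bb denQ (inv denD)))) ⟩
   (∏bb TK.* denQ TK.* w₀) TK.* inv denD TK.≈⟨ TK.*-congʳ {inv denD} (⟦⟧-cong (bb-quotient qf-unit (\ i j i<m j<C -> fst (v i j i<m j<C)) (\ i j i<m j<C -> snd (v i j i<m j<C)) bounded)) ⟩
   (numQ TK.* qf K) TK.* inv denD TK.≈⟨ TK.*-congʳ {inv denD} (TK.*-congˡ {numQ} (TK.trans (qf-large K (Nₚ.m+n≤o⇒n≤o M K-big)) (TK.sym (qf-large (K ∸ g 0 0) le)))) ⟩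
   (numQ TK.* w₀) TK.* inv denD TK.≈⟨ ⟦⟧-cong (FK.trans (FK.solve 3 (\ a w i -> (a FK.:* w) FK.:* i FK.:= w FK.:* (a FK.:* i)) FK.refl numQ w₀ (inv denD)) (FK.*-congˡ {w₀} (FK.sym B-≈))) ⟩
   w₀ TK.* B TK.∎)
   where w₀ = qf (K ∸ g 0 0)

 valid-term : Valid -> ∏bb FK.* FS.Xₛ FK.^ E TK.≈ FS.Xₛ FK.^ E FK.* B
 valid-term v with D₀ N.≤? K ∸ g 0 0
 ... | yes le = TK.trans (TK.*-congʳ {FS.Xₛ FK.^ E} (bb-B v le)) (⟦⟧-cong (FK.*-comm B (FS.Xₛ FK.^ E)))
 ... | no nle = TK.trans (TK.*-congˡ {∏bb} zero-E) (TK.trans (⟦⟧-cong (FK.trans (FK.zeroʳ ∏bb) (FK.sym (FK.zeroˡ B)))) (TK.*-congʳ {B} (TK.sym zero-E)))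
  where
  M≤E : M ≤ E
  M≤E = Nₚ.≤-trans (Nₚ.+-cancelʳ-≤ D₀ M (g 0 0) (Nₚ.≤-trans K-big (Nₚ.≤-trans (Nₚ.m≤n+m∸n K (g 0 0)) (Nₚ.+-monoʳ-≤ (g 0 0) (Nₚ.<⇒≤ (Nₚ.≰⇒> nle))))))
   (energy-≥ m 1≤m (\ j j<C -> snd (v 0 j 1≤m j<C)))
  zero-E : FS.Xₛ FK.^ E TK.≈ FK.0#
  zero-E = t^-vanish M≤E

private module FamilyTerm (m n : ℕ) (1≤m : 1 ≤ m) (n≢0 : n ≢ 0) (M D₀ K : ℕ) (M≤D₀ : M ≤ D₀) (K-big : M N.+ D₀ ≤ K) (s : Fam m (2 N.* n)) (bounded : ∀ i j -> get s i j ≤ K) where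
 private
  C = 2 N.* n
  P′ = 2 N.* C
  p = FS.Xₛ FK.^ (C N.+ C)
  g = get s
 open ArrayTerm m n 1≤m n≢0 M D₀ K M≤D₀ K-big (get s) (get-row s) (get-end s) (bounded 0) using (y; E; B; powers; Valid; valid-term; ∏bb; bb-zero; expo-energy)
 open Families FR p K (suc K) Nₚ.≤-refl using (weight; weight-get)
 open Truncated M using (agree)

 private
  weight-split : weight y s FK.≈ ∏bb FK.* FS.Xₛ FK.^ E
  weight-split = FK.trans (weight-get y s) (FK.trans (FK.∏<-cong C (\ j -> FK.∏<-* m)) (FK.trans (FK.∏<-* C) (FK.*-congˡ {∏bb} powers)))

  valid-at : valid s ≡ true -> Valid
  valid-at v i j i<m j<C = ≤ᵇ-true (g (suc i) j) (g i j) (both .fst) , ≤ᵇ-true (g i (suc j)) (g i j) (both .snd)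
   where
   both = ∧-true (g (suc i) j ≤ᵇ g i j) (g i (suc j) ≤ᵇ g i j) (allL-true _ id C (allL-true _ id m v i i<m) j j<C)

 expo-E : valid s ≡ true -> expo s ≡ + E
 expo-E v = expo-energy m (\ i j i<m j<C -> snd (valid-at v i j i<m j<C))

 private
  invalid-term : valid s ≡ false -> ∏bb FK.≈ FK.0#
  invalid-term v with allL-false _ id m v
  ... | i , i<m , e with allL-false _ id C e
  ...   | j , j<C , e′ with ∧-false (g (suc i) j ≤ᵇ g i j) (g i (suc j) ≤ᵇ g i j) e′
  ...     | inj₁ f = bb-zero i j i<m j<C (inj₁ (≤ᵇ-false (g (suc i) j) (g i j) f))
  ...     | inj₂ f = bb-zero i j i<m j<C (inj₂ (≤ᵇ-false (g i (suc j)) (g i j) f))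

 coefficient : ∀ r -> r < M -> (if valid s then shiftCoeff (Bser P′ s) (expo s) (+ r) else + 0) ≡ weight y s r
 coefficient r r<M with valid s in v
 ... | true = ≡.trans (shiftCoeff-pick B (expo s) (+ r)) (≡.trans (cong (\ z -> pick B (+ r Z.- z)) (expo-E v)) (≡.trans (≡.sym (shift-coeff E B r)) (≡.trans (≡.sym (agree (valid-term (valid-at v)) r r<M)) (≡.sym (weight-split r)))))
 ... | false = ≡.sym (≡.trans (weight-split r) (≡.trans (FK.*-congʳ {FS.Xₛ FK.^ E} (invalid-term v) r) (FK.zeroˡ (FS.Xₛ FK.^ E) r)))

 negative-coefficient : ∀ r -> (if valid s then shiftCoeff (Bser P′ s) (expo s) -[1+ r ] else + 0) ≡ + 0
 negative-coefficient r with valid s in v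
 ... | false = ≡.refl
 ... | true = ≡.trans (shiftCoeff-pick B (expo s) -[1+ r ]) (≡.trans (cong (\ z -> pick B (-[1+ r ] Z.- z)) (expo-E v)) (below-0 E))
  where
  below-0 : ∀ E -> pick B (-[1+ r ] Z.- + E) ≡ + 0
  below-0 zero = ≡.refl
  below-0 (suc E) = ≡.refl

-- The existence of K₀ expresses convergence: each coefficient of the box sums becomes constant once
-- the box is large, and this constant is the coefficient of the infinite sum.
theorem1p4 : (m n : ℕ) → 1 ≤ m → 1 ≤ n → (k : ℤ) →
  ∃[ K₀ ] ((K : ℕ) → K₀ ≤ K → lhsTrunc m n K k ≡ rhsCoeff m n k)
-- The exponent of a valid family is an energy, hence nonnegative, so K₀ = 0 serves for negative k.
theorem1p4 m n 1≤m 1≤n -[1+ r ] = 0 , \ K _ -> ≡.trans (∑-filter valid _ (famsBox K m (2 N.* n)))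
 (ZK.∑-0-All (famsBox-bounded K m (2 N.* n)) (\ s b -> FamilyTerm.negative-coefficient m n 1≤m (\ { ≡.refl -> Nₚ.n≮0 1≤n }) 0 0 K z≤n z≤n s b r))
-- Truncation at M = r + 1 keeps the coefficient of t^r. `L` is past the point where `F L` agrees
-- with the product modulo t^M, and at least M so that p^L vanishes. The bound on K leaves room for
-- the 2nL letters and for M + L.
theorem1p4 m n 1≤m 1≤n (+ r) = L N.* C N.+ (M N.+ L) , \ K le ->
 ≡.trans (∑-filter valid _ (famsBox K m C))
 (≡.trans (ZK.∑-cong-All (famsBox-bounded K m C) (\ s b -> FamilyTerm.coefficient m n 1≤m n≢0 M L K (Nₚ.m≤n⊔m (fst F-rhs M) M) (Nₚ.≤-trans (Nₚ.m≤n+m (M N.+ L) (L N.* C)) le) s b r (Nₚ.n<1+n r)))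
 (≡.trans (≡.sym (FS.∑-coeff (famsBox K m C) (Families.weight FR p K (suc K) Nₚ.≤-refl y) r))
 (≡.trans (≡.sym (sum-families K r))
 (≡.trans (Truncated.agree (TruncatedSum.box-sum m n n≢0 M L K (Nₚ.m≤n⊔m (fst F-rhs M) M) le) r (Nₚ.n<1+n r))
  (Truncated.agree (snd F-rhs M L (Nₚ.m≤m⊔n (fst F-rhs M) M)) r (Nₚ.n<1+n r))))))
 where
 C = 2 N.* n
 M = suc r
 n≢0 : n ≢ 0
 n≢0 ≡.refl = Nₚ.n≮0 1≤n
 open FormulaFPS m n n≢0 using (F-rhs)
 L = fst F-rhs M N.⊔ M
 y : ℕ -> FPS
 y j = FS.Xₛ FK.^ suc (2 N.* j)
 p = FS.Xₛ FK.^ (C N.+ C)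
 sum-families : ∀ K -> FK.∑ (Branching.box FR p K (suc K) Nₚ.≤-refl m) (Branching.RD FR p K (suc K) Nₚ.≤-refl (applyUpTo y C)) FK.≈ FK.∑ (famsBox K m C) (Families.weight FR p K (suc K) Nₚ.≤-refl y)
 sum-families K = FK.trans (FK.∑-cong (box m) (\ v -> FK.sym (FK.*-identityˡ (RD (applyUpTo y C) v)))) (FK.trans (∑-RD C y m {\ _ -> FK.1#}) (FK.∑-cong (famsBox K m C) (\ s -> FK.*-identityˡ (weight y s))))
  where
  open Branching FR p K (suc K) Nₚ.≤-refl using (box; RD)
  open Families FR p K (suc K) Nₚ.≤-refl using (weight; ∑-RD)
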